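{- Suppose $1/n\ll1/K\ll\zeta\ll\lambda\ll\alpha$. Fix a graph $Q_0$ and let $Q$ be a graph of order $n$ obtained from $Q_0$ by a sequence of operations (A) and (B) in which each edge of $Q_0$ is subdivided at least once. Suppose additionally that $|Q_0|\Delta(Q)\le\zeta n^{1/4}$ and $\Delta(Q)\le n^{(K\log n)^{ -1/2}}$, and let $G$ be a digraph with $\delta^0(G)\ge(1/2+\alpha)|G|$. (1) If $|G|\ge(1+\alpha)n$, then $G$ contains every orientation of $Q$. (2) If $|G|=n$ and $Q$ contains either $\lambda n$ vertex-disjoint bare paths of order $7$ or $\lambda n$ vertex-disjoint edges incident to leaves, then $G$ contains every orientation of $Q$.
   Context: The operations on a graph are: (A) append a leaf, i.e. add a new vertex joined to the graph by a single edge; (B) subdivide an edge, i.e. replace some edge $uv$ by a path $uxv$ with $x$ a new vertex. "Each edge of $Q_0$ is subdivided at least once" means each edge of $Q_0$ corresponds in $Q$ to a path of length at least $2$. A leaf is a vertex of degree $1$ (in any graph). A bare path $p_1\cdots p_s$ in $Q$ is a path whose internal vertices have degree $2$ in $Q$; its order is its number of vertices. $\Delta(Q)$ is the maximum degree. Hierarchy notation: $a\ll b$ means for every $b>0$ there is $a_0>0$ such that the statement holds for all $0<a<a_0$; for longer chains constants are chosen from right to left; $1/n\ll\cdot$ means $n$ sufficiently large. $\log$ is the natural logarithm. A digraph has no loops and at most one edge in each direction; $\delta^0(G)$ is the minimum over vertices of the minimum of in- and outdegree. An orientation of $Q$ replaces each edge $\{u,v\}$ by exactly one of $(u,v),(v,u)$;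 "$G$ contains $D$" means $G$ has a subdigraph isomorphic to $D$. -}

module Defs where

open import Data.Nat as ℕ using (ℕ; zero; suc; _⊔_; _!)
open import Data.Nat.Properties using (_!≢0)
open import Data.Integer using (+_)
open import Data.Rational using (ℚ; _/_; 0ℚ; 1ℚ; ½; _+_; _*_; _≤_; _<_)
open import Data.Fin using (Fin; zero; suc; inject₁; _≟_)
open import Data.Bool using (Bool; true; false; if_then_else_; _∨_; _∧_)
open import Data.List using (List; map; foldr; allFin)
open import Data.Nat.ListAction using (sum)
open import Data.Product using (Σ; _×_; ∃-syntax)
open import Data.Sum using (_⊎_)
open import Relation.Nullary using (¬_; does)
open import Relation.Binary.PropositionalEquality using (_≡_; _≢_)
open import Function.Bundles using (_↔_; Inverse)

ℚ[_] : ℕ → ℚ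
ℚ[ m ] = + m / 1

infixr 8 _^ℚ_
_^ℚ_ : ℚ → ℕ → ℚ
p ^ℚ zero  = 1ℚ
p ^ℚ suc a = p * (p ^ℚ a)

partialE : ℕ → ℚ
partialE zero    = 0ℚ
partialE (suc N) = partialE N + (+ 1 / (N !)) {{N !≢0}}

-- ExpLE a M  :⇔  e^a ≤ M   (a, M natural numbers);
-- since partialE N ↑ e, e^a ≤ M iff every (partialE N)^a ≤ M.
ExpLE : ℕ → ℕ → Set
ExpLE a M = ∀ N → (partialE N ^ℚ a) ≤ ℚ[ M ]

-- DegreeBound K Δ n  :⇔  Δ ≤ n^((K log n)^(-1/2))   (natural logarithm)
-- Encoded as  K (log Δ)² ≤ log n :  for every rational a/b ≤ log Δ
-- (i.e. e^a ≤ Δ^b) we have K (a/b)² ≤ log n (i.e. e^(K a²) ≤ n^(b²)).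
DegreeBound : ℕ → ℕ → ℕ → Set
DegreeBound K Δ n =
  ∀ a b → ExpLE a (Δ ℕ.^ b) → ExpLE (K ℕ.* a ℕ.* a) (n ℕ.^ (b ℕ.* b))

record Graph : Set where
  field
    size    : ℕ
    adj     : Fin size → Fin size → Bool
    adj-sym : ∀ i j → adj i j ≡ adj j i
    adj-irr : ∀ i → adj i i ≡ false
open Graph public

indicator : Bool → ℕ
indicator true  = 1
indicator false = 0

degree : (Q : Graph) → Fin (size Q) → ℕ
degree Q i = sum (map (λ j → indicator (adj Q i j)) (allFin (size Q)))

maxDegree : Graph → ℕ
maxDegree Q = foldr _⊔_ 0 (map (degree Q) (allFin (size Q)))

Iso : (Q : Graph) (W : ℕ) → (Fin W → Fin W → Bool) → Set
Iso Q W A = Σ (Fin (size Q) ↔ Fin W) λ σ →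
  ∀ i j → adj Q i j ≡ A (Inverse.to σ i) (Inverse.to σ j)

-- label of a vertex pair: no edge / an edge of Q₀ never subdivided /
-- any other edge
data Lbl : Set where
  none orig other : Lbl

isEdge : Lbl → Bool
isEdge none  = false
isEdge orig  = true
isEdge other = true

Lab : ℕ → Set
Lab W = Fin W → Fin W → Lbl

initLab : (Q₀ : Graph) → Lab (size Q₀)
initLab Q₀ i j = if adj Q₀ i j then orig else none

eqF : ∀ {W} → Fin W → Fin W → Bool
eqF i j = does (i ≟ j)

-- (A): new vertex (index zero, old vertices shifted by suc) joined to v
appendLeaf : ∀ {W} → Lab W → Fin W → Lab (suc W)
appendLeaf M v zero    zero    = none
appendLeaf M v zero    (suc j) = if eqF j v then other else none
appendLeaf M v (suc i) zero    = if eqF i v then other else none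
appendLeaf M v (suc i) (suc j) = M i j

-- (B): replace the edge uv by the path u x v, x the new vertex (index zero)
subdivide : ∀ {W} → Lab W → Fin W → Fin W → Lab (suc W)
subdivide M u v zero    zero    = none
subdivide M u v zero    (suc j) = if eqF j u ∨ eqF j v then other else none
subdivide M u v (suc i) zero    = if eqF i u ∨ eqF i v then other else none
subdivide M u v (suc i) (suc j) =
  if (eqF i u ∧ eqF j v) ∨ (eqF i v ∧ eqF j u) then none else M i j

data Reach (Q₀ : Graph) : (W : ℕ) → Lab W → Set where
  start : Reach Q₀ (size Q₀) (initLab Q₀)
  opA   : ∀ {W M} → Reach Q₀ W M → (v : Fin W) →
          Reach Q₀ (suc W) (appendLeaf M v)
  opB   : ∀ {W M} → Reach Q₀ W M → (u v : Fin W) → isEdge (M u v) ≡ true →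
          Reach Q₀ (suc W) (subdivide M u v)

ObtainedFrom : Graph → Graph → Set
ObtainedFrom Q₀ Q = ∃[ W ] ∃[ M ] (Reach Q₀ W M × (∀ i j → M i j ≢ orig)
  × Iso Q W (λ i j → isEdge (M i j)))

record Digraph : Set where
  field
    dsize   : ℕ
    arc     : Fin dsize → Fin dsize → Bool
    arc-irr : ∀ i → arc i i ≡ false
open Digraph public

outdeg indeg : (G : Digraph) → Fin (dsize G) → ℕ
outdeg G i = sum (map (λ j → indicator (arc G i j)) (allFin (dsize G)))
indeg  G i = sum (map (λ j → indicator (arc G j i)) (allFin (dsize G)))

MinSemiDegreeAtLeast : Digraph → ℚ → Set
MinSemiDegreeAtLeast G c = ∀ v →
  (c * ℚ[ dsize G ] ≤ ℚ[ outdeg G v ]) × (c * ℚ[ dsize G ] ≤ ℚ[ indeg G v ])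

IsOrientation : Graph → Digraph → Set
IsOrientation Q D = Σ (dsize D ≡ size Q) λ { _≡_.refl →
  ∀ i j → ((arc D i j ∨ arc D j i) ≡ adj Q i j) × ((arc D i j ∧ arc D j i) ≡ false) }

Contains : Digraph → Digraph → Set
Contains G D = Σ (Fin (dsize D) → Fin (dsize G)) λ f →
  (∀ i j → f i ≡ f j → i ≡ j) × (∀ i j → arc D i j ≡ true → arc G (f i) (f j) ≡ true)

ContainsAllOrientations : Digraph → Graph → Set
ContainsAllOrientations G Q = ∀ D → IsOrientation Q D → Contains G D

BarePaths7 : (Q : Graph) → ℕ → Set
BarePaths7 Q k = Σ (Fin k → Fin 7 → Fin (size Q)) λ P →
  (∀ a b i j → P a i ≡ P b j → (a ≡ b) × (i ≡ j)) ×
  (∀ a (i : Fin 6) → adj Q (P a (inject₁ i)) (P a (suc i)) ≡ true) ×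
  (∀ a (i : Fin 5) → degree Q (P a (suc (inject₁ i))) ≡ 2)

LeafEdges : (Q : Graph) → ℕ → Set
LeafEdges Q k = Σ (Fin k → Fin 2 → Fin (size Q)) λ E →
  (∀ a b i j → E a i ≡ E b j → (a ≡ b) × (i ≡ j)) ×
  (∀ a → adj Q (E a zero) (E a (suc zero)) ≡ true) ×
  (∀ a → degree Q (E a zero) ≡ 1)

{-# OPTIONS --safe #-}
module Submission where

open import Data.Nat as ℕ using (ℕ; zero; suc)
import Data.Nat.Properties as ℕₚ
open import Data.Fin as Fin using (Fin; zero; suc; toℕ)
import Data.Fin.Properties as Finₚ
open import Data.Bool as Bool using (Bool; true; false; if_then_else_; not; _∧_; _∨_)
open import Data.List as List using (List; []; _∷_)
open import Data.Product using (Σ; _×_; _,_; proj₁; proj₂; ∃; ∃-syntax)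
open import Data.Sum using (_⊎_; inj₁; inj₂)
open import Data.Empty using (⊥; ⊥-elim)
open import Data.Unit using (⊤; tt)
open import Relation.Nullary using (¬_; Dec; yes; no; does; contradiction)
open import Relation.Binary.PropositionalEquality hiding ([_])
open import Function using (_∘_; id)
open import Data.Maybe as Maybe using (Maybe; just; nothing)
open import Data.Integer as ℤ using (ℤ; -[1+_])
import Data.Integer.Properties as ℤₚ
import Data.Rational as ℚ
import Data.Rational.Properties as ℚₚ
import Data.Rational.Unnormalised as ℚᵘ
import Data.Rational.Unnormalised.Properties as ℚᵘₚ
open import Algebra.Bundles using (CommutativeRing)
open import Algebra.Structures using (IsCommutativeRing)
import Algebra.Solver.Ring as RingSolver
import Algebra.Solver.Ring.AlmostCommutativeRing as ACR
open import Data.Vec using (Vec; []; _∷_)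
import Data.Sum
open import Function.Bundles using (Inverse)
open import Data.Nat using (_!)
import Data.Nat.DivMod as DM
import Data.Nat.ListAction as ListAction
open ℚ using (ℚ)

-- Structure of `Q`. Following the operations, the vertices can be ranked so that every vertex has
-- one lower neighbour, its parent, except for O(|Q₀|²) exceptional vertices with at most two
-- (`graph-degen`). A leaf is ranked above its neighbour, a subdividing vertex between the ends of
-- its edge, and only the first subdivision of an edge of Q₀ creates an exceptional vertex. The
-- bound on |Q₀| leaves at most 2√n exceptional vertices. Cutting `Q` at these vertices and at every
-- k-th level, for a constant k and a suitable offset (`good-shift`), gives rooted trees of height
-- below k, so with at most (Δ+1)^k vertices; by the degree bound this is below any fixed power of n
-- (`degree-power`). Taken in order of rank, a tree meets earlier ones only at its root, which has
-- at most two earlier neighbours (`validP`).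
--
-- Embedding a tree. Suppose every in- and out-neighbourhood covers more than half of the free
-- vertices by a constant margin. The root goes into a common neighbourhood of the images of its
-- earlier neighbours. The arcs between free vertices carry a doubly stochastic matrix whose entries
-- on arcs are of order 1/r (`walk`, by augmenting paths), and the other vertices follow its walk,
-- forwards or backwards according to the orientation. Two rows overlap by a constant γ, so a vertex
-- at depth d is within (1-γ)^d of uniform (`E-mix`). Most vertices are deep, so a tree uses up
-- every neighbourhood almost in proportion to its density. The densities therefore change only by a
-- martingale and a small total bias. Collisions inside a tree are rare and are repaired.
--
-- Derandomising. A sum of fourth-moment terms, one for each neighbourhood, controls the
-- martingales. It does not increase on average, so each tree has an outcome that does not increase
-- it (`potential-step`), and the margin survives to the end as long as a linear number of host
-- vertices stays free (`loop`). This gives (1) (`spacious`).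
--
-- The tight case. Leaves, or middle vertices of the bare paths, have at most two neighbours and are
-- pairwise non-adjacent. A linear number M of them is set aside and the rest is embedded, which
-- leaves exactly M host vertices free. To put a set-aside vertex u at a free host vertex z, one
-- looks for another such vertex y whose image fits the images of the neighbours of u, while z fits
-- the images of the neighbours of y. Then u takes the place of y and y moves to z. There are 4n³
-- combinations of z with two signed host vertices. Each y passes a given one with constant
-- probability, and a second, exponential potential carried through the same loop makes more than M
-- vertices y pass each (`many-hits`). So the M swaps can be made greedily with distinct y
-- (`absorbed`), which gives (2).

module OrderedField where

  -- Ordered-field arithmetic with explicit certificates for inequalities.

  toℚ : ℤ → ℚ
  toℚ i = i ℚ./ 1

  private
    toℚᵘ-toℚ : ∀ i → ℚ.toℚᵘ (toℚ i) ℚᵘ.≃ (i ℚᵘ./ 1)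
    toℚᵘ-toℚ i = ℚₚ.toℚᵘ-fromℚᵘ (i ℚᵘ./ 1)

    toℚ-+ : ∀ i j → toℚ (i ℤ.+ j) ≡ toℚ i ℚ.+ toℚ j
    toℚ-+ i j = ℚₚ.toℚᵘ-injective (ℚᵘₚ.≃-trans (toℚᵘ-toℚ (i ℤ.+ j)) (ℚᵘₚ.≃-trans lem
      (ℚᵘₚ.≃-sym (ℚᵘₚ.≃-trans (ℚₚ.toℚᵘ-homo-+ (toℚ i) (toℚ j)) (ℚᵘₚ.+-cong (toℚᵘ-toℚ i) (toℚᵘ-toℚ j))))))
      where
      lem : ((i ℤ.+ j) ℚᵘ./ 1) ℚᵘ.≃ ((i ℚᵘ./ 1) ℚᵘ.+ (j ℚᵘ./ 1))
      lem = ℚᵘ.*≡* (cong (ℤ._* ℤ.+ 1) (sym (cong₂ ℤ._+_ (ℤₚ.*-identityʳ i) (ℤₚ.*-identityʳ j))))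

    toℚ-* : ∀ i j → toℚ (i ℤ.* j) ≡ toℚ i ℚ.* toℚ j
    toℚ-* i j = ℚₚ.toℚᵘ-injective (ℚᵘₚ.≃-trans (toℚᵘ-toℚ (i ℤ.* j))
      (ℚᵘₚ.≃-sym (ℚᵘₚ.≃-trans (ℚₚ.toℚᵘ-homo-* (toℚ i) (toℚ j)) (ℚᵘₚ.*-cong (toℚᵘ-toℚ i) (toℚᵘ-toℚ j)))))

    toℚ-neg : ∀ i → toℚ (ℤ.- i) ≡ ℚ.- toℚ i
    toℚ-neg i = ℚₚ.toℚᵘ-injective (ℚᵘₚ.≃-trans (toℚᵘ-toℚ (ℤ.- i))
      (ℚᵘₚ.≃-sym (ℚᵘₚ.≃-trans (ℚₚ.toℚᵘ-homo‿- (toℚ i)) (ℚᵘₚ.-‿cong (toℚᵘ-toℚ i)))))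

    toℚ-≤ : ∀ {i j} → i ℤ.≤ j → toℚ i ℚ.≤ toℚ j
    toℚ-≤ {i} {j} i≤j = ℚₚ.toℚᵘ-cancel-≤ (ℚᵘₚ.≤-respʳ-≃ (ℚᵘₚ.≃-sym (toℚᵘ-toℚ j))
      (ℚᵘₚ.≤-respˡ-≃ (ℚᵘₚ.≃-sym (toℚᵘ-toℚ i)) (ℚᵘ.*≤* (ℤₚ.*-monoʳ-≤-nonNeg (ℤ.+ 1) i≤j))))

    toℚ-< : ∀ {i j} → i ℤ.< j → toℚ i ℚ.< toℚ j
    toℚ-< {i} {j} i<j = ℚₚ.toℚᵘ-cancel-< (ℚᵘₚ.<-respʳ-≃ (ℚᵘₚ.≃-sym (toℚᵘ-toℚ j))
      (ℚᵘₚ.<-respˡ-≃ (ℚᵘₚ.≃-sym (toℚᵘ-toℚ i)) (ℚᵘ.*<* (ℤₚ.*-monoʳ-<-pos (ℤ.+ 1) i<j))))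

  infixl 6 _+_ _-_
  infixl 7 _*_
  infix 8 -_
  infix 4 _≤_ _<_

  -- An opaque copy of ℚ: unfolding the rational operations (which normalise by gcd) makes conversion checking intractable.
  opaque
    F : Set
    F = ℚ

    _+_ _*_ : F → F → F
    _+_ = ℚ._+_
    _*_ = ℚ._*_

    -_ : F → F
    -_ = ℚ.-_

    _≤_ _<_ : F → F → Set
    _≤_ = ℚ._≤_
    _<_ = ℚ._<_

    ℤ→F : ℤ → F
    ℤ→F = toℚ

    ℚ→F : ℚ → F
    ℚ→F q = q

    -- Made total by the default value 0 at 0, so that constants can be written without instance
    -- arguments; its two laws ask for a positive argument.
    recip : F → F
    recip p with p ℚ.≟ ℚ.0ℚ
    ... | yes _ = ℚ.0ℚ
    ... | no p≢0 = (ℚ.1/ p) {{ℚ.≢-nonZero p≢0}}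

  fromℕ : ℕ → F
  fromℕ n = ℤ→F (ℤ.+ n)

  0F 1F : F
  0F = fromℕ 0
  1F = fromℕ 1

  _-_ : F → F → F
  x - y = x + - y

  opaque
    unfolding F

    isCR : IsCommutativeRing (_≡_ {A = F}) _+_ _*_ -_ 0F 1F
    isCR = ℚₚ.+-*-isCommutativeRing

    ℤ→F-+ : ∀ i j → ℤ→F (i ℤ.+ j) ≡ ℤ→F i + ℤ→F j
    ℤ→F-+ = toℚ-+
    ℤ→F-* : ∀ i j → ℤ→F (i ℤ.* j) ≡ ℤ→F i * ℤ→F j
    ℤ→F-* = toℚ-*
    ℤ→F-neg : ∀ i → ℤ→F (ℤ.- i) ≡ - ℤ→F i
    ℤ→F-neg = toℚ-neg
    ℤ→F-≤ : ∀ {i j} → i ℤ.≤ j → ℤ→F i ≤ ℤ→F j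
    ℤ→F-≤ = toℚ-≤
    ℤ→F-< : ∀ {i j} → i ℤ.< j → ℤ→F i < ℤ→F j
    ℤ→F-< = toℚ-<

    ≤-refl : ∀ {x} → x ≤ x
    ≤-refl = ℚₚ.≤-refl
    ≤-trans : ∀ {x y z} → x ≤ y → y ≤ z → x ≤ z
    ≤-trans = ℚₚ.≤-trans
    ≤-antisym : ∀ {x y} → x ≤ y → y ≤ x → x ≡ y
    ≤-antisym = ℚₚ.≤-antisym
    ≤-<-trans : ∀ {x y z} → x ≤ y → y < z → x < z
    ≤-<-trans = ℚₚ.≤-<-trans
    <-≤-trans : ∀ {x y z} → x < y → y ≤ z → x < z
    <-≤-trans = ℚₚ.<-≤-trans
    <⇒≤ : ∀ {x y} → x < y → x ≤ y
    <⇒≤ = ℚₚ.<⇒≤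
    <-irrefl : ∀ {x} → ¬ (x < x)
    <-irrefl = ℚₚ.<-irrefl refl
    ≤-or-> : ∀ x y → x ≤ y ⊎ y < x
    ≤-or-> x y with x ℚₚ.≤? y
    ... | yes p = inj₁ p
    ... | no ¬p = inj₂ (ℚₚ.≰⇒> ¬p)
    +-mono-≤ : ∀ {x y u v} → x ≤ y → u ≤ v → x + u ≤ y + v
    +-mono-≤ = ℚₚ.+-mono-≤
    +-mono-<-≤ : ∀ {x y u v} → x < y → u ≤ v → x + u < y + v
    +-mono-<-≤ = ℚₚ.+-mono-<-≤
    *-nonneg : ∀ {x y} → 0F ≤ x → 0F ≤ y → 0F ≤ x * y
    *-nonneg {x} {y} p q = ℚₚ.nonNegative⁻¹ (x ℚ.* y) {{ℚₚ.nonNeg*nonNeg⇒nonNeg x {{ℚ.nonNegative p}} y {{ℚ.nonNegative q}}}}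
    *-pos : ∀ {x y} → 0F < x → 0F < y → 0F < x * y
    *-pos {x} {y} p q = ℚₚ.positive⁻¹ (x ℚ.* y) {{ℚₚ.pos*pos⇒pos x {{ℚ.positive p}} y {{ℚ.positive q}}}}
    recip-inv : ∀ {x} → 0F < x → x * recip x ≡ 1F
    recip-inv {x} 0<x with x ℚ.≟ ℚ.0ℚ
    ... | yes p = ⊥-elim (ℚₚ.<⇒≢ 0<x (sym p))
    ... | no p = ℚₚ.*-inverseʳ x {{ℚ.≢-nonZero p}}
    recip-pos : ∀ {x} → 0F < x → 0F < recip x
    recip-pos {x} 0<x with x ℚ.≟ ℚ.0ℚ
    ... | yes p = ⊥-elim (ℚₚ.<⇒≢ 0<x (sym p))
    ... | no p = ℚₚ.positive⁻¹ _ {{ℚₚ.1/pos⇒pos x {{ℚ.positive 0<x}}}}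

  ring : CommutativeRing _ _
  ring = record { isCommutativeRing = isCR }

  open CommutativeRing ring public using (semiring; +-comm; +-assoc; *-comm; *-assoc; *-identityˡ; *-identityʳ; +-identityˡ; +-identityʳ; zeroˡ; zeroʳ; distribˡ; distribʳ)

  private
    ℤ→F-dec : ∀ i j → Maybe (ℤ→F i ≡ ℤ→F j)
    ℤ→F-dec i j with i ℤₚ.≟ j
    ... | yes p = just (cong ℤ→F p)
    ... | no _ = nothing

    morphism : ℤ.+-*-rawRing ACR.-Raw-AlmostCommutative⟶ ACR.fromCommutativeRing ring
    morphism = record { ⟦_⟧ = ℤ→F ; +-homo = ℤ→F-+ ; *-homo = ℤ→F-* ; -‿homo = ℤ→F-neg ; 0-homo = refl ; 1-homo = refl }

    module S = RingSolver ℤ.+-*-rawRing (ACR.fromCommutativeRing ring) morphism ℤ→F-dec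
  -- Ring expressions with numbered variables. Unlike the library's polynomials they carry no implicit arguments, which keeps elaboration cheap.
  infix 4 _:=_
  infixl 7 _:+_ _:-_
  infixl 8 _:*_
  infix 9 :-_
  data Expr : Set where
    var # : ℕ → Expr
    _:+_ _:*_ _:-_ : Expr → Expr → Expr
    :-_ : Expr → Expr

  data Equation : Set where
    _:=_ : Expr → Expr → Equation

  valueOf : ∀ {n} → ℕ → Vec F n → F
  valueOf i [] = 0F
  valueOf zero (x ∷ ρ) = x
  valueOf (suc i) (x ∷ ρ) = valueOf i ρ

  evaluate : ∀ {n} → Expr → Vec F n → F
  evaluate (var i) ρ = valueOf i ρ
  evaluate (# k) ρ = fromℕ k
  evaluate (e :+ f) ρ = evaluate e ρ + evaluate f ρ
  evaluate (e :* f) ρ = evaluate e ρ * evaluate f ρ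
  evaluate (e :- f) ρ = evaluate e ρ - evaluate f ρ
  evaluate (:- e) ρ = - evaluate e ρ

  Equations : ℕ → Set
  Equations zero = Equation
  Equations (suc n) = Expr → Equations n

  instantiate : ∀ n → ℕ → Equations n → Equation
  instantiate zero k e = e
  instantiate (suc n) k f = instantiate n (suc k) (f (var k))

  ForAll : ∀ n → (Vec F n → Set) → Set
  ForAll zero P = P []
  ForAll (suc n) P = ∀ x → ForAll n (λ ρ → P (x ∷ ρ))

  HoldsAt : ∀ n → Equation → Vec F n → Set
  HoldsAt n (e := f) ρ = evaluate e ρ ≡ evaluate f ρ

  private
    index : ∀ n → ℕ → Maybe (Fin n)
    index zero i = nothing
    index (suc n) zero = just zero
    index (suc n) (suc i) = Maybe.map suc (index n i)

    variable′ : ∀ {n} → Maybe (Fin n) → S.Polynomial n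
    variable′ (just i) = S.var i
    variable′ nothing = S.con (ℤ.+ 0)

    poly : ∀ n → Expr → S.Polynomial n
    poly n (var i) = variable′ (index n i)
    poly n (# k) = S.con (ℤ.+ k)
    poly n (e :+ f) = poly n e S.:+ poly n f
    poly n (e :* f) = poly n e S.:* poly n f
    poly n (e :- f) = poly n e S.:- poly n f
    poly n (:- e) = S.:- poly n e

    valueOf-poly : ∀ {n} i (ρ : Vec F n) → S.⟦ variable′ (index n i) ⟧ ρ ≡ valueOf i ρ
    valueOf-poly i [] = refl
    valueOf-poly zero (x ∷ ρ) = refl
    valueOf-poly {suc n} (suc i) (x ∷ ρ) = trans (weaken (index n i)) (valueOf-poly i ρ)
      where
      weaken : (m : Maybe (Fin n)) → S.⟦ variable′ (Maybe.map suc m) ⟧ (x ∷ ρ) ≡ S.⟦ variable′ m ⟧ ρ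
      weaken (just _) = refl
      weaken nothing = refl

    evaluate-poly : ∀ {n} e (ρ : Vec F n) → S.⟦ poly n e ⟧ ρ ≡ evaluate e ρ
    evaluate-poly (var i) ρ = valueOf-poly i ρ
    evaluate-poly (# k) ρ = refl
    evaluate-poly (e :+ f) ρ = cong₂ _+_ (evaluate-poly e ρ) (evaluate-poly f ρ)
    evaluate-poly (e :* f) ρ = cong₂ _*_ (evaluate-poly e ρ) (evaluate-poly f ρ)
    evaluate-poly (e :- f) ρ = cong₂ _-_ (evaluate-poly e ρ) (evaluate-poly f ρ)
    evaluate-poly (:- e) ρ = cong -_ (evaluate-poly e ρ)

    generalise : ∀ n {P : Vec F n → Set} → (∀ ρ → P ρ) → ForAll n P
    generalise zero h = h []
    generalise (suc n) h x = generalise n (λ ρ → h (x ∷ ρ))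

  SameNormalForm : ∀ n → Equation → Set
  SameNormalForm n (e := f) = S.normalise (poly n e) ≡ S.normalise (poly n f)

  private
    holds : ∀ n eqn → SameNormalForm n eqn → ∀ ρ → HoldsAt n eqn ρ
    holds n (e := f) same ρ = trans (sym (evaluate-poly e ρ)) (trans (S.prove ρ (poly n e) (poly n f) (cong (λ p → S.⟦ p ⟧N ρ) same)) (evaluate-poly f ρ))

  -- The obligation is an equality of normal forms with integer coefficients, so `refl` settles it
  -- by computation in ℤ and never meets the opaque operations of `F`.
  solve : ∀ n (f : Equations n) → SameNormalForm n (instantiate n 0 f) → ForAll n (HoldsAt n (instantiate n 0 f))
  solve n f same = generalise n (holds n (instantiate n 0 f) same)

  ≤-reflexive : ∀ {x y} → x ≡ y → x ≤ y
  ≤-reflexive refl = ≤-refl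

  0≤fromℕ : ∀ n → 0F ≤ fromℕ n
  0≤fromℕ n = ℤ→F-≤ (ℤ.+≤+ ℕ.z≤n)

  0<fromℕ : ∀ n → 0F < fromℕ (suc n)
  0<fromℕ n = ℤ→F-< (ℤ.+<+ (ℕ.s≤s ℕ.z≤n))

  fromℕ-≤ : ∀ {m n} → m ℕ.≤ n → fromℕ m ≤ fromℕ n
  fromℕ-≤ p = ℤ→F-≤ (ℤ.+≤+ p)

  fromℕ-< : ∀ {m n} → m ℕ.< n → fromℕ m < fromℕ n
  fromℕ-< p = ℤ→F-< (ℤ.+<+ p)

  <⇒≱ : ∀ {x y} → x < y → ¬ (y ≤ x)
  <⇒≱ p q = <-irrefl (<-≤-trans p q)

  fromℕ-≤⁻ : ∀ {m n} → fromℕ m ≤ fromℕ n → m ℕ.≤ n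
  fromℕ-≤⁻ {m} {n} p with m ℕ.≤? n
  ... | yes q = q
  ... | no q = ⊥-elim (<⇒≱ (fromℕ-< (ℕₚ.≰⇒> q)) p)

  fromℕ-<⁻ : ∀ {m n} → fromℕ m < fromℕ n → m ℕ.< n
  fromℕ-<⁻ {m} {n} p with m ℕ.<? n
  ... | yes q = q
  ... | no q = ⊥-elim (<⇒≱ p (fromℕ-≤ (ℕₚ.≮⇒≥ q)))

  fromℕ-+ : ∀ m n → fromℕ (m ℕ.+ n) ≡ fromℕ m + fromℕ n
  fromℕ-+ m n = ℤ→F-+ (ℤ.+ m) (ℤ.+ n)

  fromℕ-* : ∀ m n → fromℕ (m ℕ.* n) ≡ fromℕ m * fromℕ n
  fromℕ-* m n = trans (cong ℤ→F (ℤₚ.pos-* m n)) (ℤ→F-* (ℤ.+ m) (ℤ.+ n))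

  fromℕ-suc : ∀ n → fromℕ (suc n) ≡ 1F + fromℕ n
  fromℕ-suc n = fromℕ-+ 1 n

  ≤⇒0≤- : ∀ {x y} → x ≤ y → 0F ≤ y - x
  ≤⇒0≤- {x} {y} p = subst (_≤ y - x) (solve 1 (λ x → x :- x := # 0) refl x) (+-mono-≤ p (≤-refl { - x}))

  <⇒0<- : ∀ {x y} → x < y → 0F < y - x
  <⇒0<- {x} {y} p = subst (_< y - x) (solve 1 (λ x → x :- x := # 0) refl x) (+-mono-<-≤ p (≤-refl { - x}))

  infixr 5 _⊹_ _⊹<_

  _⊹_ : ∀ {x y} → 0F ≤ x → 0F ≤ y → 0F ≤ x + y
  _⊹_ {x} {y} p q = subst (_≤ x + y) (+-identityˡ 0F) (+-mono-≤ p q)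

  _⊹<_ : ∀ {x y} → 0F < x → 0F ≤ y → 0F < x + y
  _⊹<_ {x} {y} p q = subst (_< x + y) (+-identityˡ 0F) (+-mono-<-≤ p q)

  sc : ∀ c {p q} → p ≤ q → 0F ≤ fromℕ c * (q - p)
  sc c h = *-nonneg (0≤fromℕ c) (≤⇒0≤- h)

  sc< : ∀ c {p q} → p < q → 0F < fromℕ (suc c) * (q - p)
  sc< c h = *-pos (0<fromℕ c) (<⇒0<- h)

  -- A positivity certificate: a positive multiple of b - a is written as a sum of nonnegative
  -- terms. The terms come from hypotheses scaled by `sc` and from products by `*-nonneg`, are
  -- joined by `⊹`, and the identity is left to `solve`. Nearly every inequality below is proved
  -- this way, with `lin<` for the strict ones.
  lin : ∀ m {a b d} → 0F ≤ d → fromℕ (suc m) * (b - a) ≡ d → a ≤ b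
  lin m {a} {b} {d} 0≤d eq with ≤-or-> a b
  ... | inj₁ a≤b = a≤b
  ... | inj₂ b<a = ⊥-elim (<⇒≱ (subst (0F <_) (solve 3 (λ k a b → k :* (a :- b) := :- (k :* (b :- a))) refl (fromℕ (suc m)) a b) (sc< m b<a))
      (subst (_≤ 0F) (cong -_ (sym eq)) (subst (_≤ 0F) (solve 1 (λ d → # 0 :- d := :- d) refl d)
        (subst (0F - d ≤_) (solve 1 (λ d → d :- d := # 0) refl d) (+-mono-≤ 0≤d ≤-refl)))))

  lin< : ∀ m {a b d} → 0F < d → fromℕ (suc m) * (b - a) ≡ d → a < b
  lin< m {a} {b} 0<d eq with ≤-or-> b a
  ... | inj₂ a<b = a<b
  ... | inj₁ b≤a = ⊥-elim (<⇒≱ 0<d (subst (_≤ 0F) eq (lin 0 (sc (suc m) b≤a)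
      (solve 3 (λ k a b → # 1 :* (# 0 :- k :* (b :- a)) := k :* (a :- b)) refl (fromℕ (suc m)) a b))))

  opaque
    unfolding F

    ℚ→F-≤ : ∀ {p q} → p ℚ.≤ q → ℚ→F p ≤ ℚ→F q
    ℚ→F-≤ h = h
    ℚ→F-≤⁻ : ∀ {p q} → ℚ→F p ≤ ℚ→F q → p ℚ.≤ q
    ℚ→F-≤⁻ h = h
    ℚ→F-+ : ∀ p q → ℚ→F (p ℚ.+ q) ≡ ℚ→F p + ℚ→F q
    ℚ→F-+ p q = refl
    ℚ→F-* : ∀ p q → ℚ→F (p ℚ.* q) ≡ ℚ→F p * ℚ→F q
    ℚ→F-* p q = refl
    ℚ→F-ℕ : ∀ m → ℚ→F (ℤ.+ m ℚ./ 1) ≡ fromℕ m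
    ℚ→F-ℕ m = refl
    ℚ→F-0 : ℚ→F ℚ.0ℚ ≡ 0F
    ℚ→F-0 = refl
    ℚ→F-1 : ℚ→F ℚ.1ℚ ≡ 1F
    ℚ→F-1 = refl
    ℚ→F-½ : fromℕ 2 * ℚ→F ℚ.½ ≡ 1F
    ℚ→F-½ = refl

    ℚ→F-recip : ∀ m .{{_ : ℕ.NonZero m}} → fromℕ m * ℚ→F (ℤ.+ 1 ℚ./ m) ≡ 1F
    ℚ→F-recip m = ℚₚ.toℚᵘ-injective (ℚᵘₚ.≃-trans (ℚₚ.toℚᵘ-homo-* (toℚ (ℤ.+ m)) (ℤ.+ 1 ℚ./ m))
      (ℚᵘₚ.≃-trans (ℚᵘₚ.*-cong (toℚᵘ-toℚ (ℤ.+ m)) (toℚᵘ-/ 1 m)) (cross m)))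
      where
      toℚᵘ-/ : ∀ i m .{{_ : ℕ.NonZero m}} → ℚ.toℚᵘ (ℤ.+ i ℚ./ m) ℚᵘ.≃ (ℤ.+ i ℚᵘ./ m)
      toℚᵘ-/ i (suc m) = ℚₚ.toℚᵘ-fromℚᵘ (ℤ.+ i ℚᵘ./ suc m)
      cross : ∀ m .{{_ : ℕ.NonZero m}} → ((ℤ.+ m ℚᵘ./ 1) ℚᵘ.* (ℤ.+ 1 ℚᵘ./ m)) ℚᵘ.≃ ℚ.toℚᵘ ℚ.1ℚ
      cross (suc m) = ℚᵘ.*≡* (trans (ℤₚ.*-identityʳ _) (trans (ℤₚ.*-identityʳ _) (sym (trans (ℤₚ.*-identityˡ _) (cong ℤ.+_ (ℕₚ.*-identityˡ (suc m)))))))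

    -- The denominator of q is such a multiplier, since it turns q into a positive integer.
    archimedean : ∀ q → ℚ.0ℚ ℚ.< q → ∃[ m ] 1F ≤ fromℕ (suc m) * ℚ→F q
    archimedean q@(ℚ.mkℚ (ℤ.+ suc n) d _) _ = d , ℚₚ.toℚᵘ-cancel-≤ (ℚᵘₚ.≤-respʳ-≃ (ℚᵘₚ.≃-sym (ℚᵘₚ.≃-trans (ℚₚ.toℚᵘ-homo-* (toℚ (ℤ.+ suc d)) q) (ℚᵘₚ.*-cong (toℚᵘ-toℚ (ℤ.+ suc d)) ℚᵘₚ.≃-refl)))
      (ℚᵘ.*≤* (ℤ.+≤+ (bound n d))))
      where
      bound : ∀ n d → 1 ℕ.* (1 ℕ.* suc d) ℕ.≤ (suc d ℕ.* suc n) ℕ.* 1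
      bound n d = subst₂ ℕ._≤_ (sym (trans (ℕₚ.*-identityˡ _) (ℕₚ.*-identityˡ _))) (sym (ℕₚ.*-identityʳ _)) (ℕₚ.m≤m*n (suc d) (suc n))
    archimedean (ℚ.mkℚ (ℤ.+ 0) d _) (ℚ.*<* (ℤ.+<+ ()))
    archimedean (ℚ.mkℚ -[1+ n ] d _) (ℚ.*<* ())

-- Finite sums, counting and selection from averages.

module Sums where
  open OrderedField

  sq-nonneg : ∀ x → 0F ≤ x * x
  sq-nonneg x with ≤-or-> 0F x
  ... | inj₁ p = *-nonneg p p
  ... | inj₂ p = (lin 0 (sc 1 (*-nonneg (≤⇒0≤- (<⇒≤ p)) (≤⇒0≤- (<⇒≤ p)))) (solve 1 (λ x → # 1 :* ((x :* x) :- # 0) := # 1 :* (((# 0 :- x) :* (# 0 :- x)) :- # 0)) refl x))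

  [_] : Bool → F
  [ true ] = 1F
  [ false ] = 0F

  0≤1 : 0F ≤ 1F
  0≤1 = 0≤fromℕ 1

  []-nonneg : ∀ b → 0F ≤ [ b ]
  []-nonneg true = 0≤1
  []-nonneg false = ≤-refl

  []-≤1 : ∀ b → [ b ] ≤ 1F
  []-≤1 true = ≤-refl
  []-≤1 false = 0≤1

  opaque
    -- Opaque so that sums do not unfold inside goals; `sum-0` and `sum-suc` are its computation
    -- rules.
    sum : ∀ {n} → (Fin n → F) → F
    sum {zero} f = 0F
    sum {suc n} f = f zero + sum (f ∘ suc)

    sum-0 : (f : Fin 0 → F) → sum f ≡ 0F
    sum-0 f = refl

    sum-suc : ∀ {n} (f : Fin (suc n) → F) → sum f ≡ f zero + sum (f ∘ suc)
    sum-suc f = refl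

  opaque
    unfolding sum

    sum-mono : ∀ {n} {f g : Fin n → F} → (∀ i → f i ≤ g i) → sum f ≤ sum g
    sum-mono {zero} h = ≤-refl
    sum-mono {suc n} h = +-mono-≤ (h zero) (sum-mono (h ∘ suc))

    sum-cong : ∀ {n} {f g : Fin n → F} → (∀ i → f i ≡ g i) → sum f ≡ sum g
    sum-cong {zero} h = refl
    sum-cong {suc n} h = cong₂ _+_ (h zero) (sum-cong (h ∘ suc))

    sum-const : ∀ n c → sum {n} (λ _ → c) ≡ fromℕ n * c
    sum-const zero c = (solve 1 (λ c → # 0 := # 0 :* c) refl c)
    sum-const (suc n) c = trans (cong (c +_) (sum-const n c))
      (trans (solve 2 (λ c m → c :+ (m :* c) := (# 1 :+ m) :* c) refl c (fromℕ n)) (cong (_* c) (sym (fromℕ-suc n))))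

  sum-zero : ∀ {n} {f : Fin n → F} → (∀ i → f i ≡ 0F) → sum f ≡ 0F
  sum-zero {n} h = trans (sum-cong h) (trans (sum-const n 0F) (zeroʳ _))

  sum-nonneg : ∀ {n} {f : Fin n → F} → (∀ i → 0F ≤ f i) → 0F ≤ sum f
  sum-nonneg {n} {f} h = subst (_≤ sum f) (sum-zero {n} (λ _ → refl)) (sum-mono h)

  opaque
    unfolding sum

    sum-+ : ∀ {n} (f g : Fin n → F) → sum (λ i → f i + g i) ≡ sum f + sum g
    sum-+ {zero} f g = (solve 0 (# 0 := # 0 :+ # 0) refl )
    sum-+ {suc n} f g = trans (cong (f zero + g zero +_) (sum-+ (f ∘ suc) (g ∘ suc)))
      (solve 4 (λ a b c d → (a :+ b) :+ (c :+ d) := (a :+ c) :+ (b :+ d)) refl (f zero) (g zero) (sum (f ∘ suc)) (sum (g ∘ suc)))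

    sum-*ˡ : ∀ {n} c (f : Fin n → F) → sum (λ i → c * f i) ≡ c * sum f
    sum-*ˡ {zero} c f = sym (zeroʳ c)
    sum-*ˡ {suc n} c f = trans (cong (c * f zero +_) (sum-*ˡ c (f ∘ suc))) (sym (distribˡ c _ _))

    sum-*ʳ : ∀ {n} c (f : Fin n → F) → sum (λ i → f i * c) ≡ sum f * c
    sum-*ʳ c f = trans (sum-cong (λ i → *-comm (f i) c)) (trans (sum-*ˡ c f) (*-comm c _))

  sum-neg : ∀ {n} (f : Fin n → F) → sum (λ i → - f i) ≡ - sum f
  sum-neg f = trans (sum-cong (λ i → (solve 1 (λ x → :- x := (:- # 1) :* x) refl (f i))))
    (trans (sum-*ˡ (- 1F) f) (solve 1 (λ x → (:- # 1) :* x := :- x) refl (sum f)))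

  sum-minus : ∀ {n} (f g : Fin n → F) → sum (λ i → f i - g i) ≡ sum f - sum g
  sum-minus f g = trans (sum-+ f (λ i → - g i)) (cong (sum f +_) (sum-neg g))

  opaque
    unfolding sum

    sum-swap : ∀ {m n} (f : Fin m → Fin n → F) → sum (λ i → sum (f i)) ≡ sum (λ j → sum (λ i → f i j))
    sum-swap {zero} {n} f = sym (sum-zero {n} (λ _ → refl))
    sum-swap {suc m} {n} f = trans (cong (sum (f zero) +_) (sum-swap (f ∘ suc))) (sym (sum-+ (f zero) _))

    term≤sum : ∀ {n} {f : Fin n → F} → (∀ i → 0F ≤ f i) → ∀ i → f i ≤ sum f
    term≤sum {suc n} {f} h zero = (lin 0 (sc 1 (sum-nonneg (h ∘ suc))) (solve 2 (λ x y → # 1 :* ((x :+ y) :- x) := # 1 :* (y :- # 0)) refl (f zero) (sum (f ∘ suc))))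
    term≤sum {suc n} {f} h (suc i) = (lin 0 (sc 1 (h zero) ⊹ sc 1 (term≤sum (h ∘ suc) i)) (solve 3 (λ x z y → # 1 :* ((x :+ y) :- z) := (# 1 :* (x :- # 0)) :+ (# 1 :* (y :- z))) refl (f zero) (f (suc i)) (sum (f ∘ suc))))

    -- Comparing sums yields a term where the comparison holds.
    sum-<⇒∃ : ∀ {n} (f g : Fin n → F) → sum f < sum g → ∃[ i ] f i < g i
    sum-<⇒∃ {zero} f g h = ⊥-elim (<-irrefl h)
    sum-<⇒∃ {suc n} f g h = go (≤-or-> (g zero) (f zero))
      where
      go : g zero ≤ f zero ⊎ f zero < g zero → ∃[ i ] f i < g i
      go (inj₂ p) = zero , p
      go (inj₁ p) = let i , q = sum-<⇒∃ (f ∘ suc) (g ∘ suc) (lin< 0 (sc< 0 h ⊹< sc 1 p) (solve 4 (λ a b x y → # 1 :* (y :- x) := (# 1 :* ((b :+ y) :- (a :+ x))) :+ (# 1 :* (a :- b))) refl (f zero) (g zero) (sum (f ∘ suc)) (sum (g ∘ suc)))) in suc i , q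

    sum-≤⇒∃ : ∀ {n} (f g : Fin (suc n) → F) → sum f ≤ sum g → ∃[ i ] f i ≤ g i
    sum-≤⇒∃ {zero} f g h = zero , (lin 0 (sc 1 h) (solve 2 (λ a b → # 1 :* (b :- a) := # 1 :* ((b :+ # 0) :- (a :+ # 0))) refl (f zero) (g zero)))
    sum-≤⇒∃ {suc n} f g h = go (≤-or-> (f zero) (g zero))
      where
      go : f zero ≤ g zero ⊎ g zero < f zero → ∃[ i ] f i ≤ g i
      go (inj₁ p) = zero , p
      go (inj₂ p) = let i , q = sum-≤⇒∃ (f ∘ suc) (g ∘ suc) (lin 0 (sc 1 h ⊹ sc 1 (<⇒≤ p)) (solve 4 (λ a b x y → # 1 :* (y :- x) := (# 1 :* ((b :+ y) :- (a :+ x))) :+ (# 1 :* (a :- b))) refl (f zero) (g zero) (sum (f ∘ suc)) (sum (g ∘ suc)))) in suc i , q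

    argmin : ∀ {n} (f : Fin (suc n) → F) → ∃[ i ] (∀ j → f i ≤ f j)
    argmin {zero} f = zero , λ { zero → ≤-refl }
    argmin {suc n} f with argmin (f ∘ suc)
    ... | i , h with ≤-or-> (f zero) (f (suc i))
    ... | inj₁ p = zero , λ { zero → ≤-refl ; (suc j) → ≤-trans p (h j) }
    ... | inj₂ p = suc i , λ { zero → <⇒≤ p ; (suc j) → h j }

  _==_ : ∀ {n} → Fin n → Fin n → Bool
  i == j = does (i Finₚ.≟ j)

  ==-refl : ∀ {n} (i : Fin n) → (i == i) ≡ true
  ==-refl i with i Finₚ.≟ i
  ... | yes _ = refl
  ... | no q = ⊥-elim (q refl)

  ==⇒≡ : ∀ {n} (i j : Fin n) → (i == j) ≡ true → i ≡ j
  ==⇒≡ i j h with i Finₚ.≟ j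
  ... | yes p = p

  ≢⇒== : ∀ {n} {i j : Fin n} → ¬ i ≡ j → (i == j) ≡ false
  ≢⇒== {i = i} {j} h with i Finₚ.≟ j
  ... | yes p = ⊥-elim (h p)
  ... | no _ = refl

  opaque
    unfolding sum

    sum-δ : ∀ {n} (k : Fin n) (f : Fin n → F) → sum (λ i → [ i == k ] * f i) ≡ f k
    sum-δ {suc n} zero f = trans (cong₂ _+_ (*-identityˡ (f zero)) (sum-zero {n} (λ i → zeroˡ (f (suc i))))) (+-identityʳ (f zero))
    sum-δ {suc n} (suc k) f = trans (cong₂ _+_ (zeroˡ (f zero)) (trans (sum-cong (λ i → cong (λ b → [ b ] * f (suc i)) (lem i))) (sum-δ k (f ∘ suc)))) (+-identityˡ _)
      where
      lem : ∀ i → (suc i == suc k) ≡ (i == k)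
      lem i with i Finₚ.≟ k
      ... | yes _ = refl
      ... | no _ = refl

  sum-[==] : ∀ {n} (k : Fin n) → sum (λ i → [ i == k ]) ≡ 1F
  sum-[==] k = trans (sum-cong (λ i → sym (*-identityʳ [ i == k ]))) (sum-δ k (λ _ → 1F))

  Bool-dec : ∀ b → b ≡ true ⊎ b ≡ false
  Bool-dec true = inj₁ refl
  Bool-dec false = inj₂ refl

  ∧-true : ∀ {a b} → a ∧ b ≡ true → a ≡ true × b ≡ true
  ∧-true {true} {true} _ = refl , refl

  ∨-false : ∀ a b → a ∨ b ≡ false → a ≡ false × b ≡ false
  ∨-false false false _ = refl , refl

  []-∧ : ∀ a b → [ a ∧ b ] ≡ [ a ] * [ b ]
  []-∧ true b = sym (*-identityˡ [ b ])
  []-∧ false b = sym (zeroˡ [ b ])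

  count-mono : ∀ {n} {a b : Fin n → Bool} → (∀ i → a i ≡ true → b i ≡ true) → sum (λ i → [ a i ]) ≤ sum (λ i → [ b i ])
  count-mono {a = a} {b} h = sum-mono lem
    where
    lem : ∀ i → [ a i ] ≤ [ b i ]
    lem i with a i in e
    ... | false = []-nonneg (b i)
    ... | true = ≤-reflexive (cong [_] (sym (h i e)))

  -- Inclusion–exclusion: two sets cover at most everything.
  count-∧ : ∀ {n} (a b : Fin n → Bool) → sum (λ i → [ a i ]) + sum (λ i → [ b i ]) ≤ fromℕ n + sum (λ i → [ a i ∧ b i ])
  count-∧ {n} a b = subst₂ _≤_ (sum-+ _ _) (trans (sum-+ _ _) (cong (_+ sum (λ i → [ a i ∧ b i ])) (trans (sum-const n 1F) (*-identityʳ _)))) (sum-mono lem)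
    where
    lem : ∀ i → [ a i ] + [ b i ] ≤ 1F + [ a i ∧ b i ]
    lem i with a i | b i
    ... | true | true = ≤-refl
    ... | true | false = ≤-refl
    ... | false | true = (lin 0 (0≤fromℕ 0) (solve 0 (# 1 :* ((# 1 :+ # 0) :- (# 0 :+ # 1)) := # 0) refl ))
    ... | false | false = (lin 0 (0≤fromℕ 1) (solve 0 (# 1 :* ((# 1 :+ # 0) :- (# 0 :+ # 0)) := # 1) refl ))

  []<[]⇒ : ∀ {a b} → [ a ] < [ b ] → a ≡ false × b ≡ true
  []<[]⇒ {true} {b} h = ⊥-elim (<⇒≱ h ([]-≤1 b))
  []<[]⇒ {false} {true} h = refl , refl
  []<[]⇒ {false} {false} h = ⊥-elim (<-irrefl h)

  0<[]⇒ : ∀ {b} → 0F < [ b ] → b ≡ true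
  0<[]⇒ {true} _ = refl
  0<[]⇒ {false} h = ⊥-elim (<-irrefl h)

  count-pos⇒∃ : ∀ {n} (a : Fin n → Bool) → 0F < sum (λ i → [ a i ]) → ∃[ i ] a i ≡ true
  count-pos⇒∃ {n} a h with sum-<⇒∃ {n} (λ _ → 0F) (λ i → [ a i ]) (subst (_< sum (λ i → [ a i ])) (sym (sum-zero {n} (λ _ → refl))) h)
  ... | i , p = i , 0<[]⇒ p

  mul-mono : ∀ {a b c} → 0F ≤ a → b ≤ c → a * b ≤ a * c
  mul-mono {a} {b} {c} h p = (lin 0 (sc 1 (*-nonneg h (≤⇒0≤- p))) (solve 3 (λ a b c → # 1 :* ((a :* c) :- (a :* b)) := # 1 :* ((a :* (c :- b)) :- # 0)) refl a b c))

  mul-mono₂ : ∀ {a b c d} → 0F ≤ a → 0F ≤ c → a ≤ b → c ≤ d → a * c ≤ b * d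
  mul-mono₂ {a} {b} {c} {d} ha hc p q = (lin 0 (sc 1 (*-nonneg ha (≤⇒0≤- q)) ⊹ sc 1 (*-nonneg (≤⇒0≤- p) (≤-trans hc q))) (solve 4 (λ a b c d → # 1 :* ((b :* d) :- (a :* c)) := (# 1 :* ((a :* (d :- c)) :- # 0)) :+ (# 1 :* (((b :- a) :* d) :- # 0))) refl a b c d))

  mul-cancel : ∀ {a b c} → 0F < a → a * b ≤ a * c → b ≤ c
  mul-cancel {a} {b} {c} h p with ≤-or-> b c
  ... | inj₁ q = q
  ... | inj₂ q = ⊥-elim (<-irrefl (lin< 0 (sc< 0 (*-pos h (<⇒0<- q)) ⊹< sc 1 p) (solve 3 (λ a b c → # 1 :* (# 0 :- # 0) := (# 1 :* ((a :* (b :- c)) :- # 0)) :+ (# 1 :* ((a :* c) :- (a :* b)))) refl a b c)))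

  search : ∀ {n} {A B : Fin n → Set} → (∀ i → A i ⊎ B i) → (∃[ i ] A i) ⊎ (∀ i → B i)
  search {zero} h = inj₂ λ ()
  search {suc n} h with h zero | search (h ∘ suc)
  ... | inj₁ a | _ = inj₁ (zero , a)
  ... | inj₂ _ | inj₁ (i , a) = inj₁ (suc i , a)
  ... | inj₂ b | inj₂ f = inj₂ λ { zero → b ; (suc i) → f i }

  -- Integrality inside `F`: a strict inequality between two counts can then be sharpened by one
  -- (`IsNat-<⇒`), which the augmenting-path argument needs.
  IsNat : F → Set
  IsNat x = ∃[ k ] x ≡ fromℕ k

  IsNat-+ : ∀ {x y} → IsNat x → IsNat y → IsNat (x + y)
  IsNat-+ (k , refl) (l , refl) = k ℕ.+ l , sym (fromℕ-+ k l)

  IsNat-[] : ∀ b → IsNat [ b ]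
  IsNat-[] true = 1 , refl
  IsNat-[] false = 0 , refl

  opaque
    unfolding sum

    IsNat-sum : ∀ {n} {f : Fin n → F} → (∀ i → IsNat (f i)) → IsNat (sum f)
    IsNat-sum {zero} h = 0 , refl
    IsNat-sum {suc n} h = IsNat-+ (h zero) (IsNat-sum (h ∘ suc))

  IsNat-<⇒ : ∀ {x y} → IsNat x → IsNat y → x < y → 1F + x ≤ y
  IsNat-<⇒ (k , refl) (l , refl) p = subst (_≤ fromℕ l) (fromℕ-suc k) (fromℕ-≤ (fromℕ-<⁻ p))

  sum-strict : ∀ {n} {f g : Fin n → F} → (∀ i → f i ≤ g i) → ∀ k → f k < g k → sum f < sum g
  sum-strict {f = f} {g} h k lt = (lin< 0 (sc< 0 (<⇒0<- lt) ⊹< sc 1 (term≤sum (λ i → ≤⇒0≤- (h i)) k) ⊹ sc 1 (≤-reflexive (sum-minus g f))) (solve 4 (λ x y d e → # 1 :* (y :- x) := (# 1 :* (e :- # 0)) :+ ((# 1 :* (d :- e)) :+ (# 1 :* ((y :- x) :- d)))) refl (sum f) (sum g) (sum (λ i → g i - f i)) (g k - f k)))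

  infixl 4 _≤≡_
  infixr 3 _≡≤_
  _≤≡_ : ∀ {x y z} → x ≤ y → y ≡ z → x ≤ z
  p ≤≡ refl = p

  _≡≤_ : ∀ {x y z} → x ≡ y → y ≤ z → x ≤ z
  refl ≡≤ p = p

  gcount : ∀ {m} → (Fin m → Bool) → ℕ
  gcount {zero} f = 0
  gcount {suc m} f = (if f zero then 1 else 0) ℕ.+ gcount (f ∘ suc)

  gcount-sum : ∀ {m} (f : Fin m → Bool) → fromℕ (gcount f) ≡ sum (λ i → [ f i ])
  gcount-sum {zero} f = sym (sum-0 _)
  gcount-sum {suc m} f = trans (fromℕ-+ _ (gcount (f ∘ suc))) (sym (trans (sum-suc _) (cong₂ _+_ (lem (f zero)) (sym (gcount-sum (f ∘ suc))))))
    where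
    lem : ∀ c → [ c ] ≡ fromℕ (if c then 1 else 0)
    lem true = refl
    lem false = refl

-- A nearly uniform doubly stochastic matrix on a dense digraph.

module Transport where
  open OrderedField
  open Sums

  -- A symmetric formulation of "minimum degree at least (1/2 + 1/b) r" for a relation on Fin r.
  record Dense (b r : ℕ) (a : Fin r → Fin r → Bool) : Set where
    field
      out : ∀ i → (fromℕ b + fromℕ 2) * fromℕ r ≤ fromℕ 2 * fromℕ b * sum (λ j → [ a i j ])
      inn : ∀ j → (fromℕ b + fromℕ 2) * fromℕ r ≤ fromℕ 2 * fromℕ b * sum (λ i → [ a i j ])

  hh : ℕ → ℕ
  hh b = b ℕ.+ 2

  -- With line sums r(b+2), at most r/(2b) entries of a line can reach this cap. A line of `a` thus
  -- keeps at least (1/2 + 1/(2b))r entries that can still grow.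
  cap : ℕ → ℕ
  cap b = 2 ℕ.* b ℕ.* hh b

  module Flow {b r : ℕ} (0<b : 0 ℕ.< b) (0<r : 0 ℕ.< r) (a : Fin r → Fin r → Bool) (dense : Dense b r a) where
    open Dense dense

    t : F
    t = fromℕ (r ℕ.* hh b)

    private
      Mat : Set
      Mat = Fin r → Fin r → ℕ

    row col : Mat → Fin r → F
    row B i = sum (λ j → fromℕ (B i j))
    col B j = sum (λ i → fromℕ (B i j))

    private
      dout din : Fin r → F
      dout i = sum (λ j → [ a i j ])
      din j = sum (λ i → [ a i j ])

    total : Mat → F
    total B = sum (row B)

    -- `B` is the weight on top of the 0/1 matrix of `a`. Every arc keeps weight at least one in the
    -- sum, and this is where the field `lower` of `Walk` comes from.
    record Partial (B : Mat) : Set where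
      field
        supp : ∀ i j → a i j ≡ false → B i j ≡ 0
        capped : ∀ i j → B i j ℕ.≤ cap b
        row≤ : ∀ i → dout i + row B i ≤ t
        col≤ : ∀ j → din j + col B j ≤ t

    at : Fin r → Fin r → Fin r → Fin r → Bool
    at x y i j = (i == x) ∧ (j == y)

    inc dec : Fin r → Fin r → Mat → Mat
    inc x y B i j = if at x y i j then suc (B i j) else B i j
    dec x y B i j = if at x y i j then ℕ.pred (B i j) else B i j

    private
      inc-F : ∀ x y B i j → fromℕ (inc x y B i j) ≡ fromℕ (B i j) + [ i == x ] * [ j == y ]
      inc-F x y B i j with i == x | j == y
      ... | true | true = trans (fromℕ-suc (B i j)) (solve 1 (λ k → # 1 :+ k := k :+ (# 1 :* # 1)) refl (fromℕ (B i j)))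
      ... | true | false = (solve 1 (λ k → k := k :+ (# 1 :* # 0)) refl (fromℕ (B i j)))
      ... | false | true = (solve 1 (λ k → k := k :+ (# 0 :* # 1)) refl (fromℕ (B i j)))
      ... | false | false = (solve 1 (λ k → k := k :+ (# 0 :* # 0)) refl (fromℕ (B i j)))

      dec-F : ∀ x y B → 0 ℕ.< B x y → ∀ i j → fromℕ (dec x y B i j) ≡ fromℕ (B i j) - [ i == x ] * [ j == y ]
      dec-F x y B pos i j with i == x in e₁ | j == y in e₂
      ... | true | false = (solve 1 (λ k → k := k :- (# 1 :* # 0)) refl (fromℕ (B i j)))
      ... | false | true = (solve 1 (λ k → k := k :- (# 0 :* # 1)) refl (fromℕ (B i j)))
      ... | false | false = (solve 1 (λ k → k := k :- (# 0 :* # 0)) refl (fromℕ (B i j)))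
      ... | true | true with ==⇒≡ i x e₁ | ==⇒≡ j y e₂
      ... | refl | refl with B i j | pos
      ... | suc k | _ = trans (solve 1 (λ k → k := (# 1 :+ k) :- (# 1 :* # 1)) refl (fromℕ k)) (cong (_- (1F * 1F)) (sym (fromℕ-suc k)))

    private
      row-upd : ∀ (f : Fin r → F) (c : F) y → sum (λ j → f j + c * [ j == y ]) ≡ sum f + c
      row-upd f c y = trans (sum-+ f _) (cong (sum f +_) (trans (sum-*ˡ c _) (trans (cong (c *_) (sum-[==] y)) (*-identityʳ c))))
      col-upd : ∀ (f : Fin r → F) (c : F) x → sum (λ i → f i + [ i == x ] * c) ≡ sum f + c
      col-upd f c x = trans (sum-cong (λ i → cong (f i +_) (*-comm _ c))) (row-upd f c x)

    private
      inc-row : ∀ x y B i → row (inc x y B) i ≡ row B i + [ i == x ]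
      inc-row x y B i = trans (sum-cong (inc-F x y B i)) (row-upd _ _ y)
      inc-col : ∀ x y B j → col (inc x y B) j ≡ col B j + [ j == y ]
      inc-col x y B j = trans (sum-cong (λ i → inc-F x y B i j)) (col-upd _ _ x)
      dec-row : ∀ x y B → 0 ℕ.< B x y → ∀ i → row (dec x y B) i ≡ row B i - [ i == x ]
      dec-row x y B p i = trans (sum-cong (λ j → trans (dec-F x y B p i j) (solve 3 (λ k u v → k :- (u :* v) := k :+ ((:- u) :* v)) refl (fromℕ (B i j)) ([ i == x ]) ([ j == y ])))) (row-upd _ _ y)
      dec-col : ∀ x y B → 0 ℕ.< B x y → ∀ j → col (dec x y B) j ≡ col B j - [ j == y ]
      dec-col x y B p j = trans (sum-cong (λ i → trans (dec-F x y B p i j) (solve 3 (λ k u v → k :- (u :* v) := k :+ (u :* (:- v))) refl (fromℕ (B i j)) ([ i == x ]) ([ j == y ])))) (col-upd _ _ x)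

      inc-supp : ∀ x y B → a x y ≡ true → (∀ i j → a i j ≡ false → B i j ≡ 0) → ∀ i j → a i j ≡ false → inc x y B i j ≡ 0
      inc-supp x y B axy s i j e with i == x in e₁ | j == y in e₂
      ... | true | false = s i j e
      ... | false | _ = s i j e
      ... | true | true with ==⇒≡ i x e₁ | ==⇒≡ j y e₂
      ... | refl | refl with trans (sym axy) e
      ... | ()
      inc-cap : ∀ x y B → B x y ℕ.< cap b → (∀ i j → B i j ℕ.≤ cap b) → ∀ i j → inc x y B i j ℕ.≤ cap b
      inc-cap x y B lt s i j with i == x in e₁ | j == y in e₂
      ... | true | false = s i j
      ... | false | _ = s i j
      ... | true | true with ==⇒≡ i x e₁ | ==⇒≡ j y e₂
      ... | refl | refl = lt
      dec-supp : ∀ x y B → (∀ i j → a i j ≡ false → B i j ≡ 0) → ∀ i j → a i j ≡ false → dec x y B i j ≡ 0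
      dec-supp x y B s i j e with at x y i j
      ... | true = cong ℕ.pred (s i j e)
      ... | false = s i j e
      dec-≤ : ∀ x y B i j → dec x y B i j ℕ.≤ B i j
      dec-≤ x y B i j with at x y i j
      ... | true = ℕₚ.pred[n]≤n
      ... | false = ℕₚ.≤-refl

      IsNat-row : ∀ B i → IsNat (dout i + row B i)
      IsNat-row B i = IsNat-+ (IsNat-sum (λ j → IsNat-[] (a i j))) (IsNat-sum (λ j → B i j , refl))
      IsNat-col : ∀ B j → IsNat (din j + col B j)
      IsNat-col B j = IsNat-+ (IsNat-sum (λ i → IsNat-[] (a i j))) (IsNat-sum (λ i → B i j , refl))

      bump : ∀ (d f : Fin r → F) (u i : Fin r) → (∀ i → d i + f i ≤ t) → 1F + (d u + f u) ≤ t → d i + (f i + [ i == u ]) ≤ t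
      bump d f u i h lt with i == u in e
      ... | false = (lin 0 (sc 1 (h i)) (solve 3 (λ d f t → # 1 :* (t :- (d :+ (f :+ # 0))) := # 1 :* (t :- (d :+ f))) refl (d i) (f i) t))
      ... | true with ==⇒≡ i u e
      ... | refl = (lin 0 (sc 1 lt) (solve 3 (λ d f t → # 1 :* (t :- (d :+ (f :+ # 1))) := # 1 :* (t :- (# 1 :+ (d :+ f)))) refl (d i) (f i) t))

      module Augment (B : Mat) (P : Partial B) (u v : Fin r) (u-def : dout u + row B u < t) (v-def : din v + col B v < t) where
        open Partial P

        private
          open? : Fin r → Fin r → Bool
          open? i j = a i j ∧ (B i j ℕ.<ᵇ cap b)

          open⇒ : ∀ {i j} → open? i j ≡ true → a i j ≡ true × B i j ℕ.< cap b
          open⇒ {i} {j} e with ∧-true {a i j} e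
          ... | p , q = p , ℕₚ.<ᵇ⇒< _ _ (subst Bool.T (sym q) tt)

          direct : ∀ x y → open? x y ≡ true → dout x + row B x < t → din y + col B y < t → ∃[ B′ ] (Partial B′ × total B′ ≡ total B + 1F)
          direct x y o dx dy = inc x y B , record
            { supp = inc-supp x y B (proj₁ (open⇒ o)) supp
            ; capped = inc-cap x y B (proj₂ (open⇒ o)) capped
            ; row≤ = λ i → subst (λ z → dout i + z ≤ t) (sym (inc-row x y B i)) (bump dout (row B) x i row≤ (IsNat-<⇒ (IsNat-row B x) (_ , refl) dx))
            ; col≤ = λ j → subst (λ z → din j + z ≤ t) (sym (inc-col x y B j)) (bump din (col B) y j col≤ (IsNat-<⇒ (IsNat-col B y) (_ , refl) dy)) }
            , trans (sum-cong (inc-row x y B)) (trans (sum-+ _ _) (cong (sum (row B) +_) (sum-[==] x)))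

        -- Alternating path u → y′, x′ → y′, x′ → v.
        private
          path : ∀ x y → open? u y ≡ true → open? x v ≡ true → 0 ℕ.< B x y → ¬ x ≡ u → ∃[ B′ ] (Partial B′ × total B′ ≡ total B + 1F)
          path x y o₁ o₂ pos x≢u = B₃ , record
            { supp = inc-supp x v B₂ (proj₁ (open⇒ o₂)) (inc-supp u y B₁ (proj₁ (open⇒ o₁)) (dec-supp x y B supp))
            ; capped = inc-cap x v B₂ (subst (ℕ._< cap b) (sym B₂xv) (ℕₚ.≤-<-trans (dec-≤ x y B x v) (proj₂ (open⇒ o₂))))
                         (inc-cap u y B₁ (ℕₚ.≤-<-trans (dec-≤ x y B u y) (proj₂ (open⇒ o₁))) (λ i j → ℕₚ.≤-trans (dec-≤ x y B i j) (capped i j)))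
            ; row≤ = λ i → subst (λ z → dout i + z ≤ t) (sym (rowB₃ i)) (bump dout (row B) u i row≤ (IsNat-<⇒ (IsNat-row B u) (_ , refl) u-def))
            ; col≤ = λ j → subst (λ z → din j + z ≤ t) (sym (colB₃ j)) (bump din (col B) v j col≤ (IsNat-<⇒ (IsNat-col B v) (_ , refl) v-def)) }
            , trans (sum-cong rowB₃) (trans (sum-+ _ _) (cong (sum (row B) +_) (sum-[==] u)))
            where
            B₁ = dec x y B
            B₂ = inc u y B₁
            B₃ = inc x v B₂
            B₂xv : B₂ x v ≡ B₁ x v
            B₂xv rewrite ≢⇒== x≢u = refl
            rowB₃ : ∀ i → row B₃ i ≡ row B i + [ i == u ]
            rowB₃ i = trans (inc-row x v B₂ i) (trans (cong (_+ [ i == x ]) (trans (inc-row u y B₁ i) (cong (_+ [ i == u ]) (dec-row x y B pos i))))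
              (solve 3 (λ k p q → ((k :- p) :+ q) :+ p := k :+ q) refl (row B i) ([ i == x ]) ([ i == u ])))
            colB₃ : ∀ j → col B₃ j ≡ col B j + [ j == v ]
            colB₃ j = trans (inc-col x v B₂ j) (trans (cong (_+ [ j == v ]) (trans (inc-col u y B₁ j) (cong (_+ [ j == y ]) (dec-col x y B pos j))))
              (solve 3 (λ k p q → ((k :- p) :+ p) :+ q := k :+ q) refl (col B j) ([ j == y ]) ([ j == v ])))

        S T : Fin r → Bool
        S j = open? u j
        T i = open? i v

        𝕓 𝕣 : F
        𝕓 = fromℕ b
        𝕣 = fromℕ r

        private
          t-eq : t ≡ 𝕣 * (𝕓 + fromℕ 2)
          t-eq = trans (fromℕ-* r (hh b)) (cong (𝕣 *_) (fromℕ-+ b 2))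

          cap-eq : fromℕ (cap b) ≡ fromℕ 2 * 𝕓 * (𝕓 + fromℕ 2)
          cap-eq = trans (fromℕ-* (2 ℕ.* b) (hh b)) (cong₂ _*_ (fromℕ-* 2 b) (fromℕ-+ b 2))

        0<𝕓 : 0F < 𝕓
        0<𝕓 = fromℕ-< 0<b
        0<𝕣 : 0F < 𝕣
        0<𝕣 = fromℕ-< 0<r

        private
          open-count : (α : Fin r → Bool) (β : Fin r → ℕ) → (𝕓 + fromℕ 2) * 𝕣 ≤ fromℕ 2 * 𝕓 * sum (λ j → [ α j ])
            → sum (λ j → [ α j ]) + sum (λ j → fromℕ (β j)) ≤ t
            → (𝕓 + 1F) * 𝕣 ≤ fromℕ 2 * 𝕓 * sum (λ j → [ α j ∧ (β j ℕ.<ᵇ cap b) ])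
          open-count α β dens le = (lin 0 (sc 1 dens ⊹ sc 2 (*-nonneg (<⇒≤ 0<𝕓) (≤⇒0≤- split)) ⊹ sc 1 full-bound) (solve 5 (λ b r s f g → # 1 :* (((# 2 :* b) :* g) :- ((b :+ # 1) :* r)) := (# 1 :* (((# 2 :* b) :* s) :- ((b :+ # 2) :* r))) :+ ((# 2 :* ((b :* ((g :+ f) :- s)) :- # 0)) :+ (# 1 :* (r :- ((# 2 :* b) :* f))))) refl 𝕓 𝕣 (sum (λ j → [ α j ])) full (sum (λ j → [ α j ∧ (β j ℕ.<ᵇ cap b) ]))))
            where
            full : F
            full = sum (λ j → [ not (β j ℕ.<ᵇ cap b) ])
            split : sum (λ j → [ α j ]) ≤ sum (λ j → [ α j ∧ (β j ℕ.<ᵇ cap b) ]) + full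
            split = subst (sum (λ j → [ α j ]) ≤_) (sum-+ _ _) (sum-mono lem)
              where
              lem : ∀ j → [ α j ] ≤ [ α j ∧ (β j ℕ.<ᵇ cap b) ] + [ not (β j ℕ.<ᵇ cap b) ]
              lem j with α j | β j ℕ.<ᵇ cap b
              ... | true | true = (lin 0 (0≤fromℕ 0) (solve 0 (# 1 :* ((# 1 :+ # 0) :- # 1) := # 0) refl ))
              ... | true | false = (lin 0 (0≤fromℕ 0) (solve 0 (# 1 :* ((# 0 :+ # 1) :- # 1) := # 0) refl ))
              ... | false | true = (lin 0 (0≤fromℕ 0) (solve 0 (# 1 :* ((# 0 :+ # 0) :- # 0) := # 0) refl ))
              ... | false | false = (lin 0 (0≤fromℕ 1) (solve 0 (# 1 :* ((# 0 :+ # 1) :- # 0) := # 1) refl ))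
            cap-full : fromℕ (cap b) * full ≤ sum (λ j → fromℕ (β j))
            cap-full = subst (_≤ sum (λ j → fromℕ (β j))) (sum-*ˡ (fromℕ (cap b)) _) (sum-mono lem)
              where
              lem : ∀ j → fromℕ (cap b) * [ not (β j ℕ.<ᵇ cap b) ] ≤ fromℕ (β j)
              lem j with β j ℕ.<ᵇ cap b in e
              ... | true = subst (_≤ fromℕ (β j)) (sym (zeroʳ _)) (0≤fromℕ _)
              ... | false = subst (_≤ fromℕ (β j)) (sym (*-identityʳ _)) (fromℕ-≤ (ℕₚ.≮⇒≥ (λ lt → subst Bool.T e (ℕₚ.<⇒<ᵇ lt))))
            full-bound : fromℕ 2 * 𝕓 * full ≤ 𝕣
            full-bound = mul-cancel {𝕓 + fromℕ 2} (lin< 0 (0<fromℕ 1 ⊹< sc 1 (<⇒≤ 0<𝕓)) (solve 1 (λ b → # 1 :* ((b :+ # 2) :- # 0) := # 2 :+ (# 1 :* (b :- # 0))) refl 𝕓))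
              (lin 0 (sc 1 (≤-reflexive (sym (cong (_* full) cap-eq))) ⊹ sc 1 cap-full ⊹ sc 1 le ⊹ sc 1 (sum-nonneg (λ j → []-nonneg (α j))) ⊹ sc 1 (≤-reflexive t-eq)) (solve 7 (λ b r f cf s w t → # 1 :* (((b :+ # 2) :* r) :- ((b :+ # 2) :* ((# 2 :* b) :* f))) := (# 1 :* (cf :- (((# 2 :* b) :* (b :+ # 2)) :* f))) :+ ((# 1 :* (w :- cf)) :+ ((# 1 :* (t :- (s :+ w))) :+ ((# 1 :* (s :- # 0)) :+ (# 1 :* ((r :* (b :+ # 2)) :- t)))))) refl 𝕓 𝕣 full (fromℕ (cap b) * full) (sum (λ j → [ α j ])) (sum (λ j → fromℕ (β j))) t))

        -- `S` holds the columns that row u can still feed, `T` the rows that can still feed column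
        -- v. If a column of `S` or a row of `T` is deficient, one entry is raised. Otherwise all of
        -- them are saturated, and the masses of `B` in the rows of `T` and the columns of `S` add
        -- up to at least r²(b+1)²/b. That exceeds r²(b+2), an upper bound for the total of `B`, so
        -- some entry in `T` × `S` is positive and an alternating path passes through it.
        augment : ∃[ B′ ] (Partial B′ × total B′ ≡ total B + 1F)
        augment with search {A = λ j → S j ≡ true × din j + col B j < t} {B = λ j → t * [ S j ] ≤ (din j + col B j) * [ S j ]} dichS
          where
          dichS : ∀ j → (S j ≡ true × din j + col B j < t) ⊎ (t * [ S j ] ≤ (din j + col B j) * [ S j ])
          dichS j with S j
          ... | false = inj₂ (≤-reflexive (trans (zeroʳ _) (sym (zeroʳ _))))
          ... | true with ≤-or-> t (din j + col B j)
          ... | inj₁ p = inj₂ (subst₂ _≤_ (sym (*-identityʳ _)) (sym (*-identityʳ _)) p)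
          ... | inj₂ p = inj₁ (refl , p)
        ... | inj₁ (j , o , d) = direct u j o u-def d
        ... | inj₂ satS with search {A = λ i → T i ≡ true × dout i + row B i < t} {B = λ i → (T i ≡ true → t ≤ dout i + row B i)} dichT
          where
          dichT : ∀ i → (T i ≡ true × dout i + row B i < t) ⊎ (T i ≡ true → t ≤ dout i + row B i)
          dichT i with T i
          ... | false = inj₂ (λ ())
          ... | true with ≤-or-> t (dout i + row B i)
          ... | inj₁ p = inj₂ (λ _ → p)
          ... | inj₂ p = inj₁ (refl , p)
        ... | inj₁ (i , o , d) = direct i v o d v-def
        ... | inj₂ satT = found
          where
          |S| |T| : F
          |S| = sum (λ j → [ S j ])
          |T| = sum (λ i → [ T i ])
          S-big : (𝕓 + 1F) * 𝕣 ≤ fromℕ 2 * 𝕓 * |S|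
          S-big = open-count (a u) (B u) (out u) (row≤ u)
          T-big : (𝕓 + 1F) * 𝕣 ≤ fromℕ 2 * 𝕓 * |T|
          T-big = open-count (λ i → a i v) (λ i → B i v) (inn v) (col≤ v)
          d≤r : ∀ (α : Fin r → Bool) → sum (λ j → [ α j ]) ≤ 𝕣
          d≤r α = subst (sum (λ j → [ α j ]) ≤_) (trans (sum-const r 1F) (*-identityʳ _)) (sum-mono (λ j → []-≤1 (α j)))
          mass : (α : Fin r → Bool) (d c : Fin r → F) → (∀ j → d j ≤ 𝕣) → (∀ j → t * [ α j ] ≤ (d j + c j) * [ α j ])
            → (t - 𝕣) * sum (λ j → [ α j ]) ≤ sum (λ j → [ α j ] * c j)
          mass α d c hd h = subst (_≤ sum (λ j → [ α j ] * c j)) (sum-*ˡ _ _) (sum-mono (λ j →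
            (lin 0 (sc 1 (h j) ⊹ sc 1 (*-nonneg ([]-nonneg (α j)) (≤⇒0≤- (hd j)))) (solve 5 (λ t r e d c → # 1 :* ((e :* c) :- ((t :- r) :* e)) := (# 1 :* (((d :+ c) :* e) :- (t :* e))) :+ (# 1 :* ((e :* (r :- d)) :- # 0))) refl t 𝕣 ([ α j ]) (d j) (c j)))))
          massS : (t - 𝕣) * |S| ≤ sum (λ j → [ S j ] * col B j)
          massS = mass S din (col B) (λ j → d≤r (λ i → a i j)) satS
          massT : (t - 𝕣) * |T| ≤ sum (λ i → [ T i ] * row B i)
          massT = mass T dout (row B) (λ i → d≤r (a i)) satT′
            where
            satT′ : ∀ i → t * [ T i ] ≤ (dout i + row B i) * [ T i ]
            satT′ i with T i in e
            ... | false = ≤-reflexive (trans (zeroʳ _) (sym (zeroʳ _)))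
            ... | true = subst₂ _≤_ (sym (*-identityʳ _)) (sym (*-identityʳ _)) (satT i e)
          M TS : F
          M = total B
          TS = sum (λ i → sum (λ j → [ T i ] * [ S j ] * fromℕ (B i j)))
          incl : sum (λ i → [ T i ] * row B i) + sum (λ j → [ S j ] * col B j) ≤ M + TS
          incl = subst₂ _≤_
            (trans (sum-cong (λ i → sum-+ _ _)) (trans (sum-+ _ _) (cong₂ _+_ (sum-cong (λ i → sum-*ˡ _ _)) (trans (sum-swap _) (sum-cong (λ j → sum-*ˡ _ _))))))
            (trans (sum-cong (λ i → sum-+ _ _)) (sum-+ _ _))
            (sum-mono (λ i → sum-mono (λ j → lem i j)))
            where
            lem : ∀ i j → [ T i ] * fromℕ (B i j) + [ S j ] * fromℕ (B i j) ≤ fromℕ (B i j) + [ T i ] * [ S j ] * fromℕ (B i j)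
            lem i j = (lin 0 (sc 1 (*-nonneg (*-nonneg (≤⇒0≤- ([]-≤1 (T i))) (≤⇒0≤- ([]-≤1 (S j)))) (0≤fromℕ (B i j)))) (solve 3 (λ p q k → # 1 :* ((k :+ ((p :* q) :* k)) :- ((p :* k) :+ (q :* k))) := # 1 :* ((((# 1 :- p) :* (# 1 :- q)) :* k) :- # 0)) refl ([ T i ]) ([ S j ]) (fromℕ (B i j))))
          M≤ : M ≤ 𝕣 * t
          M≤ = subst (M ≤_) (sum-const r t) (sum-mono (λ i → (lin 0 (sc 1 (row≤ i) ⊹ sc 1 (sum-nonneg (λ j → []-nonneg (a i j)))) (solve 3 (λ d x t → # 1 :* (t :- x) := (# 1 :* (t :- (d :+ x))) :+ (# 1 :* (d :- # 0))) refl (dout i) (row B i) t))))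
          r≤t : 𝕣 ≤ t
          r≤t = (lin 0 (sc 1 (≤-reflexive (sym t-eq)) ⊹ sc 1 (*-nonneg (<⇒≤ 0<𝕓) (<⇒≤ 0<𝕣)) ⊹ sc 1 (<⇒≤ 0<𝕣)) (solve 3 (λ b r t → # 1 :* (t :- r) := (# 1 :* (t :- (r :* (b :+ # 2)))) :+ ((# 1 :* ((b :* r) :- # 0)) :+ (# 1 :* (r :- # 0)))) refl 𝕓 𝕣 t))
          TS-pos : 0F < TS
          TS-pos with ≤-or-> TS 0F
          ... | inj₂ p = p
          ... | inj₁ p = ⊥-elim (<-irrefl (lin< 1 (sc< 1 (*-pos 0<𝕣 0<𝕣) ⊹< sc 1 (*-nonneg (≤⇒0≤- r≤t) (≤⇒0≤- S-big)) ⊹ sc 1 (*-nonneg (≤⇒0≤- r≤t) (≤⇒0≤- T-big)) ⊹ sc 2 (*-nonneg (<⇒≤ 0<𝕓) (≤⇒0≤- massS)) ⊹ sc 2 (*-nonneg (<⇒≤ 0<𝕓) (≤⇒0≤- massT)) ⊹ sc 2 (*-nonneg (<⇒≤ 0<𝕓) (≤⇒0≤- incl)) ⊹ sc 2 (*-nonneg (<⇒≤ 0<𝕓) (≤⇒0≤- p)) ⊹ sc 2 (*-nonneg (<⇒≤ 0<𝕓) (≤⇒0≤- M≤)) ⊹ sc 2 (≤-reflexive (sym (cong (𝕣 *_) t-eq)))) (solve 9 (λ b r t s u ts m x y → # 2 :* (# 0 :- # 0) := (# 2 :* ((r :* r) :- # 0)) :+ ((# 1 :* (((t :- r) :* (((#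 2 :* b) :* s) :- ((b :+ # 1) :* r))) :- # 0)) :+ ((# 1 :* (((t :- r) :* (((# 2 :* b) :* u) :- ((b :+ # 1) :* r))) :- # 0)) :+ ((# 2 :* ((b :* (x :- ((t :- r) :* s))) :- # 0)) :+ ((# 2 :* ((b :* (y :- ((t :- r) :* u))) :- # 0)) :+ ((# 2 :* ((b :* ((m :+ ts) :- (y :+ x))) :- # 0)) :+ ((# 2 :* ((b :* (# 0 :- ts)) :- # 0)) :+ ((# 2 :* ((b :* ((r :* t) :- m)) :- # 0)) :+ (# 2 :* ((r :* t) :- (r :* (r :* (b :+ # 2))))))))))))) refl 𝕓 𝕣 t |S| |T| TS M (sum (λ j → [ S j ] * col B j)) (sum (λ i → [ T i ] * row B i)))))
          found : ∃[ B′ ] (Partial B′ × total B′ ≡ total B + 1F)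
          found with sum-<⇒∃ (λ _ → 0F) _ (subst (_< TS) (sym (sum-zero {r} (λ _ → refl))) TS-pos)
          ... | i , p with sum-<⇒∃ (λ _ → 0F) _ (subst (_< sum (λ j → [ T i ] * [ S j ] * fromℕ (B i j))) (sym (sum-zero {r} (λ _ → refl))) p)
          ... | j , q with T i in eT | S j in eS
          ... | false | _ = ⊥-elim (<-irrefl (subst (0F <_) (trans (cong (_* fromℕ (B i j)) (zeroˡ _)) (zeroˡ _)) q))
          ... | true | false = ⊥-elim (<-irrefl (subst (0F <_) (trans (cong (_* fromℕ (B i j)) (zeroʳ _)) (zeroˡ _)) q))
          ... | true | true = path i j eS eT (fromℕ-<⁻ (subst (0F <_) (solve 1 (λ k → (# 1 :* # 1) :* k := k) refl (fromℕ (B i j))) q))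
                  (λ i≡u → <⇒≱ u-def (subst (λ z → t ≤ dout z + row B z) i≡u (satT i eT)))

    record Full (B : Mat) : Set where
      field
        part : Partial B
        rows : ∀ i → dout i + row B i ≡ t
        cols : ∀ j → din j + col B j ≡ t

    private
      ΣR ΣC : Mat → F
      ΣR B = sum (λ i → dout i + row B i)
      ΣC B = sum (λ j → din j + col B j)

      R≡C : ∀ B → ΣR B ≡ ΣC B
      R≡C B = trans (sum-+ _ _) (trans (cong₂ _+_ (sum-swap _) (sum-swap _)) (sym (sum-+ _ _)))

      -- Row sums and column sums have equal totals, so a deficient row comes with a deficient
      -- column. The fuel is the total deficiency, which each augmentation lowers by one.
      complete : ∀ m B → Partial B → fromℕ r * t - ΣR B ≤ fromℕ m → ∃ Full
      complete m B P fuel with search {A = λ i → dout i + row B i < t} {B = λ i → t ≤ dout i + row B i} (λ i → Data.Sum.swap (≤-or-> t (dout i + row B i)))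
      ... | inj₂ sat = B , record { part = P ; rows = rows ; cols = cols }
        where
        open Partial P
        rows : ∀ i → dout i + row B i ≡ t
        rows i = ≤-antisym (row≤ i) (sat i)
        ΣC≡ : ΣC B ≡ sum {r} (λ _ → t)
        ΣC≡ = trans (sym (R≡C B)) (sum-cong rows)
        cols : ∀ j → din j + col B j ≡ t
        cols j with ≤-or-> t (din j + col B j)
        ... | inj₁ p = ≤-antisym (col≤ j) p
        ... | inj₂ p = ⊥-elim (<-irrefl (subst (_< sum {r} (λ _ → t)) ΣC≡ (sum-strict col≤ j p)))
      ... | inj₁ (u , u-def) = next m fuel (sum-<⇒∃ (λ j → din j + col B j) (λ _ → t) (subst (_< sum {r} (λ _ → t)) (R≡C B) R<))
        where
        open Partial P
        R< : ΣR B < sum {r} (λ _ → t)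
        R< = sum-strict row≤ u u-def
        next : ∀ m → fromℕ r * t - ΣR B ≤ fromℕ m → (∃[ v ] din v + col B v < t) → ∃ Full
        next zero fuel _ = ⊥-elim (<-irrefl (lin< 0 (sc< 0 R< ⊹< sc 1 (≤-reflexive (sum-const r t)) ⊹ sc 1 fuel) (solve 3 (λ x y z → # 1 :* (# 0 :- # 0) := (# 1 :* (y :- x)) :+ ((# 1 :* (z :- y)) :+ (# 1 :* (# 0 :- (z :- x))))) refl (ΣR B) (sum {r} (λ _ → t)) (fromℕ r * t))))
        next (suc m) fuel (v , v-def) = let B′ , P′ , tot = Augment.augment B P u v u-def v-def in
          complete m B′ P′ (lin 0 (sc 1 fuel ⊹ sc 1 (≤-reflexive (fromℕ-suc m)) ⊹ sc 1 (≤-reflexive (sym tot)) ⊹ sc 1 (≤-reflexive (sum-+ dout (row B))) ⊹ sc 1 (≤-reflexive (sym (sum-+ dout (row B′))))) (solve 8 (λ x x′ d y y′ z m m′ → # 1 :* (m :- (z :- x′)) := (# 1 :* (m′ :- (z :- x))) :+ ((# 1 :* ((# 1 :+ m) :- m′)) :+ ((# 1 :* (y′ :- (y :+ # 1))) :+ ((# 1 :* ((d :+ y) :- x)) :+ (# 1 :* (x′ :- (d :+ y′))))))) refl (ΣR B) (ΣR B′) (sum dout) (total B) (total B′) (fromℕ r * t) (fromℕ m) (fromℕ (suc m))))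

      empty : Partial (λ _ _ → 0)
      empty = record { supp = λ _ _ _ → refl ; capped = λ _ _ → ℕ.z≤n ; row≤ = λ i → lem (a i) ; col≤ = λ j → lem (λ i → a i j) }
        where
        lem : (α : Fin r → Bool) → sum (λ j → [ α j ]) + sum {r} (λ j → fromℕ 0) ≤ t
        lem α = (lin 0 (sc 1 (sum-mono (λ j → []-≤1 (α j))) ⊹ sc 1 (≤-reflexive (sum-const r 1F)) ⊹ sc 1 (≤-reflexive (sum-zero {r} (λ _ → refl))) ⊹ sc 1 (≤-reflexive (sym (trans (fromℕ-* r (hh b)) (cong (fromℕ r *_) (fromℕ-+ b 2))))) ⊹ sc 1 (*-nonneg (0≤fromℕ r) (0≤fromℕ b)) ⊹ sc 1 (0≤fromℕ r)) (solve 6 (λ x y u r b t → # 1 :* (t :- (x :+ y)) := (# 1 :* (u :- x)) :+ ((# 1 :* ((r :* # 1) :- u)) :+ ((# 1 :* (# 0 :- y)) :+ ((# 1 :* (t :- (r :* (b :+ # 2)))) :+ ((# 1 :* ((r :* b) :- # 0)) :+ (# 1 :* (r :- # 0))))))) refl (sum (λ j → [ α j ])) (sum {r} (λ j → fromℕ 0)) (sum {r} (λ _ → 1F)) (fromℕ r) (fromℕ b) t))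

    full : ∃ Full
    full = complete (r ℕ.* (r ℕ.* hh b)) (λ _ _ → 0) empty (lin 0 (sc 1 (≤-reflexive (sym (fromℕ-* r (r ℕ.* hh b)))) ⊹ sc 1 (sum-nonneg (λ i → sum-nonneg (λ j → []-nonneg (a i j)) ⊹ sum-nonneg (λ j → 0≤fromℕ 0)))) (solve 3 (λ x z w → # 1 :* (w :- (z :- x)) := (# 1 :* (w :- z)) :+ (# 1 :* (x :- # 0))) refl (ΣR (λ _ _ → 0)) (fromℕ r * t) (fromℕ (r ℕ.* (r ℕ.* hh b)))))

  -- A doubly stochastic matrix carried by a, within constant factors of uniform.
  record Walk (b r : ℕ) (a : Fin r → Fin r → Bool) : Set where
    field
      P : Fin r → Fin r → F
      nonneg : ∀ i j → 0F ≤ P i j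
      supp : ∀ i j → a i j ≡ false → P i j ≡ 0F
      rows : ∀ i → sum (λ j → P i j) ≡ 1F
      cols : ∀ j → sum (λ i → P i j) ≡ 1F
      lower : ∀ i j → a i j ≡ true → 1F ≤ fromℕ r * fromℕ (hh b) * P i j
      upper : ∀ i j → fromℕ r * fromℕ (hh b) * P i j ≤ fromℕ (suc (cap b))

  opaque
    -- The full matrix `a + B` divided by its common line sum t = r(b+2).
    walk : ∀ {b r} → 0 ℕ.< b → 0 ℕ.< r → (a : Fin r → Fin r → Bool) → Dense b r a → Walk b r a
    walk {b} {r} 0<b 0<r a dense = go full
      where
      open Flow 0<b 0<r a dense
      0<t : 0F < t
      0<t = fromℕ-< (ℕₚ.*-mono-< 0<r (ℕₚ.<-≤-trans 0<b (ℕₚ.m≤m+n b 2)))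
      ρ : F
      ρ = recip t
      tρ : t * ρ ≡ 1F
      tρ = recip-inv 0<t
      0≤ρ : 0F ≤ ρ
      0≤ρ = <⇒≤ (recip-pos 0<t)
      rh : fromℕ r * fromℕ (hh b) ≡ t
      rh = sym (fromℕ-* r (hh b))
      go : ∃ Full → Walk b r a
      go (B , fl) = record
        { P = λ i j → A i j * ρ
        ; nonneg = λ i j → *-nonneg ([]-nonneg (a i j) ⊹ 0≤fromℕ (B i j)) 0≤ρ
        ; supp = λ i j e → trans (cong (_* ρ) (cong₂ _+_ (cong [_] e) (cong fromℕ (supp i j e)))) (solve 1 (λ ρ → (# 0 :+ # 0) :* ρ := # 0) refl ρ)
        ; rows = λ i → trans (sum-*ʳ ρ _) (trans (cong (_* ρ) (trans (sum-+ _ _) (rows i))) tρ)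
        ; cols = λ j → trans (sum-*ʳ ρ _) (trans (cong (_* ρ) (trans (sum-+ _ _) (cols j))) tρ)
        ; lower = λ i j e → subst (1F ≤_) (sym (red i j)) (subst (λ α → 1F ≤ [ α ] + fromℕ (B i j)) (sym e) (lin 0 (sc 1 (0≤fromℕ (B i j))) (solve 1 (λ k → # 1 :* ((# 1 :+ k) :- # 1) := # 1 :* (k :- # 0)) refl (fromℕ (B i j)))))
        ; upper = λ i j → subst (_≤ fromℕ (suc (cap b))) (sym (red i j)) (subst (A i j ≤_) (sym (fromℕ-suc (cap b))) (+-mono-≤ ([]-≤1 (a i j)) (fromℕ-≤ (capped i j)))) }
        where
        open Full fl
        open Partial part
        A : Fin r → Fin r → F
        A i j = [ a i j ] + fromℕ (B i j)
        red : ∀ i j → fromℕ r * fromℕ (hh b) * (A i j * ρ) ≡ A i j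
        red i j = trans (cong (_* (A i j * ρ)) rh) (trans (solve 3 (λ t ρ A → t :* (A :* ρ) := A :* (t :* ρ)) refl t ρ (A i j)) (trans (cong (A i j *_) tρ) (*-identityʳ _)))

-- Random homomorphisms of rooted oriented trees and their mixing.

module RandomWalks where
  open OrderedField
  open Sums
  open Transport

  infixr 8 _^^_
  _^^_ : F → ℕ → F
  x ^^ zero = 1F
  x ^^ suc n = x * x ^^ n

  ^^-nonneg : ∀ {x} → 0F ≤ x → ∀ n → 0F ≤ x ^^ n
  ^^-nonneg h zero = 0≤1
  ^^-nonneg h (suc n) = *-nonneg h (^^-nonneg h n)

  -- The overlap of any two rows of a walk, hence the contraction rate.
  γ : ℕ → F
  γ b = fromℕ 2 * recip (fromℕ b * fromℕ (hh b))

  module _ {b : ℕ} (0<b : 0 ℕ.< b) where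
    bh-pos : 0F < fromℕ b * fromℕ (hh b)
    bh-pos = *-pos (fromℕ-< 0<b) (fromℕ-< (ℕₚ.<-≤-trans 0<b (ℕₚ.m≤m+n b 2)))

    γ-eq : fromℕ b * fromℕ (hh b) * γ b ≡ fromℕ 2
    γ-eq = trans (solve 2 (λ x y → x :* (# 2 :* y) := # 2 :* (x :* y)) refl (fromℕ b * fromℕ (hh b)) (recip (fromℕ b * fromℕ (hh b)))) (trans (cong (fromℕ 2 *_) (recip-inv bh-pos)) (*-identityʳ _))

    0<γ : 0F < γ b
    0<γ = *-pos (0<fromℕ 1) (recip-pos bh-pos)

    γ≤1 : γ b ≤ 1F
    γ≤1 = mul-cancel bh-pos (lin 0 (sc 1 (≤-reflexive γ-eq) ⊹ sc 4 (fromℕ-≤ 0<b) ⊹ sc 1 (*-nonneg (≤⇒0≤- (fromℕ-≤ 0<b)) (≤⇒0≤- (fromℕ-≤ 0<b))) ⊹ sc 1 (≤-reflexive (sym (cong (fromℕ b *_) (fromℕ-+ b 2)))) ⊹ 0≤fromℕ 1) (solve 3 (λ x y z → # 1 :* (((x :* y) :* # 1) :- ((x :* y) :* z)) := (# 1 :* (# 2 :- ((x :* y) :* z))) :+ ((# 4 :* (x :- # 1)) :+ ((# 1 :* (((x :- # 1) :* (x :- # 1)) :- # 0)) :+ ((# 1 :* ((x :* y) :- (x :* (x :+ # 2)))) :+ # 1)))) refl (fromℕ b) (fromℕ (hh b)) (γ b)))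

  -- A rooted oriented tree given by its growth. The newest vertex is `zero` and hangs from an older
  -- one; the sign is `true` when the arc points from the parent to the child.
  data Piece : ℕ → Set where
    root : Piece 0
    grow : ∀ {m} → Piece m → Fin (suc m) → Bool → Piece (suc m)

  depth : ∀ {m} → Piece m → Fin (suc m) → ℕ
  depth root _ = 0
  depth (grow p a s) zero = suc (depth p a)
  depth (grow p a s) (suc i) = depth p i

  -- Par p x y s : vertex x was grown from y along sign s.
  data Par : ∀ {m} → Piece m → Fin (suc m) → Fin (suc m) → Bool → Set where
    here : ∀ {m} {p : Piece m} {a s} → Par (grow p a s) zero (suc a) s
    there : ∀ {m} {p : Piece m} {a s x y s′} → Par p x y s′ → Par (grow p a s) (suc x) (suc y) s′

  infixr 5 _▸_
  _▸_ : ∀ {A : Set} {m} → A → (Fin (suc m) → A) → Fin (suc (suc m)) → A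
  (w ▸ e) zero = w
  (w ▸ e) (suc i) = e i

  Osc : ∀ {r} → (Fin r → F) → F → Set
  Osc f o = ∀ i j → f i - f j ≤ o

  Osc-mean : ∀ {r} {f : Fin r → F} {o m} → Osc f o → sum f ≡ fromℕ r * m → ∀ i → f i ≤ m + o
  Osc-mean {suc r} {f} {o} {m} osc mean i = mul-cancel (0<fromℕ r) (lin 0 (sc 1 (sum-mono (osc i)) ⊹ sc 1 (≤-reflexive (sum-const (suc r) o)) ⊹ sc 1 (≤-reflexive (sym (sum-minus (λ _ → f i) f))) ⊹ sc 1 (≤-reflexive (sym (sum-const (suc r) (f i)))) ⊹ sc 1 (≤-reflexive mean)) (solve 8 (λ r x m o a d c w → # 1 :* ((r :* (m :+ o)) :- (r :* x)) := (# 1 :* (w :- d)) :+ ((# 1 :* ((r :* o) :- w)) :+ ((# 1 :* (d :- (c :- a))) :+ ((# 1 :* (c :- (r :* x))) :+ (# 1 :* ((r :* m) :- a)))))) refl (fromℕ (suc r)) (f i) m o (sum f) (sum (λ j → f i - f j)) (sum {suc r} (λ _ → f i)) (sum {suc r} (λ _ → o))))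

  module Walks {b r : ℕ} (0<b : 0 ℕ.< b) (0<r : 0 ℕ.< r) (a : Fin r → Fin r → Bool) (dense : Dense b r a) (W : Walk b r a) where
    open Dense dense
    open Walk W renaming (nonneg to P-nonneg; supp to P-supp; rows to P-rows; cols to P-cols; lower to P-lower; upper to P-upper)

    as : Bool → Fin r → Fin r → Bool
    as true i j = a i j
    as false i j = a j i

    -- A reversed arc is walked with the transposed matrix. Double stochasticity makes this a walk
    -- as well, and both walks preserve the uniform measure, so mixing does not depend on the
    -- orientation.
    K : Bool → Fin r → Fin r → F
    K true i j = P i j
    K false i j = P j i

    private
      K-nonneg : ∀ s i j → 0F ≤ K s i j
      K-nonneg true i j = P-nonneg i j
      K-nonneg false i j = P-nonneg j i

      K-rows : ∀ s i → sum (K s i) ≡ 1F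
      K-rows true = P-rows
      K-rows false = P-cols

      K-cols : ∀ s j → sum (λ i → K s i j) ≡ 1F
      K-cols true = P-cols
      K-cols false = P-rows

      K-supp : ∀ s i j → as s i j ≡ false → K s i j ≡ 0F
      K-supp true i j = P-supp i j
      K-supp false i j = P-supp j i

    deg : ∀ s i → (fromℕ b + fromℕ 2) * fromℕ r ≤ fromℕ 2 * fromℕ b * sum (λ j → [ as s i j ])
    deg true = out
    deg false = inn

    private
      𝕓 𝕙 𝕣 ε : F
      𝕓 = fromℕ b
      𝕙 = fromℕ (hh b)
      𝕣 = fromℕ r
      ε = recip (𝕣 * 𝕙)
      0<𝕓 : 0F < 𝕓
      0<𝕓 = fromℕ-< 0<b
      0<𝕣 : 0F < 𝕣
      0<𝕣 = fromℕ-< 0<r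
      0<𝕙 : 0F < 𝕙
      0<𝕙 = fromℕ-< (ℕₚ.<-≤-trans 0<b (ℕₚ.m≤m+n b 2))
      rh-pos : 0F < 𝕣 * 𝕙
      rh-pos = *-pos 0<𝕣 0<𝕙
      ε-eq : 𝕣 * 𝕙 * ε ≡ 1F
      ε-eq = recip-inv rh-pos
      0≤ε : 0F ≤ ε
      0≤ε = <⇒≤ (recip-pos rh-pos)

    private
      K-lower : ∀ s i j → ε * [ as s i j ] ≤ K s i j
      K-lower s i j with as s i j in e
      ... | false = subst (_≤ K s i j) (sym (zeroʳ ε)) (K-nonneg s i j)
      ... | true = subst (_≤ K s i j) (sym (*-identityʳ ε)) (mul-cancel rh-pos (subst (_≤ 𝕣 * 𝕙 * K s i j) (sym ε-eq) (low s e)))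
        where
        low : ∀ s → as s i j ≡ true → 1F ≤ 𝕣 * 𝕙 * K s i j
        low true = P-lower i j
        low false = P-lower j i

    κ₀ : F
    κ₀ = fromℕ (suc (cap b)) * ε

    private
      K-upper : ∀ s i j → K s i j ≤ κ₀
      K-upper s i j = mul-cancel rh-pos (subst (𝕣 * 𝕙 * K s i j ≤_) (trans (sym (*-identityʳ _)) (trans (cong (fromℕ (suc (cap b)) *_) (sym ε-eq))
        (solve 3 (λ c x ε → c :* (x :* ε) := x :* (c :* ε)) refl (fromℕ (suc (cap b))) (𝕣 * 𝕙) ε))) (up s))
        where
        up : ∀ s → 𝕣 * 𝕙 * K s i j ≤ fromℕ (suc (cap b))
        up true = P-upper i j
        up false = P-upper j i

    -- A set is big if it meets every neighbourhood in at least 2r/b points.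
    Big : (Fin r → Bool) → Set
    Big X = ∀ s u → fromℕ 2 * 𝕣 ≤ 𝕓 * sum (λ w → [ X w ∧ as s u w ])

    -- Inclusion-exclusion: each of the two sets exceeds half of the points by r/b.
    dense-common : ∀ X Y → (𝕓 + fromℕ 2) * 𝕣 ≤ fromℕ 2 * 𝕓 * sum (λ j → [ X j ]) → (𝕓 + fromℕ 2) * 𝕣 ≤ fromℕ 2 * 𝕓 * sum (λ j → [ Y j ])
      → fromℕ 2 * 𝕣 ≤ 𝕓 * sum (λ w → [ X w ∧ Y w ])
    dense-common X Y p q = (lin 1 (sc 1 p ⊹ sc 1 q ⊹ sc 2 (*-nonneg (<⇒≤ 0<𝕓) (≤⇒0≤- (count-∧ X Y)))) (solve 5 (λ b r x y z → # 2 :* ((b :* z) :- (# 2 :* r)) := (# 1 :* (((# 2 :* b) :* x) :- ((b :+ # 2) :* r))) :+ ((# 1 :* (((# 2 :* b) :* y) :- ((b :+ # 2) :* r))) :+ (# 2 :* ((b :* ((r :+ z) :- (x :+ y))) :- # 0)))) refl 𝕓 𝕣 (sum (λ j → [ X j ])) (sum (λ j → [ Y j ])) (sum (λ w → [ X w ∧ Y w ]))))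

    dense⇒Big : ∀ X → (𝕓 + fromℕ 2) * 𝕣 ≤ fromℕ 2 * 𝕓 * sum (λ j → [ X j ]) → Big X
    dense⇒Big X h s u = dense-common X (as s u) h (deg s u)

    private
      γ≤ε* : ∀ {c} → fromℕ 2 * 𝕣 ≤ 𝕓 * c → γ b ≤ ε * c
      γ≤ε* {c} h = mul-cancel (bh-pos 0<b) (subst₂ _≤_ (trans (cong (_* fromℕ 2) (ε-eq)) (trans (*-identityˡ _) (sym (γ-eq 0<b)))) ((solve 4 (λ b h ε c → (h :* (b :* c)) :* ε := (b :* h) :* (ε :* c)) refl 𝕓 𝕙 ε c))
        (lin 0 (sc 1 (*-nonneg (*-nonneg (<⇒≤ 0<𝕙) (≤⇒0≤- h)) 0≤ε)) (solve 5 (λ r h ε b c → # 1 :* (((h :* (b :* c)) :* ε) :- (((r :* h) :* ε) :* # 2)) := # 1 :* (((h :* ((b :* c) :- (# 2 :* r))) :* ε) :- # 0)) refl 𝕣 𝕙 ε 𝕓 c)))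

      app : Bool → (Fin r → F) → Fin r → F
      app s f u = sum (λ w → K s u w * f w)

      app-const : ∀ s c u → app s (λ _ → c) u ≡ c
      app-const s c u = trans (sum-*ʳ c (K s u)) (trans (cong (_* c) (K-rows s u)) (*-identityˡ c))

      app-sum : ∀ s f → sum (app s f) ≡ sum f
      app-sum s f = trans (sum-swap _) (sum-cong (λ w → trans (sum-*ʳ (f w) (λ u → K s u w)) (trans (cong (_* f w) (K-cols s w)) (*-identityˡ _))))

      Big⇒app : ∀ {X} → Big X → ∀ s u → γ b ≤ app s (λ w → [ X w ]) u
      Big⇒app {X} big s u = ≤-trans (γ≤ε* (big s u)) (subst (_≤ app s (λ w → [ X w ]) u) (sum-*ˡ ε _) (sum-mono lem))
        where
        lem : ∀ w → ε * [ X w ∧ as s u w ] ≤ K s u w * [ X w ]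
        lem w with X w
        ... | true = subst (ε * [ as s u w ] ≤_) (sym (*-identityʳ _)) (K-lower s u w)
        ... | false = ≤-reflexive (trans (zeroʳ _) (sym (zeroʳ _)))

      -- Doeblin's argument. The rows of u and u′ both dominate ε on the common neighbours, a common
      -- part of mass q at least γ. It cancels in the difference, and the remaining mass 1 - q in
      -- each row averages values that lie within o of each other.
      contract : ∀ s {f o} → Osc f o → Osc (app s f) ((1F - γ b) * o)
      contract s {f} {o} osc u u′ = (lin 0 (sc 1 upper ⊹ sc 1 lower ⊹ sc 1 (*-nonneg (≤⇒0≤- g≤q) 0≤o)) (solve 7 (λ o g q lo A A′ C → # 1 :* (((# 1 :- g) :* o) :- (A :- A′)) := (# 1 :* (((# 1 :- q) :* (lo :+ o)) :- (A :- C))) :+ ((# 1 :* ((A′ :- C) :- ((# 1 :- q) :* lo))) :+ (# 1 :* (((q :- g) :* o) :- # 0)))) refl o (γ b) q lo (sum (λ w → K s u w * f w)) (sum (λ w → K s u′ w * f w)) C))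
        where
        c : Fin r → F
        c w = [ as s u w ∧ as s u′ w ]
        q lo C : F
        q = ε * sum c
        g≤q : γ b ≤ q
        g≤q = γ≤ε* (dense-common (as s u) (as s u′) (deg s u) (deg s u′))
        min : ∃[ i ] (∀ j → f i ≤ f j)
        min = argmin′ u f
          where
          argmin′ : ∀ {n} → Fin n → (f : Fin n → F) → ∃[ i ] (∀ j → f i ≤ f j)
          argmin′ {suc n} _ f = argmin f
        lo = f (proj₁ min)
        C = sum (λ w → ε * c w * f w)
        0≤o : 0F ≤ o
        0≤o = subst (_≤ o) (solve 1 (λ x → x :- x := # 0) refl (f u)) (osc u u)
        K≥ : ∀ v → (∀ w → c w ≤ [ as s v w ]) → ∀ w → 0F ≤ K s v w - ε * c w
        K≥ v h w = ≤⇒0≤- (≤-trans (mul-mono 0≤ε (h w)) (K-lower s v w))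
        c≤₁ : ∀ w → c w ≤ [ as s u w ]
        c≤₁ w with as s u w | as s u′ w
        ... | true | true = ≤-refl
        ... | true | false = 0≤1
        ... | false | _ = ≤-refl
        c≤₂ : ∀ w → c w ≤ [ as s u′ w ]
        c≤₂ w with as s u w | as s u′ w
        ... | true | true = ≤-refl
        ... | false | true = 0≤1
        ... | true | false = ≤-refl
        ... | false | false = ≤-refl
        Mass : ∀ v → sum (λ w → K s v w - ε * c w) ≡ 1F - q
        Mass v = trans (sum-minus _ _) (cong₂ _-_ (K-rows s v) (sum-*ˡ ε c))
        split : ∀ v → sum (λ w → (K s v w - ε * c w) * f w) ≡ sum (λ w → K s v w * f w) - C
        split v = trans (sum-cong (λ w → (solve 3 (λ k e x → (k :- e) :* x := (k :* x) :- (e :* x)) refl (K s v w) (ε * c w) (f w)))) (sum-minus _ _)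
        upper : sum (λ w → K s u w * f w) - C ≤ (1F - q) * (lo + o)
        upper = subst₂ _≤_ (split u) (trans (sum-*ʳ (lo + o) _) (cong (_* (lo + o)) (Mass u))) (sum-mono (λ w → mul-mono (K≥ u c≤₁ w) (lin 0 (sc 1 (osc w (proj₁ min))) (solve 3 (λ x lo o → # 1 :* ((lo :+ o) :- x) := # 1 :* (o :- (x :- lo))) refl (f w) lo o))))
        lower : (1F - q) * lo ≤ sum (λ w → K s u′ w * f w) - C
        lower = subst₂ _≤_ (trans (sum-*ʳ lo _) (cong (_* lo) (Mass u′))) (split u′) (sum-mono (λ w → mul-mono (K≥ u′ c≤₂ w) (proj₂ min w)))

    -- Expectation of a functional of the random homomorphism of a piece: the root is sent to w₀ and every other vertex takes a random step from its parent.
    E : ∀ {m} → Piece m → Fin r → ((Fin (suc m) → Fin r) → F) → F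
    E root w₀ f = f (λ _ → w₀)
    E (grow p x s) w₀ f = E p w₀ (λ e → sum (λ v → K s (e x) v * f (v ▸ e)))

    Hom : ∀ {m} → Piece m → Fin r → (Fin (suc m) → Fin r) → Set
    Hom root w₀ e = e zero ≡ w₀
    Hom (grow p x s) w₀ e = as s (e (suc x)) (e zero) ≡ true × Hom p w₀ (e ∘ suc)

    E-mono : ∀ {m} (p : Piece m) w₀ {f g} → (∀ e → f e ≤ g e) → E p w₀ f ≤ E p w₀ g
    E-mono root w₀ h = h _
    E-mono (grow p x s) w₀ h = E-mono p w₀ (λ e → sum-mono (λ v → mul-mono (K-nonneg s (e x) v) (h _)))

    E-cong : ∀ {m} (p : Piece m) w₀ {f g} → (∀ e → f e ≡ g e) → E p w₀ f ≡ E p w₀ g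
    E-cong p w₀ h = ≤-antisym (E-mono p w₀ (λ e → ≤-reflexive (h e))) (E-mono p w₀ (λ e → ≤-reflexive (sym (h e))))

    E-const : ∀ {m} (p : Piece m) w₀ c → E p w₀ (λ _ → c) ≡ c
    E-const root w₀ c = refl
    E-const (grow p x s) w₀ c = trans (E-cong p w₀ (λ e → app-const s c (e x))) (E-const p w₀ c)

    E-+ : ∀ {m} (p : Piece m) w₀ f g → E p w₀ (λ e → f e + g e) ≡ E p w₀ f + E p w₀ g
    E-+ root w₀ f g = refl
    E-+ (grow p x s) w₀ f g = trans (E-cong p w₀ (λ e → trans (sum-cong (λ v → distribˡ _ _ _)) (sum-+ _ _))) (E-+ p w₀ _ _)

    E-*ˡ : ∀ {m} (p : Piece m) w₀ c f → E p w₀ (λ e → c * f e) ≡ c * E p w₀ f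
    E-*ˡ root w₀ c f = refl
    E-*ˡ (grow p x s) w₀ c f = trans (E-cong p w₀ (λ e → trans (sum-cong (λ v → (solve 3 (λ k c z → k :* (c :* z) := c :* (k :* z)) refl (K s (e x) v) c (f (v ▸ e))))) (sum-*ˡ c _))) (E-*ˡ p w₀ c _)

    E-sum : ∀ {m} (p : Piece m) w₀ {n} (f : Fin n → (Fin (suc m) → Fin r) → F) → E p w₀ (λ e → sum (λ i → f i e)) ≡ sum (λ i → E p w₀ (f i))
    E-sum root w₀ f = refl
    E-sum (grow p x s) w₀ f = trans (E-cong p w₀ (λ e → trans (sum-cong (λ v → sym (sum-*ˡ _ _))) (sum-swap _))) (E-sum p w₀ _)

    -- The method of conditional expectations: images are fixed from the root outwards, keeping the
    -- conditional mean at most T. Non-arcs have weight zero, so the choice can always be made along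
    -- an arc and the outcome is a homomorphism.
    select : ∀ {m} (p : Piece m) w₀ (f : (Fin (suc m) → Fin r) → F) T → E p w₀ f ≤ T → ∃[ e ] (Hom p w₀ e × f e ≤ T)
    select root w₀ f T h = (λ _ → w₀) , refl , h
    select (grow p x s) w₀ f T h with select p w₀ _ T h
    ... | e , hom , le = pick (search dich)
      where
      dich : ∀ v → (as s (e x) v ≡ true × f (v ▸ e) ≤ T) ⊎ (K s (e x) v * T ≤ K s (e x) v * f (v ▸ e) × (as s (e x) v ≡ true → T < f (v ▸ e)))
      dich v with as s (e x) v in eq
      ... | false = inj₂ (≤-reflexive (trans (trans (cong (_* T) (K-supp s (e x) v eq)) (zeroˡ T)) (sym (trans (cong (_* f (v ▸ e)) (K-supp s (e x) v eq)) (zeroˡ _)))) , λ ())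
      ... | true with ≤-or-> (f (v ▸ e)) T
      ... | inj₁ q = inj₁ (refl , q)
      ... | inj₂ q = inj₂ (mul-mono (K-nonneg s (e x) v) (<⇒≤ q) , λ _ → q)
      pick : (∃[ v ] (as s (e x) v ≡ true × f (v ▸ e) ≤ T)) ⊎ (∀ v → K s (e x) v * T ≤ K s (e x) v * f (v ▸ e) × (as s (e x) v ≡ true → T < f (v ▸ e)))
        → ∃[ e′ ] (Hom (grow p x s) w₀ e′ × f e′ ≤ T)
      pick (inj₁ (v , o , q)) = (v ▸ e) , (o , hom) , q
      -- Here every admissible step gives a value above T. Since the row sums to 1, some arc has
      -- positive weight, and the mean would exceed T.
      pick (inj₂ all) = ⊥-elim (none (search B))
        where
        B : ∀ v → (0F < K s (e x) v * (f (v ▸ e) - T)) ⊎ (as s (e x) v ≡ false)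
        B v with as s (e x) v in eq
        ... | false = inj₂ refl
        ... | true = inj₁ (*-pos (K-pos eq) (<⇒0<- (proj₂ (all v) eq)))
          where
          K-pos : as s (e x) v ≡ true → 0F < K s (e x) v
          K-pos eq = <-≤-trans (recip-pos rh-pos) (subst (_≤ K s (e x) v) (trans (cong (λ z → ε * [ z ]) eq) (*-identityʳ ε)) (K-lower s (e x) v))
        none : (∃[ v ] (0F < K s (e x) v * (f (v ▸ e) - T))) ⊎ (∀ v → as s (e x) v ≡ false) → ⊥
        none (inj₂ h) = (<-irrefl (lin< 0 (0<fromℕ 0 ⊹< sc 1 (≤-reflexive (sym (K-rows s (e x)))) ⊹ sc 1 (≤-reflexive (sum-zero (λ v → K-supp s (e x) v (h v))))) (solve 1 (λ z → # 1 :* (# 0 :- # 0) := # 1 :+ ((# 1 :* (z :- # 1)) :+ (# 1 :* (# 0 :- z)))) refl (sum (K s (e x))))))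
        none (inj₁ (v , pos)) = <⇒≱ (sum-strict (λ v → proj₁ (all v)) v
            (lin< 0 (sc< 0 pos) (solve 3 (λ k y T → # 1 :* ((k :* y) :- (k :* T)) := # 1 :* ((k :* (y :- T)) :- # 0)) refl (K s (e x) v) (f (v ▸ e)) T)))
          (subst (_ ≤_) (sym (app-const s T (e x))) le)

    private
      E-drop : ∀ {m} (p : Piece m) x s w₀ f → E (grow p x s) w₀ (λ e → f (e ∘ suc)) ≡ E p w₀ f
      E-drop p x s w₀ f = E-cong p w₀ (λ e → app-const s (f e) (e x))

      -- The Markov property: vertices grown later, or in other branches, do not influence the step
      -- from y to x. The three versions differ in the weight carried along: none, a function at the
      -- parent, or functions at the parent and the grandparent.
      E-par : ∀ {m} {p : Piece m} {x y s} → Par p x y s → ∀ w₀ (f : Fin r → F) → E p w₀ (λ e → f (e x)) ≡ E p w₀ (λ e → app s f (e y))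
      E-par {p = grow p a s} here w₀ f = sym (E-drop p a s w₀ (λ e → app s f (e a)))
      E-par {p = grow p a s} (there {x = x} {y} {s′} q) w₀ f = trans (E-drop p a s w₀ (λ e → f (e x))) (trans (E-par q w₀ f) (sym (E-drop p a s w₀ (λ e → app s′ f (e y)))))

      E-par₂ : ∀ {m} {p : Piece m} {x y s} → Par p x y s → ∀ w₀ (h f : Fin r → F) → E p w₀ (λ e → h (e y) * f (e x)) ≡ E p w₀ (λ e → h (e y) * app s f (e y))
      E-par₂ {p = grow p a s} here w₀ h f = trans (E-cong p w₀ (λ e → trans (sum-cong (λ v → (solve 3 (λ k h f → k :* (h :* f) := h :* (k :* f)) refl (K s (e a) v) (h (e a)) (f v)))) (sum-*ˡ _ _)))
        (sym (E-drop p a s w₀ (λ e → h (e a) * app s f (e a))))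
      E-par₂ {p = grow p a s} (there {x = x} {y} {s′} q) w₀ h f = trans (E-drop p a s w₀ (λ e → h (e y) * f (e x))) (trans (E-par₂ q w₀ h f) (sym (E-drop p a s w₀ (λ e → h (e y) * app s′ f (e y)))))

      E-par₃ : ∀ {m} {p : Piece m} {x y z s s′} → Par p x y s → Par p y z s′ → ∀ w₀ (k h f : Fin r → F)
        → E p w₀ (λ e → k (e z) * h (e y) * f (e x)) ≡ E p w₀ (λ e → k (e z) * h (e y) * app s f (e y))
      E-par₃ {p = grow p a s} here (there {y = z} q) w₀ k h f = trans (E-cong p w₀ (λ e → trans (sum-cong (λ v → (solve 3 (λ k h f → k :* (h :* f) := h :* (k :* f)) refl (K s (e a) v) (k (e z) * h (e a)) (f v)))) (sum-*ˡ _ _)))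
        (sym (E-drop p a s w₀ (λ e → k (e z) * h (e a) * app s f (e a))))
      E-par₃ {p = grow p a s} (there {x = x} {y} {s′} q) (there {y = z} q′) w₀ k h f = trans (E-drop p a s w₀ (λ e → k (e z) * h (e y) * f (e x)))
        (trans (E-par₃ q q′ w₀ k h f) (sym (E-drop p a s w₀ (λ e → k (e z) * h (e y) * app s′ f (e y)))))

    -- Each step towards the root averages the function once, which shrinks its oscillation by 1 - γ
    -- and keeps its sum. After depth-many steps every value is within the remaining oscillation of
    -- the mean.
    E-mix : ∀ {m} (p : Piece m) w₀ x {f o μ} → Osc f o → sum f ≡ 𝕣 * μ → E p w₀ (λ e → f (e x)) ≤ μ + (1F - γ b) ^^ depth p x * o
    E-mix root w₀ x {f} {o} {μ} osc mean = subst (f w₀ ≤_) (cong (μ +_) (sym (*-identityˡ o))) (Osc-mean osc mean w₀)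
    E-mix (grow p a s) w₀ zero {f} {o} {μ} osc mean = subst (E p w₀ (λ e → app s f (e a)) ≤_)
      (solve 4 (λ m d c o → m :+ (d :* (c :* o)) := m :+ ((c :* d) :* o)) refl μ ((1F - γ b) ^^ depth p a) (1F - γ b) o)
      (E-mix p w₀ a (contract s osc) (trans (app-sum s f) mean))
    E-mix (grow p a s) w₀ (suc x) {f} osc mean = subst (_≤ _) (sym (E-drop p a s w₀ (λ e → f (e x)))) (E-mix p w₀ x osc mean)

    coll : ∀ {m} → Piece m → (Fin (suc m) → Fin r) → F
    coll root e = 0F
    coll (grow p a s) e = sum (λ j → [ e zero == e (suc j) ]) + coll p (e ∘ suc)

    coll-nonneg : ∀ {m} (p : Piece m) e → 0F ≤ coll p e
    coll-nonneg root e = ≤-refl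
    coll-nonneg (grow p a s) e = sum-nonneg (λ j → []-nonneg (e zero == e (suc j))) ⊹ coll-nonneg p (e ∘ suc)

    κ₀-nonneg : 0F ≤ κ₀
    κ₀-nonneg = *-nonneg (0≤fromℕ _) 0≤ε

    -- Whatever the earlier positions are, a new vertex hits a given one of them with probability at
    -- most the largest entry `κ₀`.
    E-coll : ∀ {m} (p : Piece m) w₀ → E p w₀ (coll p) ≤ fromℕ (suc m) * fromℕ (suc m) * κ₀
    E-coll root w₀ = *-nonneg (*-nonneg (0≤fromℕ 1) (0≤fromℕ 1)) κ₀-nonneg
    E-coll {suc m} (grow p a s) w₀ = subst (_≤ _) (sym (E-+ (grow p a s) w₀ (λ e → sum (λ j → [ e zero == e (suc j) ])) (λ e → coll p (e ∘ suc))))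
      (lin 0 (sc 1 first ⊹ sc 1 (≤-reflexive (E-drop p a s w₀ (coll p))) ⊹ sc 1 (E-coll p w₀) ⊹ sc 1 (*-nonneg (*-nonneg (≤⇒0≤- (≤-reflexive (sym (fromℕ-suc (suc m))))) (0≤fromℕ (suc (suc m)) ⊹ 0≤fromℕ (suc m))) κ₀-nonneg) ⊹ sc 1 (*-nonneg (≤⇒0≤- (≤-reflexive (sym (fromℕ-suc (suc m))))) κ₀-nonneg) ⊹ sc 1 (*-nonneg (0≤fromℕ (suc m)) κ₀-nonneg) ⊹ sc 1 κ₀-nonneg) (solve 6 (λ A B C M N k → # 1 :* (((N :* N) :* k) :- (A :+ B)) := (# 1 :* ((M :* k) :- A)) :+ ((# 1 :* (C :- B)) :+ ((# 1 :* (((M :* M) :* k) :- C)) :+ ((# 1 :* ((((N :- (# 1 :+ M)) :* (N :+ M)) :* k) :- # 0)) :+ ((# 1 :* (((N :- (# 1 :+ M)) :* k) :- # 0)) :+ ((# 1 :* ((M :* k) :- # 0)) :+ (# 1 :* (k :- # 0)))))))) refl (E (grow p a s) w₀ (λ e → sum (λ j → [ e zero == e (suc j) ]))) (E (grow p a s) w₀ (λ e → coll p (e ∘ suc))) (E p w₀ (coll p)) (fromℕ (suc m)) (fromℕ (suc (suc m))) κ₀))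
      where
      first : E p w₀ (λ e → sum (λ v → K s (e a) v * sum (λ j → [ v == e j ]))) ≤ fromℕ (suc m) * κ₀
      first = subst (E p w₀ (λ e → sum (λ v → K s (e a) v * sum (λ j → [ v == e j ]))) ≤_) (E-const p w₀ (fromℕ (suc m) * κ₀)) (E-mono p w₀ λ e →
        subst (_≤ fromℕ (suc m) * κ₀) (sym (trans (sum-cong (λ v → sym (sum-*ˡ _ _))) (sum-swap (λ v j → K s (e a) v * [ v == e j ]))))
          (subst (sum (λ j → sum (λ v → K s (e a) v * [ v == e j ])) ≤_) (sum-const (suc m) κ₀) (sum-mono (λ j → subst (_≤ κ₀) (sym (trans (sum-cong (λ v → *-comm (K s (e a) v) [ v == e j ])) (sum-δ (e j) (K s (e a))))) (K-upper s (e a) (e j))))))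

    coll⇒inj : ∀ {m} (p : Piece m) e → coll p e < 1F → ∀ i j → e i ≡ e j → i ≡ j
    coll⇒inj root e h zero zero _ = refl
    coll⇒inj (grow p a s) e h = go
      where
      A B : F
      A = sum (λ j → [ e zero == e (suc j) ])
      B = coll p (e ∘ suc)
      no-hit : ∀ j → e zero ≡ e (suc j) → ⊥
      no-hit j q = (<-irrefl (lin< 0 (sc< 0 h ⊹< sc 1 (coll-nonneg p (e ∘ suc)) ⊹ sc 1 (term≤sum (λ j → []-nonneg (e zero == e (suc j))) j) ⊹ sc 1 (≤-reflexive (sym (trans (cong (λ z → [ z == e (suc j) ]) q) (cong [_] (==-refl (e (suc j)))))))) (solve 3 (λ A B x → # 1 :* (# 0 :- # 0) := (# 1 :* (# 1 :- (A :+ B))) :+ ((# 1 :* (B :- # 0)) :+ ((# 1 :* (A :- x)) :+ (# 1 :* (x :- # 1))))) refl A B ([ e zero == e (suc j) ]))))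
      go : ∀ i j → e i ≡ e j → i ≡ j
      go zero zero q = refl
      go zero (suc j) q = ⊥-elim (no-hit j q)
      go (suc i) zero q = ⊥-elim (no-hit i (sym q))
      go (suc i) (suc j) q = cong suc (coll⇒inj p (e ∘ suc) (lin< 0 (sc< 0 h ⊹< sc 1 (sum-nonneg (λ j → []-nonneg (e zero == e (suc j))))) (solve 2 (λ A B → # 1 :* (# 1 :- B) := (# 1 :* (# 1 :- (A :+ B))) :+ (# 1 :* (A :- # 0))) refl A B)) i j q)

    -- From any position, two steps reach every vertex with probability at least 2r/b · ε².
    private
      two-steps : ∀ s₀ s₁ f → (∀ i → 0F ≤ f i) → ∀ u → γ b * ε * sum f ≤ app s₀ (app s₁ f) u
      two-steps s₀ s₁ f f≥0 u = subst₂ _≤_ (sum-*ˡ _ f) eq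
          (sum-mono (λ v → subst₂ _≤_ (*-comm (f v) _) (*-comm (f v) _) (mul-mono (f≥0 v) (hit v))))
        where
        eq : sum (λ v → sum (λ g → K s₀ u g * K s₁ g v) * f v) ≡ app s₀ (app s₁ f) u
        eq = trans (sum-cong (λ v → sym (sum-*ʳ (f v) _))) (trans (sum-swap (λ v g → K s₀ u g * K s₁ g v * f v))
          (sum-cong (λ g → trans (sum-cong (λ v → *-assoc (K s₀ u g) (K s₁ g v) (f v))) (sum-*ˡ (K s₀ u g) _))))
        as-flip : ∀ s i j → as (not s) i j ≡ as s j i
        as-flip true i j = refl
        as-flip false i j = refl
        hit : ∀ v → γ b * ε ≤ sum (λ g → K s₀ u g * K s₁ g v)
        hit v = ≤-trans (subst (_≤ sum (λ g → ε * (ε * [ as s₀ u g ∧ as (not s₁) v g ])) ) refl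
            (subst (γ b * ε ≤_) (sym (trans (sum-*ˡ ε _) (cong (ε *_) (sum-*ˡ ε _))))
              (lin 0 (sc 1 (*-nonneg (≤⇒0≤- (γ≤ε* (dense-common (as s₀ u) (as (not s₁) v) (deg s₀ u) (deg (not s₁) v)))) 0≤ε)) (solve 3 (λ g e c → # 1 :* ((e :* (e :* c)) :- (g :* e)) := # 1 :* ((((e :* c) :- g) :* e) :- # 0)) refl (γ b) ε (sum (λ g → [ as s₀ u g ∧ as (not s₁) v g ]))))))
          (sum-mono lem)
          where
          lem : ∀ g → ε * (ε * [ as s₀ u g ∧ as (not s₁) v g ]) ≤ K s₀ u g * K s₁ g v
          lem g = subst (_≤ K s₀ u g * K s₁ g v) (trans (cong (ε * [ as s₀ u g ] *_) (cong (λ z → ε * [ z ]) (sym (as-flip s₁ v g))))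
              (trans (solve 3 (λ e x y → (e :* x) :* (e :* y) := e :* (e :* (x :* y))) refl ε ([ as s₀ u g ]) ([ as (not s₁) v g ])) (cong (λ z → ε * (ε * z)) (sym ([]-∧ (as s₀ u g) _)))))
            (mul-mono₂ (*-nonneg 0≤ε ([]-nonneg (as s₀ u g))) (*-nonneg 0≤ε ([]-nonneg (as s₁ g v))) (K-lower s₀ u g) (K-lower s₁ g v))

      K-flip : ∀ s i j → K (not s) i j ≡ K s j i
      K-flip true i j = refl
      K-flip false i j = refl

      γ₀ : F
      γ₀ = γ b

    -- The two steps from g′ to a spread the position of a over all free vertices with density at
    -- least γε, wherever g′ is. It remains to sum over a in `A` the chance that y lands in `C`.
    -- Read backwards from `C`, each of its points steps into the big set `A` with probability at
    -- least γ, and ε|C| is at least γ.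
    gadget-leaf : ∀ {m} {p : Piece m} {y a g g′ s s₁ s₀} → Par p y a s → Par p a g s₁ → Par p g g′ s₀ → ∀ w₀ (A C : Fin r → Bool) → Big A → fromℕ 2 * 𝕣 ≤ 𝕓 * sum (λ w → [ C w ])
      → γ₀ * γ₀ * γ₀ ≤ E p w₀ (λ e → [ A (e a) ] * [ C (e y) ])
    gadget-leaf {p = p} {y} {a} {g} {g′} {s} {s₁} {s₀} py pa pg w₀ A C bigA bigC =
      subst (γ₀ * γ₀ * γ₀ ≤_) (sym (trans (E-par₂ py w₀ (λ v → [ A v ]) (λ v → [ C v ])) (trans (E-par pa w₀ f) (E-par pg w₀ (app s₁ f)))))
        (subst (_≤ E p w₀ (λ e → app s₀ (app s₁ f) (e g′))) (E-const p w₀ _) (E-mono p w₀ (λ e → ≤-trans main (two-steps s₀ s₁ f f≥0 (e g′)))))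
      where
      f : Fin r → F
      f v = [ A v ] * app s (λ w → [ C w ]) v
      f≥0 : ∀ v → 0F ≤ f v
      f≥0 v = *-nonneg ([]-nonneg (A v)) (sum-nonneg (λ w → *-nonneg (K-nonneg s v w) ([]-nonneg (C w))))
      sum-f : γ₀ * sum (λ w → [ C w ]) ≤ sum f
      sum-f = subst₂ _≤_ (sum-*ˡ γ₀ _) (trans (sum-swap (λ w v → [ A v ] * (K s v w * [ C w ]))) (sum-cong (λ v → sum-*ˡ [ A v ] _)))
        (sum-mono (λ w → subst (γ₀ * [ C w ] ≤_)
          (trans (sym (sum-*ʳ [ C w ] _)) (sum-cong (λ v → trans (cong (λ z → z * [ A v ] * [ C w ]) (K-flip s w v)) (solve 3 (λ k x y → (k :* x) :* y := x :* (k :* y)) refl (K s v w) ([ A v ]) ([ C w ])))))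
          (subst₂ _≤_ (*-comm [ C w ] _) (*-comm [ C w ] _) (mul-mono ([]-nonneg (C w)) (Big⇒app {A} bigA (not s) w)))))
      main : γ₀ * γ₀ * γ₀ ≤ γ₀ * ε * sum f
      main = (lin 0 (sc 1 (*-nonneg (*-nonneg (<⇒≤ (0<γ 0<b)) 0≤ε) (≤⇒0≤- sum-f)) ⊹ sc 1 (*-nonneg (*-nonneg (<⇒≤ (0<γ 0<b)) (<⇒≤ (0<γ 0<b))) (≤⇒0≤- (γ≤ε* bigC)))) (solve 4 (λ g e c z → # 1 :* (((g :* e) :* z) :- ((g :* g) :* g)) := (# 1 :* (((g :* e) :* (z :- (g :* c))) :- # 0)) :+ (# 1 :* (((g :* g) :* ((e :* c) :- g)) :- # 0))) refl γ₀ ε (sum (λ w → [ C w ])) (sum f)))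

    -- One further step, from y to its child x, meets the big set `B` with probability at least γ
    -- from any position of y.
    gadget-mid : ∀ {m} {p : Piece m} {x y a g g′ s₂ s s₁ s₀} → Par p x y s₂ → Par p y a s → Par p a g s₁ → Par p g g′ s₀ → ∀ w₀ (A B C : Fin r → Bool) → Big A → Big B → fromℕ 2 * 𝕣 ≤ 𝕓 * sum (λ w → [ C w ])
      → γ₀ * γ₀ * γ₀ * γ₀ ≤ E p w₀ (λ e → [ A (e a) ] * [ C (e y) ] * [ B (e x) ])
    gadget-mid {m} {p} {x} {y} {a} {s₂ = s₂} px py pa pg w₀ A B C bigA bigB bigC =
      subst (γ₀ * γ₀ * γ₀ * γ₀ ≤_) (sym (E-par₃ px py w₀ (λ v → [ A v ]) (λ v → [ C v ]) (λ v → [ B v ])))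
        (≤-trans (lin 0 (sc 1 (*-nonneg (<⇒≤ (0<γ 0<b)) (≤⇒0≤- (gadget-leaf py pa pg w₀ A C bigA bigC)))) (solve 2 (λ g x → # 1 :* ((g :* x) :- (((g :* g) :* g) :* g)) := # 1 :* ((g :* (x :- ((g :* g) :* g))) :- # 0)) refl γ₀ (E p w₀ AC)))
          (subst (_≤ E p w₀ G) (E-*ˡ p w₀ γ₀ AC) (E-mono p w₀ {f = λ e → γ₀ * AC e} {g = G} step)))
      where
      AC : (Fin (suc m) → Fin r) → F
      AC e = [ A (e a) ] * [ C (e y) ]
      G : (Fin (suc m) → Fin r) → F
      G e = AC e * app s₂ (λ v → [ B v ]) (e y)
      step : ∀ e → γ₀ * AC e ≤ G e
      step e = subst (_≤ G e) (*-comm (AC e) γ₀) (mul-mono {AC e} (*-nonneg ([]-nonneg (A (e a))) ([]-nonneg (C (e y)))) (Big⇒app {B} bigB s₂ (e y)))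

-- Averages that can be derandomised, and the potential step.

module Selection where
  open OrderedField
  open Sums

  -- The properties of expectation that the potential argument relies on. `pick` is the
  -- derandomisation, returning an outcome that also satisfies `Good`.
  record Avg (A : Set) : Set₁ where
    field
      avg : (A → F) → F
      Good : A → Set
      mono : ∀ {f g} → (∀ e → f e ≤ g e) → avg f ≤ avg g
      add : ∀ f g → avg (λ e → f e + g e) ≡ avg f + avg g
      scale : ∀ c f → avg (λ e → c * f e) ≡ c * avg f
      const : ∀ c → avg (λ _ → c) ≡ c
      swap : ∀ {n} (f : Fin n → A → F) → avg (λ e → sum (λ i → f i e)) ≡ sum (λ i → avg (f i))
      pick : ∀ f T → avg f ≤ T → ∃[ e ] (Good e × f e ≤ T)

    cong-avg : ∀ {f g} → (∀ e → f e ≡ g e) → avg f ≡ avg g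
    cong-avg h = ≤-antisym (mono (λ e → ≤-reflexive (h e))) (mono (λ e → ≤-reflexive (sym (h e))))

    shift : ∀ c f → avg (λ e → f e - c) ≡ avg f - c
    shift c f = trans (add f (λ _ → - c)) (cong (avg f +_) (const (- c)))

  sqr : F → F
  sqr x = x * x

  -- The last term is linear in Z and averages to zero. So (D² + 4σk)², with k the number of steps
  -- still to come, is a supermartingale. Fourth moments are what the sum over 2N neighbourhoods
  -- requires: with N steps and σ of order S²/N² the total is of order S⁴/N, whereas second moments
  -- would give a total of order S², which is not small.
  fourth : ∀ D Z σ k → Z * Z ≤ σ → 0F ≤ k →
    sqr ((D + Z) * (D + Z) + fromℕ 4 * σ * k) ≤ sqr (D * D + fromℕ 4 * σ * (k + 1F)) + fromℕ 4 * D * (D * D + fromℕ 4 * σ * k) * Z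
  fourth D Z σ k h k≥0 = (lin 0 (sc 2 (sq-nonneg ((D - Z) * Z)) ⊹ sc 8 (*-nonneg (*-nonneg (≤-trans (sq-nonneg Z) h) k≥0) (≤⇒0≤- h)) ⊹ sc 8 (*-nonneg (sq-nonneg D) (≤⇒0≤- h)) ⊹ sc 3 (*-nonneg (≤⇒0≤- h) (sq-nonneg Z)) ⊹ sc 3 (*-nonneg (≤⇒0≤- h) (≤-trans (sq-nonneg Z) h)) ⊹ sc 24 (*-nonneg (*-nonneg (≤-trans (sq-nonneg Z) h) (≤-trans (sq-nonneg Z) h)) k≥0) ⊹ sc 13 (sq-nonneg σ)) (solve 4 (λ D Z s k → # 1 :* (((((D :* D) :+ ((# 4 :* s) :* (k :+ # 1))) :* ((D :* D) :+ ((# 4 :* s) :* (k :+ # 1)))) :+ (((# 4 :* D) :* ((D :* D) :+ ((# 4 :* s) :* k))) :* Z)) :- ((((D :+ Z) :* (D :+ Z)) :+ ((# 4 :* s) :* k)) :* (((D :+ Z) :* (D :+ Z)) :+ ((# 4 :* s) :* k)))) := (# 2 :* ((((D :- Z) :* Z) :* ((D :- Z) :* Z)) :- # 0)) :+ ((# 8 :* (((s :* k) :* (s :- (Z :* Z))) :- # 0)) :+ ((# 8 :* (((D :* D) :* (s :- (Z :* Z))) :- # 0)) :+ ((# 3 :* (((s :- (Z :* Z)) :* (Z :* Z)) :- # 0)) :+ ((# 3 :* (((s :- (Z :* Z)) :* s) :- # 0)) :+ ((# 24 :* (((s :* s) :* k) :- # 0)) :+ (# 13 :* ((s :* s) :-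 # 0)))))))) refl D Z σ k))

  Σ₂ : ∀ {N} → (Bool → Fin N → F) → F
  Σ₂ f = sum (f true) + sum (f false)

  Σ₂-mono : ∀ {N} {f g : Bool → Fin N → F} → (∀ s v → f s v ≤ g s v) → Σ₂ f ≤ Σ₂ g
  Σ₂-mono h = +-mono-≤ (sum-mono (h true)) (sum-mono (h false))

  term≤Σ₂ : ∀ {N} {f : Bool → Fin N → F} → (∀ s v → 0F ≤ f s v) → ∀ s v → f s v ≤ Σ₂ f
  term≤Σ₂ {f = f} h true v = (lin 0 (sc 1 (term≤sum (h true) v) ⊹ sc 1 (sum-nonneg (h false))) (solve 3 (λ x a c → # 1 :* ((a :+ c) :- x) := (# 1 :* (a :- x)) :+ (# 1 :* (c :- # 0))) refl (f true v) (sum (f true)) (sum (f false))))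
  term≤Σ₂ {f = f} h false v = (lin 0 (sc 1 (term≤sum (h false) v) ⊹ sc 1 (sum-nonneg (h true))) (solve 3 (λ x a c → # 1 :* ((a :+ c) :- x) := (# 1 :* (c :- x)) :+ (# 1 :* (a :- # 0))) refl (f false v) (sum (f true)) (sum (f false))))

  module _ {A : Set} (𝔸 : Avg A) where
    open Avg 𝔸

    avg-fourth : ∀ D σ k (Z : A → F) → (∀ e → Z e * Z e ≤ σ) → 0F ≤ k → avg Z ≡ 0F
      → avg (λ e → sqr ((D + Z e) * (D + Z e) + fromℕ 4 * σ * k)) ≤ sqr (D * D + fromℕ 4 * σ * (k + 1F))
    avg-fourth D σ k Z h k≥0 z = mono (λ e → fourth D (Z e) σ k (h e) k≥0)
      ≤≡ trans (add _ _) (trans (cong₂ _+_ (const _) (trans (scale _ Z) (trans (cong (fourthCoeff *_) z) (zeroʳ _)))) (+-identityʳ _))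
      where
      fourthCoeff : F
      fourthCoeff = fromℕ 4 * D * (D * D + fromℕ 4 * σ * k)

    -- The two potentials (fourth moments of the usage deviations, exponential weights of the absorber tests) are
    -- supermartingales, so one outcome keeps their sum from increasing.
    potential-step : ∀ {N T} (σ k ξ μ c₁ c₂ : F) (D : Bool → Fin N → F) (Z : Bool → Fin N → A → F) (w : Fin T → F) (X : Fin T → A → F)
      → (∀ s v e → Z s v e * Z s v e ≤ σ) → 0F ≤ k → (∀ s v → avg (Z s v) ≡ 0F)
      → (∀ τ → 0F ≤ w τ) → 0F ≤ ξ → (∀ τ → μ ≤ avg (X τ)) → 0F ≤ c₁ → 0F ≤ c₂
      → ∃[ e ] (Good e × c₁ * Σ₂ (λ s v → sqr ((D s v + Z s v e) * (D s v + Z s v e) + fromℕ 4 * σ * k)) + c₂ * sum (λ τ → w τ * (1F - ξ * X τ e))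
          ≤ c₁ * Σ₂ (λ s v → sqr (D s v * D s v + fromℕ 4 * σ * (k + 1F))) + c₂ * ((1F - ξ * μ) * sum w))
    potential-step σ k ξ μ c₁ c₂ D Z w X Z² k≥0 Z₀ w≥0 ξ≥0 X≥ c₁≥0 c₂≥0 = pick _ _
        (subst (_≤ c₁ * Σ₂ Ψ₀ + c₂ * ((1F - ξ * μ) * sum w)) (sym (trans (add _ _) (cong₂ _+_ (scale c₁ _) (scale c₂ _))))
          (+-mono-≤ (mul-mono c₁≥0 first) (mul-mono c₂≥0 second)))
      where
      Ψ : Bool → Fin _ → A → F
      Ψ s v e = sqr ((D s v + Z s v e) * (D s v + Z s v e) + fromℕ 4 * σ * k)
      Ψ₀ : Bool → Fin _ → F
      Ψ₀ s v = sqr (D s v * D s v + fromℕ 4 * σ * (k + 1F))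
      first : avg (λ e → Σ₂ (λ s v → Ψ s v e)) ≤ Σ₂ Ψ₀
      first = subst (_≤ Σ₂ Ψ₀) (sym (trans (add _ _) (cong₂ _+_ (swap (Ψ true)) (swap (Ψ false)))))
        (Σ₂-mono (λ s v → avg-fourth (D s v) σ k (Z s v) (Z² s v) k≥0 (Z₀ s v)))
      second : avg (λ e → sum (λ τ → w τ * (1F - ξ * X τ e))) ≤ (1F - ξ * μ) * sum w
      second = subst₂ _≤_ (sym (swap (λ τ e → w τ * (1F - ξ * X τ e)))) (trans (sum-*ʳ (1F - ξ * μ) w) (*-comm _ _)) (sum-mono lem)
        where
        lem : ∀ τ → avg (λ e → w τ * (1F - ξ * X τ e)) ≤ w τ * (1F - ξ * μ)
        lem τ = subst (_≤ w τ * (1F - ξ * μ)) (sym (trans (scale (w τ) _) (cong (w τ *_) (trans (cong-avg (λ e → (solve 2 (λ x y → # 1 :- (x :* y) := ((:- x) :* y) :+ # 1) refl ξ (X τ e))))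
            (trans (add _ _) (cong₂ _+_ (scale (- ξ) (X τ)) (const 1F)))))))
          (mul-mono (w≥0 τ) (lin 0 (sc 1 (*-nonneg ξ≥0 (≤⇒0≤- (X≥ τ)))) (solve 3 (λ x m y → # 1 :* ((# 1 :- (x :* m)) :- (((:- x) :* y) :+ # 1)) := # 1 :* ((x :* (y :- m)) :- # 0)) refl ξ μ (avg (X τ)))))

  module _ where
    keepSub : ∀ {r} (keep : Fin r → Bool) → ∃[ r′ ] Σ (Fin r′ → Fin r) λ κ →
      (∀ i j → κ i ≡ κ j → i ≡ j) × (∀ i → keep (κ i) ≡ true) × (∀ f → sum (λ i → [ keep i ] * f i) ≡ sum (f ∘ κ))
    keepSub {zero} keep = 0 , (λ ()) , (λ ()) , (λ ()) , (λ f → trans (sum-0 _) (sym (sum-0 _)))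
    keepSub {suc r} keep with keepSub (keep ∘ suc) | keep zero in eq
    ... | r′ , κ , inj , ok , sums | false = r′ , suc ∘ κ , (λ i j h → inj i j (Finₚ.suc-injective h)) , ok ,
          λ f → trans (sum-suc _) (trans (cong₂ _+_ (trans (cong (λ z → [ z ] * f zero) eq) (zeroˡ _)) (sums (f ∘ suc))) (+-identityˡ _))
    ... | r′ , κ , inj , ok , sums | true = suc r′ , κ′ , inj′ , ok′ ,
          λ f → trans (sum-suc _) (trans (cong₂ _+_ (trans (cong (λ z → [ z ] * f zero) eq) (*-identityˡ _)) (sums (f ∘ suc))) (sym (sum-suc (f ∘ κ′))))
      where
      κ′ : Fin (suc r′) → Fin (suc r)
      κ′ zero = zero
      κ′ (suc i) = suc (κ i)
      inj′ : ∀ i j → κ′ i ≡ κ′ j → i ≡ j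
      inj′ zero zero _ = refl
      inj′ (suc i) (suc j) h = cong suc (inj i j (Finₚ.suc-injective h))
      ok′ : ∀ i → keep (κ′ i) ≡ true
      ok′ zero = eq
      ok′ (suc i) = ok i

    -- Removing the image of an injection from Fin r.
    complement : ∀ {r l} (e : Fin l → Fin r) (real : Fin l → Bool) → (∀ i j → e i ≡ e j → i ≡ j)
      → ∃[ r′ ] Σ (Fin r′ → Fin r) λ κ → (∀ i j → κ i ≡ κ j → i ≡ j) × (∀ i x → real x ≡ true → ¬ κ i ≡ e x)
        × (∀ f → sum f ≡ sum (f ∘ κ) + sum (λ x → [ real x ] * f (e x)))
    complement {r} {l} e real inj = let r′ , κ , κ-inj , ok , sums = keepSub keep in
        r′ , κ , κ-inj , (λ i x rx q → miss (κ i) (ok i) x rx q) , λ f → trans (split f) (cong₂ _+_ (sums f) (hits f))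
      where
      hit? : ∀ i → (∃[ x ] (real x ≡ true × i ≡ e x)) ⊎ (∀ x → ¬ (real x ≡ true × i ≡ e x))
      hit? i = search dich
        where
        dich : ∀ x → (real x ≡ true × i ≡ e x) ⊎ (¬ (real x ≡ true × i ≡ e x))
        dich x with Bool-dec (real x) | i Finₚ.≟ e x
        ... | inj₁ a | yes c = inj₁ (a , c)
        ... | inj₂ a | _ = inj₂ λ p → contradiction (trans (sym (proj₁ p)) a) λ ()
        ... | inj₁ a | no c = inj₂ λ p → c (proj₂ p)
      keepOf : ∀ {i} → (∃[ x ] (real x ≡ true × i ≡ e x)) ⊎ (∀ x → ¬ (real x ≡ true × i ≡ e x)) → Bool
      keepOf (inj₁ _) = false
      keepOf (inj₂ _) = true
      keep : Fin r → Bool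
      keep i = keepOf (hit? i)
      miss : ∀ i → keep i ≡ true → ∀ x → real x ≡ true → i ≡ e x → ⊥
      miss i k x rx q with hit? i
      ... | inj₂ h = h x (rx , q)
      count : ∀ i → 1F ≡ [ keep i ] + sum (λ x → [ real x ] * [ i == e x ])
      count i with hit? i
      ... | inj₂ h = trans (solve 0 (# 1 := # 1 :+ # 0) refl ) (cong (1F +_) (sym (sum-zero z)))
        where
        z : ∀ x → [ real x ] * [ i == e x ] ≡ 0F
        z x with real x in rx | i == e x in q
        ... | true | true = ⊥-elim (h x (rx , ==⇒≡ i (e x) q))
        ... | true | false = zeroʳ 1F
        ... | false | _ = zeroˡ _
      ... | inj₁ (x₀ , rx₀ , q₀) = trans (solve 0 (# 1 := # 0 :+ # 1) refl ) (cong (0F +_) (sym (trans (sum-cong z) (sum-[==] x₀))))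
        where
        z : ∀ x → [ real x ] * [ i == e x ] ≡ [ x == x₀ ]
        z x with x Finₚ.≟ x₀
        ... | yes refl rewrite rx₀ | q₀ | ==-refl (e x₀) = *-identityˡ 1F
        ... | no ne rewrite ≢⇒== {i = i} {e x} (λ q → ne (inj x x₀ (trans (sym q) q₀))) = zeroʳ _
      split : ∀ f → sum f ≡ sum (λ i → [ keep i ] * f i) + sum (λ i → sum (λ x → [ real x ] * [ i == e x ]) * f i)
      split f = trans (sum-cong (λ i → trans (sym (*-identityˡ (f i))) (trans (cong (_* f i) (count i)) (distribʳ (f i) _ _)))) (sum-+ _ _)
      hits : ∀ f → sum (λ i → sum (λ x → [ real x ] * [ i == e x ]) * f i) ≡ sum (λ x → [ real x ] * f (e x))
      hits f = trans (sum-cong (λ i → sym (sum-*ʳ (f i) _))) (trans (sum-swap (λ i x → [ real x ] * [ i == e x ] * f i))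
        (sum-cong (λ x → trans (sum-cong (λ i → *-assoc [ real x ] [ i == e x ] (f i))) (trans (sum-*ˡ [ real x ] (λ i → [ i == e x ] * f i)) (cong ([ real x ] *_) (sum-δ (e x) f))))))

-- Embedding one tree into the free vertices.

module Step where
  open OrderedField
  open Sums
  open Transport
  open RandomWalks
  open Selection

  recip-≤ : ∀ {x y} → 0F < x → x ≤ y → recip y ≤ recip x
  recip-≤ {x} {y} 0<x x≤y = mul-cancel (*-pos 0<x 0<y) (lin 0 (sc 1 (≤-reflexive (cong (x *_) (recip-inv 0<y))) ⊹ sc 1 (≤-reflexive (sym (cong (y *_) (recip-inv 0<x)))) ⊹ sc 1 x≤y) (solve 4 (λ x y u v → # 1 :* (((x :* y) :* u) :- ((x :* y) :* v)) := (# 1 :* ((x :* # 1) :- (x :* (y :* v)))) :+ ((# 1 :* ((y :* (x :* u)) :- (y :* # 1))) :+ (# 1 :* (y :- x)))) refl x y (recip x) (recip y)))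
    where
    0<y : 0F < y
    0<y = <-≤-trans 0<x x≤y

  rootIx : ∀ {m} → Piece m → Fin (suc m)
  rootIx root = zero
  rootIx (grow p a s) = suc (rootIx p)

  rootOrPar : ∀ {m} (p : Piece m) x → x ≡ rootIx p ⊎ (∃[ y ] ∃[ s ] Par p x y s)
  rootOrPar root zero = inj₁ refl
  rootOrPar (grow p a s) zero = inj₂ (suc a , s , here)
  rootOrPar (grow p a s) (suc x) with rootOrPar p x
  ... | inj₁ q = inj₁ (cong suc q)
  ... | inj₂ (y , s′ , q) = inj₂ (suc y , s′ , there q)

  adjOf : ∀ {N} → (Fin N → Fin N → Bool) → Bool → Fin N → Fin N → Bool
  adjOf arc true u w = arc u w
  adjOf arc false u w = arc w u

  module Steps {N : ℕ} (arc : Fin N → Fin N → Bool) {b : ℕ} (0<b : 0 ℕ.< b) (rmin S : ℕ) (0<rmin : 0 ℕ.< rmin) where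
    adjS : Bool → Fin N → Fin N → Bool
    adjS = adjOf arc

    -- For trees of at most S vertices and at least rmin free vertices, `κ` bounds the expected
    -- number of collisions in one tree and `σ` the square of the change that one tree makes to a
    -- density.
    ρ κ σ : F
    ρ = recip (fromℕ rmin)
    κ = fromℕ S * fromℕ S * (fromℕ (suc (cap b)) * ρ)
    σ = fromℕ S * ρ * (fromℕ S * ρ)

    0<ρ : 0F < ρ
    0<ρ = recip-pos (fromℕ-< 0<rmin)

    κ-nonneg : 0F ≤ κ
    κ-nonneg = *-nonneg (*-nonneg (0≤fromℕ S) (0≤fromℕ S)) (*-nonneg (0≤fromℕ _) (<⇒≤ 0<ρ))

    module OnFree (κ<1 : κ < 1F) {r : ℕ} (ι : Fin r → Fin N)
      (dens : ∀ s v → (fromℕ b + fromℕ 2) * fromℕ r ≤ fromℕ 2 * fromℕ b * sum (λ i → [ adjS s v (ι i) ]))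
      (rmin≤r : fromℕ rmin ≤ fromℕ r) where

      a : Fin r → Fin r → Bool
      a i j = arc (ι i) (ι j)

      0<r : 0 ℕ.< r
      0<r = fromℕ-<⁻ (<-≤-trans (fromℕ-< 0<rmin) rmin≤r)

      dense : Dense b r a
      dense = record { out = λ i → dens true (ι i) ; inn = λ j → dens false (ι j) }

      W : Walk b r a
      W = walk 0<b 0<r a dense

      open Walks 0<b 0<r a dense W public

      q : Bool → Fin N → F
      q s v = sum (λ i → [ adjS s v (ι i) ])

      𝕣 𝕓 : F
      𝕣 = fromℕ r
      𝕓 = fromℕ b
      0<𝕣 : 0F < 𝕣
      0<𝕣 = fromℕ-< 0<r

      common : ∀ s v s′ v′ → fromℕ 2 * 𝕣 ≤ 𝕓 * sum (λ w → [ adjS s v (ι w) ∧ adjS s′ v′ (ι w) ])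
      common s v s′ v′ = dense-common (λ w → adjS s v (ι w)) (λ w → adjS s′ v′ (ι w)) (dens s v) (dens s′ v′)

      common-exists : ∀ s v s′ v′ → ∃[ w ] (adjS s v (ι w) ≡ true × adjS s′ v′ (ι w) ≡ true)
      common-exists s v s′ v′ = let w , h = count-pos⇒∃ (λ w → adjS s v (ι w) ∧ adjS s′ v′ (ι w)) (mul-pos⁻ (<-≤-trans 0<2r (common s v s′ v′))) in w , ∧-true h
        where
        0<2r : 0F < fromℕ 2 * 𝕣
        0<2r = *-pos (0<fromℕ 1) 0<𝕣
        mul-pos⁻ : ∀ {c} → 0F < 𝕓 * c → 0F < c
        mul-pos⁻ {c} h with ≤-or-> c 0F
        ... | inj₂ p = p
        ... | inj₁ p = ⊥-elim (<⇒≱ h (mul-mono (0≤fromℕ b) p ≤≡ zeroʳ 𝕓))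

      Big-adj : ∀ s v → Big (λ w → adjS s v (ι w))
      Big-adj s v = dense⇒Big (λ w → adjS s v (ι w)) (dens s v)

      module OnPiece {m : ℕ} (p : Piece m) (m<S : suc m ℕ.≤ S) (w₀ : Fin r) where
        Env : Set
        Env = Fin (suc m) → Fin r

        𝕝 : F
        𝕝 = fromℕ (suc m)

        𝕝≤S : 𝕝 ≤ fromℕ S
        𝕝≤S = fromℕ-≤ m<S

        private
          E-coll≤κ : E p w₀ (coll p) ≤ κ
          E-coll≤κ = ≤-trans (E-coll p w₀) (mul-mono₂ (*-nonneg (0≤fromℕ _) (0≤fromℕ _)) κ₀-nonneg
              (mul-mono₂ (0≤fromℕ _) (0≤fromℕ _) 𝕝≤S 𝕝≤S)
              (mul-mono (0≤fromℕ _) (recip-≤ (fromℕ-< 0<rmin) (lin 0 (sc 1 rmin≤r ⊹ sc 1 (*-nonneg (<⇒≤ 0<𝕣) (≤⇒0≤- (≤-reflexive (sym (fromℕ-+ b 2))))) ⊹ sc 1 (*-nonneg (<⇒≤ 0<𝕣) (0≤fromℕ b)) ⊹ sc 1 (<⇒≤ 0<𝕣)) (solve 4 (λ x r h b → # 1 :* ((r :* h) :- x) := (# 1 :* (r :- x)) :+ ((# 1 :* ((r :* (h :- (b :+ # 2))) :- # 0)) :+ ((# 1 :* ((r :* b) :- # 0)) :+ (# 1 :* (r :- # 0))))) refl (fromℕ rmin) 𝕣 (fromℕ (hh b)) 𝕓)))))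

        private
          fall : ∃[ e ] (Hom p w₀ e × coll p e ≤ κ)
          fall = select p w₀ (coll p) κ E-coll≤κ
          e* : Env
          e* = proj₁ fall

        -- Outcomes with a collision are replaced by one fixed collision-free outcome, which exists
        -- because `κ` < 1. Every outcome of the repaired expectation is then injective, at the
        -- price computed in `avg-close`.
        o : Env → Env
        o e with ≤-or-> 1F (coll p e)
        ... | inj₁ _ = e*
        ... | inj₂ _ = e

        Good : Env → Set
        Good e = Hom p w₀ e × (∀ i j → e i ≡ e j → i ≡ j)

        private
          o-good : ∀ e → Hom p w₀ e → Good (o e)
          o-good e hom with ≤-or-> 1F (coll p e)
          ... | inj₁ _ = proj₁ (proj₂ fall) , coll⇒inj p e* (≤-<-trans (proj₂ (proj₂ fall)) κ<1)
          ... | inj₂ h = hom , coll⇒inj p e h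

        𝔸 : Avg Env
        𝔸 = record
          { avg = λ f → E p w₀ (λ e → f (o e)) ; Good = Good
          ; mono = λ h → E-mono p w₀ (λ e → h (o e))
          ; add = λ f g → E-+ p w₀ _ _ ; scale = λ c f → E-*ˡ p w₀ c _ ; const = λ c → E-const p w₀ c
          ; swap = λ f → E-sum p w₀ _
          ; pick = λ f T h → let e , hom , le = select p w₀ (λ e → f (o e)) T h in o e , o-good e hom , le }

        open Avg 𝔸 public using (avg)

        -- The repair changes f only where `coll` is at least 1, and there by at most 𝕝, so the
        -- error is at most 𝕝 times the expected number of collisions.
        avg-close : ∀ (f : Env → F) → (∀ e → 0F ≤ f e) → (∀ e → f e ≤ 𝕝) → avg f ≤ E p w₀ f + 𝕝 * κ × E p w₀ f ≤ avg f + 𝕝 * κ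
        avg-close f f≥0 f≤l = close (λ e → f (o e)) f (λ e → proj₁ (lem e)) , close f (λ e → f (o e)) (λ e → proj₂ (lem e))
          where
          close : ∀ (g h : Env → F) → (∀ e → g e ≤ h e + 𝕝 * coll p e) → E p w₀ g ≤ E p w₀ h + 𝕝 * κ
          close g h k = ≤-trans (E-mono p w₀ k ≤≡ trans (E-+ p w₀ h _) (cong (E p w₀ h +_) (E-*ˡ p w₀ 𝕝 (coll p)))) (+-mono-≤ ≤-refl (mul-mono (0≤fromℕ _) E-coll≤κ))
          lem : ∀ e → f (o e) ≤ f e + 𝕝 * coll p e × f e ≤ f (o e) + 𝕝 * coll p e
          lem e with ≤-or-> 1F (coll p e)
          ... | inj₂ _ = le , le
            where
            le : f e ≤ f e + 𝕝 * coll p e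
            le = (lin 0 (sc 1 (*-nonneg (0≤fromℕ (suc m)) (coll-nonneg p e))) (solve 3 (λ x l c → # 1 :* ((x :+ (l :* c)) :- x) := # 1 :* ((l :* c) :- # 0)) refl (f e) 𝕝 (coll p e)))
          ... | inj₁ c≥1 = le e* e , le e e*
            where
            le : ∀ e₁ e₂ → f e₁ ≤ f e₂ + 𝕝 * coll p e
            le e₁ e₂ = (lin 0 (sc 1 (f≤l e₁) ⊹ sc 1 (f≥0 e₂) ⊹ sc 1 (*-nonneg (0≤fromℕ (suc m)) (≤⇒0≤- c≥1))) (solve 4 (λ x y l c → # 1 :* ((y :+ (l :* c)) :- x) := (# 1 :* (l :- x)) :+ ((# 1 :* (y :- # 0)) :+ (# 1 :* ((l :* (c :- # 1)) :- # 0)))) refl (f e₁) (f e₂) 𝕝 (coll p e)))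

        module Usage (real : Fin (suc m) → Bool) (r′ : F) (r′-def : r′ ≡ 𝕣 - sum (λ x → [ real x ])) (rmin≤r′ : fromℕ rmin ≤ r′) where
          U : Bool → Fin N → Env → F
          U s v e = sum (λ x → [ real x ] * [ adjS s v (ι (e x)) ])

          L ω : F
          L = sum (λ x → [ real x ])
          ω = sum (λ x → (1F - γ b) ^^ depth p x)

          private
            U-nonneg : ∀ s v e → 0F ≤ U s v e
            U-nonneg s v e = sum-nonneg (λ x → *-nonneg ([]-nonneg (real x)) ([]-nonneg (adjS s v (ι (e x)))))

            U≤𝕝 : ∀ s v e → U s v e ≤ 𝕝
            U≤𝕝 s v e = sum-mono (λ x → mul-mono₂ ([]-nonneg (real x)) ([]-nonneg (adjS s v (ι (e x)))) ([]-≤1 (real x)) ([]-≤1 (adjS s v (ι (e x)))))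
              ≤≡ trans (sum-const (suc m) (1F * 1F)) (solve 1 (λ l → l :* (# 1 :* # 1) := l) refl 𝕝)

          Δ : Bool → Fin N → F
          Δ s v = avg (U s v)

          private
            0<r′ : 0F < r′
            0<r′ = <-≤-trans (fromℕ-< 0<rmin) rmin≤r′

          -- Usage of a neighbourhood minus its mean, measured in units of density among the r′
          -- vertices that stay free.
          Z : Bool → Fin N → Env → F
          Z s v e = recip r′ * (U s v e - Δ s v)

          Z-centred : ∀ s v → avg (Z s v) ≡ 0F
          Z-centred s v = trans (Avg.scale 𝔸 (recip r′) (λ e → U s v e - Δ s v)) (trans (cong (recip r′ *_) (trans (Avg.shift 𝔸 (Δ s v) (U s v)) (solve 1 (λ d → d :- d := # 0) refl (Δ s v)))) (zeroʳ _))

          Z-bound : ∀ s v e → Z s v e * Z s v e ≤ σ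
          Z-bound s v e = (solve 2 (λ u y → (u :* y) :* (u :* y) := (y :* y) :* (u :* u)) refl (recip r′) (U s v e - Δ s v)) ≡≤ mul-mono₂ (sq-nonneg _) (sq-nonneg _) diff recips
              ≤≡ (solve 2 (λ s r → (s :* s) :* (r :* r) := (s :* r) :* (s :* r)) refl (fromℕ S) ρ)
            where
            recips : recip r′ * recip r′ ≤ ρ * ρ
            recips = mul-mono₂ (<⇒≤ (recip-pos 0<r′)) (<⇒≤ (recip-pos 0<r′)) (recip-≤ (fromℕ-< 0<rmin) rmin≤r′) (recip-≤ (fromℕ-< 0<rmin) rmin≤r′)
            Δ≥0 : 0F ≤ Δ s v
            Δ≥0 = sym (Avg.const 𝔸 0F) ≡≤ Avg.mono 𝔸 (U-nonneg s v)
            Δ≤ : Δ s v ≤ fromℕ S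
            Δ≤ = ≤-trans (Avg.mono 𝔸 (U≤𝕝 s v) ≤≡ Avg.const 𝔸 𝕝) 𝕝≤S
            U≤ : U s v e ≤ fromℕ S
            U≤ = ≤-trans (U≤𝕝 s v e) 𝕝≤S
            diff : (U s v e - Δ s v) * (U s v e - Δ s v) ≤ fromℕ S * fromℕ S
            diff = (lin 0 (sc 1 (*-nonneg (≤⇒0≤- (+-mono-≤ U≤ Δ≥0)) (≤⇒0≤- (+-mono-≤ Δ≤ (U-nonneg s v e))))) (solve 3 (λ u d s → # 1 :* ((s :* s) :- ((u :- d) :* (u :- d))) := # 1 :* ((((s :+ d) :- (u :+ # 0)) :* ((s :+ u) :- (d :+ # 0))) :- # 0)) refl (U s v e) (Δ s v) (fromℕ S)))

          private
            f : Bool → Fin N → Fin r → F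
            f s v i = [ adjS s v (ι i) ]
            osc : ∀ s v → Osc (f s v) 1F
            osc s v i j = (lin 0 (sc 1 ([]-≤1 (adjS s v (ι i))) ⊹ sc 1 ([]-nonneg (adjS s v (ι j)))) (solve 2 (λ x y → # 1 :* (# 1 :- (x :- y)) := (# 1 :* (# 1 :- x)) :+ (# 1 :* (y :- # 0))) refl (f s v i) (f s v j)))

          private
            -- By `E-mix` each real vertex lands in the neighbourhood with probability at most q/r
            -- plus its mixing error. These errors add up to at most `ω`, and repairing collisions
            -- costs 𝕝κ.
            Δ-upper : ∀ s v → 𝕣 * Δ s v ≤ L * q s v + 𝕣 * (ω + 𝕝 * κ)
            Δ-upper s v = (lin 0 (sc 1 (*-nonneg (<⇒≤ 0<𝕣) (≤⇒0≤- (proj₁ (avg-close (U s v) (U-nonneg s v) (U≤𝕝 s v))))) ⊹ sc 1 (*-nonneg (<⇒≤ 0<𝕣) (≤⇒0≤- EU)) ⊹ sc 1 (≤-reflexive (cong (λ z → L * q s v * z) (recip-inv 0<𝕣)))) (solve 8 (λ r d A l q ir w k → # 1 :* (((l :* q) :+ (r :* (w :+ k))) :- (r :* d)) := (# 1 :* ((r :* ((A :+ k) :- d)) :- # 0)) :+ ((# 1 :* ((r :* (((l :* (ir :* q)) :+ w) :- A)) :- # 0)) :+ (# 1 :* (((l :* q) :* # 1) :- ((l :* q) :* (r :* ir)))))) refl 𝕣 (Δ s v) (E p w₀ (U s v)) L (q s v) (recip 𝕣) ω (𝕝 * κ)))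
              where
              mean : sum (f s v) ≡ 𝕣 * (recip 𝕣 * q s v)
              mean = trans (sym (*-identityˡ _)) (trans (cong (_* q s v) (sym (recip-inv 0<𝕣))) (*-assoc 𝕣 (recip 𝕣) (q s v)))
              EU : E p w₀ (U s v) ≤ L * (recip 𝕣 * q s v) + ω
              EU = E-sum p w₀ (λ x e → [ real x ] * f s v (e x)) ≡≤ sum-mono lem ≤≡ trans (sum-+ _ _) (cong (_+ ω) (sum-*ʳ (recip 𝕣 * q s v) (λ x → [ real x ])))
                where
                lem : ∀ x → E p w₀ (λ e → [ real x ] * f s v (e x)) ≤ [ real x ] * (recip 𝕣 * q s v) + (1F - γ b) ^^ depth p x
                lem x = E-*ˡ p w₀ [ real x ] (λ e → f s v (e x)) ≡≤ (lin 0 (sc 1 (*-nonneg ([]-nonneg (real x)) (≤⇒0≤- (E-mix p w₀ x (osc s v) mean))) ⊹ sc 1 (*-nonneg (≤⇒0≤- ([]-≤1 (real x))) (^^-nonneg (≤⇒0≤- (γ≤1 0<b)) (depth p x)))) (solve 4 (λ t y μ c → # 1 :* (((t :* μ) :+ c) :- (t :* y)) := (# 1 :* ((t :* ((μ :+ (c :* # 1)) :- y)) :- # 0)) :+ (# 1 :* (((# 1 :- t) :* c) :- # 0))) refl ([ real x ]) (E p w₀ (λ e → f s v (e x))) (recip 𝕣 * q s v) ((1F - γ b) ^^ depth p x)))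

          -- The density of each neighbourhood in the free set changes by the centred deviation Z, up to ω + 𝕝κ.
          density-step : ∀ s v e D → r′ * (q s v + 𝕣 * D) ≤ 𝕣 * (q s v - U s v e + r′ * (D + Z s v e) + (ω + 𝕝 * κ))
          density-step s v e D = (lin 0 (sc 1 (Δ-upper s v) ⊹ sc 1 (≤-reflexive (sym (cong (λ z → 𝕣 * (U s v e - Δ s v) * z) (recip-inv 0<r′)))) ⊹ sc 1 (≤-reflexive (cong (_* q s v) r′-def))) (solve 9 (λ r r′ q D u d i l w → # 1 :* ((r :* (((q :- u) :+ (r′ :* (D :+ (i :* (u :- d))))) :+ w)) :- (r′ :* (q :+ (r :* D)))) := (# 1 :* (((l :* q) :+ (r :* w)) :- (r :* d))) :+ ((# 1 :* (((r :* (u :- d)) :* (r′ :* i)) :- ((r :* (u :- d)) :* # 1))) :+ (# 1 :* (((r :- l) :* q) :- (r′ :* q))))) refl 𝕣 r′ (q s v) D (U s v e) (Δ s v) (recip r′) L (ω + 𝕝 * κ)))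

-- The embedding loop, its invariant and its potential.

module Loop where
  open OrderedField
  open Sums
  open Transport
  open RandomWalks
  open Selection
  open Step

  -- A vertex y with all its intended neighbours inside the tree: the parent a alone, or a and one
  -- child x. The ancestors g and g′ supply the two random steps that make the position of a
  -- independent enough of what came before.
  data Gadget {m : ℕ} (p : Piece m) (y : Fin (suc m)) : Set where
    leaf : ∀ {a g g′ s s₁ s₀} → Par p y a s → Par p a g s₁ → Par p g g′ s₀ → Gadget p y
    mid : ∀ {x a g g′ s₂ s s₁ s₀} → Par p x y s₂ → Par p y a s → Par p a g s₁ → Par p g g′ s₀ → Gadget p y

  record LP (n : ℕ) : Set where
    field
      {m} : ℕ
      piece : Piece m
      lab : Fin (suc m) → Fin n
      gads : ∀ i → Maybe (Gadget piece i)

  isJust : ∀ {A : Set} → Maybe A → Bool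
  isJust (just _) = true
  isJust nothing = false

  gnum : ∀ {n} → LP n → ℕ
  gnum lp = gcount (λ i → isJust (LP.gads lp i))

  gtotal : ∀ {n} → List (LP n) → ℕ
  gtotal [] = 0
  gtotal (lp ∷ lps) = gnum lp ℕ.+ gtotal lps

  find : ∀ {n} (lp : LP n) x → (∃[ i ] x ≡ LP.lab lp i) ⊎ (∀ i → ¬ x ≡ LP.lab lp i)
  find lp x = search dich
    where
    dich : ∀ i → x ≡ LP.lab lp i ⊎ ¬ x ≡ LP.lab lp i
    dich i with x Finₚ.≟ LP.lab lp i
    ... | yes p = inj₁ p
    ... | no p = inj₂ p

  isInj₁ : ∀ {A B : Set} → A ⊎ B → Bool
  isInj₁ (inj₁ _) = true
  isInj₁ (inj₂ _) = false

  _∪_ : ∀ {n} → (Fin n → Bool) → LP n → Fin n → Bool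
  (done ∪ lp) x = isInj₁ (find lp x) ∨ done x

  Hom-root : ∀ {b r} {0<b : 0 ℕ.< b} {0<r : 0 ℕ.< r} {a dense W} → let open Walks 0<b 0<r a dense W in
    ∀ {m} (p : Piece m) {w₀ e} → Hom p w₀ e → e (rootIx p) ≡ w₀
  Hom-root root h = h
  Hom-root {0<b = 0<b} {0<r} {a} {dense} {W} (grow p x s) (_ , h) = Hom-root {0<b = 0<b} {0<r} {a} {dense} {W} p h

  Hom-par : ∀ {b r} {0<b : 0 ℕ.< b} {0<r : 0 ℕ.< r} {a dense W} → let open Walks 0<b 0<r a dense W in
    ∀ {m} {p : Piece m} {w₀ e x y s} → Par p x y s → Hom p w₀ e → as s (e y) (e x) ≡ true
  Hom-par here (h , _) = h
  Hom-par {0<b = 0<b} {0<r} {a} {dense} {W} (there q) (_ , h) = Hom-par {0<b = 0<b} {0<r} {a} {dense} {W} q h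

  ^^-+ : ∀ x m n → x ^^ (m ℕ.+ n) ≡ x ^^ m * x ^^ n
  ^^-+ x zero n = sym (*-identityˡ _)
  ^^-+ x (suc m) n = trans (cong (x *_) (^^-+ x m n)) (sym (*-assoc x _ _))

  bernoulli : ∀ {x} → 0F ≤ 1F - x → ∀ g → 1F - fromℕ g * x ≤ (1F - x) ^^ g
  bernoulli {x} h zero = (lin 0 (0≤fromℕ 0) (solve 1 (λ x → # 1 :* (# 1 :- (# 1 :- (# 0 :* x))) := # 0) refl x))
  bernoulli {x} h (suc g) = (lin 0 (sc 1 (*-nonneg h (≤⇒0≤- (bernoulli h g))) ⊹ sc 1 (≤-reflexive (sym (cong (_* x) (fromℕ-suc g)))) ⊹ sc 1 (*-nonneg (0≤fromℕ g) (sq-nonneg x))) (solve 4 (λ x g g′ c → # 1 :* (((# 1 :- x) :* c) :- (# 1 :- (g′ :* x))) := (# 1 :* (((# 1 :- x) :* (c :- (# 1 :- (g :* x)))) :- # 0)) :+ ((# 1 :* ((g′ :* x) :- ((# 1 :+ g) :* x))) :+ (# 1 :* ((g :* (x :* x)) :- # 0)))) refl x (fromℕ g) (fromℕ (suc g)) ((1F - x) ^^ g)))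

  -- One possible swap. `p₁` and `p₂` are images of the neighbours of a set-aside vertex, with the
  -- directions in which it is joined to them, and `z` is a free host vertex. A vertex y passes if
  -- its image suits `p₁` and `p₂` and if `z` can take over the role of y.
  record Test (N : ℕ) : Set where
    constructor mkTest
    field
      z : Fin N
      s₁ : Bool
      p₁ : Fin N
      s₂ : Bool
      p₂ : Fin N

  module Loops {N : ℕ} (arc : Fin N → Fin N → Bool) {b : ℕ} (0<b : 0 ℕ.< b) (rmin S : ℕ) (0<rmin : 0 ℕ.< rmin)
    {n : ℕ} (arcD : Fin n → Fin n → Bool) (antisym : ∀ x y → arcD x y ≡ true → arcD y x ≡ false) (real Yset : Fin n → Bool)
    {T : ℕ} (test : Fin T → Test N) where

    open Steps arc 0<b rmin S 0<rmin
    open LP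
    open Test

    Adj : Fin n → Fin n → Set
    Adj x y = arcD x y ≡ true ⊎ arcD y x ≡ true

    -- Earlier real vertices touch the tree only at its root, and only `cA` and `cB` do. So the root
    -- is placed in a common neighbourhood of their images and all other vertices are free to walk.
    record ValidP (done : Fin n → Bool) (lp : LP n) : Set where
      field
        size : suc (m lp) ℕ.≤ S
        lab-inj : ∀ i j → lab lp i ≡ lab lp j → i ≡ j
        fresh : ∀ i → done (lab lp i) ≡ false
        inner : ∀ i j → real (lab lp i) ≡ true → real (lab lp j) ≡ true → arcD (lab lp i) (lab lp j) ≡ true → (∃[ s ] Par (piece lp) j i s) ⊎ (∃[ s ] Par (piece lp) i j s)
        cA cB : Fin n
        outer : ∀ i d → done d ≡ true → real d ≡ true → real (lab lp i) ≡ true → Adj d (lab lp i) → i ≡ rootIx (piece lp) × (d ≡ cA ⊎ d ≡ cB)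
        gadget-real : ∀ i → isJust (gads lp i) ≡ true → (Yset (lab lp i) ≡ true × real (lab lp i) ≡ true) × (∀ d → Adj d (lab lp i) → real d ≡ true × (∃[ j ] d ≡ lab lp j))
        gadget-mid : ∀ i {x a g g′ s₂ s s₁ s₀} (px : Par (piece lp) x i s₂) (py : Par (piece lp) i a s) (pa : Par (piece lp) a g s₁) (pg : Par (piece lp) g g′ s₀)
          → gads lp i ≡ just (mid px py pa pg) → ∀ j → Adj (lab lp j) (lab lp i) → j ≡ x ⊎ j ≡ a
        gadget-leaf : ∀ i {a g g′ s s₁ s₀} (py : Par (piece lp) i a s) (pa : Par (piece lp) a g s₁) (pg : Par (piece lp) g g′ s₀)
          → gads lp i ≡ just (leaf py pa pg) → ∀ j → Adj (lab lp j) (lab lp i) → j ≡ a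
        sign-ok : ∀ {x y s} → Par (piece lp) x y s → arcD (lab lp y) (lab lp x) ≡ s

    Valid : (Fin n → Bool) → List (LP n) → Set
    Valid done [] = ⊤
    Valid done (lp ∷ lps) = ValidP done lp × Valid (done ∪ lp) lps

    Hit : (Fin n → Bool) → (Fin n → Fin N) → Test N → Fin n → Set
    Hit done φ τ y = done y ≡ true × (Yset y ≡ true × real y ≡ true) × adjS (s₁ τ) (p₁ τ) (φ y) ≡ true × adjS (s₂ τ) (p₂ τ) (φ y) ≡ true ×
      (∀ d → arcD d y ≡ true → done d ≡ true × real d ≡ true × arc (φ d) (z τ) ≡ true) ×
      (∀ d → arcD y d ≡ true → done d ≡ true × real d ≡ true × arc (z τ) (φ d) ≡ true)

    -- `p₀` bounds below the probability that a gadget passes a test; half of it remains after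
    -- repairing collisions. `ξ` is so small that 1 - ξX is at least `x₁`^X for X up to S, and `y₀`
    -- is the factor that one gadget contributes to the expected weight. `δ` is the density that may
    -- be lost to deviations, and again to bias.
    p₀ ξ y₀ x₁ δ : F
    p₀ = γ b * γ b * γ b * γ b
    ξ = recip (fromℕ 2 * fromℕ S)
    y₀ = 1F - ξ * (p₀ * recip (fromℕ 2))
    x₁ = 1F - fromℕ 2 * ξ
    δ = recip (fromℕ 2 * fromℕ b)

    -- The field `dens` says q/r + D + B ≥ 1/2 + 2/b. Here `D` is the accumulated centred deviation
    -- and `B` the accumulated bias of that neighbourhood's density. `wt` is an exponential weight
    -- for each test, which falls as hits accumulate but stays above `x₁`^cnt.
    record St (done : Fin n → Bool) : Set where
      field
        r : ℕ
        φ : Fin n → Fin N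
        ι : Fin r → Fin N
        ι-inj : ∀ i j → ι i ≡ ι j → i ≡ j
        φ-inj : ∀ x y → done x ≡ true → real x ≡ true → done y ≡ true → real y ≡ true → φ x ≡ φ y → x ≡ y
        avoid : ∀ x → done x ≡ true → real x ≡ true → ∀ i → ¬ φ x ≡ ι i
        arcs : ∀ x y → done x ≡ true → real x ≡ true → done y ≡ true → real y ≡ true → arcD x y ≡ true → arc (φ x) (φ y) ≡ true
        count : fromℕ r + sum (λ x → [ done x ∧ real x ]) ≡ fromℕ N
        hit : Fin T → Fin n → Bool
        hit-ok : ∀ τ y → hit τ y ≡ true → Hit done φ (test τ) y
        D : Bool → Fin N → F
        B : F
        wt : Fin T → F
        wt-nonneg : ∀ τ → 0F ≤ wt τ
        cnt : Fin T → ℕ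
        cnt-ok : ∀ τ → fromℕ (cnt τ) ≡ sum (λ y → [ hit τ y ])
        wt-ok : ∀ τ → x₁ ^^ cnt τ ≤ wt τ
      q : Bool → Fin N → F
      q s v = sum (λ i → [ adjS s v (ι i) ])
      field
        dens : ∀ s v → (fromℕ b + fromℕ 4) * fromℕ r ≤ fromℕ 2 * fromℕ b * (q s v + fromℕ r * D s v + fromℕ r * B)

    private
      ωOf : LP n → F
      ωOf lp = sum (λ x → (1F - γ b) ^^ depth (piece lp) x)

    -- The bias still to come. Its sum with `B` is unchanged by a step, so the bias stays below `δ`
    -- throughout.
    budget : List (LP n) → F
    budget [] = 0F
    budget (lp ∷ lps) = (ωOf lp + fromℕ (suc (m lp)) * κ) * ρ + budget lps

    private
      budget-nonneg : ∀ lps → 0F ≤ budget lps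
      budget-nonneg [] = ≤-refl
      budget-nonneg (lp ∷ lps) = *-nonneg (sum-nonneg (λ x → ^^-nonneg (≤⇒0≤- (γ≤1 0<b)) (depth (piece lp) x)) ⊹ *-nonneg (0≤fromℕ _) κ-nonneg) (<⇒≤ 0<ρ) ⊹ budget-nonneg lps

      module Extend {done : Fin n → Bool} (st : St done) (lp : LP n) (valid : ValidP done lp) where
        open St st
        open ValidP valid

        cover : ∀ x → (∃[ i ] x ≡ lab lp i) ⊎ (∀ i → ¬ x ≡ lab lp i)
        cover = find lp

        pos : ∀ x → (∃[ i ] x ≡ lab lp i) ⊎ (∀ i → ¬ x ≡ lab lp i) → (Fin (suc (m lp)) → Fin r) → Fin N
        pos x (inj₁ (i , _)) e = ι (e i)
        pos x (inj₂ _) e = φ x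

        φ′ : (Fin (suc (m lp)) → Fin r) → Fin n → Fin N
        φ′ e x = pos x (cover x) e

        φ′-lab : ∀ e i → φ′ e (lab lp i) ≡ ι (e i)
        φ′-lab e i with cover (lab lp i)
        ... | inj₁ (j , h) = cong (λ k → ι (e k)) (sym (lab-inj i j h))
        ... | inj₂ h = ⊥-elim (h i refl)

        φ′-done : ∀ e x → done x ≡ true → φ′ e x ≡ φ x
        φ′-done e x dx with cover x
        ... | inj₁ (j , refl) = contradiction (trans (sym dx) (fresh j)) λ ()
        ... | inj₂ h = refl

        data View (x : Fin n) : Set where
          old : done x ≡ true → (∀ i → ¬ x ≡ lab lp i) → View x
          new : ∀ i → x ≡ lab lp i → View x

        view : ∀ x → (done ∪ lp) x ≡ true → View x
        view x h with cover x
        ... | inj₁ (i , q) = new i q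
        ... | inj₂ no-lab = old h no-lab

        done-old : ∀ x → done x ≡ true → (done ∪ lp) x ≡ true
        done-old x h with cover x
        ... | inj₁ _ = refl
        ... | inj₂ _ = h

        done-new : ∀ i → (done ∪ lp) (lab lp i) ≡ true
        done-new i with cover (lab lp i)
        ... | inj₁ _ = refl
        ... | inj₂ h = ⊥-elim (h i refl)

        L : F
        L = sum (λ i → [ real (lab lp i) ])

        sum-lab : ∀ (f : Fin n → F) → sum (λ x → [ isInj₁ (cover x) ] * f x) ≡ sum (λ i → f (lab lp i))
        sum-lab f = trans (sum-cong (λ x → cong (_* f x) (mem x))) (trans (sum-cong (λ x → sym (sum-*ʳ (f x) _))) (trans (sum-swap (λ x i → [ x == lab lp i ] * f x)) (sum-cong (λ i → sum-δ (lab lp i) f))))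
          where
          mem : ∀ x → [ isInj₁ (cover x) ] ≡ sum (λ i → [ x == lab lp i ])
          mem x with cover x
          ... | inj₂ h = sym (sum-zero (λ i → cong [_] (≢⇒== (h i))))
          ... | inj₁ (j , h) = sym (trans (sum-cong hit-j) (sum-[==] j))
            where
            hit-j : ∀ i → [ x == lab lp i ] ≡ [ i == j ]
            hit-j i with i Finₚ.≟ j
            ... | yes refl = cong [_] (trans (cong (_== lab lp j) h) (==-refl (lab lp j)))
            ... | no ne = cong [_] (≢⇒== (λ q → ne (lab-inj i j (trans (sym q) h))))

        count-step : sum (λ x → [ (done ∪ lp) x ∧ real x ]) ≡ sum (λ x → [ done x ∧ real x ]) + L
        count-step = trans (sum-cong lem) (trans (sum-+ _ _) (cong (sum (λ x → [ done x ∧ real x ]) +_) (sum-lab (λ x → [ real x ]))))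
          where
          lem : ∀ x → [ (done ∪ lp) x ∧ real x ] ≡ [ done x ∧ real x ] + [ isInj₁ (cover x) ] * [ real x ]
          lem x with cover x
          ... | inj₂ h = (solve 2 (λ u v → u := u :+ (# 0 :* v)) refl ([ done x ∧ real x ]) ([ real x ]))
          ... | inj₁ (i , refl) rewrite fresh i = (solve 1 (λ v → v := # 0 :+ (# 1 :* v)) refl ([ real (lab lp i) ]))

    record Bounds : Set where
      field
        κ<1 : κ < 1F
        κ-small : fromℕ S * κ ≤ p₀ * recip (fromℕ 2)
        2≤S : 2 ℕ.≤ S
        room : sum (λ x → [ real x ]) + fromℕ rmin ≤ fromℕ N
        c₁ c₂ C₀ : F
        c₁-nonneg : 0F ≤ c₁
        c₂-nonneg : 0F ≤ c₂
        small : C₀ < c₁ * sqr (δ * δ)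

    -- Both parts are written with the remaining steps and gadgets already charged: 4σ for each tree
    -- to come, and a factor `y₀` for each gadget to come. This is what makes the sum
    -- non-increasing.
    Potential : (Bounds) → ∀ {done} → St done → List (LP n) → F
    Potential bd st lps = c₁ * Σ₂ (λ s v → sqr (D s v * D s v + fromℕ 4 * σ * fromℕ (List.length lps))) + c₂ * (y₀ ^^ gtotal lps * sum wt)
      where
      open Bounds bd
      open St st

    private
      module Advance (bd : Bounds) {done : Fin n → Bool} (st : St done) (lp : LP n) (lps : List (LP n)) (valid : ValidP done lp)
          (pot : Potential bd st (lp ∷ lps) ≤ Bounds.C₀ bd) (bud : St.B st + budget (lp ∷ lps) ≤ δ) where
        open Bounds bd
        open St st
        open ValidP valid
        open Extend st lp valid

        private
          𝕓 : F
          𝕓 = fromℕ b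
          0<𝕓 : 0F < 𝕓
          0<𝕓 = fromℕ-< 0<b
          k : F
          k = fromℕ (List.length lps)
          k≥0 : 0F ≤ k
          k≥0 = 0≤fromℕ _
          σ≥0 : 0F ≤ σ
          σ≥0 = sq-nonneg (fromℕ S * ρ)
          2bδ : fromℕ 2 * 𝕓 * δ ≡ 1F
          2bδ = recip-inv (*-pos (0<fromℕ 1) 0<𝕓)
          δ>0 : 0F < δ
          δ>0 = recip-pos (*-pos (0<fromℕ 1) 0<𝕓)
          0<S : 0F < fromℕ S
          0<S = fromℕ-< (ℕₚ.<-≤-trans (ℕ.s≤s ℕ.z≤n) 2≤S)
          2Sξ : fromℕ 2 * fromℕ S * ξ ≡ 1F
          2Sξ = recip-inv (*-pos (0<fromℕ 1) 0<S)
          ξ>0 : 0F < ξ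
          ξ>0 = recip-pos (*-pos (0<fromℕ 1) 0<S)
          half≥0 : 0F ≤ recip (fromℕ 2)
          half≥0 = <⇒≤ (recip-pos (0<fromℕ 1))
          2half : fromℕ 2 * recip (fromℕ 2) ≡ 1F
          2half = recip-inv (0<fromℕ 1)
          γ≥0 : 0F ≤ γ b
          γ≥0 = <⇒≤ (0<γ 0<b)
          p₀≥0 : 0F ≤ p₀
          p₀≥0 = *-nonneg (*-nonneg (*-nonneg γ≥0 γ≥0) γ≥0) γ≥0
          γ³≤1 : γ b * γ b * γ b ≤ 1F
          γ³≤1 = mul-mono₂ (*-nonneg γ≥0 γ≥0) γ≥0 (mul-mono₂ γ≥0 γ≥0 (γ≤1 0<b) (γ≤1 0<b)) (γ≤1 0<b) ≤≡ (solve 0 ((# 1 :* # 1) :* # 1 := # 1) refl )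
          p₀≤γ³ : p₀ ≤ γ b * γ b * γ b
          p₀≤γ³ = (lin 0 (sc 1 (*-nonneg (*-nonneg (*-nonneg γ≥0 γ≥0) γ≥0) (≤⇒0≤- (γ≤1 0<b)))) (solve 1 (λ g → # 1 :* (((g :* g) :* g) :- (((g :* g) :* g) :* g)) := # 1 :* ((((g :* g) :* g) :* (# 1 :- g)) :- # 0)) refl (γ b)))
          p₀≤1 : p₀ ≤ 1F
          p₀≤1 = ≤-trans p₀≤γ³ γ³≤1
          y₀≥0 : 0F ≤ y₀
          y₀≥0 = (lin 7 (sc 8 (*-nonneg (*-nonneg (<⇒≤ ξ>0) half≥0) (≤⇒0≤- p₀≤1)) ⊹ sc 1 (≤-reflexive 2Sξ) ⊹ sc 2 (*-nonneg (≤⇒0≤- (fromℕ-≤ 2≤S)) (<⇒≤ ξ>0)) ⊹ sc 4 (≤-reflexive (cong (ξ *_) 2half)) ⊹ 0≤fromℕ 7) (solve 4 (λ x p h S → # 8 :* ((# 1 :- (x :* (p :* h))) :- # 0) := (# 8 :* (((x :* h) :* (# 1 :- p)) :- # 0)) :+ ((# 1 :* (# 1 :- ((# 2 :* S) :* x))) :+ ((# 2 :* (((S :- # 2) :* x) :- # 0)) :+ ((# 4 :* ((x :* # 1) :- (x :* (# 2 :* h)))) :+ # 7)))) refl ξ p₀ (recip (fromℕ 2)) (fromℕ S)))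

        private
          -- A single deviation above `δ` would alone make the potential at least c₁δ⁴, which is
          -- larger than C₀.
          D≤δ : ∀ s v → D s v ≤ δ
          D≤δ s v with ≤-or-> (D s v) δ
          ... | inj₁ h = h
          ... | inj₂ h = ⊥-elim (<⇒≱ small (≤-trans (mul-mono c₁-nonneg (≤-trans (sqr-mono (*-nonneg (<⇒≤ δ>0) (<⇒≤ δ>0)) δδ≤) (term≤Σ₂ {f = λ s v → sqr (D s v * D s v + fromℕ 4 * σ * fromℕ (suc (List.length lps)))} (λ s v → sq-nonneg _) s v)))
              (≤-trans (lin 0 (sc 1 (*-nonneg c₂-nonneg (*-nonneg (^^-nonneg y₀≥0 (gtotal (lp ∷ lps))) (sum-nonneg wt-nonneg)))) (solve 2 (λ A B → # 1 :* ((A :+ B) :- A) := # 1 :* (B :- # 0)) refl (c₁ * Σ₂ (λ s v → sqr (D s v * D s v + fromℕ 4 * σ * fromℕ (suc (List.length lps))))) (c₂ * (y₀ ^^ gtotal (lp ∷ lps) * sum wt)))) pot)))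
            where
            sqr-mono : ∀ {x y} → 0F ≤ x → x ≤ y → sqr x ≤ sqr y
            sqr-mono h p = mul-mono₂ h h p p
            δδ≤ : δ * δ ≤ D s v * D s v + fromℕ 4 * σ * fromℕ (suc (List.length lps))
            δδ≤ = (lin 0 (sc 1 (mul-mono₂ (<⇒≤ δ>0) (<⇒≤ δ>0) (<⇒≤ h) (<⇒≤ h)) ⊹ sc 1 (*-nonneg (*-nonneg (0≤fromℕ 4) σ≥0) (0≤fromℕ (suc (List.length lps))))) (solve 3 (λ A B C → # 1 :* ((B :+ C) :- A) := (# 1 :* (B :- A)) :+ (# 1 :* (C :- # 0))) refl (δ * δ) (D s v * D s v) (fromℕ 4 * σ * fromℕ (suc (List.length lps)))))

        𝕣 : F
        𝕣 = fromℕ r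

        opaque
          densR : ∀ s v → (𝕓 + fromℕ 2) * 𝕣 ≤ fromℕ 2 * 𝕓 * q s v
          -- From 1/2 + 2/b, deviations and bias each take at most δ = 1/(2b), leaving the 1/2 + 1/b
          -- of `Dense`.
          densR s v = (lin 0 (sc 1 (dens s v) ⊹ sc 2 (*-nonneg (*-nonneg (0≤fromℕ b) (0≤fromℕ r)) (≤⇒0≤- (D≤δ s v))) ⊹ sc 2 (*-nonneg (*-nonneg (0≤fromℕ b) (0≤fromℕ r)) (≤⇒0≤- bud)) ⊹ sc 2 (*-nonneg (*-nonneg (0≤fromℕ b) (0≤fromℕ r)) (budget-nonneg (lp ∷ lps))) ⊹ sc 2 (≤-reflexive (cong (𝕣 *_) 2bδ))) (solve 7 (λ b r q D B d e → # 1 :* (((# 2 :* b) :* q) :- ((b :+ # 2) :* r)) := (# 1 :* (((# 2 :* b) :* ((q :+ (r :* D)) :+ (r :* B))) :- ((b :+ # 4) :* r))) :+ ((# 2 :* (((b :* r) :* (d :- D)) :- # 0)) :+ ((# 2 :* (((b :* r) :* (d :- (B :+ e))) :- # 0)) :+ ((# 2 :* (((b :* r) :* e) :- # 0)) :+ (# 2 :* ((r :* # 1) :- (r :* ((# 2 :* b) :* d)))))))) refl 𝕓 𝕣 (q s v) (D s v) B δ (budget (lp ∷ lps))))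

        private
          r′F : F
          r′F = 𝕣 - L

        opaque
          r′-room : fromℕ rmin ≤ r′F
          r′-room = (lin 0 (sc 1 (≤-reflexive (sym count)) ⊹ sc 1 (≤-reflexive (sym count-step)) ⊹ sc 1 room ⊹ sc 1 (count-mono (λ x h → proj₂ (∧-true {(done ∪ lp) x} h)))) (solve 7 (λ r l N d d′ w m → # 1 :* ((r :- l) :- m) := (# 1 :* ((r :+ d) :- N)) :+ ((# 1 :* (d′ :- (d :+ l))) :+ ((# 1 :* (N :- (w :+ m))) :+ (# 1 :* (w :- d′))))) refl 𝕣 L (fromℕ N) (sum (λ x → [ done x ∧ real x ])) (sum (λ x → [ (done ∪ lp) x ∧ real x ])) (sum (λ x → [ real x ])) (fromℕ rmin)))

          L≥0 : 0F ≤ L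
          L≥0 = sum-nonneg (λ i → []-nonneg (real (lab lp i)))

          rmin≤r : fromℕ rmin ≤ 𝕣
          rmin≤r = (lin 0 (sc 1 r′-room ⊹ sc 1 L≥0) (solve 3 (λ r l m → # 1 :* (r :- m) := (# 1 :* ((r :- l) :- m)) :+ (# 1 :* (l :- # 0))) refl 𝕣 L (fromℕ rmin)))

        module R = OnFree κ<1 ι densR rmin≤r

        private
          sgn : Fin n → Bool
          sgn c = arcD c (lab lp (rootIx (piece lp)))

          rootSpot : ∃[ w ] (adjS (sgn cA) (φ cA) (ι w) ≡ true × adjS (sgn cB) (φ cB) (ι w) ≡ true)
          rootSpot = R.common-exists (sgn cA) (φ cA) (sgn cB) (φ cB)

        module P = R.OnPiece (piece lp) size (proj₁ rootSpot)
        module U = P.Usage (λ i → real (lab lp i)) r′F refl r′-room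

        private
          -- The signs are read from `z`, which has to stand towards the images of a and x as the
          -- gadget vertex does. The parent's sign is recorded from the parent's side, hence
          -- `not s`.
          goodG : Test N → ∀ {i} → Maybe (Gadget (piece lp) i) → P.Env → Bool
          goodG τ nothing e = false
          goodG τ {i} (just (leaf {a = a} {s = s} _ _ _)) e = adjS (not s) (z τ) (ι (e a)) ∧ (adjS (s₁ τ) (p₁ τ) (ι (e i)) ∧ adjS (s₂ τ) (p₂ τ) (ι (e i)))
          goodG τ {i} (just (mid {x = x} {a = a} {s₂ = s₂′} {s = s} _ _ _ _)) e =
            (adjS (not s) (z τ) (ι (e a)) ∧ (adjS (s₁ τ) (p₁ τ) (ι (e i)) ∧ adjS (s₂ τ) (p₂ τ) (ι (e i)))) ∧ adjS s₂′ (z τ) (ι (e x))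

        good : Fin T → Fin (suc (m lp)) → P.Env → Bool
        good τ i e = goodG (test τ) (gads lp i) e

        X : Fin T → P.Env → F
        X τ e = sum (λ i → [ good τ i e ])

        w₀ : Fin r
        w₀ = proj₁ rootSpot

        private
          good-prob : ∀ τ i → [ isJust (gads lp i) ] * p₀ ≤ R.E (piece lp) w₀ (λ e → [ good τ i e ])
          good-prob τ i = go (gads lp i)
            where
            A : Bool → Fin r → Bool
            A s w = adjS s (z (test τ)) (ι w)
            C : Fin r → Bool
            C w = adjS (s₁ (test τ)) (p₁ (test τ)) (ι w) ∧ adjS (s₂ (test τ)) (p₂ (test τ)) (ι w)
            go : (g : Maybe (Gadget (piece lp) i)) → [ isJust g ] * p₀ ≤ R.E (piece lp) w₀ (λ e → [ goodG (test τ) g e ])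
            go nothing = ≤-reflexive (trans (zeroˡ p₀) (sym (R.E-const (piece lp) w₀ 0F)))
            go (just (leaf {a = a} {s = s} py pa pg)) = *-identityˡ p₀ ≡≤ ≤-trans p₀≤γ³ (R.gadget-leaf py pa pg w₀ (A (not s)) C (R.Big-adj (not s) (z (test τ))) (R.common (s₁ (test τ)) (p₁ (test τ)) (s₂ (test τ)) (p₂ (test τ)))
              ≤≡ R.E-cong (piece lp) w₀ (λ e → sym ([]-∧ (A (not s) (e a)) (C (e i)))))
            go (just (mid {x = x} {a = a} {s₂ = s₂′} {s = s} px py pa pg)) = *-identityˡ p₀ ≡≤ (R.gadget-mid px py pa pg w₀ (A (not s)) (A s₂′) C (R.Big-adj (not s) (z (test τ))) (R.Big-adj s₂′ (z (test τ))) (R.common (s₁ (test τ)) (p₁ (test τ)) (s₂ (test τ)) (p₂ (test τ)))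
              ≤≡ R.E-cong (piece lp) w₀ (λ e → sym (trans ([]-∧ (A (not s) (e a) ∧ C (e i)) (A s₂′ (e x))) (cong (_* [ A s₂′ (e x) ]) ([]-∧ (A (not s) (e a)) (C (e i)))))))

        G : ℕ
        G = gnum lp

        private
          X≥0 : ∀ τ e → 0F ≤ X τ e
          X≥0 τ e = sum-nonneg (λ i → []-nonneg (good τ i e))

          X≤𝕝 : ∀ τ e → X τ e ≤ P.𝕝
          X≤𝕝 τ e = sum-mono (λ i → []-≤1 (good τ i e)) ≤≡ trans (sum-const (suc (m lp)) 1F) (*-identityʳ _)

        μ : F
        μ = fromℕ G * (p₀ * recip (fromℕ 2))

        private
          -- The unrepaired mean is at least G·p₀ by `good-prob`, and repairing costs at most Sκ,
          -- that is at most p₀/2.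
          X-avg : ∀ τ → μ ≤ P.avg (X τ)
          X-avg τ = go G refl
            where
            EX : fromℕ G * p₀ ≤ R.E (piece lp) w₀ (X τ)
            EX = trans (cong (_* p₀) (gcount-sum (λ i → isJust (gads lp i)))) (sym (sum-*ʳ p₀ _)) ≡≤ sum-mono {f = λ i → [ isJust (gads lp i) ] * p₀} {g = λ i → R.E (piece lp) w₀ (λ e → [ good τ i e ])} (good-prob τ) ≤≡ sym (R.E-sum (piece lp) w₀ (λ i e → [ good τ i e ]))
            go : ∀ g → G ≡ g → μ ≤ P.avg (X τ)
            -- Without gadgets nothing pays for the repair, but then the bound is zero and X is
            -- nonnegative.
            go zero eq = (trans (cong (λ g → fromℕ g * (p₀ * recip (fromℕ 2))) eq) (zeroˡ _)) ≡≤ (sym (Avg.const P.𝔸 0F) ≡≤ Avg.mono P.𝔸 {f = λ _ → 0F} {g = X τ} (X≥0 τ))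
            go (suc g) eq = (lin 0 (sc 1 EX ⊹ sc 1 (proj₂ (P.avg-close (X τ) (X≥0 τ) (X≤𝕝 τ))) ⊹ sc 1 (*-nonneg (≤⇒0≤- P.𝕝≤S) κ-nonneg) ⊹ sc 1 κ-small ⊹ sc 1 (*-nonneg (≤⇒0≤- G≥1) (*-nonneg p₀≥0 half≥0)) ⊹ sc 1 (≤-reflexive (cong (λ z → fromℕ G * p₀ * z) 2half))) (solve 8 (λ g p h a e l k S → # 1 :* (a :- (g :* (p :* h))) := (# 1 :* (e :- (g :* p))) :+ ((# 1 :* ((a :+ (l :* k)) :- e)) :+ ((# 1 :* (((S :- l) :* k) :- # 0)) :+ ((# 1 :* ((p :* h) :- (S :* k))) :+ ((# 1 :* (((g :- # 1) :* (p :* h)) :- # 0)) :+ (# 1 :* (((g :* p) :* # 1) :- ((g :* p) :* (# 2 :* h))))))))) refl (fromℕ G) p₀ (recip (fromℕ 2)) (P.avg (X τ)) (R.E (piece lp) w₀ (X τ)) P.𝕝 κ (fromℕ S)))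
              where
              G≥1 : 1F ≤ fromℕ G
              G≥1 = fromℕ-≤ (subst (1 ℕ.≤_) (sym eq) (ℕ.s≤s ℕ.z≤n))

        private
          c₂′ : F
          c₂′ = c₂ * y₀ ^^ gtotal lps
          ξ≥0 : 0F ≤ ξ
          ξ≥0 = <⇒≤ ξ>0
        private
          module Finish (e : P.Env) (e-good : P.Good e) (r₁ : ℕ) (κ₁ : Fin r₁ → Fin r)
              (κ₁-inj : ∀ i j → κ₁ i ≡ κ₁ j → i ≡ j) (κ₁-miss : ∀ i x → real (lab lp x) ≡ true → ¬ κ₁ i ≡ e x)
              (κ₁-sums : ∀ f → sum f ≡ sum (f ∘ κ₁) + sum (λ x → [ real (lab lp x) ] * f (e x)))
              (e-pot : c₁ * Σ₂ (λ s v → sqr ((D s v + U.Z s v e) * (D s v + U.Z s v e) + fromℕ 4 * σ * k)) + c₂′ * sum (λ τ → wt τ * (1F - ξ * X τ e))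
                ≤ c₁ * Σ₂ (λ s v → sqr (D s v * D s v + fromℕ 4 * σ * (k + 1F))) + c₂′ * ((1F - ξ * μ) * sum wt)) where
            private
              e-root : e (rootIx (piece lp)) ≡ w₀
              e-root = Hom-root {0<b = 0<b} {R.0<r} {R.a} {R.dense} {R.W} (piece lp) (proj₁ e-good)

              e-par : ∀ {x y s} → Par (piece lp) x y s → R.as s (e y) (e x) ≡ true
              e-par q = Hom-par {0<b = 0<b} {R.0<r} {R.a} {R.dense} {R.W} q (proj₁ e-good)

              r₁≡ : fromℕ r₁ ≡ r′F
              r₁≡ = (≤-antisym (lin 0 (sc 1 (≤-reflexive (sym (κ₁-sums (λ _ → 1F)))) ⊹ sc 1 (≤-reflexive (sum-const r 1F)) ⊹ sc 1 (≤-reflexive (sym (sum-const r₁ 1F))) ⊹ sc 1 (≤-reflexive (sym (sum-cong (λ x → *-identityʳ [ real (lab lp x) ]))))) (solve 6 (λ r r1 l u v w → # 1 :* ((r :- l) :- r1) := (# 1 :* (u :- (v :+ w))) :+ ((# 1 :* ((r :* # 1) :- u)) :+ ((# 1 :* (v :- (r1 :* # 1))) :+ (# 1 :* (w :- l))))) refl 𝕣 (fromℕ r₁) L (sum {r} (λ _ → 1F)) (sum {r₁} (λ _ → 1F)) (sum (λ x → [ real (lab lp x) ] * 1F)))) (lin 0 (sc 1 (≤-reflexive (κ₁-sums (λ _ → 1F))) ⊹ sc 1 (≤-reflexive (sym (sum-const r 1F))) ⊹ sc 1 (≤-reflexive (sum-const r₁ 1F)) ⊹ sc 1 (≤-reflexive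 (sum-cong (λ x → *-identityʳ [ real (lab lp x) ])))) (solve 6 (λ r r1 l u v w → # 1 :* (r1 :- (r :- l)) := (# 1 :* ((v :+ w) :- u)) :+ ((# 1 :* (u :- (r :* # 1))) :+ ((# 1 :* ((r1 :* # 1) :- v)) :+ (# 1 :* (l :- w))))) refl 𝕣 (fromℕ r₁) L (sum {r} (λ _ → 1F)) (sum {r₁} (λ _ → 1F)) (sum (λ x → [ real (lab lp x) ] * 1F)))))

              q₁ : Bool → Fin N → F
              q₁ s v = sum (λ i → [ adjS s v (ι (κ₁ i)) ])

              D₁ : Bool → Fin N → F
              D₁ s v = D s v + U.Z s v e

            B₁ : F
            B₁ = B + (ωOf lp + P.𝕝 * κ) * ρ

            private
              dens₁ : ∀ s v → (𝕓 + fromℕ 4) * fromℕ r₁ ≤ fromℕ 2 * 𝕓 * (q₁ s v + fromℕ r₁ * D₁ s v + fromℕ r₁ * B₁)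
              dens₁ s v = subst (λ z → (𝕓 + fromℕ 4) * z ≤ fromℕ 2 * 𝕓 * (q₁ s v + z * D₁ s v + z * B₁)) (sym r₁≡) (mul-cancel R.0<𝕣
                (lin 0 (sc 1 (*-nonneg (≤-trans (0≤fromℕ rmin) r′-room) (≤⇒0≤- (dens s v))) ⊹ sc 2 (*-nonneg (0≤fromℕ b) (≤⇒0≤- (U.density-step s v e (D s v)))) ⊹ sc 2 (≤-reflexive (cong (λ z → 𝕓 * 𝕣 * z) (κ₁-sums (λ i → [ adjS s v (ι i) ])))) ⊹ sc 2 (*-nonneg (*-nonneg (0≤fromℕ b) (0≤fromℕ r)) (*-nonneg (*-nonneg w≥0 (<⇒≤ 0<ρ)) (≤⇒0≤- r′-room))) ⊹ sc 2 (≤-reflexive (sym (cong (λ z → 𝕓 * 𝕣 * (ωOf lp + P.𝕝 * κ) * z) (recip-inv (fromℕ-< 0<rmin)))))) (solve 12 (λ b r r′ q q1 D D1 B u w ρ m → # 1 :* ((r :* ((# 2 :* b) :* ((q1 :+ (r′ :* D1)) :+ (r′ :* (B :+ (w :* ρ)))))) :- (r :* ((b :+ # 4) :* r′))) := (# 1 :* ((r′ :* (((# 2 :* b) :* ((q :+ (r :* D)) :+ (r :* B))) :- ((b :+ # 4) :* r))) :- # 0)) :+ ((# 2 :* ((b :* ((r :* (((q :- u) :+ (r′ :* D1)) :+ w)) :- (r′ :* (q :+ (r :* D))))) :- # 0)) :+ ((# 2 :* (((b :* r) :* (q1 :+ u)) :- ((b :* r) :* q))) :+ ((# 2 :* (((b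 :* r) :* ((w :* ρ) :* (r′ :- m))) :- # 0)) :+ (# 2 :* ((((b :* r) :* w) :* (m :* ρ)) :- (((b :* r) :* w) :* # 1))))))) refl 𝕓 𝕣 r′F (q s v) (q₁ s v) (D s v) (D₁ s v) B (U.U s v e) (ωOf lp + P.𝕝 * κ) ρ (fromℕ rmin))))
                where
                w≥0 : 0F ≤ ωOf lp + P.𝕝 * κ
                w≥0 = sum-nonneg (λ x → ^^-nonneg (≤⇒0≤- (γ≤1 0<b)) (depth (piece lp) x)) ⊹ *-nonneg (0≤fromℕ _) κ-nonneg

              gc : Fin T → ℕ
              gc τ = gcount (λ i → good τ i e)

              X≡gc : ∀ τ → X τ e ≡ fromℕ (gc τ)
              X≡gc τ = sym (gcount-sum (λ i → good τ i e))

              gc≤S : ∀ τ → gc τ ℕ.≤ S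
              gc≤S τ = fromℕ-≤⁻ (≤-trans (sym (X≡gc τ) ≡≤ X≤𝕝 τ e) P.𝕝≤S)

              -- Induction on c: the step needs 2ξc ≤ 1, which holds up to c = S because 2Sξ = 1.
              bern₂ : ∀ c → c ℕ.≤ S → x₁ ^^ c ≤ 1F - ξ * fromℕ c
              bern₂ zero _ = (lin 0 (0≤fromℕ 0) (solve 1 (λ x → # 1 :* ((# 1 :- (x :* # 0)) :- # 1) := # 0) refl ξ))
              bern₂ (suc c) h = (lin 0 (sc 1 (*-nonneg x₁≥0 (≤⇒0≤- (bern₂ c (ℕₚ.≤-trans (ℕₚ.n≤1+n c) h)))) ⊹ sc 1 (≤-reflexive (cong (ξ *_) (fromℕ-suc c))) ⊹ sc 2 (*-nonneg (*-nonneg ξ≥0 ξ≥0) (≤⇒0≤- (fromℕ-≤ (ℕₚ.≤-trans (ℕₚ.n≤1+n c) h)))) ⊹ sc 1 (≤-reflexive (cong (ξ *_) 2Sξ))) (solve 5 (λ x y c c′ S → # 1 :* ((# 1 :- (x :* c′)) :- ((# 1 :- (# 2 :* x)) :* y)) := (# 1 :* (((# 1 :- (# 2 :* x)) :* ((# 1 :- (x :* c)) :- y)) :- # 0)) :+ ((# 1 :* ((x :* (# 1 :+ c)) :- (x :* c′))) :+ ((# 2 :* (((x :* x) :* (S :- c)) :- # 0)) :+ (# 1 :* ((x :* # 1) :- (x :* ((# 2 :* S) :* x))))))) refl ξ (x₁ ^^ c) (fromℕ c) (fromℕ (suc c)) (fromℕ S)))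
                where
                x₁≥0 : 0F ≤ 1F - fromℕ 2 * ξ
                x₁≥0 = (lin 0 (sc 1 (≤-reflexive 2Sξ) ⊹ sc 2 (*-nonneg (≤⇒0≤- (fromℕ-≤ 2≤S)) ξ≥0) ⊹ sc 2 ξ≥0) (solve 2 (λ x S → # 1 :* ((# 1 :- (# 2 :* x)) :- # 0) := (# 1 :* (# 1 :- ((# 2 :* S) :* x))) :+ ((# 2 :* (((S :- # 2) :* x) :- # 0)) :+ (# 2 :* (x :- # 0)))) refl ξ (fromℕ S)))

              x₁-pow≥0 : ∀ c → 0F ≤ x₁ ^^ c
              x₁-pow≥0 = ^^-nonneg (lin 0 (sc 1 (≤-reflexive 2Sξ) ⊹ sc 2 (*-nonneg (≤⇒0≤- (fromℕ-≤ 2≤S)) ξ≥0) ⊹ sc 2 ξ≥0) (solve 2 (λ x S → # 1 :* ((# 1 :- (# 2 :* x)) :- # 0) := (# 1 :* (# 1 :- ((# 2 :* S) :* x))) :+ ((# 2 :* (((S :- # 2) :* x) :- # 0)) :+ (# 2 :* (x :- # 0)))) refl ξ (fromℕ S)))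

              step≥ : ∀ τ → x₁ ^^ gc τ ≤ 1F - ξ * X τ e
              step≥ τ = bern₂ (gc τ) (gc≤S τ) ≤≡ cong (λ z → 1F - ξ * z) (sym (X≡gc τ))

              hitOf : Fin T → ∀ y → (∃[ i ] y ≡ lab lp i) ⊎ (∀ i → ¬ y ≡ lab lp i) → Bool
              hitOf τ y (inj₁ (i , _)) = good τ i e
              hitOf τ y (inj₂ _) = hit τ y

              hit₁ : Fin T → Fin n → Bool
              hit₁ τ y = hitOf τ y (cover y)

              hit₁-lab : ∀ τ i → hit₁ τ (lab lp i) ≡ good τ i e
              hit₁-lab τ i = go (cover (lab lp i))
                where
                go : ∀ c → hitOf τ (lab lp i) c ≡ good τ i e
                go (inj₁ (j , h)) = cong (λ k → good τ k e) (sym (lab-inj i j h))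
                go (inj₂ h) = ⊥-elim (h i refl)

              hit-new : ∀ τ i → hit τ (lab lp i) ≡ false
              hit-new τ i = go (Bool-dec (hit τ (lab lp i)))
                where
                go : hit τ (lab lp i) ≡ true ⊎ hit τ (lab lp i) ≡ false → hit τ (lab lp i) ≡ false
                go (inj₁ eq) = contradiction (trans (sym (proj₁ (hit-ok τ _ eq))) (fresh i)) λ ()
                go (inj₂ eq) = eq

              cnt₁-ok : ∀ τ → fromℕ (cnt τ ℕ.+ gc τ) ≡ sum (λ y → [ hit₁ τ y ])
              cnt₁-ok τ = trans (fromℕ-+ (cnt τ) (gc τ)) (trans (cong₂ _+_ (cnt-ok τ) (trans (gcount-sum (λ i → good τ i e)) (trans (sum-cong (λ i → cong [_] (sym (hit₁-lab τ i)))) (sym (sum-lab (λ y → [ hit₁ τ y ]))))))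
                (trans (sym (sum-+ _ _)) (sum-cong (λ y → lem y (cover y)))))
                where
                lem : ∀ y c → [ hit τ y ] + [ isInj₁ c ] * [ hitOf τ y c ] ≡ [ hitOf τ y c ]
                lem y (inj₂ h) = (solve 1 (λ u → u :+ (# 0 :* u) := u) refl ([ hit τ y ]))
                lem y (inj₁ (i , h)) = trans (cong (λ z → [ z ] + 1F * [ good τ i e ]) (trans (cong (hit τ) h) (hit-new τ i))) (solve 1 (λ u → # 0 :+ (# 1 :* u) := u) refl ([ good τ i e ]))

              Compat : Fin T → Fin n → Set
              Compat τ y = ∀ d → Adj d y → real d ≡ true × Σ (Fin (suc (m lp))) λ j → d ≡ lab lp j × adjS (arcD y d) (z (test τ)) (ι (e j)) ≡ true

              gadget-compat : ∀ τ i → good τ i e ≡ true → (Yset (lab lp i) ≡ true × real (lab lp i) ≡ true) × adjS (s₁ (test τ)) (p₁ (test τ)) (ι (e i)) ≡ true × adjS (s₂ (test τ)) (p₂ (test τ)) (ι (e i)) ≡ true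
                × Compat τ (lab lp i)
              gadget-compat τ i h = go (gads lp i) refl h
                where
                zτ : Fin N
                zτ = z (test τ)
                C : Bool
                C = adjS (s₁ (test τ)) (p₁ (test τ)) (ι (e i)) ∧ adjS (s₂ (test τ)) (p₂ (test τ)) (ι (e i))
                up : ∀ {a s} → Par (piece lp) i a s → Adj (lab lp a) (lab lp i) → arcD (lab lp i) (lab lp a) ≡ not s
                up {a} {true} py _ = antisym _ _ (sign-ok py)
                up {a} {false} py (inj₁ k) = contradiction (trans (sym k) (sign-ok py)) λ ()
                up {a} {false} py (inj₂ k) = k
                finish : isJust (gads lp i) ≡ true → C ≡ true → (∀ j → Adj (lab lp j) (lab lp i) → adjS (arcD (lab lp i) (lab lp j)) zτ (ι (e j)) ≡ true) →
                  (Yset (lab lp i) ≡ true × real (lab lp i) ≡ true) × adjS (s₁ (test τ)) (p₁ (test τ)) (ι (e i)) ≡ true × adjS (s₂ (test τ)) (p₂ (test τ)) (ι (e i)) ≡ true × Compat τ (lab lp i)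
                finish j c nb = proj₁ (gadget-real i j) , proj₁ (∧-true {adjS (s₁ (test τ)) (p₁ (test τ)) (ι (e i))} c) , proj₂ (∧-true {adjS (s₁ (test τ)) (p₁ (test τ)) (ι (e i))} c) ,
                  λ d adj → let rd , j , dj = proj₂ (gadget-real i j) d adj in rd , j , dj ,
                    subst (λ d → adjS (arcD (lab lp i) d) zτ (ι (e j)) ≡ true) (sym dj) (nb j (subst (λ d → Adj d (lab lp i)) dj adj))
                Res : Set
                Res = (Yset (lab lp i) ≡ true × real (lab lp i) ≡ true) × adjS (s₁ (test τ)) (p₁ (test τ)) (ι (e i)) ≡ true × adjS (s₂ (test τ)) (p₂ (test τ)) (ι (e i)) ≡ true × Compat τ (lab lp i)
                go : (g : Maybe (Gadget (piece lp) i)) → gads lp i ≡ g → goodG (test τ) g e ≡ true → Res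
                go nothing eq ()
                go (just (leaf {a = a} {s = s} py pa pg)) eq h = finish (cong isJust eq) (proj₂ (∧-true {adjS (not s) zτ (ι (e a))} h)) nb
                  where
                  nb : ∀ j → Adj (lab lp j) (lab lp i) → adjS (arcD (lab lp i) (lab lp j)) zτ (ι (e j)) ≡ true
                  nb j adj = subst (λ j → adjS (arcD (lab lp i) (lab lp j)) zτ (ι (e j)) ≡ true) (sym j≡a)
                      (trans (cong (λ s → adjS s zτ (ι (e a))) (up py (subst (λ j → Adj (lab lp j) (lab lp i)) j≡a adj))) (proj₁ (∧-true {adjS (not s) zτ (ι (e a))} h)))
                    where
                    j≡a : j ≡ a
                    j≡a = gadget-leaf i py pa pg eq j adj
                go (just (mid {x = x} {a = a} {s₂ = s₂′} {s = s} px py pa pg)) eq h = finish (cong isJust eq) (proj₂ (∧-true {A} AC)) (λ j adj → nb j adj (gadget-mid i px py pa pg eq j adj))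
                  where
                  A : Bool
                  A = adjS (not s) zτ (ι (e a))
                  AC : A ∧ C ≡ true
                  AC = proj₁ (∧-true {A ∧ C} h)
                  nb : ∀ j → Adj (lab lp j) (lab lp i) → j ≡ x ⊎ j ≡ a → adjS (arcD (lab lp i) (lab lp j)) zτ (ι (e j)) ≡ true
                  nb j adj (inj₁ j≡x) = subst (λ j → adjS (arcD (lab lp i) (lab lp j)) zτ (ι (e j)) ≡ true) (sym j≡x)
                    (trans (cong (λ s → adjS s zτ (ι (e x))) (sign-ok px)) (proj₂ (∧-true {A ∧ C} h)))
                  nb j adj (inj₂ j≡a) = subst (λ j → adjS (arcD (lab lp i) (lab lp j)) zτ (ι (e j)) ≡ true) (sym j≡a)
                    (trans (cong (λ s → adjS s zτ (ι (e a))) (up py (subst (λ j → Adj (lab lp j) (lab lp i)) j≡a adj))) (proj₁ (∧-true {A} AC)))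

              hit₁-ok : ∀ τ y → hit₁ τ y ≡ true → Hit (done ∪ lp) (φ′ e) (test τ) y
              hit₁-ok τ y h = go (cover y) refl h
                where
                zτ : Fin N
                zτ = z (test τ)
                go : ∀ c → cover y ≡ c → hitOf τ y c ≡ true → Hit (done ∪ lp) (φ′ e) (test τ) y
                go (inj₂ no-lab) eq h = let dy , ry , t₁ , t₂ , ins , outs = hit-ok τ y h in
                  done-old y dy , ry , subst (λ w → adjS (s₁ (test τ)) (p₁ (test τ)) w ≡ true) (sym (φ′-done e y dy)) t₁ , subst (λ w → adjS (s₂ (test τ)) (p₂ (test τ)) w ≡ true) (sym (φ′-done e y dy)) t₂ ,
                  (λ d a → let dd , rd , c = ins d a in done-old d dd , rd , subst (λ w → arc w zτ ≡ true) (sym (φ′-done e d dd)) c) ,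
                  (λ d a → let dd , rd , c = outs d a in done-old d dd , rd , subst (λ w → arc zτ w ≡ true) (sym (φ′-done e d dd)) c)
                go (inj₁ (i , y≡)) eq h = subst (Hit (done ∪ lp) (φ′ e) (test τ)) (sym y≡) (new-hit (gadget-compat τ i h))
                  where
                  new-hit : (Yset (lab lp i) ≡ true × real (lab lp i) ≡ true) × adjS (s₁ (test τ)) (p₁ (test τ)) (ι (e i)) ≡ true × adjS (s₂ (test τ)) (p₂ (test τ)) (ι (e i)) ≡ true × Compat τ (lab lp i) → Hit (done ∪ lp) (φ′ e) (test τ) (lab lp i)
                  new-hit (rl , C₁ , C₂ , nb) = done-new i , rl , subst (λ w → adjS (s₁ (test τ)) (p₁ (test τ)) w ≡ true) (sym (φ′-lab e i)) C₁ , subst (λ w → adjS (s₂ (test τ)) (p₂ (test τ)) w ≡ true) (sym (φ′-lab e i)) C₂ ,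
                    (λ d a → let rd , j , dj , c = nb d (inj₁ a) in subst (λ d → (done ∪ lp) d ≡ true) (sym dj) (done-new j) , rd ,
                      subst₂ (λ w s → adjS s zτ w ≡ true) (sym (trans (cong (φ′ e) dj) (φ′-lab e j))) (antisym d (lab lp i) a) c) ,
                    (λ d a → let rd , j , dj , c = nb d (inj₂ a) in subst (λ d → (done ∪ lp) d ≡ true) (sym dj) (done-new j) , rd ,
                      subst₂ (λ w s → adjS s zτ w ≡ true) (sym (trans (cong (φ′ e) dj) (φ′-lab e j))) a c)

              wt₁ : Fin T → F
              wt₁ τ = wt τ * (1F - ξ * X τ e)

              φ₁ : Fin n → Fin N
              φ₁ = φ′ e

              inj₁′ : ∀ x y → View x → View y → real x ≡ true → real y ≡ true → φ₁ x ≡ φ₁ y → x ≡ y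
              inj₁′ x y (old dx _) (old dy _) rx ry h = φ-inj x y dx rx dy ry (trans (sym (φ′-done e x dx)) (trans h (φ′-done e y dy)))
              inj₁′ x _ (old dx _) (new i refl) rx ry h = ⊥-elim (avoid x dx rx (e i) (trans (sym (φ′-done e x dx)) (trans h (φ′-lab e i))))
              inj₁′ _ y (new i refl) (old dy _) rx ry h = ⊥-elim (avoid y dy ry (e i) (trans (sym (φ′-done e y dy)) (trans (sym h) (φ′-lab e i))))
              inj₁′ _ _ (new i refl) (new j refl) rx ry h = cong (lab lp) (proj₂ e-good i j (ι-inj _ _ (trans (sym (φ′-lab e i)) (trans h (φ′-lab e j)))))

              avoid₁ : ∀ x → View x → real x ≡ true → ∀ i → ¬ φ₁ x ≡ ι (κ₁ i)
              avoid₁ x (old dx _) rx i h = avoid x dx rx (κ₁ i) (trans (sym (φ′-done e x dx)) h)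
              avoid₁ _ (new j refl) rx i h = κ₁-miss i j rx (ι-inj _ _ (trans (sym h) (φ′-lab e j)))

              root-adj : ∀ i d → done d ≡ true → real d ≡ true → real (lab lp i) ≡ true → Adj d (lab lp i) → adjS (arcD d (lab lp i)) (φ d) (ι (e i)) ≡ true
              root-adj i d dd rd ri adj = go (outer i d dd rd ri adj)
                where
                go : i ≡ rootIx (piece lp) × (d ≡ cA ⊎ d ≡ cB) → adjS (arcD d (lab lp i)) (φ d) (ι (e i)) ≡ true
                go (refl , inj₁ refl) = trans (cong (λ w → adjS (sgn cA) (φ cA) (ι w)) e-root) (proj₁ (proj₂ rootSpot))
                go (refl , inj₂ refl) = trans (cong (λ w → adjS (sgn cB) (φ cB) (ι w)) e-root) (proj₂ (proj₂ rootSpot))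

              arcs₁ : ∀ x y → View x → View y → real x ≡ true → real y ≡ true → arcD x y ≡ true → arc (φ₁ x) (φ₁ y) ≡ true
              arcs₁ x y (old dx _) (old dy _) rx ry a = subst₂ (λ u w → arc u w ≡ true) (sym (φ′-done e x dx)) (sym (φ′-done e y dy)) (arcs x y dx rx dy ry a)
              arcs₁ x _ (old dx _) (new i refl) rx ry a = subst₂ (λ u w → arc u w ≡ true) (sym (φ′-done e x dx)) (sym (φ′-lab e i))
                (subst (λ s → adjS s (φ x) (ι (e i)) ≡ true) a (root-adj i x dx rx ry (inj₁ a)))
              arcs₁ _ y (new i refl) (old dy _) rx ry a = subst₂ (λ u w → arc u w ≡ true) (sym (φ′-lab e i)) (sym (φ′-done e y dy))
                (subst (λ s → adjS s (φ y) (ι (e i)) ≡ true) (antisym _ _ a) (root-adj i y dy ry rx (inj₂ a)))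
              arcs₁ _ _ (new i refl) (new j refl) rx ry a = subst₂ (λ u w → arc u w ≡ true) (sym (φ′-lab e i)) (sym (φ′-lab e j)) (go (inner i j rx ry a))
                where
                go : (∃[ s ] Par (piece lp) j i s) ⊎ (∃[ s ] Par (piece lp) i j s) → arc (ι (e i)) (ι (e j)) ≡ true
                go (inj₁ (s , q)) = subst (λ s → R.as s (e i) (e j) ≡ true) (trans (sym (sign-ok q)) a) (e-par q)
                go (inj₂ (s , q)) = subst (λ s → R.as s (e j) (e i) ≡ true) (trans (sym (sign-ok q)) (antisym _ _ a)) (e-par q)

            st₁ : St (done ∪ lp)
            st₁ = record
              { r = r₁ ; φ = φ₁ ; ι = λ i → ι (κ₁ i)
              ; ι-inj = λ i j h → κ₁-inj i j (ι-inj _ _ h)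
              ; φ-inj = λ x y dx rx dy ry → inj₁′ x y (view x dx) (view y dy) rx ry
              ; avoid = λ x dx rx → avoid₁ x (view x dx) rx
              ; arcs = λ x y dx rx dy ry → arcs₁ x y (view x dx) (view y dy) rx ry
              ; count = (≤-antisym (lin 0 (sc 1 (≤-reflexive r₁≡) ⊹ sc 1 (≤-reflexive count-step) ⊹ sc 1 (≤-reflexive count)) (solve 6 (λ r1 r l d d1 N → # 1 :* (N :- (r1 :+ d1)) := (# 1 :* ((r :- l) :- r1)) :+ ((# 1 :* ((d :+ l) :- d1)) :+ (# 1 :* (N :- (r :+ d))))) refl (fromℕ r₁) 𝕣 L (sum (λ x → [ done x ∧ real x ])) (sum (λ x → [ (done ∪ lp) x ∧ real x ])) (fromℕ N))) (lin 0 (sc 1 (≤-reflexive (sym r₁≡)) ⊹ sc 1 (≤-reflexive (sym count-step)) ⊹ sc 1 (≤-reflexive (sym count))) (solve 6 (λ r1 r l d d1 N → # 1 :* ((r1 :+ d1) :- N) := (# 1 :* (r1 :- (r :- l))) :+ ((# 1 :* (d1 :- (d :+ l))) :+ (# 1 :* ((r :+ d) :- N)))) refl (fromℕ r₁) 𝕣 L (sum (λ x → [ done x ∧ real x ])) (sum (λ x → [ (done ∪ lp) x ∧ real x ])) (fromℕ N))))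
              ; hit = hit₁ ; hit-ok = hit₁-ok ; D = D₁ ; B = B₁ ; wt = wt₁
              ; wt-nonneg = λ τ → *-nonneg (wt-nonneg τ) (≤-trans (x₁-pow≥0 (gc τ)) (step≥ τ))
              ; cnt = λ τ → cnt τ ℕ.+ gc τ ; cnt-ok = cnt₁-ok
              ; wt-ok = λ τ → ^^-+ x₁ (cnt τ) (gc τ) ≡≤ mul-mono₂ (x₁-pow≥0 (cnt τ)) (x₁-pow≥0 (gc τ)) (wt-ok τ) (step≥ τ)
              ; dens = dens₁ }

            -- The chosen outcome does not raise the sum. The factor 1 - ξμ of the weights is at
            -- most `y₀`^G by Bernoulli's inequality, as already charged in the potential for this
            -- tree.
            pot₁ : Potential bd st₁ lps ≤ Potential bd st (lp ∷ lps)
            pot₁ = (lin 0 (sc 1 e-pot ⊹ sc 1 (≤-reflexive (sym (cong (λ z → c₁ * Σ₂ (λ s v → sqr (D s v * D s v + fromℕ 4 * σ * z))) (trans (fromℕ-suc (List.length lps)) (+-comm 1F k))))) ⊹ sc 1 (*-nonneg (*-nonneg (*-nonneg c₂-nonneg (^^-nonneg y₀≥0 (gtotal lps))) (sum-nonneg wt-nonneg)) (≤⇒0≤- f≤)) ⊹ sc 1 (≤-reflexive (sym (cong (λ z → c₂ * (z * sum wt)) (^^-+ y₀ (gnum lp) (gtotal lps)))))) (solve 10 (λ a c y w1 a0 a2 f w yg y2 → # 1 :* ((a2 :+ (c :* (y2 :* w))) :- (a :+ (c :* (y :* w1)))) := (# 1 :* ((a0 :+ ((c :* y) :* (f :* w)))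 :- (a :+ ((c :* y) :* w1)))) :+ ((# 1 :* (a2 :- a0)) :+ ((# 1 :* ((((c :* y) :* w) :* (yg :- f)) :- # 0)) :+ (# 1 :* ((c :* (y2 :* w)) :- (c :* ((yg :* y) :* w))))))) refl (c₁ * Σ₂ (λ s v → sqr (D₁ s v * D₁ s v + fromℕ 4 * σ * k))) c₂ (y₀ ^^ gtotal lps) (sum wt₁) (c₁ * Σ₂ (λ s v → sqr (D s v * D s v + fromℕ 4 * σ * (k + 1F)))) (c₁ * Σ₂ (λ s v → sqr (D s v * D s v + fromℕ 4 * σ * fromℕ (suc (List.length lps))))) (1F - ξ * μ) (sum wt) (y₀ ^^ gnum lp) (y₀ ^^ gtotal (lp ∷ lps))))
              where
              f≤ : 1F - ξ * μ ≤ y₀ ^^ gnum lp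
              f≤ = (solve 3 (λ x g p → # 1 :- (x :* (g :* p)) := # 1 :- (g :* (x :* p))) refl ξ (fromℕ G) (p₀ * recip (fromℕ 2))) ≡≤ bernoulli y₀≥0 G

            bud₁ : B₁ + budget lps ≤ δ
            bud₁ = (lin 0 (sc 1 bud) (solve 4 (λ B b1 b2 d → # 1 :* (d :- ((B :+ b1) :+ b2)) := # 1 :* (d :- (B :+ (b1 :+ b2)))) refl B ((ωOf lp + P.𝕝 * κ) * ρ) (budget lps) δ))

        advance : Σ (St (done ∪ lp)) λ st₁ → Potential bd st₁ lps ≤ Potential bd st (lp ∷ lps) × St.B st₁ + budget lps ≤ δ
        advance = go (potential-step P.𝔸 σ k ξ μ c₁ c₂′ D U.Z wt X U.Z-bound k≥0 U.Z-centred wt-nonneg ξ≥0 X-avg c₁-nonneg (*-nonneg c₂-nonneg (^^-nonneg y₀≥0 (gtotal lps))))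
          where
          go : ∃[ e ] (P.Good e × (c₁ * Σ₂ (λ s v → sqr ((D s v + U.Z s v e) * (D s v + U.Z s v e) + fromℕ 4 * σ * k)) + c₂′ * sum (λ τ → wt τ * (1F - ξ * X τ e))
              ≤ c₁ * Σ₂ (λ s v → sqr (D s v * D s v + fromℕ 4 * σ * (k + 1F))) + c₂′ * ((1F - ξ * μ) * sum wt))) → _
          -- Only real vertices occupy host vertices. Set-aside ones are walked as placeholders, so
          -- that the tree stays connected, and their positions return to the free set.
          go (e , e-good , e-pot) = go₂ (complement e (λ i → real (lab lp i)) (proj₂ e-good))
            where
            go₂ : _ → Σ (St (done ∪ lp)) λ st₁ → Potential bd st₁ lps ≤ Potential bd st (lp ∷ lps) × St.B st₁ + budget lps ≤ δ
            go₂ (r₁ , κ₁ , inj , miss , sums) = let module Fi = Finish e e-good r₁ κ₁ inj miss sums e-pot in Fi.st₁ , Fi.pot₁ , Fi.bud₁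

    _∪*_ : (Fin n → Bool) → List (LP n) → Fin n → Bool
    done ∪* [] = done
    done ∪* (lp ∷ lps) = (done ∪ lp) ∪* lps

    -- When no tree is left, the potential still bounds c₂ times each weight, and a weight is at
    -- least `x₁`^cnt. A bounded potential thus forces many hits for every test.
    loop : (bd : Bounds) → ∀ lps done (st : St done) → Valid done lps → Potential bd st lps ≤ Bounds.C₀ bd → St.B st + budget lps ≤ δ
      → Σ (St (done ∪* lps)) λ st′ → ∀ τ → Bounds.c₂ bd * x₁ ^^ St.cnt st′ τ ≤ Bounds.C₀ bd
    loop bd [] done st _ pot bud = st , λ τ → (lin 0 (sc 1 pot ⊹ sc 1 (*-nonneg c₁-nonneg (sum-nonneg {f = λ v → sqr (D true v * D true v + fromℕ 4 * σ * fromℕ 0)} (λ v → sq-nonneg _) ⊹ sum-nonneg {f = λ v → sqr (D false v * D false v + fromℕ 4 * σ * fromℕ 0)} (λ v → sq-nonneg _))) ⊹ sc 1 (*-nonneg c₂-nonneg (≤⇒0≤- (≤-trans (wt-ok τ) (term≤sum wt-nonneg τ))))) (solve 5 (λ c x s A C → # 1 :* (C :- (c :* x)) := (# 1 :* (C :- (A :+ (c :* (# 1 :* s))))) :+ ((# 1 :* (A :- # 0)) :+ (# 1 :* ((c :* (s :- x)) :- # 0)))) refl c₂ (x₁ ^^ cnt τ) (sum wt) (c₁ * Σ₂ (λ s v → sqr (D s v * D s v + fromℕ 4 * σ * fromℕ 0))) C₀))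
      where
      open Bounds bd
      open St st
    loop bd (lp ∷ lps) done st (v , vs) pot bud = go (Advance.advance bd st lp lps v pot bud)
      where
      go : (Σ (St (done ∪ lp)) λ st₁ → Potential bd st₁ lps ≤ Potential bd st (lp ∷ lps) × St.B st₁ + budget lps ≤ δ) → _
      go (st₁ , pot₁ , bud₁) = loop bd lps (done ∪ lp) st₁ vs (≤-trans pot₁ pot) bud₁

-- A ranking in which almost every vertex has one lower neighbour.

module Degeneracy where
  open import Defs
  open OrderedField
  open Sums
  open Selection using (complement)

  isOrig : Lbl → Bool
  isOrig orig = true
  isOrig _ = false

  -- Every vertex has at most one lower neighbour, or two if it is exceptional.
  record Degen {W : ℕ} (E : Fin W → Fin W → Set) : Set where
    field
      rank : Fin W → F
      exc : Fin W → Bool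
      p q : Fin W → Fin W
      lower : ∀ x y → E x y → rank y < rank x → y ≡ p x ⊎ (exc x ≡ true × y ≡ q x)
      strict : ∀ x y → E x y → ¬ rank x ≡ rank y
      par : ∀ x → exc x ≡ false → E x (p x) × rank (p x) < rank x

  Other : ∀ {W} → Lab W → Fin W → Fin W → Set
  Other M x y = M x y ≡ other

  exceptions : ∀ {W} {E : Fin W → Fin W → Set} → Degen E → F
  exceptions d = sum (λ x → [ Degen.exc d x ])

  originals : ∀ {W} → Lab W → F
  originals M = sum (λ i → sum (λ j → [ isOrig (M i j) ]))

  Symm : ∀ {W} → Lab W → Set
  Symm M = ∀ i j → M i j ≡ M j i

  -- The effect of a subdivision described symmetrically in u and v, so that one proof covers both
  -- relative orders of their ranks (`Subd-swap`).
  record Subd {W : ℕ} (M : Lab W) (M′ : Lab (suc W)) (u v : Fin W) : Set where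
    field
      zz : M′ zero zero ≡ none
      zs : ∀ j → M′ zero (suc j) ≡ other → j ≡ u ⊎ j ≡ v
      zu : M′ zero (suc u) ≡ other
      zv : M′ zero (suc v) ≡ other
      sz : ∀ i → M′ (suc i) zero ≡ M′ zero (suc i)
      z-orig : ∀ j → isOrig (M′ zero (suc j)) ≡ false
      ss : ∀ i j → (i ≡ u × j ≡ v) ⊎ (i ≡ v × j ≡ u) ⊎ M′ (suc i) (suc j) ≡ M i j
      uv : M′ (suc u) (suc v) ≡ none
      vu : M′ (suc v) (suc u) ≡ none

  Subd-swap : ∀ {W} {M : Lab W} {M′ u v} → Subd M M′ u v → Subd M M′ v u
  Subd-swap s = record { zz = zz ; zs = λ j h → Data.Sum.swap (zs j h) ; zu = zv ; zv = zu ; sz = sz ; z-orig = z-orig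
                       ; ss = λ i j → rot (ss i j) ; uv = vu ; vu = uv }
    where
    open Subd s
    rot : ∀ {A B C : Set} → A ⊎ B ⊎ C → B ⊎ A ⊎ C
    rot (inj₁ a) = inj₂ (inj₁ a)
    rot (inj₂ (inj₁ b)) = inj₁ b
    rot (inj₂ (inj₂ c)) = inj₂ (inj₂ c)

  subd : ∀ {W} (M : Lab W) u v → Subd M (subdivide M u v) u v
  subd M u v = record { zz = refl ; zs = zs ; zu = zu ; zv = zv ; sz = λ i → refl ; z-orig = zo ; ss = ss ; uv = uv ; vu = vu }
    where
    zs : ∀ j → (if eqF j u ∨ eqF j v then other else none) ≡ other → j ≡ u ⊎ j ≡ v
    zs j h with j Finₚ.≟ u | j Finₚ.≟ v
    ... | yes e | _ = inj₁ e
    ... | no _ | yes e = inj₂ e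
    zs j () | no _ | no _
    zu : (if eqF u u ∨ eqF u v then other else none) ≡ other
    zu rewrite ==-refl u = refl
    zv : (if eqF v u ∨ eqF v v then other else none) ≡ other
    zv rewrite ==-refl v with v Finₚ.≟ u
    ... | yes _ = refl
    ... | no _ = refl
    zo : ∀ j → isOrig (if eqF j u ∨ eqF j v then other else none) ≡ false
    zo j with eqF j u ∨ eqF j v
    ... | true = refl
    ... | false = refl
    ss : ∀ i j → (i ≡ u × j ≡ v) ⊎ (i ≡ v × j ≡ u) ⊎ (if (eqF i u ∧ eqF j v) ∨ (eqF i v ∧ eqF j u) then none else M i j) ≡ M i j
    ss i j with i Finₚ.≟ u | j Finₚ.≟ v | i Finₚ.≟ v | j Finₚ.≟ u
    ... | yes a | yes c | _ | _ = inj₁ (a , c)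
    ... | yes _ | no _ | yes a | yes c = inj₂ (inj₁ (a , c))
    ... | yes _ | no _ | yes _ | no _ = inj₂ (inj₂ refl)
    ... | yes _ | no _ | no _ | _ = inj₂ (inj₂ refl)
    ... | no _ | _ | yes a | yes c = inj₂ (inj₁ (a , c))
    ... | no _ | _ | yes _ | no _ = inj₂ (inj₂ refl)
    ... | no _ | _ | no _ | _ = inj₂ (inj₂ refl)
    uv : (if (eqF u u ∧ eqF v v) ∨ (eqF u v ∧ eqF v u) then none else M u v) ≡ none
    uv rewrite ==-refl u | ==-refl v = refl
    vu : (if (eqF v u ∧ eqF u v) ∨ (eqF v v ∧ eqF u u) then none else M v u) ≡ none
    vu rewrite ==-refl u | ==-refl v with eqF v u ∧ eqF u v
    ... | true = refl
    ... | false = refl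

  infixr 5 _◂_
  _◂_ : ∀ {A : Set} {W} → A → (Fin W → A) → Fin (suc W) → A
  (a ◂ f) zero = a
  (a ◂ f) (suc i) = f i

  module _ {W : ℕ} {M : Lab W} (symm : Symm M) (d : Degen (Other M)) where
    open Degen d

    -- The new leaf is ranked just above its neighbour, which becomes its parent.
    degen-leaf : ∀ v → Degen (Other (appendLeaf M v))
    degen-leaf v = record
      { rank = (rank v + 1F) ◂ rank ; exc = false ◂ exc ; p = suc v ◂ (suc ∘ p) ; q = suc v ◂ (suc ∘ q)
      ; lower = low ; strict = str ; par = pr }
      where
      v-lt : rank v < rank v + 1F
      v-lt = (lin< 0 (0<fromℕ 0) (solve 1 (λ x → # 1 :* ((x :+ # 1) :- x) := # 1) refl (rank v)))
      only : ∀ i → (if eqF i v then other else none) ≡ other → i ≡ v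
      only i h with i Finₚ.≟ v
      ... | yes e = e
      only i () | no _
      low : ∀ x y → appendLeaf M v x y ≡ other → ((rank v + 1F) ◂ rank) y < ((rank v + 1F) ◂ rank) x
        → y ≡ (suc v ◂ (suc ∘ p)) x ⊎ ((false ◂ exc) x ≡ true × y ≡ (suc v ◂ (suc ∘ q)) x)
      low zero (suc j) e lt = inj₁ (cong suc (only j e))
      low (suc i) zero e lt with only i e
      ... | refl = ⊥-elim (<-irrefl (<-≤-trans lt (<⇒≤ v-lt)))
      low (suc i) (suc j) e lt with lower i j e lt
      ... | inj₁ h = inj₁ (cong suc h)
      ... | inj₂ (x , h) = inj₂ (x , cong suc h)
      str : ∀ x y → appendLeaf M v x y ≡ other → ¬ ((rank v + 1F) ◂ rank) x ≡ ((rank v + 1F) ◂ rank) y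
      str zero (suc j) e h with only j e
      ... | refl = <-irrefl (subst (rank v <_) h v-lt)
      str (suc i) zero e h with only i e
      ... | refl = <-irrefl (subst (rank v <_) (sym h) v-lt)
      str (suc i) (suc j) e h = strict i j e h
      pr : ∀ x → (false ◂ exc) x ≡ false → appendLeaf M v x ((suc v ◂ (suc ∘ p)) x) ≡ other × ((rank v + 1F) ◂ rank) ((suc v ◂ (suc ∘ p)) x) < ((rank v + 1F) ◂ rank) x
      pr zero _ rewrite ==-refl v = refl , v-lt
      pr (suc i) h = par i h

    module _ {M′ : Lab (suc W)} {u v : Fin W} (s : Subd M M′ u v) where
      open Subd s

      private
        ss-other : ∀ i j → M′ (suc i) (suc j) ≡ other → M i j ≡ other × ¬ (i ≡ u × j ≡ v) × ¬ (i ≡ v × j ≡ u)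
        ss-other i j e = m , (λ { (refl , refl) → contradiction (trans (sym e) uv) λ () }) , (λ { (refl , refl) → contradiction (trans (sym e) vu) λ () })
          where
          m : M i j ≡ other
          m with ss i j
          ... | inj₁ (refl , refl) = contradiction (trans (sym e) uv) λ ()
          ... | inj₂ (inj₁ (refl , refl)) = contradiction (trans (sym e) vu) λ ()
          ... | inj₂ (inj₂ k) = trans (sym k) e
        ¬zz : ¬ M′ zero zero ≡ other
        ¬zz e = contradiction (trans (sym e) zz) λ ()

      -- An original edge imposes no condition on ranks. When it is first subdivided, the new vertex
      -- is ranked above both ends and declared exceptional, so no older vertex gains a lower
      -- neighbour.
      degen-orig : M u v ≡ orig → Degen (Other M′)
      degen-orig uv-orig = record { rank = top ◂ rank ; exc = true ◂ exc ; p = suc u ◂ (suc ∘ p) ; q = suc v ◂ (suc ∘ q) ; lower = low ; strict = str ; par = pr }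
        where
        maxi : ∃[ t ] (rank u < t × rank v < t)
        maxi with ≤-or-> (rank u) (rank v)
        ... | inj₁ h = rank v + 1F , (lin< 0 (0<fromℕ 0 ⊹< sc 1 h) (solve 2 (λ x y → # 1 :* ((y :+ # 1) :- x) := # 1 :+ (# 1 :* (y :- x))) refl (rank u) (rank v))) , (lin< 0 (0<fromℕ 0) (solve 1 (λ y → # 1 :* ((y :+ # 1) :- y) := # 1) refl (rank v)))
        ... | inj₂ h = rank u + 1F , (lin< 0 (0<fromℕ 0) (solve 1 (λ x → # 1 :* ((x :+ # 1) :- x) := # 1) refl (rank u))) , (lin< 0 (0<fromℕ 0 ⊹< sc 1 (<⇒≤ h)) (solve 2 (λ x y → # 1 :* ((x :+ # 1) :- y) := # 1 :+ (# 1 :* (x :- y))) refl (rank u) (rank v)))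
        top : F
        top = proj₁ maxi
        nb< : ∀ j → M′ zero (suc j) ≡ other → rank j < top
        nb< j e with zs j e
        ... | inj₁ refl = proj₁ (proj₂ maxi)
        ... | inj₂ refl = proj₂ (proj₂ maxi)
        low : ∀ x y → M′ x y ≡ other → (top ◂ rank) y < (top ◂ rank) x → y ≡ (suc u ◂ (suc ∘ p)) x ⊎ ((true ◂ exc) x ≡ true × y ≡ (suc v ◂ (suc ∘ q)) x)
        low zero zero e _ = ⊥-elim (¬zz e)
        low zero (suc j) e lt with zs j e
        ... | inj₁ h = inj₁ (cong suc h)
        ... | inj₂ h = inj₂ (refl , cong suc h)
        low (suc i) zero e lt = ⊥-elim (<-irrefl (<-≤-trans lt (<⇒≤ (nb< i (trans (sym (sz i)) e)))))
        low (suc i) (suc j) e lt with lower i j (proj₁ (ss-other i j e)) lt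
        ... | inj₁ h = inj₁ (cong suc h)
        ... | inj₂ (x , h) = inj₂ (x , cong suc h)
        str : ∀ x y → M′ x y ≡ other → ¬ (top ◂ rank) x ≡ (top ◂ rank) y
        str zero zero e = ⊥-elim (¬zz e)
        str zero (suc j) e h = <-irrefl (subst (rank j <_) h (nb< j e))
        str (suc i) zero e h = <-irrefl (subst (rank i <_) (sym h) (nb< i (trans (sym (sz i)) e)))
        str (suc i) (suc j) e = strict i j (proj₁ (ss-other i j e))
        pr : ∀ x → (true ◂ exc) x ≡ false → M′ x ((suc u ◂ (suc ∘ p)) x) ≡ other × (top ◂ rank) ((suc u ◂ (suc ∘ p)) x) < (top ◂ rank) x
        pr (suc i) h with ss i (p i)
        ... | inj₂ (inj₂ k) = trans k (proj₁ (par i h)) , proj₂ (par i h)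
        ... | inj₁ (refl , k) = contradiction (trans (sym uv-orig) (trans (cong (M u) (sym k)) (proj₁ (par i h)))) λ ()
        ... | inj₂ (inj₁ (refl , k)) = contradiction (trans (sym uv-orig) (trans (symm u v) (trans (cong (M v) (sym k)) (proj₁ (par i h))))) λ ()

      -- Subdividing an edge u v with rank u < rank v: the new vertex is ranked in between and replaces u as a lower neighbour of v.
      degen-other : M v u ≡ other → rank u < rank v → Degen (Other M′)
      degen-other vu-other u<v = record { rank = μ ◂ rank ; exc = false ◂ exc ; p = suc u ◂ redirect p ; q = suc u ◂ redirect q ; lower = low ; strict = str ; par = pr }
        where
        half : F
        half = recip (fromℕ 2)
        half-eq : fromℕ 2 * half ≡ 1F
        half-eq = recip-inv (0<fromℕ 1)
        μ : F
        μ = (rank u + rank v) * half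
        u<μ : rank u < μ
        u<μ = (lin< 0 (sc< 0 (*-pos (<⇒0<- u<v) (recip-pos (0<fromℕ 1))) ⊹< sc 1 (≤-reflexive (sym (cong (rank u *_) half-eq)))) (solve 3 (λ x y h → # 1 :* (((x :+ y) :* h) :- x) := (# 1 :* (((y :- x) :* h) :- # 0)) :+ (# 1 :* ((x :* (# 2 :* h)) :- (x :* # 1)))) refl (rank u) (rank v) half))
        μ<v : μ < rank v
        μ<v = (lin< 0 (sc< 0 (*-pos (<⇒0<- u<v) (recip-pos (0<fromℕ 1))) ⊹< sc 1 (≤-reflexive (cong (rank v *_) half-eq))) (solve 3 (λ x y h → # 1 :* (y :- ((x :+ y) :* h)) := (# 1 :* (((y :- x) :* h) :- # 0)) :+ (# 1 :* ((y :* # 1) :- (y :* (# 2 :* h))))) refl (rank u) (rank v) half))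
        redirect : (Fin W → Fin W) → Fin W → Fin (suc W)
        redirect f i = if eqF i v ∧ eqF (f i) u then zero else suc (f i)
        redirect-v : ∀ f i → i ≡ v → f i ≡ u → redirect f i ≡ zero
        redirect-v f i refl h rewrite h | ==-refl v | ==-refl u = refl
        redirect-≢ : ∀ f i → ¬ (i ≡ v × f i ≡ u) → redirect f i ≡ suc (f i)
        redirect-≢ f i n with i Finₚ.≟ v | f i Finₚ.≟ u
        ... | yes a | yes c = ⊥-elim (n (a , c))
        ... | yes _ | no _ = refl
        ... | no _ | _ = refl
        low : ∀ x y → M′ x y ≡ other → (μ ◂ rank) y < (μ ◂ rank) x → y ≡ (suc u ◂ redirect p) x ⊎ ((false ◂ exc) x ≡ true × y ≡ (suc u ◂ redirect q) x)
        low zero zero e _ = ⊥-elim (¬zz e)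
        low zero (suc j) e lt with zs j e
        ... | inj₁ h = inj₁ (cong suc h)
        ... | inj₂ refl = ⊥-elim (<-irrefl (<-≤-trans lt (<⇒≤ μ<v)))
        low (suc i) zero e lt with zs i (trans (sym (sz i)) e)
        ... | inj₁ refl = ⊥-elim (<-irrefl (<-≤-trans lt (<⇒≤ u<μ)))
        ... | inj₂ refl with lower v u vu-other u<v
        ... | inj₁ h = inj₁ (sym (redirect-v p v refl (sym h)))
        ... | inj₂ (x , h) = inj₂ (x , sym (redirect-v q v refl (sym h)))
        low (suc i) (suc j) e lt with lower i j (proj₁ (ss-other i j e)) lt
        ... | inj₁ h = inj₁ (trans (cong suc h) (sym (redirect-≢ p i (λ { (refl , k) → proj₂ (proj₂ (ss-other i j e)) (refl , trans h k) }))))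
        ... | inj₂ (x , h) = inj₂ (x , trans (cong suc h) (sym (redirect-≢ q i (λ { (refl , k) → proj₂ (proj₂ (ss-other i j e)) (refl , trans h k) }))))
        str : ∀ x y → M′ x y ≡ other → ¬ (μ ◂ rank) x ≡ (μ ◂ rank) y
        str zero zero e = ⊥-elim (¬zz e)
        str zero (suc j) e h with zs j e
        ... | inj₁ refl = <-irrefl (subst (rank u <_) h u<μ)
        ... | inj₂ refl = <-irrefl (subst (_< rank v) h μ<v)
        str (suc i) zero e h with zs i (trans (sym (sz i)) e)
        ... | inj₁ refl = <-irrefl (subst (rank u <_) (sym h) u<μ)
        ... | inj₂ refl = <-irrefl (subst (_< rank v) (sym h) μ<v)
        str (suc i) (suc j) e = strict i j (proj₁ (ss-other i j e))
        pr : ∀ x → (false ◂ exc) x ≡ false → M′ x ((suc u ◂ redirect p) x) ≡ other × (μ ◂ rank) ((suc u ◂ redirect p) x) < (μ ◂ rank) x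
        pr zero _ = zu , u<μ
        pr (suc i) h with i Finₚ.≟ v | p i Finₚ.≟ u
        ... | yes refl | yes _ = trans (sz v) zv , μ<v
        ... | yes refl | no p≢u = keep , proj₂ (par i h)
          where
          keep : M′ (suc v) (suc (p v)) ≡ other
          keep with ss v (p v)
          ... | inj₂ (inj₂ k) = trans k (proj₁ (par v h))
          ... | inj₁ (v≡u , _) = ⊥-elim (<-irrefl (subst (λ z → rank z < rank v) (sym v≡u) u<v))
          ... | inj₂ (inj₁ (_ , k)) = ⊥-elim (p≢u k)
        ... | no i≢v | _ = keep , proj₂ (par i h)
          where
          keep : M′ (suc i) (suc (p i)) ≡ other
          keep with ss i (p i)
          ... | inj₂ (inj₂ k) = trans k (proj₁ (par i h))
          ... | inj₁ (refl , k) = ⊥-elim (<-irrefl (<-≤-trans u<v (<⇒≤ (subst (λ z → rank z < rank u) k (proj₂ (par u h))))))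
          ... | inj₂ (inj₁ (k , _)) = ⊥-elim (i≢v k)

  originals-leaf : ∀ {W} (M : Lab W) v → originals (appendLeaf M v) ≤ originals M
  originals-leaf M v = ≤-reflexive (trans (sum-suc _) (trans (cong₂ _+_ (sum-zero row₀) (sum-cong row)) (+-identityˡ _)))
    where
    no-orig : ∀ (c : Bool) → [ isOrig (if c then other else none) ] ≡ 0F
    no-orig true = refl
    no-orig false = refl
    row₀ : ∀ j → [ isOrig (appendLeaf M v zero j) ] ≡ 0F
    row₀ zero = refl
    row₀ (suc j) = no-orig (eqF j v)
    row : ∀ i → sum (λ j → [ isOrig (appendLeaf M v (suc i) j) ]) ≡ sum (λ j → [ isOrig (M i j) ])
    row i = trans (sum-suc _) (trans (cong₂ _+_ (no-orig (eqF i v)) refl) (+-identityˡ _))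

  -- No pair involving the new vertex is original, and the pair (u, v) has lost its label.
  originals-subd : ∀ {W} {M : Lab W} {M′ u v} → Subd M M′ u v → originals M′ + [ isOrig (M u v) ] ≤ originals M
  originals-subd {W} {M} {M′} {u} {v} s = ≤-trans (≤-reflexive (cong₂ _+_ shrink (sym spike))) (≤-reflexive (sym (sum-+ _ _)) ⨾ sum-mono (λ i → ≤-reflexive (sym (sum-+ _ _)) ⨾ sum-mono (λ j → lem i j)))
    where
    open Subd s
    infixr 3 _⨾_
    _⨾_ : ∀ {x y z} → x ≤ y → y ≤ z → x ≤ z
    _⨾_ = ≤-trans
    c : F
    c = [ isOrig (M u v) ]
    spike : sum (λ i → sum (λ j → [ i == u ] * ([ j == v ] * c))) ≡ c
    spike = trans (sum-cong (λ i → sum-*ˡ [ i == u ] _)) (trans (sum-δ u _) (sum-δ v (λ _ → c)))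
    shrink : originals M′ ≡ sum (λ i → sum (λ j → [ isOrig (M′ (suc i) (suc j)) ]))
    shrink = trans (sum-suc _) (trans (cong₂ _+_ (sum-zero row₀) (sum-cong row)) (+-identityˡ _))
      where
      row₀ : ∀ j → [ isOrig (M′ zero j) ] ≡ 0F
      row₀ zero rewrite zz = refl
      row₀ (suc j) = cong [_] (z-orig j)
      row : ∀ i → sum (λ j → [ isOrig (M′ (suc i) j) ]) ≡ sum (λ j → [ isOrig (M′ (suc i) (suc j)) ])
      row i = trans (sum-suc _) (trans (cong (_+ sum (λ j → [ isOrig (M′ (suc i) (suc j)) ])) (trans (cong (λ l → [ isOrig l ]) (sz i)) (cong [_] (z-orig i)))) (+-identityˡ _))
    at-uv : ∀ i j → (i ≡ u × j ≡ v → c ≤ [ isOrig (M i j) ]) → isOrig (M′ (suc i) (suc j)) ≡ false → [ isOrig (M′ (suc i) (suc j)) ] + [ i == u ] * ([ j == v ] * c) ≤ [ isOrig (M i j) ]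
    at-uv i j h e rewrite e with i Finₚ.≟ u | j Finₚ.≟ v
    ... | yes a | yes b = (lin 0 (sc 1 (h (a , b))) (solve 2 (λ c x → # 1 :* (x :- (# 0 :+ (# 1 :* (# 1 :* c)))) := # 1 :* (x :- c)) refl c ([ isOrig (M i j) ])))
    ... | yes _ | no _ = (lin 0 (sc 1 ([]-nonneg (isOrig (M i j)))) (solve 2 (λ c x → # 1 :* (x :- (# 0 :+ (# 1 :* (# 0 :* c)))) := # 1 :* (x :- # 0)) refl c ([ isOrig (M i j) ])))
    ... | no _ | _ = (trans (cong (0F +_) (zeroˡ _)) (+-identityˡ _)) ≡≤ []-nonneg (isOrig (M i j))
    here-c : ∀ i j → i ≡ u × j ≡ v → c ≤ [ isOrig (M i j) ]
    here-c i j (refl , refl) = ≤-refl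
    lem : ∀ i j → [ isOrig (M′ (suc i) (suc j)) ] + [ i == u ] * ([ j == v ] * c) ≤ [ isOrig (M i j) ]
    lem i j with ss i j
    ... | inj₁ (refl , refl) = at-uv i j (here-c i j) (cong isOrig uv)
    ... | inj₂ (inj₁ (refl , refl)) = at-uv i j (here-c i j) (cong isOrig vu)
    ... | inj₂ (inj₂ k) with (i Finₚ.≟ u) | (j Finₚ.≟ v)
    ... | yes refl | yes refl = (lin 0 (sc 1 (≤-reflexive (cong (λ l → [ isOrig l ]) uv))) (solve 2 (λ x y → # 1 :* (y :- (x :+ (# 1 :* (# 1 :* y)))) := # 1 :* (# 0 :- x)) refl ([ isOrig (M′ (suc i) (suc j)) ]) ([ isOrig (M i j) ])))
    ... | yes _ | no _ = (lin 0 (sc 1 (≤-reflexive (cong (λ l → [ isOrig l ]) k))) (solve 3 (λ c x y → # 1 :* (y :- (x :+ (# 1 :* (# 0 :* c)))) := # 1 :* (y :- x)) refl c ([ isOrig (M′ (suc i) (suc j)) ]) ([ isOrig (M i j) ])))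
    ... | no _ | _ = ≤-reflexive (trans (cong ([ isOrig (M′ (suc i) (suc j)) ] +_) (zeroˡ _)) (trans (+-identityʳ _) (cong (λ l → [ isOrig l ]) k)))

  Structured : ∀ {W} → Lab W → F → Set
  Structured M B = Symm M × Σ (Degen (Other M)) λ d → exceptions d + originals M ≤ B

  -- A new exceptional vertex appears only together with the loss of an original edge, so exceptions
  -- plus remaining original pairs never exceed their initial value.
  reach-structured : ∀ {Q₀ W M} → Reach Q₀ W M → Structured M (fromℕ (size Q₀) + fromℕ (size Q₀) * fromℕ (size Q₀))
  -- At the start every edge is original, so the ranking conditions are vacuous, and all vertices of
  -- Q₀ are counted as exceptional.
  reach-structured {Q₀} start = sy , record
      { rank = λ _ → 0F ; exc = λ _ → true ; p = id ; q = id ; lower = λ x y _ lt → ⊥-elim (<-irrefl lt) ; strict = λ x y e → ⊥-elim (no-other x y e) ; par = λ x () }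
    , +-mono-≤ (≤-reflexive (trans (sum-const (size Q₀) 1F) (*-identityʳ _)))
        (sum-mono (λ i → sum-mono (λ j → []-≤1 (isOrig (initLab Q₀ i j))) ≤≡ trans (sum-const (size Q₀) 1F) (*-identityʳ _)) ≤≡ sum-const (size Q₀) (fromℕ (size Q₀)))
    where
    sy : Symm (initLab Q₀)
    sy i j = cong (λ c → if c then orig else none) (adj-sym Q₀ i j)
    no-other : ∀ x y → Other (initLab Q₀) x y → ⊥
    no-other x y e with adj Q₀ x y
    no-other x y () | true
    no-other x y () | false
  reach-structured (opA {W} {M} R v) with reach-structured R
  ... | sy , d , le = sy′ , degen-leaf sy d v , ≤-trans (+-mono-≤ (≤-reflexive (trans (sum-suc _) (+-identityˡ _))) (originals-leaf M v)) le
    where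
    sy′ : Symm (appendLeaf M v)
    sy′ zero zero = refl
    sy′ zero (suc j) = refl
    sy′ (suc i) zero = refl
    sy′ (suc i) (suc j) = sy i j
  reach-structured (opB {W} {M} R u v edge) with reach-structured R
  ... | sy , d , le = sy′ , go (M u v) refl
    where
    sd : Subd M (subdivide M u v) u v
    sd = subd M u v
    sy′ : Symm (subdivide M u v)
    sy′ zero zero = refl
    sy′ zero (suc j) = sym (Subd.sz sd j)
    sy′ (suc i) zero = Subd.sz sd i
    sy′ (suc i) (suc j) = cong₂ (λ c l → if c then none else l) (swap-or (eqF i u) (eqF j v) (eqF i v) (eqF j u)) (sy i j)
      where
      swap-or : ∀ a b c d → (a ∧ b) ∨ (c ∧ d) ≡ (d ∧ c) ∨ (b ∧ a)
      swap-or true true true true = refl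
      swap-or true true true false = refl
      swap-or true true false true = refl
      swap-or true true false false = refl
      swap-or true false true true = refl
      swap-or true false true false = refl
      swap-or true false false true = refl
      swap-or true false false false = refl
      swap-or false true true true = refl
      swap-or false true true false = refl
      swap-or false true false true = refl
      swap-or false true false false = refl
      swap-or false false true true = refl
      swap-or false false true false = refl
      swap-or false false false true = refl
      swap-or false false false false = refl
    Bnd : F
    Bnd = fromℕ _ + fromℕ _ * fromℕ _
    fin : ∀ {x} (d′ : Degen (Other (subdivide M u v))) → exceptions d′ ≤ x + exceptions d → x ≤ [ isOrig (M u v) ] → Σ (Degen (Other (subdivide M u v))) λ d → exceptions d + originals (subdivide M u v) ≤ Bnd
    fin {x} d′ h₁ h₂ = d′ , (lin 0 (sc 1 h₁ ⊹ sc 1 h₂ ⊹ sc 1 (originals-subd sd) ⊹ sc 1 le) (solve 7 (λ x a a′ o o′ c B → # 1 :* (B :- (a′ :+ o′)) := (# 1 :* ((x :+ a) :- a′)) :+ ((# 1 :* (c :- x)) :+ ((# 1 :* (o :- (o′ :+ c))) :+ (# 1 :* (B :- (a :+ o)))))) refl x (exceptions d) (exceptions d′) (originals M) (originals (subdivide M u v)) ([ isOrig (M u v) ]) Bnd))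
    go : ∀ l → M u v ≡ l → Σ (Degen (Other (subdivide M u v))) λ d → exceptions d + originals (subdivide M u v) ≤ Bnd
    go none e = contradiction (trans (sym edge) (cong isEdge e)) λ ()
    go orig e = fin (degen-orig sy d sd e) (≤-reflexive (sum-suc _)) (≤-reflexive (cong (λ l → [ isOrig l ]) (sym e)))
    go other e with ≤-or-> (Degen.rank d u) (Degen.rank d v)
    ... | inj₂ v<u = fin {0F} (degen-other sy d (Subd-swap sd) e v<u) (≤-reflexive (sum-suc _)) ([]-nonneg (isOrig (M u v)))
    ... | inj₁ u≤v with ≤-or-> (Degen.rank d v) (Degen.rank d u)
    ... | inj₂ u<v = fin {0F} (degen-other sy d sd (trans (sy v u) e) u<v) (≤-reflexive (sum-suc _)) ([]-nonneg (isOrig (M u v)))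
    ... | inj₁ v≤u = ⊥-elim (Degen.strict d u v e (≤-antisym u≤v v≤u))

  sum-inj : ∀ {m n} (e : Fin m → Fin n) → (∀ i j → e i ≡ e j → i ≡ j) → (f : Fin n → F) → (∀ i → 0F ≤ f i) → sum (f ∘ e) ≤ sum f
  sum-inj e inj f h = go (complement e (λ _ → true) inj)
    where
    go : _ → sum (f ∘ e) ≤ sum f
    go (r′ , κ , _ , _ , sums) = (lin 0 (sc 1 (≤-reflexive (sym (sums f))) ⊹ sc 1 (≤-reflexive (sym (sum-cong (λ x → *-identityˡ (f (e x)))))) ⊹ sc 1 (sum-nonneg (λ i → h (κ i)))) (solve 4 (λ a s k t → # 1 :* (s :- a) := (# 1 :* (s :- (k :+ t))) :+ ((# 1 :* (t :- a)) :+ (# 1 :* (k :- # 0)))) refl (sum (f ∘ e)) (sum f) (sum (f ∘ κ)) (sum (λ x → 1F * f (e x)))))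

  -- Since every edge of Q₀ has been subdivided, all edges of `Q` carry the label `other`, and the
  -- ranking of `Other M` is one of `Q`.
  graph-degen : ∀ {Q₀ Q} → ObtainedFrom Q₀ Q → Σ (Degen (λ x y → adj Q x y ≡ true)) λ d → exceptions d ≤ fromℕ (size Q₀) + fromℕ (size Q₀) * fromℕ (size Q₀)
  graph-degen {Q₀} {Q} (W , M , R , no-orig , σ , iso) = go (reach-structured R)
    where
    to : Fin (size Q) → Fin W
    to = Inverse.to σ
    from : Fin W → Fin (size Q)
    from = Inverse.from σ
    from-to : ∀ x → from (to x) ≡ x
    from-to x = Inverse.strictlyInverseʳ σ x
    to-from : ∀ y → to (from y) ≡ y
    to-from y = Inverse.strictlyInverseˡ σ y
    edge⇒ : ∀ x y → adj Q x y ≡ true → Other M (to x) (to y)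
    edge⇒ x y e with M (to x) (to y) in eq | trans (sym (iso x y)) e
    ... | other | _ = refl
    ... | orig | _ = ⊥-elim (no-orig _ _ eq)
    ⇒edge : ∀ x y → Other M (to x) (to y) → adj Q x y ≡ true
    ⇒edge x y e = trans (iso x y) (cong isEdge e)
    go : Structured M _ → _
    go (sy , d , le) = d′ , (lin 0 (sc 1 (sum-inj to (λ i j h → trans (sym (from-to i)) (trans (cong from h) (from-to j))) (λ w → [ exc w ]) (λ w → []-nonneg (exc w))) ⊹ sc 1 le ⊹ sc 1 (sum-nonneg (λ i → sum-nonneg (λ j → []-nonneg (isOrig (M i j)))))) (solve 4 (λ a x o B → # 1 :* (B :- a) := (# 1 :* (x :- a)) :+ ((# 1 :* (B :- (x :+ o))) :+ (# 1 :* (o :- # 0)))) refl (exceptions d′) (exceptions d) (originals M) (fromℕ (size Q₀) + fromℕ (size Q₀) * fromℕ (size Q₀))))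
      where
      open Degen d
      d′ : Degen (λ x y → adj Q x y ≡ true)
      d′ = record
        { rank = λ x → rank (to x) ; exc = λ x → exc (to x) ; p = λ x → from (p (to x)) ; q = λ x → from (q (to x))
        ; lower = λ x y e lt → low x y (lower (to x) (to y) (edge⇒ x y e) lt)
        ; strict = λ x y e → strict (to x) (to y) (edge⇒ x y e)
        ; par = λ x h → let e , lt = par (to x) h in ⇒edge x _ (trans (cong (M (to x)) (to-from _)) e) , subst (λ z → rank z < rank (to x)) (sym (to-from _)) lt }
        where
        low : ∀ x y → to y ≡ p (to x) ⊎ (exc (to x) ≡ true × to y ≡ q (to x)) → y ≡ from (p (to x)) ⊎ (exc (to x) ≡ true × y ≡ from (q (to x)))
        low x y (inj₁ h) = inj₁ (trans (sym (from-to y)) (cong from h))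
        low x y (inj₂ (e , h)) = inj₂ (e , trans (sym (from-to y)) (cong from h))

-- Recursion along ranks and enumeration by rank.

module Pieces where
  open OrderedField
  open Sums
  open RandomWalks
  open Selection
  open Step
  open Loop
  open Degeneracy using (Degen)

  module Ranked {n : ℕ} {E : Fin n → Fin n → Set} (d : Degen E) where
    open Degen d

    private
      below : Fin n → Fin n → Bool
      below x z = not (isInj₁ (≤-or-> (rank x) (rank z)))

      below⇒ : ∀ x z → below x z ≡ true → rank z < rank x
      below⇒ x z h with ≤-or-> (rank x) (rank z)
      ... | inj₂ lt = lt

      ⇒below : ∀ x z → rank z < rank x → below x z ≡ true
      ⇒below x z h with ≤-or-> (rank x) (rank z)
      ... | inj₂ lt = refl
      ... | inj₁ le = ⊥-elim (<⇒≱ h le)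

    -- Rational ranks let a vertex be inserted between two others. Counting the vertices below turns
    -- them into natural numbers on which recursion terminates.
    rk : Fin n → ℕ
    rk x = gcount (below x)

    rk-mono : ∀ {x y} → rank y < rank x → rk y ℕ.< rk x
    rk-mono {x} {y} h = fromℕ-<⁻ (subst₂ _<_ (sym (gcount-sum (below y))) (sym (gcount-sum (below x))) (sum-strict le y strict-y))
      where
      le : ∀ z → [ below y z ] ≤ [ below x z ]
      le z with below y z in eq
      ... | false = []-nonneg (below x z)
      ... | true = ≤-reflexive (cong [_] (sym (⇒below x z (≤-<-trans (<⇒≤ (below⇒ y z eq)) h))))
      strict-y : [ below y y ] < [ below x y ]
      strict-y with below y y in eq
      ... | true = ⊥-elim (<-irrefl (below⇒ y y eq))
      ... | false = subst (λ c → 0F < [ c ]) (sym (⇒below x y h)) (0<fromℕ 0)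

    -- Recursion along parents down to the vertices marked as roots.
    module Fold {A : Set} (isRoot : Fin n → Bool) (exc⇒root : ∀ x → exc x ≡ true → isRoot x ≡ true) (base : Fin n → A) (step : A → A) where
      private
        foldF : ℕ → Fin n → A
        foldF zero x = base x
        foldF (suc f) x = if isRoot x then base x else step (foldF f (p x))

      p< : ∀ x → isRoot x ≡ false → rk (p x) ℕ.< rk x
      p< x h = rk-mono (proj₂ (par x (nonexc (Bool-dec (exc x)))))
        where
        nonexc : exc x ≡ true ⊎ exc x ≡ false → exc x ≡ false
        nonexc (inj₁ e) = contradiction (trans (sym (exc⇒root x e)) h) λ ()
        nonexc (inj₂ e) = e

      private
        stable : ∀ f f′ x → rk x ℕ.< f → rk x ℕ.< f′ → foldF f x ≡ foldF f′ x
        stable (suc f) (suc f′) x (ℕ.s≤s h) (ℕ.s≤s h′) with isRoot x in eq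
        ... | true = refl
        ... | false = cong step (stable f f′ (p x) (ℕₚ.<-≤-trans (p< x eq) h) (ℕₚ.<-≤-trans (p< x eq) h′))

      opaque
        fold : Fin n → A
        fold x = foldF (suc (rk x)) x

        fold-root : ∀ x → isRoot x ≡ true → fold x ≡ base x
        fold-root x h rewrite h = refl

        fold-step : ∀ x → isRoot x ≡ false → fold x ≡ step (fold (p x))
        fold-step x h rewrite h = cong step (stable (rk x) (suc (rk (p x))) (p x) (p< x h) (ℕₚ.n<1+n _))

      -- Induction along parents.
      ind : (P : Fin n → Set) → (∀ x → isRoot x ≡ true → P x) → (∀ x → isRoot x ≡ false → P (p x) → P x) → ∀ x → P x
      ind P rt st x = go (suc (rk x)) x (ℕₚ.n<1+n _)
        where
        go : ∀ f x → rk x ℕ.< f → P x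
        go (suc f) x (ℕ.s≤s h) with Bool-dec (isRoot x)
        ... | inj₁ e = rt x e
        ... | inj₂ e = st x e (go f (p x) (ℕₚ.<-≤-trans (p< x e) h))

    insert : (Fin n → Bool) → Fin n → Fin n → Bool
    insert B x y = (y == x) ∨ B y

    -- Each listed vertex is new, and everything of smaller rank has been visited before it; in
    -- particular its parent has.
    Ord : (Fin n → Bool) → List (Fin n) → Set
    Ord B [] = ∀ x → B x ≡ true
    Ord B (x ∷ xs) = B x ≡ false × (∀ y → rk y ℕ.< rk x → B y ≡ true) × Ord (insert B x) xs

    private
      missing : (Fin n → Bool) → ℕ
      missing B = gcount (not ∘ B)

    ordering : ∀ f B → missing B ℕ.≤ f → ∃[ xs ] Ord B xs
    ordering f B h = go f h least
      where
      least : (∀ x → B x ≡ true) ⊎ (∃[ x ] (B x ≡ false × (∀ y → rk y ℕ.< rk x → B y ≡ true)))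
      least with search (λ x → Data.Sum.swap (Bool-dec (B x)))
      ... | inj₂ all = inj₁ all
      ... | inj₁ (x₀ , e) = inj₂ (descend (suc (rk x₀)) x₀ e (ℕₚ.n<1+n _))
        where
        descend : ∀ f x → B x ≡ false → rk x ℕ.< f → ∃[ x ] (B x ≡ false × (∀ y → rk y ℕ.< rk x → B y ≡ true))
        descend (suc f) x e (ℕ.s≤s lt) with search {A = λ y → B y ≡ false × rk y ℕ.< rk x} {B = λ y → rk y ℕ.< rk x → B y ≡ true} dich
          where
          dich : ∀ y → (B y ≡ false × rk y ℕ.< rk x) ⊎ (rk y ℕ.< rk x → B y ≡ true)
          dich y with B y | rk y ℕ.<? rk x
          ... | true | _ = inj₂ λ _ → refl
          ... | false | yes l = inj₁ (refl , l)
          ... | false | no l = inj₂ λ l′ → ⊥-elim (l l′)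
        ... | inj₁ (y , e′ , l) = descend f y e′ (ℕₚ.<-≤-trans l lt)
        ... | inj₂ all = x , e , all
      go : ∀ f → missing B ℕ.≤ f → (∀ x → B x ≡ true) ⊎ (∃[ x ] (B x ≡ false × (∀ y → rk y ℕ.< rk x → B y ≡ true))) → ∃[ xs ] Ord B xs
      go f h (inj₁ all) = [] , all
      go zero h (inj₂ (x , e , l)) = ⊥-elim (ℕₚ.n≮0 (ℕₚ.<-≤-trans pos h))
        where
        pos : 0 ℕ.< missing B
        pos = fromℕ-<⁻ (<-≤-trans (0<fromℕ 0) (≤-trans (≤-reflexive (cong (λ c → [ not c ]) (sym e))) (term≤sum (λ y → []-nonneg (not (B y))) x ≤≡ sym (gcount-sum (not ∘ B)))))
      go (suc f) h (inj₂ (x , e , l)) = let xs , o = ordering f (insert B x) (ℕₚ.≤-pred (ℕₚ.<-≤-trans less h)) in x ∷ xs , e , l , o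
        where
        less : missing (insert B x) ℕ.< missing B
        less = fromℕ-<⁻ (subst₂ _<_ (sym (gcount-sum _)) (sym (gcount-sum _)) (sum-strict le x st))
          where
          le : ∀ y → [ not (insert B x y) ] ≤ [ not (B y) ]
          le y with y == x
          ... | true = []-nonneg (not (B y))
          ... | false = ≤-refl
          st : [ not (insert B x x) ] < [ not (B x) ]
          st rewrite ==-refl x | e = 0<fromℕ 0

  -- Cutting the graph into rooted trees at the marked roots.

  module Cut {n : ℕ} (E : Fin n → Fin n → Bool) (d : Degen (λ x y → E x y ≡ true)) (arcD : Fin n → Fin n → Bool)
    (Adj⇒E : ∀ x y → arcD x y ≡ true ⊎ arcD y x ≡ true → E x y ≡ true) (E-sym : ∀ x y → E x y ≡ E y x)
    (isRoot : Fin n → Bool) (exc⇒root : ∀ x → Degen.exc d x ≡ true → isRoot x ≡ true)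
    (real Y : Fin n → Bool) (w : Fin n → Fin n)
    (Y-real : ∀ y → Y y ≡ true → real y ≡ true × (∀ z → E z y ≡ true → real z ≡ true × (z ≡ Degen.p d y ⊎ z ≡ w y)))
    (Y-kid : ∀ y → Y y ≡ true → w y ≡ Degen.p d y ⊎ E (w y) y ≡ true) where

    open Degen d
    open Ranked d

    module RT = Fold isRoot exc⇒root id id
    module PD = Fold isRoot exc⇒root (λ _ → 0) suc

    rt : Fin n → Fin n
    rt = RT.fold
    pd : Fin n → ℕ
    pd = PD.fold

    nonexc : ∀ x → isRoot x ≡ false → exc x ≡ false
    nonexc x h with Bool-dec (exc x)
    ... | inj₂ e = e
    ... | inj₁ e = contradiction (trans (sym (exc⇒root x e)) h) λ ()

    private
      rt-isRoot : ∀ x → isRoot (rt x) ≡ true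
      rt-isRoot = RT.ind _ (λ x h → subst (λ z → isRoot z ≡ true) (sym (RT.fold-root x h)) h) (λ x h ih → subst (λ z → isRoot z ≡ true) (sym (RT.fold-step x h)) ih)

      rt-rk : ∀ x → x ≡ rt x ⊎ rk (rt x) ℕ.< rk x
      rt-rk = RT.ind _ (λ x h → inj₁ (sym (RT.fold-root x h))) st
        where
        st : ∀ x → isRoot x ≡ false → p x ≡ rt (p x) ⊎ rk (rt (p x)) ℕ.< rk (p x) → x ≡ rt x ⊎ rk (rt x) ℕ.< rk x
        st x h (inj₁ e) = inj₂ (subst (λ z → rk z ℕ.< rk x) (trans e (sym (RT.fold-step x h))) (RT.p< x h))
        st x h (inj₂ l) = inj₂ (subst (λ z → rk z ℕ.< rk x) (sym (RT.fold-step x h)) (ℕₚ.<-trans l (RT.p< x h)))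

      rt-≤ : ∀ x → rk (rt x) ℕ.≤ rk x
      rt-≤ x with rt-rk x
      ... | inj₁ e = ℕₚ.≤-reflexive (cong rk (sym e))
      ... | inj₂ l = ℕₚ.<⇒≤ l

    -- The tree of r restricted to the visited vertices `B`, as a stage in building `Hang`. The root
    -- belongs to it from the beginning, even before it is visited.
    record Core (r : Fin n) (B : Fin n → Bool) : Set where
      field
        {m} : ℕ
        piece : Piece m
        lab : Fin (suc m) → Fin n
        lab-inj : ∀ i j → lab i ≡ lab j → i ≡ j
        image : ∀ i → rt (lab i) ≡ r × (lab i ≡ r ⊎ B (lab i) ≡ true)
        complete : ∀ x → rt x ≡ r → x ≡ r ⊎ B x ≡ true → ∃[ i ] lab i ≡ x
        root-lab : lab (rootIx piece) ≡ r
        links : ∀ {x y s} → Par piece x y s → p (lab x) ≡ lab y × arcD (lab y) (lab x) ≡ s × isRoot (lab x) ≡ false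
        depths : ∀ i → depth piece i ≡ pd (lab i)

    private
      core-start : ∀ r → isRoot r ≡ true → Core r (λ _ → false)
      core-start r h = record
        { piece = root ; lab = λ _ → r ; lab-inj = λ { zero zero _ → refl } ; image = λ _ → RT.fold-root r h , inj₁ refl
        ; complete = λ { x _ (inj₁ e) → zero , sym e } ; root-lab = refl ; links = λ () ; depths = λ _ → sym (PD.fold-root r h) }

      core-skip : ∀ r B x → Core r B → (rt x ≡ r → x ≡ r) → Core r (insert B x)
      core-skip r B x c skip = record
        { piece = piece ; lab = lab ; lab-inj = lab-inj ; image = λ i → proj₁ (image i) , weaken i (proj₂ (image i)) ; complete = comp
        ; root-lab = root-lab ; links = links ; depths = depths }
        where
        open Core c
        weaken : ∀ i → lab i ≡ r ⊎ B (lab i) ≡ true → lab i ≡ r ⊎ insert B x (lab i) ≡ true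
        weaken i (inj₁ e) = inj₁ e
        weaken i (inj₂ e) with lab i == x
        ... | true = inj₂ refl
        ... | false = inj₂ e
        comp : ∀ y → rt y ≡ r → y ≡ r ⊎ insert B x y ≡ true → ∃[ i ] lab i ≡ y
        comp y h (inj₁ e) = complete y h (inj₁ e)
        comp y h (inj₂ e) with y Finₚ.≟ x
        ... | yes refl = complete y h (inj₁ (skip h))
        ... | no _ = complete y h (inj₂ e)

      -- The parent of x has smaller rank, so it was visited and is in the tree already; x is grown
      -- from it with the sign of the arc between them.
      core-grow : ∀ r B x → Core r B → rt x ≡ r → ¬ x ≡ r → B x ≡ false → (∀ y → rk y ℕ.< rk x → B y ≡ true) → Core r (insert B x)
      core-grow r B x c rx x≢r fresh low = record
        { piece = grow piece a (arcD (p x) x) ; lab = lab′ ; lab-inj = inj ; image = img ; complete = comp ; root-lab = root-lab ; links = lk ; depths = dp }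
        where
        open Core c
        x-nonroot : isRoot x ≡ false
        x-nonroot with Bool-dec (isRoot x)
        ... | inj₂ e = e
        ... | inj₁ e = ⊥-elim (x≢r (trans (sym (RT.fold-root x e)) rx))
        parent : ∃[ i ] lab i ≡ p x
        parent = complete (p x) (trans (sym (RT.fold-step x x-nonroot)) rx) (inj₂ (low (p x) (RT.p< x x-nonroot)))
        a : Fin (suc m)
        a = proj₁ parent
        lab′ : Fin (suc (suc m)) → Fin n
        lab′ = x ▸ lab
        notin : ∀ i → ¬ x ≡ lab i
        notin i h with proj₂ (image i)
        ... | inj₁ e = x≢r (trans h e)
        ... | inj₂ e = contradiction (trans (sym e) (trans (cong B (sym h)) fresh)) λ ()
        inj : ∀ i j → lab′ i ≡ lab′ j → i ≡ j
        inj zero zero _ = refl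
        inj zero (suc j) h = ⊥-elim (notin j h)
        inj (suc i) zero h = ⊥-elim (notin i (sym h))
        inj (suc i) (suc j) h = cong suc (lab-inj i j h)
        img : ∀ i → rt (lab′ i) ≡ r × (lab′ i ≡ r ⊎ insert B x (lab′ i) ≡ true)
        img zero = rx , inj₂ (cong (_∨ B x) (==-refl x))
        img (suc i) with proj₂ (image i)
        ... | inj₁ e = proj₁ (image i) , inj₁ e
        ... | inj₂ e = proj₁ (image i) , inj₂ (trans (cong (_∨ B (lab i)) (≢⇒== (λ h → notin i (sym h)))) e)
        comp : ∀ y → rt y ≡ r → y ≡ r ⊎ insert B x y ≡ true → ∃[ i ] lab′ i ≡ y
        comp y h q with y Finₚ.≟ x | q
        ... | yes e | _ = zero , sym e
        ... | no _ | inj₁ e = let i , k = complete y h (inj₁ e) in suc i , k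
        ... | no _ | inj₂ e = let i , k = complete y h (inj₂ e) in suc i , k
        lk : ∀ {u v s} → Par (grow piece a (arcD (p x) x)) u v s → p (lab′ u) ≡ lab′ v × arcD (lab′ v) (lab′ u) ≡ s × isRoot (lab′ u) ≡ false
        lk here = sym (proj₂ parent) , cong (λ z → arcD z x) (proj₂ parent) , x-nonroot
        lk (there q) = links q
        dp : ∀ i → depth (grow piece a (arcD (p x) x)) i ≡ pd (lab′ i)
        dp zero = trans (cong suc (trans (depths a) (cong pd (proj₂ parent)))) (sym (PD.fold-step x x-nonroot))
        dp (suc i) = depths i

      build : ∀ r B xs → Ord B xs → Core r B → ∃[ B′ ] ((∀ x → B′ x ≡ true) × Core r B′)
      build r B [] all c = B , all , c
      build r B (x ∷ xs) (fresh , low , o) c with rt x Finₚ.≟ r | x Finₚ.≟ r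
      ... | yes rx | no x≢r = build r _ xs o (core-grow r B x c rx x≢r fresh low)
      ... | yes rx | yes e = build r _ xs o (core-skip r B x c (λ _ → e))
      ... | no ¬rx | _ = build r _ xs o (core-skip r B x c (λ h → ⊥-elim (¬rx h)))

      order : ∃[ xs ] Ord (λ _ → false) xs
      order = ordering n (λ _ → false) (fromℕ-≤⁻ (gcount-sum (λ _ → true) ≡≤ ≤-reflexive (trans (sum-const n 1F) (*-identityʳ _))))

    -- The piece of a root, containing exactly the vertices hanging from it.
    record Hang (r : Fin n) : Set where
      field
        {m} : ℕ
        piece : Piece m
        lab : Fin (suc m) → Fin n
        lab-inj : ∀ i j → lab i ≡ lab j → i ≡ j
        rt-lab : ∀ i → rt (lab i) ≡ r
        complete : ∀ x → rt x ≡ r → ∃[ i ] lab i ≡ x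
        root-lab : lab (rootIx piece) ≡ r
        links : ∀ {x y s} → Par piece x y s → p (lab x) ≡ lab y × arcD (lab y) (lab x) ≡ s × isRoot (lab x) ≡ false
        depths : ∀ i → depth piece i ≡ pd (lab i)

    opaque
      hang : ∀ r → isRoot r ≡ true → Hang r
      hang r h = go (build r _ (proj₁ order) (proj₂ order) (core-start r h))
        where
        go : ∃[ B′ ] ((∀ x → B′ x ≡ true) × Core r B′) → Hang r
        go (B′ , all , c) = record { piece = piece ; lab = lab ; lab-inj = lab-inj ; rt-lab = λ i → proj₁ (image i) ; complete = λ x e → complete x e (inj₂ (all x))
                                   ; root-lab = root-lab ; links = links ; depths = depths }
          where open Core c

    private
      module Gads {r : Fin n} (hg : Hang r) where
        open Hang hg

        Adj : Fin n → Fin n → Set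
        Adj x y = arcD x y ≡ true ⊎ arcD y x ≡ true

        private
          Ok : ∀ {i} → Gadget piece i → Set
          Ok {i} (leaf {a = a} _ _ _) = w (lab i) ≡ p (lab i) × (∀ j → Adj (lab j) (lab i) → j ≡ a)
          Ok {i} (mid {x = x} {a = a} _ _ _ _) = ∀ j → Adj (lab j) (lab i) → j ≡ x ⊎ j ≡ a

        up : ∀ i → (∃[ y ] ∃[ s ] Par piece i y s) ⊎ isRoot (lab i) ≡ true
        up i with rootOrPar piece i
        ... | inj₂ q = inj₁ q
        ... | inj₁ refl = inj₂ (subst (λ z → isRoot z ≡ true) (trans (rt-lab i) (sym root-lab)) (rt-isRoot (lab i)))

        same : ∀ {i j} → lab i ≡ lab j → i ≡ j
        same = lab-inj _ _

        private
          child-edge : ∀ {x y s} → Par piece x y s → E (lab x) (lab y) ≡ true × rank (lab y) < rank (lab x)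
          child-edge q = subst (λ z → E _ z ≡ true) (proj₁ (links q)) (proj₁ e) , subst (λ z → rank z < _) (proj₁ (links q)) (proj₂ e)
            where e = par _ (nonexc _ (proj₂ (proj₂ (links q))))

          GadgetOk : Fin (suc m) → Set
          GadgetOk i = Σ (Gadget piece i) Ok

        module Mk (i : Fin (suc m)) (Yi : Y (lab i) ≡ true) where
          nbr : ∀ j → Adj (lab j) (lab i) → lab j ≡ p (lab i) ⊎ lab j ≡ w (lab i)
          nbr j adj = proj₂ (proj₂ (Y-real (lab i) Yi) (lab j) (Adj⇒E _ _ adj))

          private
            Child : Set
            Child = ∃[ x ] ∃[ s ] Par piece x i s

            child? : ∀ x → (∃[ s ] Par piece x i s) ⊎ ¬ (∃[ s ] Par piece x i s)
            child? x with rootOrPar piece x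
            ... | inj₁ refl = inj₂ λ { (s , q) → no-par-root piece q }
              where
              no-par-root : ∀ {m} (p : Piece m) {y s} → Par p (rootIx p) y s → ⊥
              no-par-root (grow p _ _) (there q) = no-par-root p q
            ... | inj₂ (y , s , q) with y Finₚ.≟ i
            ... | yes refl = inj₁ (s , q)
            ... | no y≢i = inj₂ λ { (s′ , q′) → y≢i (same (trans (sym (proj₁ (links q))) (proj₁ (links q′)))) }

            children : Child ⊎ (∀ x → ¬ (∃[ s ] Par piece x i s))
            children = search child?

          -- A child ranks above the vertex and the parent below it, so of the two possible
          -- neighbours the child must be `w`.
          child-w : ∀ {x s a s′} → Par piece x i s → Par piece i a s′ → lab x ≡ w (lab i)
          child-w {x} qx qi with proj₂ (proj₂ (Y-real (lab i) Yi) (lab x) (proj₁ (child-edge qx)))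
          ... | inj₂ e = e
          ... | inj₁ e = ⊥-elim (<-irrefl (<-≤-trans (proj₂ (child-edge qx)) (≤-trans (≤-reflexive (cong rank (trans e (proj₁ (links qi))))) (<⇒≤ (proj₂ (child-edge qi))))))

          private
            mk₄ : ∀ {a g g′ s s₁ s₀} → Par piece i a s → Par piece a g s₁ → Par piece g g′ s₀ → Child ⊎ (∀ x → ¬ (∃[ s ] Par piece x i s)) → Maybe (GadgetOk i)
            mk₄ qi qa qg (inj₂ _) = nothing
            mk₄ {a = a} qi qa qg (inj₁ (x , s , qx)) = just (mid qx qi qa qg , ok)
              where
              ok : ∀ j → Adj (lab j) (lab i) → j ≡ x ⊎ j ≡ a
              ok j adj with nbr j adj
              ... | inj₁ e = inj₂ (same (trans e (proj₁ (links qi))))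
              ... | inj₂ e = inj₁ (same (trans e (sym (child-w qx qi))))

            mk₃ : ∀ {a g g′ s s₁ s₀} → Par piece i a s → Par piece a g s₁ → Par piece g g′ s₀ → Dec (w (lab i) ≡ p (lab i)) → Maybe (GadgetOk i)
            mk₃ {a = a} qi qa qg (yes e) = just (leaf qi qa qg , e , ok)
              where
              ok : ∀ j → Adj (lab j) (lab i) → j ≡ a
              ok j adj with nbr j adj
              ... | inj₁ k = same (trans k (proj₁ (links qi)))
              ... | inj₂ k = same (trans k (trans e (proj₁ (links qi))))
            mk₃ qi qa qg (no _) = mk₄ qi qa qg children

            Up : Fin (suc m) → Set
            Up j = (∃[ y ] ∃[ s ] Par piece j y s) ⊎ isRoot (lab j) ≡ true

            mk₂ : ∀ {a g s s₁} → Par piece i a s → Par piece a g s₁ → Up g → Maybe (GadgetOk i)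
            mk₂ qi qa (inj₁ (_ , _ , qg)) = mk₃ qi qa qg (w (lab i) Finₚ.≟ p (lab i))
            mk₂ qi qa (inj₂ _) = nothing

            mk₁ : ∀ {a s} → Par piece i a s → Up a → Maybe (GadgetOk i)
            mk₁ qi (inj₁ (g , _ , qa)) = mk₂ qi qa (up g)
            mk₁ qi (inj₂ _) = nothing

            mk₀ : Up i → Maybe (GadgetOk i)
            mk₀ (inj₁ (a , _ , qi)) = mk₁ qi (up a)
            mk₀ (inj₂ _) = nothing

          mk : Maybe (GadgetOk i)
          mk = mk₀ (up i)

          module _ (deep : 3 ℕ.≤ pd (lab i)) (kid : w (lab i) ≡ p (lab i) ⊎ isRoot (w (lab i)) ≡ false) where
            private
              not-root : ∀ z → 1 ℕ.≤ pd z → isRoot z ≡ true → ⊥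
              not-root z h e = ℕₚ.n≮0 (subst (1 ℕ.≤_) (PD.fold-root z e) h)

              pd-step : ∀ {x y s} → Par piece x y s → pd (lab x) ≡ suc (pd (lab y))
              pd-step q = trans (PD.fold-step _ (proj₂ (proj₂ (links q)))) (cong (λ z → suc (pd z)) (proj₁ (links q)))

              just₄ : ∀ {a g g′ s s₁ s₀} (qi : Par piece i a s) (qa : Par piece a g s₁) (qg : Par piece g g′ s₀) → ¬ w (lab i) ≡ p (lab i) → ∀ c → isJust (mk₄ qi qa qg c) ≡ true
              just₄ qi qa qg w≢p (inj₁ _) = refl
              just₄ qi qa qg w≢p (inj₂ none) = ⊥-elim (go kid (Y-kid (lab i) Yi))
                where
                u : Fin n
                u = w (lab i)
                go : u ≡ p (lab i) ⊎ isRoot u ≡ false → u ≡ p (lab i) ⊎ E u (lab i) ≡ true → ⊥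
                go (inj₁ e) _ = w≢p e
                go _ (inj₁ e) = w≢p e
                go (inj₂ nr) (inj₂ edge) = found (complete u (trans (RT.fold-step u nr) (trans (cong rt pu) (rt-lab i))))
                  where
                  y-lower : rank (lab i) < rank u
                  y-lower with ≤-or-> (rank u) (rank (lab i))
                  ... | inj₂ h = h
                  ... | inj₁ h with ≤-or-> (rank (lab i)) (rank u)
                  ... | inj₁ h′ = ⊥-elim (strict u (lab i) edge (≤-antisym h h′))
                  ... | inj₂ h′ with lower (lab i) u (trans (E-sym _ _) edge) h′
                  ... | inj₁ e = ⊥-elim (w≢p e)
                  ... | inj₂ (e , _) = contradiction (trans (sym e) (nonexc (lab i) (proj₂ (proj₂ (links qi))))) λ ()
                  pu : p u ≡ lab i
                  pu with lower u (lab i) edge y-lower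
                  ... | inj₁ e = sym e
                  ... | inj₂ (e , _) = contradiction (trans (sym e) (nonexc u nr)) λ ()
                  found : ∃[ j ] lab j ≡ u → ⊥
                  found (j , e) with up j
                  ... | inj₂ rj = contradiction (trans (sym rj) (trans (cong isRoot e) nr)) λ ()
                  ... | inj₁ (y , s , q) = none j (s , subst (λ y → Par piece j y s) (same (trans (sym (proj₁ (links q))) (trans (cong p e) pu))) q)

              just₃ : ∀ {a g g′ s s₁ s₀} (qi : Par piece i a s) (qa : Par piece a g s₁) (qg : Par piece g g′ s₀) → ∀ c → isJust (mk₃ qi qa qg c) ≡ true
              just₃ qi qa qg (yes _) = refl
              just₃ qi qa qg (no w≢p) = just₄ qi qa qg w≢p children

              just₀ : ∀ u → isJust (mk₀ u) ≡ true
              just₀ (inj₂ r) = ⊥-elim (not-root _ (ℕₚ.≤-trans (ℕ.s≤s ℕ.z≤n) deep) r)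
              just₀ (inj₁ (a , _ , qi)) = just₁ (up a)
                where
                deep-a : 2 ℕ.≤ pd (lab a)
                deep-a = ℕₚ.≤-pred (subst (3 ℕ.≤_) (pd-step qi) deep)
                just₁ : ∀ u → isJust (mk₁ qi u) ≡ true
                just₁ (inj₂ r) = ⊥-elim (not-root _ (ℕₚ.≤-trans (ℕ.s≤s ℕ.z≤n) deep-a) r)
                just₁ (inj₁ (g , _ , qa)) = just₂ (up g)
                  where
                  just₂ : ∀ u → isJust (mk₂ qi qa u) ≡ true
                  just₂ (inj₂ r) = ⊥-elim (not-root _ (ℕₚ.≤-pred (subst (2 ℕ.≤_) (pd-step qa) deep-a)) r)
                  just₂ (inj₁ (_ , _ , qg)) = just₃ qi qa qg (w (lab i) Finₚ.≟ p (lab i))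

            -- Depth three supplies the parent, grandparent and great-grandparent. If `w` is not the
            -- parent it ranks higher, since a non-exceptional vertex has one lower neighbour. Not
            -- being a root, `w` then hangs from this vertex within the same tree.
            mk-just : isJust mk ≡ true
            mk-just = just₀ (up i)

        private
          mkB : ∀ i → Y (lab i) ≡ true ⊎ Y (lab i) ≡ false → Maybe (GadgetOk i)
          mkB i (inj₁ Yi) = Mk.mk i Yi
          mkB i (inj₂ _) = nothing

          gadOk : ∀ i → Maybe (GadgetOk i)
          gadOk i = mkB i (Bool-dec (Y (lab i)))

        opaque
          gads : ∀ i → Maybe (Gadget piece i)
          gads i = Maybe.map proj₁ (gadOk i)

          gads-ok : ∀ i {g} → gads i ≡ just g → Ok g
          gads-ok i e with gadOk i
          gads-ok i refl | just (g , ok) = ok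
          gads-ok i () | nothing

          gads-Y : ∀ i → isJust (gads i) ≡ true → Y (lab i) ≡ true
          gads-Y i e = go (Bool-dec (Y (lab i))) e
            where
            go : ∀ c → isJust (Maybe.map proj₁ (mkB i c)) ≡ true → Y (lab i) ≡ true
            go (inj₁ Yi) _ = Yi
            go (inj₂ _) ()

          gads-just : ∀ i → Y (lab i) ≡ true → 3 ℕ.≤ pd (lab i) → w (lab i) ≡ p (lab i) ⊎ isRoot (w (lab i)) ≡ false → isJust (gads i) ≡ true
          gads-just i Yi deep kid = go (Bool-dec (Y (lab i)))
            where
            map-just : ∀ (x : Maybe (GadgetOk i)) → isJust x ≡ true → isJust (Maybe.map proj₁ x) ≡ true
            map-just (just _) _ = refl
            go : ∀ c → isJust (Maybe.map proj₁ (mkB i c)) ≡ true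
            go (inj₁ Yi′) = map-just (Mk.mk i Yi′) (Mk.mk-just i Yi′ deep kid)
            go (inj₂ e) = contradiction (trans (sym Yi) e) λ ()

        lp : LP n
        lp = record { piece = piece ; lab = lab ; gads = gads }

        private
          ind-rt : ∀ {x} → isInj₁ (find lp x) ≡ true → rt x ≡ r
          ind-rt {x} e with find lp x
          ... | inj₁ (i , refl) = rt-lab i

          rt-ind : ∀ {x} → rt x ≡ r → isInj₁ (find lp x) ≡ true
          rt-ind {x} e with find lp x
          ... | inj₁ _ = refl
          ... | inj₂ h = let i , k = complete x e in ⊥-elim (h i (sym k))

        find-rt : ∀ x → isInj₁ (find lp x) ≡ (rt x == r)
        find-rt x = go (Bool-dec (isInj₁ (find lp x)))
          where
          go : isInj₁ (find lp x) ≡ true ⊎ isInj₁ (find lp x) ≡ false → isInj₁ (find lp x) ≡ (rt x == r)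
          go (inj₁ e) = trans e (sym (trans (cong (_== r) (ind-rt e)) (==-refl r)))
          go (inj₂ e) = trans e (sym (≢⇒== (λ h → contradiction (trans (sym (rt-ind h)) e) λ ())))

        sum-hang : ∀ (g : Fin n → F) → sum (g ∘ lab) ≡ sum (λ x → [ rt x == r ] * g x)
        sum-hang g = trans (sym (trans (sum-swap (λ x i → [ x == lab i ] * g x)) (sum-cong (λ i → sum-δ (lab i) g)))) (sum-cong (λ x → trans (sum-*ʳ (g x) (λ i → [ x == lab i ])) (cong (_* g x) (mem x))))
          where
          mem : ∀ x → sum (λ i → [ x == lab i ]) ≡ [ rt x == r ]
          mem x with rt x Finₚ.≟ r
          ... | no ne = sum-zero (λ i → cong [_] (≢⇒== {i = x} {lab i} (λ e → ne (trans (cong rt e) (rt-lab i)))))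
          ... | yes e with complete x e
          ... | j , refl = trans (sum-cong at-j) (sum-[==] j)
            where
            at-j : ∀ i → [ lab j == lab i ] ≡ [ i == j ]
            at-j i with i Finₚ.≟ j
            ... | yes refl = cong [_] (==-refl (lab i))
            ... | no ne = cong [_] (≢⇒== (λ h → ne (sym (same h))))

    -- The candidates that survive the cutting: deep enough, and not cut off from their other
    -- neighbour.
    okY : Fin n → Bool
    okY y = Y y ∧ ((3 ℕ.≤ᵇ pd y) ∧ ((w y == p y) ∨ not (isRoot (w y))))

    module Listing {N : ℕ} (arc : Fin N → Fin N → Bool) {b : ℕ} (0<b : 0 ℕ.< b) (rmin S : ℕ) (0<rmin : 0 ℕ.< rmin)
        (antisym : ∀ x y → arcD x y ≡ true → arcD y x ≡ false) {T : ℕ} (test : Fin T → Test N)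
        (piece-size : ∀ r → sum (λ x → [ rt x == r ]) ≤ fromℕ S) where

      open Loops arc 0<b rmin S 0<rmin arcD antisym real Y test hiding (Adj)

      κ₀ ρ₀ : F
      κ₀ = Steps.κ arc 0<b rmin S 0<rmin
      ρ₀ = Steps.ρ arc 0<b rmin S 0<rmin

      private
        Closed : (Fin n → Bool) → Set
        Closed B = ∀ x y → B x ≡ true → rk y ℕ.< rk x → B y ≡ true

        Closed-insert : ∀ B x → Closed B → (∀ y → rk y ℕ.< rk x → B y ≡ true) → Closed (insert B x)
        Closed-insert B x cl low u v h lt with u Finₚ.≟ x | v == x
        ... | _ | true = refl
        ... | yes refl | false = low v lt
        ... | no _ | false = cl u v h lt

        hangOf : ∀ r → isRoot r ≡ true → LP n
        hangOf r h = Gads.lp (hang r h)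

        -- The delicate field is `outer`. A done neighbour ranked below a vertex of the tree must be
        -- `p r` or `q r`, met at the root, since any other lower neighbour lies in the tree itself.
        -- A done neighbour d ranked above is impossible: if d is a root then r, having smaller
        -- rank, would be visited already, and otherwise d hangs from the tree and is not done.
        validP : ∀ B done → Closed B → (∀ x → done x ≡ B (rt x)) → ∀ r (h : isRoot r ≡ true) → B r ≡ false → ValidP done (hangOf r h)
        validP B done closed done≡ r h fresh = record
          { size = fromℕ-≤⁻ (≤-trans (≤-reflexive (trans (sym (trans (sum-const (suc m) 1F) (*-identityʳ _))) (G.sum-hang (λ _ → 1F)))) (≤-trans (≤-reflexive (sum-cong (λ x → *-identityʳ _))) (piece-size r)))
          ; lab-inj = lab-inj
          ; fresh = λ i → trans (done≡ (lab i)) (trans (cong B (rt-lab i)) fresh)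
          ; inner = inner ; cA = p r ; cB = q r ; outer = outer
          ; gadget-real = λ i e → let rl , nb = Y-real (lab i) (G.gads-Y i e) in (G.gads-Y i e , rl) , λ d adj → proj₁ (nb d (Adj⇒E _ _ adj)) , in-piece i e d (Adj⇒E _ _ adj)
          ; gadget-mid = λ i px py pa pg e j adj → G.gads-ok i e j adj
          ; gadget-leaf = λ i py pa pg e j adj → proj₂ (G.gads-ok i e) j adj
          ; sign-ok = λ q → proj₁ (proj₂ (links q)) }
          where
          hg : Hang r
          hg = hang r h
          open Hang hg
          module G = Gads hg
          root-of : ∀ i → lab i ≡ r ⊎ rk r ℕ.< rk (lab i)
          root-of i with rt-rk (lab i)
          ... | inj₁ e = inj₁ (trans e (rt-lab i))
          ... | inj₂ l = inj₂ (subst (λ z → rk z ℕ.< rk (lab i)) (rt-lab i) l)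
          -- a lower neighbour of a non-root vertex of the piece is its parent in the piece
          down : ∀ i y → E (lab i) y ≡ true → rank y < rank (lab i) → (∃[ a ] (y ≡ lab a × ∃[ s ] Par piece i a s)) ⊎ (i ≡ rootIx piece × (y ≡ p r ⊎ y ≡ q r))
          down i y e lt with rootOrPar piece i
          ... | inj₂ (a , s , q) with lower (lab i) y e lt
          ... | inj₁ k = inj₁ (a , trans k (proj₁ (links q)) , s , q)
          ... | inj₂ (ex , _) = contradiction (trans (sym ex) (nonexc _ (proj₂ (proj₂ (links q))))) λ ()
          down i y e lt | inj₁ refl with lower (lab i) y e lt
          ... | inj₁ k = inj₂ (refl , inj₁ (trans k (cong p root-lab)))
          ... | inj₂ (_ , k) = inj₂ (refl , inj₂ (trans k (cong q root-lab)))
          split : ∀ x y → E x y ≡ true → rank x < rank y ⊎ rank y < rank x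
          split x y e with ≤-or-> (rank x) (rank y) | ≤-or-> (rank y) (rank x)
          ... | inj₂ k | _ = inj₂ k
          ... | _ | inj₂ k = inj₁ k
          ... | inj₁ k | inj₁ k′ = ⊥-elim (strict x y e (≤-antisym k k′))
          inner : ∀ i j → real (lab i) ≡ true → real (lab j) ≡ true → arcD (lab i) (lab j) ≡ true → (∃[ s ] Par piece j i s) ⊎ (∃[ s ] Par piece i j s)
          inner i j _ _ a with split (lab i) (lab j) (Adj⇒E _ _ (inj₁ a))
          ... | inj₁ lt = inj₁ (go (down j (lab i) (Adj⇒E _ _ (inj₂ a)) lt))
            where
            go : _ → ∃[ s ] Par piece j i s
            go (inj₁ (a , e , s , q)) = s , subst (λ a → Par piece j a s) (sym (lab-inj _ _ e)) q
            go (inj₂ (refl , _)) with root-of i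
            ... | inj₁ e = ⊥-elim (<-irrefl (subst (λ z → rank z < rank (lab (rootIx piece))) (trans e (sym root-lab)) lt))
            ... | inj₂ l = ⊥-elim (ℕₚ.<-asym l (subst (λ z → rk (lab i) ℕ.< rk z) root-lab (rk-mono lt)))
          ... | inj₂ lt = inj₂ (go (down i (lab j) (Adj⇒E _ _ (inj₁ a)) lt))
            where
            go : _ → ∃[ s ] Par piece i j s
            go (inj₁ (a , e , s , q)) = s , subst (λ a → Par piece i a s) (sym (lab-inj _ _ e)) q
            go (inj₂ (refl , _)) with root-of j
            ... | inj₁ e = ⊥-elim (<-irrefl (subst (λ z → rank z < rank (lab (rootIx piece))) (trans e (sym root-lab)) lt))
            ... | inj₂ l = ⊥-elim (ℕₚ.<-asym l (subst (λ z → rk (lab j) ℕ.< rk z) root-lab (rk-mono lt)))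
          outer : ∀ i d → done d ≡ true → real d ≡ true → real (lab i) ≡ true → arcD d (lab i) ≡ true ⊎ arcD (lab i) d ≡ true → i ≡ rootIx piece × (d ≡ p r ⊎ d ≡ q r)
          outer i d dd _ _ adj with split d (lab i) (Adj⇒E _ _ adj)
          ... | inj₁ lt with down i d (trans (E-sym _ _) (Adj⇒E _ _ adj)) lt
          ... | inj₂ k = k
          ... | inj₁ (a , refl , _) = contradiction (trans (sym dd) (trans (done≡ _) (trans (cong B (rt-lab a)) fresh))) λ ()
          outer i d dd _ _ adj | inj₂ lt = ⊥-elim (go (Bool-dec (isRoot d)))
            where
            Bd : B (rt d) ≡ true
            Bd = trans (sym (done≡ d)) dd
            go : isRoot d ≡ true ⊎ isRoot d ≡ false → ⊥
            go (inj₁ rd) = contradiction (trans (sym (closed d r (subst (λ z → B z ≡ true) (RT.fold-root d rd) Bd) (ℕₚ.≤-<-trans (subst (λ z → rk z ℕ.≤ rk (lab i)) (rt-lab i) (rt-≤ (lab i))) (rk-mono lt)))) fresh) λ ()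
            go (inj₂ nr) with lower d (lab i) (Adj⇒E _ _ adj) lt
            ... | inj₁ e = contradiction (trans (sym Bd) (trans (cong B (trans (RT.fold-step d nr) (trans (cong rt (sym e)) (rt-lab i)))) fresh)) λ ()
            ... | inj₂ (ex , _) = contradiction (trans (sym ex) (nonexc d nr)) λ ()
          in-piece : ∀ i → isJust (LP.gads (hangOf r h) i) ≡ true → ∀ d → E d (lab i) ≡ true → ∃[ j ] d ≡ lab j
          in-piece i e d ed = go (LP.gads (hangOf r h) i) refl e
            where
            Yi : Y (lab i) ≡ true
            Yi = G.gads-Y i e
            go : ∀ (g : Maybe (Gadget piece i)) → LP.gads (hangOf r h) i ≡ g → isJust g ≡ true → ∃[ j ] d ≡ lab j
            go nothing _ ()
            go (just (leaf {a = a} py pa pg)) eq _ with proj₂ (proj₂ (Y-real (lab i) Yi) d ed)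
            ... | inj₁ k = a , trans k (proj₁ (links py))
            ... | inj₂ k = a , trans k (trans (proj₁ (G.gads-ok i eq)) (proj₁ (links py)))
            go (just (mid {x = x} {a = a} px py pa pg)) eq _ with proj₂ (proj₂ (Y-real (lab i) Yi) d ed)
            ... | inj₁ k = a , trans k (proj₁ (links py))
            ... | inj₂ k = x , trans k (sym (G.Mk.child-w i Yi px py))

        mkList : ∀ B xs → Ord B xs → List (LP n)
        consIf : ∀ x → isRoot x ≡ true ⊎ isRoot x ≡ false → List (LP n) → List (LP n)
        consIf x (inj₁ h) lps = hangOf x h ∷ lps
        consIf x (inj₂ _) lps = lps
        mkList B [] _ = []
        mkList B (x ∷ xs) (_ , _ , o) = consIf x (Bool-dec (isRoot x)) (mkList (insert B x) xs o)

      private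
        insert-rt-skip : ∀ B x y → isRoot x ≡ false → insert B x (rt y) ≡ B (rt y)
        insert-rt-skip B x y h = cong (_∨ B (rt y)) (≢⇒== λ e → contradiction (trans (sym (rt-isRoot y)) (trans (cong isRoot e) h)) λ ())

        done-step : ∀ B done → (∀ x → done x ≡ B (rt x)) → ∀ r (h : isRoot r ≡ true) x → (done ∪ hangOf r h) x ≡ insert B r (rt x)
        done-step B done done≡ r h x = cong₂ _∨_ (Gads.find-rt (hang r h) x) (done≡ x)

      private
        valid-list : ∀ B xs (o : Ord B xs) done → Closed B → (∀ x → done x ≡ B (rt x)) → Valid done (mkList B xs o) × (∀ x → (done ∪* mkList B xs o) x ≡ true)
        valid-list B [] all done cl done≡ = tt , λ x → trans (done≡ x) (all (rt x))
        valid-list B (x ∷ xs) (fresh , low , o) done cl done≡ = go (Bool-dec (isRoot x))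
          where
          go : ∀ c → Valid done (consIf x c (mkList (insert B x) xs o)) × (∀ y → (done ∪* consIf x c (mkList (insert B x) xs o)) y ≡ true)
          go (inj₂ h) = valid-list (insert B x) xs o done (Closed-insert B x cl low) (λ y → trans (done≡ y) (sym (insert-rt-skip B x y h)))
          go (inj₁ h) = let v , f = valid-list (insert B x) xs o (done ∪ hangOf x h) (Closed-insert B x cl low) (done-step B done done≡ x h) in
            (validP B done cl done≡ x h fresh , v) , f

        sumLP : (Fin n → F) → List (LP n) → F
        sumLP g [] = 0F
        sumLP g (lp ∷ lps) = sum (g ∘ LP.lab lp) + sumLP g lps

        -- The trees of the remaining roots partition the vertices hanging from them. This converts
        -- totals over trees (bias, gadgets, lengths) into sums over vertices.
        sum-list : ∀ g B xs (o : Ord B xs) → sumLP g (mkList B xs o) ≡ sum (λ x → [ not (B (rt x)) ] * g x)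
        sum-list g B [] all = sym (sum-zero (λ x → trans (cong (λ c → [ not c ] * g x) (all (rt x))) (zeroˡ _)))
        sum-list g B (x ∷ xs) (fresh , low , o) = go (Bool-dec (isRoot x))
          where
          rest : F
          rest = sum (λ y → [ not (insert B x (rt y)) ] * g y)
          go : ∀ c → sumLP g (consIf x c (mkList (insert B x) xs o)) ≡ sum (λ y → [ not (B (rt y)) ] * g y)
          go (inj₂ h) = trans (sum-list g (insert B x) xs o) (sum-cong (λ y → cong (λ c → [ not c ] * g y) (insert-rt-skip B x y h)))
          go (inj₁ h) = trans (cong₂ _+_ (Gads.sum-hang (hang x h) g) (sum-list g (insert B x) xs o)) (trans (sym (sum-+ _ _)) (sum-cong lem))
            where
            lem : ∀ y → [ rt y == x ] * g y + [ not (insert B x (rt y)) ] * g y ≡ [ not (B (rt y)) ] * g y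
            lem y with rt y Finₚ.≟ x
            ... | yes e rewrite trans (cong B e) fresh = (solve 1 (λ u → (# 1 :* u) :+ (# 0 :* u) := # 1 :* u) refl (g y))
            ... | no _ = (solve 2 (λ u v → (# 0 :* u) :+ (v :* u) := v :* u) refl (g y) ([ not (B (rt y)) ]))

        sumLP-+ : ∀ g g′ lps → sumLP (λ x → g x + g′ x) lps ≡ sumLP g lps + sumLP g′ lps
        sumLP-+ g g′ [] = (solve 0 (# 0 := # 0 :+ # 0) refl )
        sumLP-+ g g′ (lp ∷ lps) = trans (cong₂ _+_ (sum-+ (g ∘ LP.lab lp) (g′ ∘ LP.lab lp)) (sumLP-+ g g′ lps))
          (solve 4 (λ a c e f → (a :+ c) :+ (e :+ f) := (a :+ e) :+ (c :+ f)) refl (sum (g ∘ LP.lab lp)) (sum (g′ ∘ LP.lab lp)) (sumLP g lps) (sumLP g′ lps))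

        length≤ : ∀ lps → fromℕ (List.length lps) ≤ sumLP (λ _ → 1F) lps
        length≤ [] = ≤-refl
        length≤ (lp ∷ lps) = (lin 0 (sc 1 (≤-reflexive (fromℕ-suc (List.length lps))) ⊹ sc 1 (≤-reflexive (sym (sum-const (suc (LP.m lp)) 1F))) ⊹ sc 1 (≤-reflexive (sym (fromℕ-suc (LP.m lp)))) ⊹ sc 1 (0≤fromℕ (LP.m lp)) ⊹ sc 1 (length≤ lps)) (solve 6 (λ l l′ a m m′ s → # 1 :* ((a :+ s) :- l′) := (# 1 :* ((# 1 :+ l) :- l′)) :+ ((# 1 :* (a :- (m :* # 1))) :+ ((# 1 :* (m :- (# 1 :+ m′))) :+ ((# 1 :* (m′ :- # 0)) :+ (# 1 :* (s :- l)))))) refl (fromℕ (List.length lps)) (fromℕ (suc (List.length lps))) (sum {suc (LP.m lp)} (λ _ → 1F)) (fromℕ (suc (LP.m lp))) (fromℕ (LP.m lp)) (sumLP (λ _ → 1F) lps)))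

      private
        okY⇒ : ∀ y → okY y ≡ true → Y y ≡ true × 3 ℕ.≤ pd y × (w y ≡ p y ⊎ isRoot (w y) ≡ false)
        okY⇒ y h with ∧-true {Y y} h
        ... | a , h′ with ∧-true {3 ℕ.≤ᵇ pd y} h′
        ... | c , e = a , ℕₚ.≤ᵇ⇒≤ 3 (pd y) (subst Bool.T (sym c) tt) , kid e
          where
          kid : (w y == p y) ∨ not (isRoot (w y)) ≡ true → w y ≡ p y ⊎ isRoot (w y) ≡ false
          kid e with w y Finₚ.≟ p y | isRoot (w y)
          ... | yes k | _ = inj₁ k
          ... | no _ | false = inj₂ refl

      private
        gtotal≥ : ∀ B xs (o : Ord B xs) → sumLP (λ y → [ okY y ]) (mkList B xs o) ≤ fromℕ (gtotal (mkList B xs o))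
        gtotal≥ B [] _ = ≤-refl
        gtotal≥ B (x ∷ xs) (_ , _ , o) = go (Bool-dec (isRoot x))
          where
          go : ∀ c → sumLP (λ y → [ okY y ]) (consIf x c (mkList (insert B x) xs o)) ≤ fromℕ (gtotal (consIf x c (mkList (insert B x) xs o)))
          go (inj₂ _) = gtotal≥ (insert B x) xs o
          go (inj₁ h) = +-mono-≤ (sum-mono lem ≤≡ sym (gcount-sum (λ i → isJust (G.gads i)))) (gtotal≥ (insert B x) xs o) ≤≡ sym (fromℕ-+ _ (gtotal (mkList (insert B x) xs o)))
            where
            module G = Gads (hang x h)
            open Hang (hang x h)
            lem : ∀ i → [ okY (lab i) ] ≤ [ isJust (G.gads i) ]
            lem i with okY (lab i) in e
            ... | false = []-nonneg (isJust (G.gads i))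
            ... | true = let a , c , k = okY⇒ (lab i) e in ≤-reflexive (cong [_] (sym (G.gads-just i a c k)))

        budget≡ : ∀ B xs (o : Ord B xs) → budget (mkList B xs o) ≡ sumLP (λ x → ((1F - γ b) ^^ pd x + κ₀) * ρ₀) (mkList B xs o)
        budget≡ B [] _ = refl
        budget≡ B (x ∷ xs) (_ , _ , o) = go (Bool-dec (isRoot x))
          where
          go : ∀ c → budget (consIf x c (mkList (insert B x) xs o)) ≡ sumLP (λ x → ((1F - γ b) ^^ pd x + κ₀) * ρ₀) (consIf x c (mkList (insert B x) xs o))
          go (inj₂ _) = budget≡ (insert B x) xs o
          go (inj₁ h) = cong₂ _+_ (trans (cong (_* ρ₀) (trans (cong₂ _+_ (sum-cong (λ i → cong ((1F - γ b) ^^_) (depths i))) (sym (sum-const (suc m) κ₀))) (sym (sum-+ _ _)))) (sym (sum-*ʳ ρ₀ _))) (budget≡ (insert B x) xs o)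
            where open Hang (hang x h)

      opaque
        pieces : List (LP n)
        pieces = mkList (λ _ → false) (proj₁ order) (proj₂ order)

        pieces-valid : Valid (λ _ → false) pieces × (∀ x → ((λ _ → false) ∪* pieces) x ≡ true)
        pieces-valid = valid-list (λ _ → false) (proj₁ order) (proj₂ order) (λ _ → false) (λ x y ()) (λ x → refl)

        pieces-sum : ∀ g → sumLP g pieces ≡ sum g
        pieces-sum g = trans (sum-list g (λ _ → false) (proj₁ order) (proj₂ order)) (sum-cong (λ x → *-identityˡ (g x)))

        pieces-gtotal : sum (λ y → [ okY y ]) ≤ fromℕ (gtotal pieces)
        pieces-gtotal = sym (pieces-sum (λ y → [ okY y ])) ≡≤ gtotal≥ (λ _ → false) (proj₁ order) (proj₂ order)

        pieces-length : fromℕ (List.length pieces) ≤ fromℕ n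
        pieces-length = length≤ pieces ≤≡ trans (pieces-sum (λ _ → 1F)) (trans (sum-const n 1F) (*-identityʳ _))

        pieces-budget : budget pieces ≡ sum (λ x → ((1F - γ b) ^^ pd x + κ₀) * ρ₀)
        pieces-budget = trans (budget≡ (λ _ → false) (proj₁ order) (proj₂ order)) (pieces-sum _)

-- Choosing the level at which to cut.

module Shifting where
  open OrderedField
  open Sums
  open RandomWalks
  open Selection
  open Loop
  open Degeneracy using (Degen; exceptions)
  open Pieces

  -- Addition of one modulo the size, written recursively so that its invariance of sums is an
  -- induction.
  cyc : ∀ {k} → Fin (suc k) → Fin (suc k)
  cyc-bump : ∀ {k} → Fin (suc k) → Fin (suc (suc k))
  cyc {zero} zero = zero
  cyc {suc k} zero = suc zero
  cyc {suc k} (suc i) = cyc-bump (cyc i)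
  cyc-bump zero = zero
  cyc-bump (suc j) = suc (suc j)

  sum-cyc : ∀ {k} (f : Fin (suc k) → F) → sum (f ∘ cyc) ≡ sum f
  sum-cyc {zero} f = trans (sum-suc _) (trans (cong (f zero +_) (trans (sum-0 _) (sym (sum-0 _)))) (sym (sum-suc f)))
  sum-cyc {suc k} f = trans (sum-suc _) (trans (cong (f (suc zero) +_) (trans (sum-cyc (f ∘ cyc-bump)) (sum-suc _)))
    (trans (solve 3 (λ a b c → a :+ (b :+ c) := b :+ (a :+ c)) refl (f (suc zero)) (f zero) (sum (λ j → f (suc (suc j)))))
      (sym (trans (sum-suc f) (cong (f zero +_) (sum-suc _))))))

  cyc-suc : ∀ {k} (i : Fin (suc k)) → cyc i ≡ zero ⊎ toℕ (cyc i) ≡ suc (toℕ i)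
  cyc-suc {zero} zero = inj₁ refl
  cyc-suc {suc k} zero = inj₂ refl
  cyc-suc {suc k} (suc i) with cyc i | cyc-suc i
  ... | zero | inj₁ _ = inj₁ refl
  ... | suc j | inj₂ h = inj₂ (cong suc h)

  count-< : ∀ k m → sum {k} (λ i → [ toℕ i ℕ.<ᵇ m ]) ≤ fromℕ m
  count-< zero m = ≤-trans (≤-reflexive (sum-0 _)) (0≤fromℕ m)
  count-< (suc k) zero = ≤-reflexive (sum-zero {suc k} (λ _ → refl))
  count-< (suc k) (suc m) = ≤-trans (≤-reflexive (sum-suc _)) (+-mono-≤ (≤-refl {1F}) (count-< k m) ≤≡ sym (fromℕ-suc m))

  <ᵇ-true : ∀ {m n} → (m ℕ.<ᵇ n) ≡ true → m ℕ.< n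
  <ᵇ-true {m} {n} h = ℕₚ.<ᵇ⇒< m n (subst Bool.T (sym h) tt)

  <ᵇ-false : ∀ {m n} → (m ℕ.<ᵇ n) ≡ false → n ℕ.≤ m
  <ᵇ-false {m} {n} h = ℕₚ.≮⇒≥ λ l → subst Bool.T h (ℕₚ.<⇒<ᵇ l)

  true-<ᵇ : ∀ {m n} → m ℕ.< n → (m ℕ.<ᵇ n) ≡ true
  true-<ᵇ {m} {n} h with m ℕ.<ᵇ n in e
  ... | true = refl
  ... | false = ⊥-elim (ℕₚ.<⇒≱ h (<ᵇ-false e))

  pow-antitone : ∀ {x} → 0F ≤ x → x ≤ 1F → ∀ {m n} → m ℕ.≤ n → x ^^ n ≤ x ^^ m
  pow-antitone {x} h h1 {zero} {zero} _ = ≤-refl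
  pow-antitone {x} h h1 {zero} {suc n} _ = (lin 0 (sc 1 (*-nonneg (≤⇒0≤- h1) (^^-nonneg h n)) ⊹ sc 1 (pow-antitone h h1 {0} {n} ℕ.z≤n)) (solve 2 (λ x y → # 1 :* (# 1 :- (x :* y)) := (# 1 :* (((# 1 :- x) :* y) :- # 0)) :+ (# 1 :* (# 1 :- y))) refl x (x ^^ n)))
  pow-antitone {x} h h1 {suc m} {suc n} (ℕ.s≤s l) = mul-mono h (pow-antitone h h1 l)

  fromℕ-^ : ∀ m n → fromℕ (m ℕ.^ n) ≡ fromℕ m ^^ n
  fromℕ-^ m zero = refl
  fromℕ-^ m (suc n) = trans (fromℕ-* m (m ℕ.^ n)) (cong (fromℕ m *_) (fromℕ-^ m n))

  module Shifts {n : ℕ} (E : Fin n → Fin n → Bool) (d : Degen (λ x y → E x y ≡ true)) (arcD : Fin n → Fin n → Bool)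
    (Adj⇒E : ∀ x y → arcD x y ≡ true ⊎ arcD y x ≡ true → E x y ≡ true) (E-sym : ∀ x y → E x y ≡ E y x)
    (real Y : Fin n → Bool) (w : Fin n → Fin n)
    (Y-real : ∀ y → Y y ≡ true → real y ≡ true × (∀ z → E z y ≡ true → real z ≡ true × (z ≡ Degen.p d y ⊎ z ≡ w y)))
    (Y-kid : ∀ y → Y y ≡ true → w y ≡ Degen.p d y ⊎ E (w y) y ≡ true)
    (Y-nonexc : ∀ y → Y y ≡ true → Degen.exc d y ≡ false)
    (Δ : ℕ) (deg≤ : ∀ y → sum (λ x → [ E x y ]) ≤ fromℕ Δ) (k′ : ℕ) where

    open Degen d
    open Ranked d

    k : ℕ
    k = suc k′

    private
      module DepthClass (s : Fin k) where
        open Fold exc (λ x h → h) (λ _ → s) cyc public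

      -- Number of parent steps down to an exceptional vertex, plus the shift s, modulo k. Cutting
      -- where this is zero keeps every tree of height below k.
      cls : Fin k → Fin n → Fin k
      cls s = DepthClass.fold s

      isZero : Fin k → Bool
      isZero zero = true
      isZero (suc _) = false

    isRoot : Fin k → Fin n → Bool
    isRoot s x = exc x ∨ isZero (cls s x)

    exc⇒root : ∀ s x → exc x ≡ true → isRoot s x ≡ true
    exc⇒root s x h rewrite h = refl

    module C (s : Fin k) = Cut E d arcD Adj⇒E E-sym (isRoot s) (exc⇒root s) real Y w Y-real Y-kid

    S : ℕ
    S = suc Δ ℕ.^ k

    private
      -- For a fixed vertex the class runs once through all residues as the shift varies: it is s at
      -- exceptional vertices, and each step applies the permutation `cyc`.
      cls-sum : ∀ (f : Fin k → F) x → sum (λ s → f (cls s x)) ≡ sum f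
      cls-sum f x = D0.ind (λ x → ∀ f → sum (λ s → f (cls s x)) ≡ sum f) rt st x f
        where
        module D0 = DepthClass zero
        rt : ∀ x → exc x ≡ true → ∀ f → sum (λ s → f (cls s x)) ≡ sum f
        rt x h f = sum-cong (λ s → cong f (DepthClass.fold-root s x h))
        st : ∀ x → exc x ≡ false → (∀ f → sum (λ s → f (cls s (p x))) ≡ sum f) → ∀ f → sum (λ s → f (cls s x)) ≡ sum f
        st x h ih f = trans (sum-cong (λ s → cong f (DepthClass.fold-step s x h))) (trans (ih (f ∘ cyc)) (sum-cyc f))

    module At (s : Fin k) where
      open C s public

      c : Fin n → ℕ
      c x = toℕ (cls s x)

      private
        c-step : ∀ x → isRoot s x ≡ false → c x ≡ suc (c (p x))
        c-step x h = go (cyc-suc (cls s (p x)))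
          where
          fs : cls s x ≡ cyc (cls s (p x))
          fs = DepthClass.fold-step s x (proj₁ (∨-false (exc x) _ h))
          go : cyc (cls s (p x)) ≡ zero ⊎ toℕ (cyc (cls s (p x))) ≡ suc (toℕ (cls s (p x))) → c x ≡ suc (c (p x))
          go (inj₁ z) = contradiction (trans (sym (cong isZero (trans fs z))) (proj₂ (∨-false (exc x) _ h))) λ ()
          go (inj₂ e) = trans (cong toℕ fs) e

        pd≤c : ∀ x → pd x ℕ.≤ c x
        pd≤c = PD.ind _ (λ x h → subst (ℕ._≤ c x) (sym (PD.fold-root x h)) ℕ.z≤n) (λ x h ih → subst₂ ℕ._≤_ (sym (PD.fold-step x h)) (sym (c-step x h)) (ℕ.s≤s ih))

        pd<k : ∀ x → pd x ℕ.< k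
        pd<k x = ℕₚ.≤-<-trans (pd≤c x) (Finₚ.toℕ<n (cls s x))

        -- A tree whose root is not exceptional starts in class zero, so class and depth agree along
        -- it. Trees with exceptional roots start in class s and are accounted for separately.
        c≤pd : ∀ x → exc (rt x) ≡ true ⊎ pd x ≡ c x
        c≤pd = PD.ind _ base stp
          where
          base : ∀ x → isRoot s x ≡ true → exc (rt x) ≡ true ⊎ pd x ≡ c x
          base x h with Bool-dec (exc x)
          ... | inj₁ e = inj₁ (trans (cong exc (RT.fold-root x h)) e)
          ... | inj₂ e = inj₂ (trans (PD.fold-root x h) (sym (zero-c (trans (sym (cong (_∨ isZero (cls s x)) e)) h))))
            where
            zero-c : isZero (cls s x) ≡ true → toℕ (cls s x) ≡ 0
            zero-c z with cls s x
            ... | zero = refl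
          stp : ∀ x → isRoot s x ≡ false → exc (rt (p x)) ≡ true ⊎ pd (p x) ≡ c (p x) → exc (rt x) ≡ true ⊎ pd x ≡ c x
          stp x h (inj₁ e) = inj₁ (trans (cong exc (RT.fold-step x h)) e)
          stp x h (inj₂ e) = inj₂ (trans (PD.fold-step x h) (trans (cong suc e) (sym (c-step x h))))

        pd0-root : ∀ x → pd x ≡ 0 → isRoot s x ≡ true
        pd0-root x h with Bool-dec (isRoot s x)
        ... | inj₁ e = e
        ... | inj₂ e = contradiction (trans (sym (PD.fold-step x e)) h) λ ()

      -- vertices of the piece of r at depth at most i
      A : Fin n → ℕ → F
      A r i = sum (λ x → [ rt x == r ] * [ pd x ℕ.<ᵇ suc i ])

      private
        -- Every vertex of depth at most i + 1 is the root or a neighbour of one of depth at most i,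
        -- so the count grows by a factor of at most Δ, plus one.
        A-bound : ∀ r i → A r i ≤ fromℕ (suc Δ) ^^ i
        A-bound r zero = sum-mono lem ≤≡ sum-[==] r
          where
          lem : ∀ x → [ rt x == r ] * [ pd x ℕ.<ᵇ 1 ] ≤ [ x == r ]
          lem x with rt x Finₚ.≟ r | pd x ℕ.<ᵇ 1 in e
          ... | no _ | _ = (zeroˡ _) ≡≤ []-nonneg (x == r)
          ... | yes _ | false = (zeroʳ _) ≡≤ []-nonneg (x == r)
          ... | yes h | true = ≤-trans (≤-reflexive (*-identityˡ 1F)) (≤-reflexive (cong [_] (sym (trans (cong (_== r) (trans (sym (RT.fold-root x (pd0-root x (ℕₚ.n<1⇒n≡0 (<ᵇ-true e))))) h)) (==-refl r)))))
        A-bound r (suc i) = ≤-trans step (lin 0 (sc 1 (*-nonneg (0≤fromℕ Δ) (≤⇒0≤- (A-bound r i))) ⊹ sc 1 (one≤ i) ⊹ sc 1 (≤-reflexive (sym (cong (_* (fromℕ (suc Δ) ^^ i)) (fromℕ-suc Δ))))) (solve 4 (λ D D′ y a → # 1 :* ((D′ :* y) :- (# 1 :+ (D :* a))) := (# 1 :* ((D :* (y :- a)) :- # 0)) :+ ((# 1 :* (y :- # 1)) :+ (# 1 :* ((D′ :* y) :- ((# 1 :+ D) :* y))))) refl (fromℕ Δ) (fromℕ (suc Δ)) (fromℕ (suc Δ) ^^ i) (A r i)))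
          where
          one≤ : ∀ i → 1F ≤ fromℕ (suc Δ) ^^ i
          one≤ zero = ≤-refl
          one≤ (suc i) = (lin 0 (sc 1 (one≤ i) ⊹ sc 1 (*-nonneg (0≤fromℕ Δ) (≤-trans 0≤1 (one≤ i))) ⊹ sc 1 (≤-reflexive (sym (cong (_* (fromℕ (suc Δ) ^^ i)) (fromℕ-suc Δ))))) (solve 3 (λ D D′ y → # 1 :* ((D′ :* y) :- # 1) := (# 1 :* (y :- # 1)) :+ ((# 1 :* ((D :* y) :- # 0)) :+ (# 1 :* ((D′ :* y) :- ((# 1 :+ D) :* y))))) refl (fromℕ Δ) (fromℕ (suc Δ)) (fromℕ (suc Δ) ^^ i)))
          α : Fin n → F
          α y = [ rt y == r ] * [ pd y ℕ.<ᵇ suc i ]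
          α≥0 : ∀ y → 0F ≤ α y
          α≥0 y = *-nonneg ([]-nonneg (rt y == r)) ([]-nonneg (pd y ℕ.<ᵇ suc i))
          lem : ∀ x → [ rt x == r ] * [ pd x ℕ.<ᵇ suc (suc i) ] ≤ [ x == r ] + sum (λ y → [ E x y ] * α y)
          lem x with Bool-dec (isRoot s x)
          ... | inj₁ h rewrite RT.fold-root x h = (lin 0 (sc 1 (*-nonneg ([]-nonneg (x == r)) (≤⇒0≤- ([]-≤1 (pd x ℕ.<ᵇ suc (suc i))))) ⊹ sc 1 (sum-nonneg (λ y → *-nonneg ([]-nonneg (E x y)) (α≥0 y)))) (solve 3 (λ u v t → # 1 :* ((u :+ t) :- (u :* v)) := (# 1 :* ((u :* (# 1 :- v)) :- # 0)) :+ (# 1 :* (t :- # 0))) refl ([ x == r ]) ([ pd x ℕ.<ᵇ suc (suc i) ]) (sum (λ y → [ E x y ] * α y))))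
          ... | inj₂ h rewrite RT.fold-step x h | PD.fold-step x h = (lin 0 (sc 1 ([]-nonneg (x == r)) ⊹ sc 1 (term≤sum (λ y → *-nonneg ([]-nonneg (E x y)) (α≥0 y)) (p x)) ⊹ sc 1 (≤-reflexive (sym (trans (cong (λ e → [ e ] * α (p x)) (proj₁ (par x (nonexc x h)))) (*-identityˡ _))))) (solve 4 (λ u a za t → # 1 :* ((u :+ t) :- a) := (# 1 :* (u :- # 0)) :+ ((# 1 :* (t :- za)) :+ (# 1 :* (za :- a)))) refl ([ x == r ]) (α (p x)) ([ E x (p x) ] * α (p x)) (sum (λ y → [ E x y ] * α y))))
          step : A r (suc i) ≤ 1F + fromℕ Δ * A r i
          step = ≤-trans (sum-mono lem) (≤-trans (≤-reflexive (trans (sum-+ _ _) (cong₂ _+_ (sum-[==] r) (trans (sum-swap (λ x y → [ E x y ] * α y)) (sum-cong (λ y → sum-*ʳ (α y) _))))))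
            (+-mono-≤ ≤-refl (sum-mono (λ y → subst₂ _≤_ (*-comm (α y) _) (*-comm (α y) _) (mul-mono (α≥0 y) (deg≤ y))) ≤≡ sum-*ˡ (fromℕ Δ) α)))

      opaque
        piece-size : ∀ r → sum (λ x → [ rt x == r ]) ≤ fromℕ S
        piece-size r = ≤-trans (≤-reflexive (sum-cong (λ x → sym (trans (cong ([ rt x == r ] *_) (cong [_] (true-<ᵇ (ℕₚ.<-trans (pd<k x) (ℕₚ.n<1+n k))))) (*-identityʳ _))))) (A-bound r k ≤≡ sym (fromℕ-^ (suc Δ) k))

      private
        exc-pieces : sum (λ x → [ exc (rt x) ]) ≤ fromℕ S * exceptions d
        exc-pieces = (trans (sum-cong (λ x → trans (sym (sum-δ (rt x) (λ r → [ exc r ]))) (sum-cong (λ r → *-comm _ [ exc r ])))) (sum-swap (λ x r → [ exc r ] * [ r == rt x ])))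
          ≡≤ (sum-mono lem ≤≡ trans (sum-*ʳ (fromℕ S) _) (*-comm _ _))
          where
          eq-sym : ∀ (i j : Fin n) → (i == j) ≡ (j == i)
          eq-sym i j with i Finₚ.≟ j
          ... | yes refl = sym (==-refl i)
          ... | no ne = sym (≢⇒== (λ h → ne (sym h)))
          lem : ∀ r → sum (λ x → [ exc r ] * [ r == rt x ]) ≤ [ exc r ] * fromℕ S
          lem r = (sum-*ˡ [ exc r ] _) ≡≤ mul-mono ([]-nonneg (exc r)) ((sum-cong (λ x → cong [_] (eq-sym r (rt x)))) ≡≤ piece-size r)

      module Shallow (k₀ : ℕ) where
        shallow : Fin n → Bool
        shallow x = c x ℕ.<ᵇ k₀

        Sh : F
        Sh = fromℕ S * exceptions d + sum (λ x → [ shallow x ])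

        private
          low-pd : ∀ x → [ pd x ℕ.<ᵇ k₀ ] ≤ [ exc (rt x) ] + [ shallow x ]
          low-pd x with c≤pd x
          ... | inj₂ e rewrite e = (lin 0 (sc 1 ([]-nonneg (exc (rt x)))) (solve 2 (λ u v → # 1 :* ((u :+ v) :- v) := # 1 :* (u :- # 0)) refl ([ exc (rt x) ]) ([ shallow x ])))
          ... | inj₁ e rewrite e = (lin 0 (sc 1 ([]-≤1 (pd x ℕ.<ᵇ k₀)) ⊹ sc 1 ([]-nonneg (shallow x))) (solve 2 (λ u v → # 1 :* ((# 1 :+ v) :- u) := (# 1 :* (# 1 :- u)) :+ (# 1 :* (v :- # 0))) refl ([ pd x ℕ.<ᵇ k₀ ]) ([ shallow x ])))

          count-low : sum (λ x → [ pd x ℕ.<ᵇ k₀ ]) ≤ Sh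
          count-low = ≤-trans (sum-mono low-pd ≤≡ sum-+ _ _) (+-mono-≤ exc-pieces ≤-refl)

        -- `Sh` bounds the vertices of depth below k₀, trees with exceptional roots being counted
        -- whole. Such vertices weigh at most 1 each and all others at most g^k₀.
        weight : ∀ {g} → 0F ≤ g → g ≤ 1F → sum (λ x → g ^^ pd x) ≤ Sh + fromℕ n * g ^^ k₀
        weight {g} h h1 = ≤-trans (sum-mono lem ≤≡ trans (sum-+ _ _) (cong (sum (λ x → [ pd x ℕ.<ᵇ k₀ ]) +_) (sum-const n _))) (+-mono-≤ count-low ≤-refl)
          where
          lem : ∀ x → g ^^ pd x ≤ [ pd x ℕ.<ᵇ k₀ ] + g ^^ k₀
          lem x with pd x ℕ.<ᵇ k₀ in e
          ... | true = (lin 0 (sc 1 (pow-antitone h h1 {0} {pd x} ℕ.z≤n) ⊹ sc 1 (^^-nonneg h k₀)) (solve 2 (λ a z → # 1 :* ((# 1 :+ z) :- a) := (# 1 :* (# 1 :- a)) :+ (# 1 :* (z :- # 0))) refl (g ^^ pd x) (g ^^ k₀)))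
          ... | false = (lin 0 (sc 1 (pow-antitone h h1 {k₀} {pd x} (<ᵇ-false {pd x} {k₀} e))) (solve 2 (λ a z → # 1 :* ((# 0 :+ z) :- a) := # 1 :* (z :- a)) refl (g ^^ pd x) (g ^^ k₀)))

        -- A lost candidate either has depth below 3, so is shallow, or its other neighbour is a
        -- root, and then the candidate is `p` or `q` of that root. Roots are themselves shallow, so
        -- the losses are at most `Sh` plus twice `Sh`.
        gadgets-lost : 3 ℕ.≤ k₀ → sum (λ y → [ Y y ]) ≤ sum (λ y → [ okY y ]) + fromℕ 3 * Sh
        gadgets-lost 3≤k₀ = ≤-trans (sum-mono lem ≤≡ trans (sum-+ _ _) (cong (sum (λ y → [ okY y ]) +_) (trans (sum-+ _ _) (cong (sum (λ y → [ pd y ℕ.<ᵇ k₀ ]) +_)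
            (trans (sum-swap (λ y z → [ isRoot s z ] * ([ y == p z ] + [ y == q z ]))) (sum-cong (λ z → trans (sum-*ˡ [ isRoot s z ] _) (cong ([ isRoot s z ] *_) (trans (sum-+ _ _) (cong₂ _+_ (sum-[==] (p z)) (sum-[==] (q z)))))))))))) total
          where
          lost : Fin n → F
          lost y = sum (λ z → [ isRoot s z ] * ([ y == p z ] + [ y == q z ]))
          lost≥0 : ∀ y → 0F ≤ lost y
          lost≥0 y = sum-nonneg (λ z → *-nonneg ([]-nonneg (isRoot s z)) ([]-nonneg (y == p z) ⊹ []-nonneg (y == q z)))
          total : sum (λ y → [ okY y ]) + (sum (λ y → [ pd y ℕ.<ᵇ k₀ ]) + sum (λ z → [ isRoot s z ] * (1F + 1F))) ≤ sum (λ y → [ okY y ]) + fromℕ 3 * Sh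
          total = (lin 0 (sc 3 count-low ⊹ sc 1 (≤-reflexive (sum-*ʳ (1F + 1F) (λ z → [ isRoot s z ]))) ⊹ sc 2 (count-mono root-low)) (solve 5 (λ o a r r2 h → # 1 :* ((o :+ (# 3 :* h)) :- (o :+ (a :+ r2))) := (# 3 :* (h :- a)) :+ ((# 1 :* ((r :* (# 1 :+ # 1)) :- r2)) :+ (# 2 :* (a :- r)))) refl (sum (λ y → [ okY y ])) (sum (λ y → [ pd y ℕ.<ᵇ k₀ ])) (sum (λ z → [ isRoot s z ])) (sum (λ z → [ isRoot s z ] * (1F + 1F))) Sh))
            where
            root-low : ∀ z → isRoot s z ≡ true → (pd z ℕ.<ᵇ k₀) ≡ true
            root-low z h = true-<ᵇ (subst (ℕ._< k₀) (sym (PD.fold-root z h)) (ℕₚ.<-≤-trans (ℕ.s≤s ℕ.z≤n) 3≤k₀))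
          hit : ∀ y z → isRoot s z ≡ true → y ≡ p z ⊎ y ≡ q z → 1F ≤ lost y
          hit y z rz h = ≤-trans (one h) (term≤sum (λ z → *-nonneg ([]-nonneg (isRoot s z)) ([]-nonneg (y == p z) ⊹ []-nonneg (y == q z))) z)
            where
            one : y ≡ p z ⊎ y ≡ q z → 1F ≤ [ isRoot s z ] * ([ y == p z ] + [ y == q z ])
            one (inj₁ refl) rewrite rz | ==-refl (p z) = (lin 0 (sc 1 ([]-nonneg (p z == q z))) (solve 1 (λ v → # 1 :* ((# 1 :* (# 1 :+ v)) :- # 1) := # 1 :* (v :- # 0)) refl ([ p z == q z ])))
            one (inj₂ refl) rewrite rz | ==-refl (q z) = (lin 0 (sc 1 ([]-nonneg (q z == p z))) (solve 1 (λ v → # 1 :* ((# 1 :* (v :+ # 1)) :- # 1) := # 1 :* (v :- # 0)) refl ([ q z == p z ])))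
          kid-lower : ∀ y → Y y ≡ true → ¬ w y ≡ p y → isRoot s (w y) ≡ true → 1F ≤ lost y
          kid-lower y Yy w≢p rw with Y-kid y Yy
          ... | inj₁ e = ⊥-elim (w≢p e)
          ... | inj₂ edge with ≤-or-> (rank (w y)) (rank y)
          ... | inj₂ lt = hit y (w y) rw (Data.Sum.map₂ proj₂ (lower (w y) y edge lt))
          ... | inj₁ le with ≤-or-> (rank y) (rank (w y))
          ... | inj₁ le′ = ⊥-elim (strict (w y) y edge (≤-antisym le le′))
          ... | inj₂ lt with lower y (w y) (trans (E-sym _ _) edge) lt
          ... | inj₁ e = ⊥-elim (w≢p e)
          ... | inj₂ (ex , _) = contradiction (trans (sym ex) (Y-nonexc y Yy)) λ ()
          lem : ∀ y → [ Y y ] ≤ [ okY y ] + ([ pd y ℕ.<ᵇ k₀ ] + lost y)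
          lem y with Y y in Yy
          ... | false = []-nonneg false ⊹ ([]-nonneg (pd y ℕ.<ᵇ k₀) ⊹ lost≥0 y)
          ... | true with 3 ℕ.≤ᵇ pd y in e3
          ... | false = (lin 0 (sc 1 (lost≥0 y) ⊹ sc 1 (≤-reflexive (sym (cong [_] (true-<ᵇ (ℕₚ.<-≤-trans (ℕₚ.≰⇒> (λ h → subst Bool.T e3 (ℕₚ.≤⇒≤ᵇ h))) 3≤k₀)))))) (solve 2 (λ z l → # 1 :* ((# 0 :+ (z :+ l)) :- # 1) := (# 1 :* (l :- # 0)) :+ (# 1 :* (z :- # 1))) refl ([ pd y ℕ.<ᵇ k₀ ]) (lost y)))
          ... | true with w y Finₚ.≟ p y
          ... | yes _ = (lin 0 (sc 1 ([]-nonneg (pd y ℕ.<ᵇ k₀)) ⊹ sc 1 (lost≥0 y)) (solve 2 (λ z l → # 1 :* ((# 1 :+ (z :+ l)) :- # 1) := (# 1 :* (z :- # 0)) :+ (# 1 :* (l :- # 0))) refl ([ pd y ℕ.<ᵇ k₀ ]) (lost y)))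
          ... | no w≢p with isRoot s (w y) in rw
          ... | false = (lin 0 (sc 1 ([]-nonneg (pd y ℕ.<ᵇ k₀)) ⊹ sc 1 (lost≥0 y)) (solve 2 (λ z l → # 1 :* ((# 1 :+ (z :+ l)) :- # 1) := (# 1 :* (z :- # 0)) :+ (# 1 :* (l :- # 0))) refl ([ pd y ℕ.<ᵇ k₀ ]) (lost y)))
          ... | true = (lin 0 (sc 1 ([]-nonneg (pd y ℕ.<ᵇ k₀)) ⊹ sc 1 (kid-lower y Yy w≢p rw)) (solve 2 (λ z l → # 1 :* ((# 0 :+ (z :+ l)) :- # 1) := (# 1 :* (z :- # 0)) :+ (# 1 :* (l :- # 1))) refl ([ pd y ℕ.<ᵇ k₀ ]) (lost y)))

    -- Some shift makes the shallow classes as rare as on average.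
    good-shift : ∀ k₀ → ∃[ s ] fromℕ k * sum (λ x → [ At.Shallow.shallow s k₀ x ]) ≤ fromℕ n * fromℕ k₀
    good-shift k₀ = sum-≤⇒∃ (λ s → fromℕ k * sum (λ x → [ At.Shallow.shallow s k₀ x ])) (λ _ → fromℕ n * fromℕ k₀)
      (trans (sum-*ˡ (fromℕ k) _) (cong (fromℕ k *_) (sum-swap _)) ≡≤ (mul-mono (0≤fromℕ k) (sum-mono per-vertex ≤≡ sum-const n (fromℕ k₀)) ≤≡ sym (sum-const k _)))
      where
      per-vertex : ∀ x → sum (λ s → [ At.Shallow.shallow s k₀ x ]) ≤ fromℕ k₀
      per-vertex x = cls-sum (λ i → [ toℕ i ℕ.<ᵇ k₀ ]) x ≡≤ count-< k k₀

-- The choice of constants and the resulting partial embedding.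

module Embed where
  open OrderedField
  open Sums
  open Transport using (hh; cap)
  open RandomWalks
  open Selection
  open Step
  open Loop
  open Degeneracy using (Degen; exceptions)
  open Pieces
  open Shifting

  -- A rational substitute for (1-x)^m ≤ e^(-mx).
  one-minus-pow : ∀ {x} → 0F ≤ x → x ≤ 1F → ∀ m → (1F - x) ^^ m * (1F + fromℕ m * x) ≤ 1F
  one-minus-pow {x} h h1 zero = (lin 0 (0≤fromℕ 0) (solve 1 (λ x → # 1 :* (# 1 :- (# 1 :* (# 1 :+ (# 0 :* x)))) := # 0) refl x))
  one-minus-pow {x} h h1 (suc m) = ≤-trans (lin 0 (sc 1 (≤-reflexive (cong (λ z → (1F - x) * (1F - x) ^^ m * (z * x)) (fromℕ-suc m))) ⊹ sc 1 (*-nonneg (*-nonneg (^^-nonneg (≤⇒0≤- h1) m) (*-nonneg h h)) (0≤fromℕ (suc m))) ⊹ sc 1 (≤-reflexive (cong (λ z → (1F - x) ^^ m * (x * x) * z) (fromℕ-suc m)))) (solve 4 (λ x y m m′ → # 1 :* ((y :* (# 1 :+ (m :* x))) :- (((# 1 :- x) :* y) :* (# 1 :+ (m′ :* x)))) := (# 1 :* ((((# 1 :- x) :* y) :* ((# 1 :+ m) :* x)) :- (((# 1 :- x) :* y) :* (m′ :* x)))) :+ ((# 1 :* (((y :* (x :* x)) :* m′) :- # 0)) :+ (# 1 :* (((y :* (x :* x)) :* (# 1 :+ m)) :- ((y :* (x :* x)) :* m′))))) refl x ((1F - x) ^^ m) (fromℕ m) (fromℕ (suc m)))) (one-minus-pow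 h h1 m)

  ^^-mono : ∀ {x y} → 0F ≤ x → x ≤ y → ∀ m → x ^^ m ≤ y ^^ m
  ^^-mono h p zero = ≤-refl
  ^^-mono h p (suc m) = mul-mono₂ h (^^-nonneg h m) p (^^-mono h p m)

  ^^-* : ∀ x m n → x ^^ (m ℕ.* n) ≡ (x ^^ m) ^^ n
  ^^-* x m zero = cong (x ^^_) (ℕₚ.*-zeroʳ m)
  ^^-* x m (suc n) = trans (cong (x ^^_) (ℕₚ.*-suc m n)) (trans (^^-+ x m (m ℕ.* n)) (cong (x ^^ m *_) (^^-* x m n)))

  *-^^ : ∀ x y n → (x * y) ^^ n ≡ x ^^ n * y ^^ n
  *-^^ x y zero = (solve 0 (# 1 := # 1 :* # 1) refl )
  *-^^ x y (suc n) = trans (cong (x * y *_) (*-^^ x y n)) (solve 4 (λ x y u v → (x :* y) :* (u :* v) := (x :* u) :* (y :* v)) refl x y (x ^^ n) (y ^^ n))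

  one^^ : ∀ n → 1F ^^ n ≡ 1F
  one^^ zero = refl
  one^^ (suc n) = trans (*-identityˡ _) (one^^ n)

  ^^-pos : ∀ {x} → 0F < x → ∀ n → 0F < x ^^ n
  ^^-pos h zero = 0<fromℕ 0
  ^^-pos h (suc n) = *-pos h (^^-pos h n)

  -- This is 16/p₀, as γ = 2/(b(b+2)).
  P₁ : ℕ → ℕ
  P₁ b = (b ℕ.* hh b) ℕ.* (b ℕ.* hh b) ℕ.* (b ℕ.* hh b) ℕ.* (b ℕ.* hh b)

  -- `kk₀` is a depth at which the mixing error is at most 1/(8bR); its summand 3 also guarantees
  -- the depth a gadget needs. The period `kk′` + 1 exceeds it by a factor 8bR, so that after
  -- averaging over shifts few vertices are shallow.
  kk₀ kk′ : ℕ → ℕ → ℕ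
  kk₀ b R = 8 ℕ.* b ℕ.* R ℕ.* (b ℕ.* hh b) ℕ.+ 3
  kk′ b R = 8 ℕ.* b ℕ.* kk₀ b R ℕ.* R

  -- In turn: collisions cost at most half of `p₀`; the fourth moments stay below δ⁴; trees with
  -- exceptional roots, and collisions, each contribute little to the bias; and S² is at most rmin.
  record Num (b R S N : ℕ) : Set where
    field
      nA : fromℕ 2 * fromℕ (suc (cap b)) * fromℕ (P₁ b) * fromℕ R * (fromℕ S * fromℕ S * fromℕ S) ≤ fromℕ N
      nB : fromℕ 1024 * sqr (sqr (fromℕ b * fromℕ R * fromℕ S)) < fromℕ N
      nC : fromℕ 256 * sqr (fromℕ b * fromℕ R * fromℕ S) ≤ fromℕ N
      nD : fromℕ 8 * fromℕ b * fromℕ R * fromℕ R * fromℕ (suc (cap b)) * sqr (fromℕ S) ≤ fromℕ N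
      nE : fromℕ R * sqr (fromℕ S) ≤ fromℕ N

  sq-cancel : ∀ {x y} → 0F ≤ y → x * x ≤ y * y → x ≤ y
  sq-cancel {x} {y} h p with ≤-or-> x y
  ... | inj₁ q = q
  ... | inj₂ q = ⊥-elim (<-irrefl (lin< 0 (sc< 0 (*-pos (<⇒0<- q) (<-≤-trans (<⇒0<- q) (lin 0 (sc 2 h) (solve 2 (λ x y → # 1 :* ((x :+ y) :- (x :- y)) := # 2 :* (y :- # 0)) refl x y)))) ⊹< sc 1 p) (solve 2 (λ x y → # 1 :* (# 0 :- # 0) := (# 1 :* (((x :- y) :* (x :+ y)) :- # 0)) :+ (# 1 :* ((y :* y) :- (x :* x)))) refl x y)))

  Passes : ∀ {N n} (arc : Fin N → Fin N → Bool) (arcD : Fin n → Fin n → Bool) (real Y : Fin n → Bool) (φ : Fin n → Fin N) → Test N → Fin n → Set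
  Passes arc arcD real Y φ (mkTest z s₁ p₁ s₂ p₂) y = (Y y ≡ true × real y ≡ true) × adjOf arc s₁ p₁ (φ y) ≡ true × adjOf arc s₂ p₂ (φ y) ≡ true ×
    (∀ d → arcD d y ≡ true → arc (φ d) z ≡ true) × (∀ d → arcD y d ≡ true → arc z (φ d) ≡ true)

  record Embedded {N n T : ℕ} (arc : Fin N → Fin N → Bool) (arcD : Fin n → Fin n → Bool) (real Y : Fin n → Bool) (test : Fin T → Test N) (b rmin S : ℕ) : Set where
    field
      r : ℕ
      φ : Fin n → Fin N
      ι : Fin r → Fin N
      ι-inj : ∀ i j → ι i ≡ ι j → i ≡ j
      φ-inj : ∀ x y → real x ≡ true → real y ≡ true → φ x ≡ φ y → x ≡ y
      avoid : ∀ x → real x ≡ true → ∀ i → ¬ φ x ≡ ι i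
      arcs : ∀ x y → real x ≡ true → real y ≡ true → arcD x y ≡ true → arc (φ x) (φ y) ≡ true
      count : fromℕ r + sum (λ x → [ real x ]) ≡ fromℕ N
      hit : Fin T → Fin n → Bool
      hit-ok : ∀ τ y → hit τ y ≡ true → Passes arc arcD real Y φ (test τ) y
      -- If enough gadgets are available, every test is passed by more than rmin of them.
      many-hits : fromℕ (2 ℕ.* P₁ b ℕ.+ 3) * fromℕ rmin ≤ sum (λ y → [ Y y ]) → fromℕ 2 * fromℕ T < fromℕ 2 ^^ S → ∀ τ → fromℕ rmin < sum (λ y → [ hit τ y ])

  module Embedding {N : ℕ} (arc : Fin N → Fin N → Bool) {b R rmin S : ℕ} (0<b : 0 ℕ.< b) (0<R : 0 ℕ.< R) (0<rmin : 0 ℕ.< rmin) (2≤S : 2 ℕ.≤ S)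
    (dens : ∀ s v → (fromℕ b + fromℕ 4) * fromℕ N ≤ fromℕ 2 * fromℕ b * sum (λ i → [ adjOf arc s v i ]))
    {n : ℕ} (0<n : 0 ℕ.< n) (n≤N : n ℕ.≤ N) (N≤Rr : fromℕ N ≤ fromℕ R * fromℕ rmin) (num : Num b R S N)
    (E : Fin n → Fin n → Bool) (d : Degen (λ x y → E x y ≡ true)) (exc-small : exceptions d * exceptions d ≤ fromℕ 4 * fromℕ n)
    (arcD : Fin n → Fin n → Bool) (antisym : ∀ x y → arcD x y ≡ true → arcD y x ≡ false)
    (Adj⇒E : ∀ x y → arcD x y ≡ true ⊎ arcD y x ≡ true → E x y ≡ true) (E-sym : ∀ x y → E x y ≡ E y x)
    (real Y : Fin n → Bool) (w : Fin n → Fin n)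
    (Y-real : ∀ y → Y y ≡ true → real y ≡ true × (∀ z → E z y ≡ true → real z ≡ true × (z ≡ Degen.p d y ⊎ z ≡ w y)))
    (Y-kid : ∀ y → Y y ≡ true → w y ≡ Degen.p d y ⊎ E (w y) y ≡ true)
    (Y-nonexc : ∀ y → Y y ≡ true → Degen.exc d y ≡ false)
    (Δ : ℕ) (deg≤ : ∀ y → sum (λ x → [ E x y ]) ≤ fromℕ Δ) (S-big : suc Δ ℕ.^ suc (kk′ b R) ℕ.≤ S)
    (room : sum (λ x → [ real x ]) + fromℕ rmin ≤ fromℕ N)
    {T : ℕ} (0<T : 0 ℕ.< T) (test : Fin T → Test N) where

    open Shifts E d arcD Adj⇒E E-sym real Y w Y-real Y-kid Y-nonexc Δ deg≤ (kk′ b R) using (module At; good-shift; k)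
    open Num num

    private
      𝕓 ℛ 𝕤 μ ℕN 𝕟 c κ ρ δ e h : F
      𝕓 = fromℕ b
      ℛ = fromℕ R
      𝕤 = fromℕ S
      μ = fromℕ rmin
      ℕN = fromℕ N
      𝕟 = fromℕ n
      c = fromℕ (suc (cap b))
      κ = Steps.κ arc 0<b rmin S 0<rmin
      ρ = Steps.ρ arc 0<b rmin S 0<rmin
      δ = recip (fromℕ 2 * fromℕ b)
      e = exceptions d
      h = fromℕ (hh b)

      0<𝕓 : 0F < 𝕓
      0<𝕓 = fromℕ-< 0<b
      0<ℛ : 0F < ℛ
      0<ℛ = fromℕ-< 0<R
      0<μ : 0F < μ
      0<μ = fromℕ-< 0<rmin
      2≤𝕤 : fromℕ 2 ≤ 𝕤
      2≤𝕤 = fromℕ-≤ 2≤S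
      0<𝕤 : 0F < 𝕤
      0<𝕤 = <-≤-trans (0<fromℕ 1) 2≤𝕤
      n≤Rr : 𝕟 ≤ ℛ * μ
      n≤Rr = ≤-trans (fromℕ-≤ n≤N) N≤Rr
      μρ : μ * ρ ≡ 1F
      μρ = recip-inv 0<μ
      0<ρ : 0F < ρ
      0<ρ = recip-pos 0<μ
      e≥0 : 0F ≤ e
      e≥0 = sum-nonneg (λ x → []-nonneg (Degen.exc d x))
      2bδ : fromℕ 2 * 𝕓 * δ ≡ 1F
      2bδ = recip-inv (*-pos (0<fromℕ 1) 0<𝕓)

      -- κ · rmin = S²(cap + 1)
      κμ : κ * μ ≡ 𝕤 * 𝕤 * c
      κμ = trans (solve 4 (λ s c r m → ((s :* s) :* (c :* r)) :* m := ((s :* s) :* c) :* (m :* r)) refl 𝕤 c ρ μ) (trans (cong (𝕤 * 𝕤 * c *_) μρ) (*-identityʳ _))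

      cancelR : ∀ {x y} → ℛ * x ≤ ℛ * y → x ≤ y
      cancelR = mul-cancel 0<ℛ

      P₁-eq : fromℕ (P₁ b) * (γ b * γ b * γ b * γ b) ≡ fromℕ 16
      P₁-eq = trans (cong (_* (γ b * γ b * γ b * γ b)) (trans (fromℕ-* (b ℕ.* hh b ℕ.* (b ℕ.* hh b) ℕ.* (b ℕ.* hh b)) _) (cong₂ _*_ (trans (fromℕ-* (b ℕ.* hh b ℕ.* (b ℕ.* hh b)) _) (cong₂ _*_ (trans (fromℕ-* (b ℕ.* hh b) _) (cong₂ _*_ bh bh)) bh)) bh)))
        (trans (solve 2 (λ x g → (((x :* x) :* x) :* x) :* (((g :* g) :* g) :* g) := (((x :* g) :* (x :* g)) :* (x :* g)) :* (x :* g)) refl (𝕓 * h) (γ b)) (trans (cong (λ z → z * z * z * z) (γ-eq 0<b)) (solve 0 (((# 2 :* # 2) :* # 2) :* # 2 := # 16) refl )))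
        where
        bh : fromℕ (b ℕ.* hh b) ≡ 𝕓 * h
        bh = fromℕ-* b (hh b)

      p₀ : F
      p₀ = γ b * γ b * γ b * γ b
      0<p₀ : 0F < p₀
      0<p₀ = *-pos (*-pos (*-pos (0<γ 0<b) (0<γ 0<b)) (0<γ 0<b)) (0<γ 0<b)

      half : F
      half = recip (fromℕ 2)
      2half : fromℕ 2 * half ≡ 1F
      2half = recip-inv (0<fromℕ 1)

      κ-small : 𝕤 * κ ≤ p₀ * half
      κ-small = mul-cancel (*-pos (*-pos 0<μ 0<ℛ) (fromℕ-< P₁>0)) (lin 1 (sc 1 nA ⊹ sc 1 N≤Rr ⊹ sc 2 (≤-reflexive (cong (λ z → 𝕤 * ℛ * fromℕ (P₁ b) * z) κμ)) ⊹ sc 2 (≤-reflexive (sym (cong (λ z → μ * ℛ * z * half) P₁-eq))) ⊹ sc 16 (≤-reflexive (sym (cong (λ z → μ * ℛ * z) 2half))) ⊹ sc 15 (<⇒≤ (*-pos 0<μ 0<ℛ))) (solve 9 (λ s c m R k p hf P N → # 2 :* ((((m :* R) :* P) :* (p :* hf)) :- (((m :* R) :* P) :* (s :* k))) := (# 1 :* (N :- ((((# 2 :* c) :* P) :* R) :* ((s :* s) :* s)))) :+ ((# 1 :* ((R :* m) :- N)) :+ ((# 2 :* ((((s :* R) :* P) :* ((s :* s) :* c)) :- (((s :* R) :* P) :* (k :* m)))) :+ ((# 2 :* ((((m :* R) :* (P :* p)) :* hf) :- (((m :* R) :* # 16) :* hf))) :+ ((# 16 :* (((m :* R) :* (# 2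 :* hf)) :- ((m :* R) :* # 1))) :+ (# 15 :* ((m :* R) :- # 0))))))) refl 𝕤 c μ ℛ κ p₀ half (fromℕ (P₁ b)) ℕN))
        where
        bh>0 : 0 ℕ.< b ℕ.* hh b
        bh>0 = ℕₚ.*-mono-< 0<b (ℕₚ.<-≤-trans 0<b (ℕₚ.m≤m+n b 2))
        P₁>0 : 0 ℕ.< P₁ b
        P₁>0 = ℕₚ.*-mono-< (ℕₚ.*-mono-< (ℕₚ.*-mono-< bh>0 bh>0) bh>0) bh>0

      p₀≤1 : p₀ ≤ 1F
      p₀≤1 = mul-mono₂ (*-nonneg (*-nonneg g≥0 g≥0) g≥0) g≥0 (mul-mono₂ (*-nonneg g≥0 g≥0) g≥0 (mul-mono₂ g≥0 g≥0 g1 g1) g1) g1 ≤≡ (solve 0 (((# 1 :* # 1) :* # 1) :* # 1 := # 1) refl )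
        where
        g≥0 : 0F ≤ γ b
        g≥0 = <⇒≤ (0<γ 0<b)
        g1 : γ b ≤ 1F
        g1 = γ≤1 0<b

      κ≥0 : 0F ≤ κ
      κ≥0 = Steps.κ-nonneg arc 0<b rmin S 0<rmin

      κ<1 : κ < 1F
      κ<1 = (lin< 3 (0<fromℕ 2 ⊹< sc 2 (*-nonneg (≤⇒0≤- 2≤𝕤) κ≥0) ⊹ sc 2 κ-small ⊹ sc 2 (*-nonneg (≤⇒0≤- p₀≤1) (<⇒≤ (recip-pos (0<fromℕ 1)))) ⊹ sc 1 (≤-reflexive 2half)) (solve 4 (λ k s p hf → # 4 :* (# 1 :- k) := # 3 :+ ((# 2 :* (((s :- # 2) :* k) :- # 0)) :+ ((# 2 :* ((p :* hf) :- (s :* k))) :+ ((# 2 :* (((# 1 :- p) :* hf) :- # 0)) :+ (# 1 :* (# 1 :- (# 2 :* hf))))))) refl κ 𝕤 p₀ half))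

      κ-tiny : fromℕ 8 * 𝕓 * ℛ * κ ≤ 1F
      κ-tiny = mul-cancel (*-pos 0<μ 0<ℛ) (lin 0 (sc 1 nD ⊹ sc 1 N≤Rr ⊹ sc 8 (≤-reflexive (cong (λ z → 𝕓 * ℛ * ℛ * z) κμ))) (solve 7 (λ b R k m s c N → # 1 :* (((m :* R) :* # 1) :- ((m :* R) :* (((# 8 :* b) :* R) :* k))) := (# 1 :* (N :- (((((# 8 :* b) :* R) :* R) :* c) :* (s :* s)))) :+ ((# 1 :* ((R :* m) :- N)) :+ (# 8 :* ((((b :* R) :* R) :* ((s :* s) :* c)) :- (((b :* R) :* R) :* (k :* m)))))) refl 𝕓 ℛ κ μ 𝕤 c ℕN))

      -- The exceptional vertices number at most 2√n and each carries a tree of at most S vertices,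
      -- which is negligible against rmin. The comparison is made between squares to avoid the root.
      exc-tiny : fromℕ 8 * 𝕓 * 𝕤 * e ≤ μ
      exc-tiny = cancelR (sq-cancel (*-nonneg (<⇒≤ 0<ℛ) (<⇒≤ 0<μ)) (≤-trans (lin 0 (sc 64 (*-nonneg (sq-nonneg (𝕓 * ℛ * 𝕤)) (≤⇒0≤- exc-small)) ⊹ sc 1 (*-nonneg (≤⇒0≤- nC) (0≤fromℕ n)) ⊹ sc 1 (*-nonneg (0≤fromℕ N) (≤⇒0≤- (fromℕ-≤ n≤N)))) (solve 6 (λ b s e R n N → # 1 :* ((N :* N) :- ((R :* (((# 8 :* b) :* s) :* e)) :* (R :* (((# 8 :* b) :* s) :* e)))) := (# 64 :* (((((b :* R) :* s) :* ((b :* R) :* s)) :* ((# 4 :* n) :- (e :* e))) :- # 0)) :+ ((# 1 :* (((N :- (# 256 :* (((b :* R) :* s) :* ((b :* R) :* s)))) :* n) :- # 0)) :+ (# 1 :* ((N :* (N :- n)) :- # 0)))) refl 𝕓 𝕤 e ℛ 𝕟 ℕN))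
          (mul-mono₂ (0≤fromℕ N) (0≤fromℕ N) N≤Rr N≤Rr)))

      k₀ : ℕ
      k₀ = kk₀ b R

      g : F
      g = 1F - γ b
      g≥0 : 0F ≤ g
      g≥0 = ≤⇒0≤- (γ≤1 0<b)

      pow-tiny : fromℕ 8 * 𝕓 * ℛ * g ^^ k₀ ≤ 1F
      pow-tiny = ≤-trans (lin 0 (sc 1 (≤-reflexive (sym (cong (λ z → g ^^ k₀ * (z * γ b)) (trans (fromℕ-+ (8 ℕ.* b ℕ.* R ℕ.* (b ℕ.* hh b)) 3) (cong (_+ fromℕ 3) K-eq))))) ⊹ sc 1 (≤-reflexive (sym (cong (λ z → g ^^ k₀ * (fromℕ 8 * 𝕓 * ℛ * z)) (γ-eq 0<b)))) ⊹ sc 8 (*-nonneg (^^-nonneg g≥0 k₀) (*-nonneg (<⇒≤ 0<𝕓) (<⇒≤ 0<ℛ))) ⊹ sc 1 (^^-nonneg g≥0 k₀) ⊹ sc 3 (*-nonneg (^^-nonneg g≥0 k₀) (<⇒≤ (0<γ 0<b)))) (solve 6 (λ b R y K x h → # 1 :* ((y :* (# 1 :+ (K :* x))) :- (((# 8 :* b) :* R) :* y)) := (# 1 :* ((y :* (K :* x)) :- (y :* (((((# 8 :* b) :* R) :* (b :* h)) :+ # 3) :* x)))) :+ ((# 1 :* ((y :* (((# 8 :* b) :* R) :* ((b :* h) :* x))) :- (y :* (((# 8 :* b) :* R) :* # 2)))) :+ ((# 8 :* ((y :* (b :* R)) :- # 0)) :+ ((# 1 :* (y :- # 0)) :+ (#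 3 :* ((y :* x) :- # 0)))))) refl 𝕓 ℛ (g ^^ k₀) (fromℕ k₀) (γ b) h)) (one-minus-pow (<⇒≤ (0<γ 0<b)) (γ≤1 0<b) k₀)
        where
        K-eq : fromℕ (8 ℕ.* b ℕ.* R ℕ.* (b ℕ.* hh b)) ≡ fromℕ 8 * 𝕓 * ℛ * (𝕓 * h)
        K-eq = trans (fromℕ-* (8 ℕ.* b ℕ.* R) _) (cong₂ _*_ (trans (fromℕ-* (8 ℕ.* b) R) (cong (_* ℛ) (fromℕ-* 8 b))) (fromℕ-* b (hh b)))

      shift : _
      shift = good-shift k₀
      s₀ : Fin k
      s₀ = proj₁ shift

      module A = At s₀
      module Sw = A.Shallow k₀

      sh : F
      sh = sum (λ x → [ Sw.shallow x ])

      -- For the chosen shift at most n·k₀/k vertices are shallow, and k > 8b·k₀·R while n ≤ R·rmin.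
      shallow-tiny : fromℕ 8 * 𝕓 * sh ≤ μ
      shallow-tiny = mul-cancel (*-pos (fromℕ-< {0} {k₀} (ℕₚ.<-≤-trans (ℕ.s≤s ℕ.z≤n) (ℕₚ.m≤n+m 3 (8 ℕ.* b ℕ.* R ℕ.* (b ℕ.* hh b))))) 0<ℛ)
          (lin 0 (sc 1 (proj₂ shift) ⊹ sc 1 (≤-reflexive (sym (cong (_* sh) (fromℕ-suc (kk′ b R))))) ⊹ sc 1 (≤-reflexive (sym (cong (_* sh) kk′-eq))) ⊹ sc 1 (sum-nonneg (λ x → []-nonneg (Sw.shallow x))) ⊹ sc 1 (*-nonneg (0≤fromℕ k₀) (≤⇒0≤- n≤Rr))) (solve 8 (λ b R sh m K kk kp n → # 1 :* (((K :* R) :* m) :- ((K :* R) :* ((# 8 :* b) :* sh))) := (# 1 :* ((n :* K) :- (kk :* sh))) :+ ((# 1 :* ((kk :* sh) :- ((# 1 :+ kp) :* sh))) :+ ((# 1 :* ((kp :* sh) :- ((((# 8 :* b) :* K) :* R) :* sh))) :+ ((# 1 :* (sh :- # 0)) :+ (# 1 :* ((K :* ((R :* m) :- n)) :- # 0)))))) refl 𝕓 ℛ sh μ (fromℕ k₀) (fromℕ k) (fromℕ (kk′ b R)) 𝕟))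
        where
        kk′-eq : fromℕ (kk′ b R) ≡ fromℕ 8 * 𝕓 * fromℕ k₀ * ℛ
        kk′-eq = trans (fromℕ-* (8 ℕ.* b ℕ.* k₀) R) (cong (_* ℛ) (trans (fromℕ-* (8 ℕ.* b) k₀) (cong (_* fromℕ k₀) (fromℕ-* 8 b))))

      Sh≤ : fromℕ 8 * 𝕓 * Sw.Sh ≤ fromℕ 2 * μ
      Sh≤ = (lin 0 (sc 8 (*-nonneg (*-nonneg (<⇒≤ 0<𝕓) e≥0) (≤⇒0≤- (fromℕ-≤ S-big))) ⊹ sc 1 exc-tiny ⊹ sc 1 shallow-tiny) (solve 6 (λ b s′ s e sh m → # 1 :* ((# 2 :* m) :- ((# 8 :* b) :* ((s′ :* e) :+ sh))) := (# 8 :* (((b :* e) :* (s :- s′)) :- # 0)) :+ ((# 1 :* (m :- (((# 8 :* b) :* s) :* e))) :+ (# 1 :* (m :- ((# 8 :* b) :* sh))))) refl 𝕓 (fromℕ (suc Δ ℕ.^ k)) 𝕤 e sh μ))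

      module Li = A.Listing arc 0<b rmin S 0<rmin antisym test (λ r → ≤-trans (A.piece-size r) (fromℕ-≤ S-big))
      module Lo = Loops arc 0<b rmin S 0<rmin arcD antisym real Y test

      G : ℕ
      G = gtotal Li.pieces

      σ ξ y₀ x₁ TT Ψ₀ yG : F
      σ = Steps.σ arc 0<b rmin S 0<rmin
      ξ = Lo.ξ
      y₀ = Lo.y₀
      x₁ = Lo.x₁
      TT = fromℕ T
      Ψ₀ = fromℕ 2 * ℕN * sqr (fromℕ 4 * σ * ℕN)
      yG = y₀ ^^ G

      0<N : 0F < ℕN
      0<N = fromℕ-< (ℕₚ.<-≤-trans 0<n n≤N)
      2sξ : fromℕ 2 * 𝕤 * ξ ≡ 1F
      2sξ = recip-inv (*-pos (0<fromℕ 1) 0<𝕤)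
      0<ξ : 0F < ξ
      0<ξ = recip-pos (*-pos (0<fromℕ 1) 0<𝕤)
      4ξ≤1 : fromℕ 4 * ξ ≤ 1F
      4ξ≤1 = (lin 0 (sc 2 (*-nonneg (≤⇒0≤- 2≤𝕤) (<⇒≤ 0<ξ)) ⊹ sc 1 (≤-reflexive 2sξ)) (solve 2 (λ s x → # 1 :* (# 1 :- (# 4 :* x)) := (# 2 :* (((s :- # 2) :* x) :- # 0)) :+ (# 1 :* (# 1 :- ((# 2 :* s) :* x)))) refl 𝕤 ξ))
      x₁>0 : 0F < x₁
      x₁>0 = (lin< 1 (0<fromℕ 0 ⊹< sc 1 4ξ≤1) (solve 1 (λ x → # 2 :* ((# 1 :- (# 2 :* x)) :- # 0) := # 1 :+ (# 1 :* (# 1 :- (# 4 :* x)))) refl ξ))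
      px≤ξ : ξ * (p₀ * half) ≤ ξ
      px≤ξ = (lin 1 (sc 2 (*-nonneg (<⇒≤ 0<ξ) (*-nonneg (≤⇒0≤- p₀≤1) (<⇒≤ (recip-pos (0<fromℕ 1))))) ⊹ sc 1 (≤-reflexive (cong (ξ *_) 2half)) ⊹ sc 1 (<⇒≤ 0<ξ)) (solve 3 (λ x p hf → # 2 :* (x :- (x :* (p :* hf))) := (# 2 :* ((x :* ((# 1 :- p) :* hf)) :- # 0)) :+ ((# 1 :* ((x :* # 1) :- (x :* (# 2 :* hf)))) :+ (# 1 :* (x :- # 0)))) refl ξ p₀ half))
      y₀>0 : 0F < y₀
      y₀>0 = (lin< 3 (0<fromℕ 2 ⊹< sc 4 px≤ξ ⊹ sc 1 4ξ≤1) (solve 2 (λ x p → # 4 :* ((# 1 :- p) :- # 0) := # 3 :+ ((# 4 :* (x :- p)) :+ (# 1 :* (# 1 :- (# 4 :* x))))) refl ξ (ξ * (p₀ * half))))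
      0<TT : 0F < TT
      0<TT = fromℕ-< 0<T
      yT>0 : 0F < yG * TT
      yT>0 = *-pos (^^-pos y₀>0 G) 0<TT
      σ>0 : 0F < σ
      σ>0 = *-pos (*-pos 0<𝕤 0<ρ) (*-pos 0<𝕤 0<ρ)
      Ψ₀>0 : 0F < Ψ₀
      Ψ₀>0 = *-pos (*-pos (0<fromℕ 1) 0<N) (*-pos w>0 w>0)
        where
        w>0 : 0F < fromℕ 4 * σ * ℕN
        w>0 = *-pos (*-pos (0<fromℕ 3) σ>0) 0<N

      -- Multiplied by (2b·rmin·R)⁴, the left side becomes 1024(bRS)⁴N³ and the right side
      -- (R·rmin)⁴, which is at least N⁴; what remains is `nB`.
      small : Ψ₀ + Ψ₀ < 1F * sqr (δ * δ)
      small = cancel< (*-pos Q>0 Q>0) (<-≤-trans (≤-<-trans (≤-reflexive lhs) middle) (≤-trans N⁴≤ (≤-reflexive (sym rhs))))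
        where
        Q t : F
        Q = sqr (fromℕ 2 * 𝕓 * μ * ℛ)
        t = 𝕤 * ρ
        tμ : t * μ ≡ 𝕤
        tμ = trans (solve 3 (λ s r m → (s :* r) :* m := s :* (m :* r)) refl 𝕤 ρ μ) (trans (cong (𝕤 *_) μρ) (*-identityʳ _))
        Q>0 : 0F < Q
        Q>0 = *-pos z>0 z>0
          where
          z>0 : 0F < fromℕ 2 * 𝕓 * μ * ℛ
          z>0 = *-pos (*-pos (*-pos (0<fromℕ 1) 0<𝕓) 0<μ) 0<ℛ
        cancel< : ∀ {a x y} → 0F < a → a * x < a * y → x < y
        cancel< {a} {x} {y} ha h with ≤-or-> y x
        ... | inj₂ q = q
        ... | inj₁ q = ⊥-elim (<⇒≱ h (mul-mono (<⇒≤ ha) q))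
        lhs : Q * Q * (Ψ₀ + Ψ₀) ≡ ℕN * ℕN * ℕN * (fromℕ 1024 * sqr (sqr (𝕓 * ℛ * 𝕤)))
        lhs = trans (solve 5 (λ b m R N t → (((((# 2 :* b) :* m) :* R) :* (((# 2 :* b) :* m) :* R)) :* ((((# 2 :* b) :* m) :* R) :* (((# 2 :* b) :* m) :* R))) :* (((# 2 :* N) :* (((# 4 :* (t :* t)) :* N) :* ((# 4 :* (t :* t)) :* N))) :+ ((# 2 :* N) :* (((# 4 :* (t :* t)) :* N) :* ((# 4 :* (t :* t)) :* N)))) := ((N :* N) :* N) :* (# 1024 :* ((((b :* R) :* (t :* m)) :* ((b :* R) :* (t :* m))) :* (((b :* R) :* (t :* m)) :* ((b :* R) :* (t :* m)))))) refl 𝕓 μ ℛ ℕN t)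
                    (cong (λ z → ℕN * ℕN * ℕN * (fromℕ 1024 * sqr (sqr (𝕓 * ℛ * z)))) tμ)
        rhs : Q * Q * (1F * sqr (δ * δ)) ≡ sqr (sqr (ℛ * μ))
        rhs = trans (solve 4 (λ b m R d → (((((# 2 :* b) :* m) :* R) :* (((# 2 :* b) :* m) :* R)) :* ((((# 2 :* b) :* m) :* R) :* (((# 2 :* b) :* m) :* R))) :* (# 1 :* ((d :* d) :* (d :* d))) := (((R :* m) :* ((# 2 :* b) :* d)) :* ((R :* m) :* ((# 2 :* b) :* d))) :* (((R :* m) :* ((# 2 :* b) :* d)) :* ((R :* m) :* ((# 2 :* b) :* d)))) refl 𝕓 μ ℛ δ)
                    (trans (cong (λ z → sqr (sqr (ℛ * μ * z))) 2bδ) (cong (λ z → sqr (sqr z)) (*-identityʳ _)))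
        N³>0 : 0F < ℕN * ℕN * ℕN
        N³>0 = *-pos (*-pos 0<N 0<N) 0<N
        middle : ℕN * ℕN * ℕN * (fromℕ 1024 * sqr (sqr (𝕓 * ℛ * 𝕤))) < sqr (sqr ℕN)
        middle = (lin< 0 (sc< 0 (*-pos N³>0 (<⇒0<- nB)) ⊹< sc 1 (≤-reflexive (solve 1 (λ N → ((N :* N) :* N) :* N := (N :* N) :* (N :* N)) refl ℕN))) (solve 4 (λ N n3 x z → # 1 :* (z :- (n3 :* x)) := (# 1 :* ((n3 :* (N :- x)) :- # 0)) :+ (# 1 :* (z :- (n3 :* N)))) refl ℕN (ℕN * ℕN * ℕN) (fromℕ 1024 * sqr (sqr (𝕓 * ℛ * 𝕤))) (sqr (sqr ℕN))))
        N⁴≤ : sqr (sqr ℕN) ≤ sqr (sqr (ℛ * μ))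
        N⁴≤ = mul-mono₂ (sq-nonneg ℕN) (sq-nonneg ℕN) N²≤ N²≤
          where
          N²≤ : sqr ℕN ≤ sqr (ℛ * μ)
          N²≤ = mul-mono₂ (<⇒≤ 0<N) (<⇒≤ 0<N) N≤Rr N≤Rr

      bd : Lo.Bounds
      -- `c₂` makes the initial weight part, with all `G` gadgets charged and all weights 1, equal
      -- to `Ψ₀`; the fourth-moment part starts at most at `Ψ₀`, whence C₀ = 2Ψ₀.
      bd = record { κ<1 = κ<1 ; κ-small = κ-small ; 2≤S = 2≤S ; room = room ; c₁ = 1F ; c₂ = Ψ₀ * recip (yG * TT) ; C₀ = Ψ₀ + Ψ₀
                  ; c₁-nonneg = 0≤1 ; c₂-nonneg = *-nonneg (<⇒≤ Ψ₀>0) (<⇒≤ (recip-pos yT>0)) ; small = small }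

      st₀ : Lo.St (λ _ → false)
      st₀ = record
        -- Nothing is placed yet, so `φ` is an arbitrary constant and all host vertices are free.
        { r = N ; φ = λ _ → Fin.fromℕ< (ℕₚ.<-≤-trans 0<n n≤N) ; ι = id ; ι-inj = λ _ _ h → h ; φ-inj = λ x y () ; avoid = λ x () ; arcs = λ x y ()
        ; count = trans (cong (ℕN +_) (sum-zero {n} (λ _ → refl))) (+-identityʳ _)
        ; hit = λ _ _ → false ; hit-ok = λ τ y () ; D = λ _ _ → 0F ; B = 0F ; wt = λ _ → 1F ; wt-nonneg = λ _ → 0≤1
        ; cnt = λ _ → 0 ; cnt-ok = λ τ → sym (sum-zero {n} (λ _ → refl)) ; wt-ok = λ _ → ≤-refl
        ; dens = λ s v → dens s v ≤≡ (solve 3 (λ b N q → (# 2 :* b) :* q := (# 2 :* b) :* ((q :+ (N :* # 0)) :+ (N :* # 0))) refl 𝕓 ℕN (sum (λ i → [ adjOf arc s v i ]))) }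

      pot₀ : Lo.Potential bd st₀ Li.pieces ≤ Ψ₀ + Ψ₀
      pot₀ = +-mono-≤ first (≤-reflexive second)
        where
        Jn W : F
        Jn = fromℕ (List.length Li.pieces)
        W = sqr (0F * 0F + fromℕ 4 * σ * Jn)
        Jn≤N : Jn ≤ ℕN
        Jn≤N = ≤-trans Li.pieces-length (fromℕ-≤ n≤N)
        inner : 0F * 0F + fromℕ 4 * σ * Jn ≤ fromℕ 4 * σ * ℕN
        inner = (lin 0 (sc 4 (*-nonneg (<⇒≤ σ>0) (≤⇒0≤- Jn≤N))) (solve 3 (λ s Jn N → # 1 :* (((# 4 :* s) :* N) :- ((# 0 :* # 0) :+ ((# 4 :* s) :* Jn))) := # 4 :* ((s :* (N :- Jn)) :- # 0)) refl σ Jn ℕN))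
        inner≥0 : 0F ≤ 0F * 0F + fromℕ 4 * σ * Jn
        inner≥0 = (lin 0 (sc 4 (*-nonneg (<⇒≤ σ>0) (0≤fromℕ (List.length Li.pieces)))) (solve 2 (λ s Jn → # 1 :* (((# 0 :* # 0) :+ ((# 4 :* s) :* Jn)) :- # 0) := # 4 :* ((s :* Jn) :- # 0)) refl σ Jn))
        first : 1F * Σ₂ {N} (λ _ _ → W) ≤ Ψ₀
        first = (lin 0 (sc 2 (≤-reflexive (sum-const N W)) ⊹ sc 2 (*-nonneg (<⇒≤ 0<N) (≤⇒0≤- (mul-mono₂ inner≥0 inner≥0 inner inner)))) (solve 4 (λ w a N z → # 1 :* (((# 2 :* N) :* z) :- (# 1 :* (a :+ a))) := (# 2 :* ((N :* w) :- a)) :+ (# 2 :* ((N :* (z :- w)) :- # 0))) refl W (sum {N} (λ _ → W)) ℕN (sqr (fromℕ 4 * σ * ℕN))))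
        second : Ψ₀ * recip (yG * TT) * (yG * sum {T} (λ _ → 1F)) ≡ Ψ₀
        second = trans (cong (λ z → Ψ₀ * recip (yG * TT) * (yG * z)) (trans (sum-const T 1F) (*-identityʳ _))) (trans (solve 3 (λ p r x → (p :* r) :* x := p :* (x :* r)) refl Ψ₀ (recip (yG * TT)) (yG * TT)) (trans (cong (Ψ₀ *_) (recip-inv yT>0)) (*-identityʳ _)))

      -- Four sources of bias, each at most δ/4: trees with exceptional roots, shallow vertices, the
      -- mixing error at depth k₀, and collisions.
      bud₀ : 0F + Lo.budget Li.pieces ≤ δ
      bud₀ = mul-cancel (*-pos 0<𝕓 0<μ) (lin 7 (sc 8 (≤-reflexive (cong (λ z → 𝕓 * μ * z) (trans Li.pieces-budget (sum-*ʳ ρ (λ x → g ^^ A.pd x + κ))))) ⊹ sc 8 (≤-reflexive (cong (λ z → 𝕓 * sum (λ x → g ^^ A.pd x + κ) * z) μρ)) ⊹ sc 8 (≤-reflexive (cong (𝕓 *_) (trans (sum-+ (λ x → g ^^ A.pd x) (λ _ → κ)) (cong (sum (λ x → g ^^ A.pd x) +_) (sum-const n κ))))) ⊹ sc 8 (*-nonneg (<⇒≤ 0<𝕓) (≤⇒0≤- (Sw.weight g≥0 (lin 0 (sc 1 (<⇒≤ (0<γ 0<b))) (solve 1 (λ x → # 1 :* (# 1 :- (# 1 :- x)) := # 1 :* (x :- # 0)) refl (γ b)))))) ⊹ sc 1 Sh≤ ⊹ sc 8 (*-nonneg (*-nonneg (<⇒≤ 0<𝕓) (^^-nonneg g≥0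 k₀)) (≤⇒0≤- n≤Rr)) ⊹ sc 1 (*-nonneg (<⇒≤ 0<μ) (≤⇒0≤- pow-tiny)) ⊹ sc 8 (*-nonneg (*-nonneg (<⇒≤ 0<𝕓) κ≥0) (≤⇒0≤- n≤Rr)) ⊹ sc 1 (*-nonneg (<⇒≤ 0<μ) (≤⇒0≤- κ-tiny)) ⊹ sc 4 (≤-reflexive (sym (cong (μ *_) 2bδ)))) (solve 12 (λ b m d B w wk n k r H y R → # 8 :* (((b :* m) :* d) :- ((b :* m) :* (# 0 :+ B))) := (# 8 :* (((b :* m) :* (wk :* r)) :- ((b :* m) :* B))) :+ ((# 8 :* (((b :* wk) :* # 1) :- ((b :* wk) :* (m :* r)))) :+ ((# 8 :* ((b :* (w :+ (n :* k))) :- (b :* wk))) :+ ((# 8 :* ((b :* ((H :+ (n :* y)) :- w)) :- # 0)) :+ ((# 1 :* ((# 2 :* m) :- ((# 8 :* b) :* H))) :+ ((# 8 :* (((b :* y) :* ((R :* m) :- n)) :- # 0)) :+ ((# 1 :* ((m :* (# 1 :- (((# 8 :* b) :* R) :* y))) :- # 0)) :+ ((# 8 :* (((b :* k) :* ((R :* m) :- n)) :- # 0)) :+ ((# 1 :* ((m :* (# 1 :- (((# 8 :* b) :* R) :* k))) :- # 0)) :+ (# 4 :* ((m :* ((# 2 :* b) :* d)) :- (m :* # 1)))))))))))) refl 𝕓 μ δ (Lo.budget Li.pieces) (sum (λ x → g ^^ A.pd x)) (sum {n} (λ x → g ^^ A.pd x + κ)) 𝕟 κ ρ Sw.Sh (g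 ^^ k₀) ℛ))

      opaque
        final : Σ (Lo.St ((λ _ → false) Lo.∪* Li.pieces)) λ st → ∀ τ → Ψ₀ * recip (yG * TT) * x₁ ^^ Lo.St.cnt st τ ≤ Ψ₀ + Ψ₀
        final = Lo.loop bd Li.pieces (λ _ → false) st₀ (proj₁ Li.pieces-valid) pot₀ bud₀

      all-done : ∀ x → ((λ _ → false) Lo.∪* Li.pieces) x ≡ true
      all-done = proj₂ Li.pieces-valid

      module St = Lo.St (proj₁ final)

      -- The final bound of the loop divided by `c₂`.
      few : ∀ τ → x₁ ^^ St.cnt τ ≤ fromℕ 2 * TT * yG
      few τ = mul-cancel Ψ₀>0 (subst₂ _≤_ lhs rhs (mul-mono (<⇒≤ yT>0) (proj₂ final τ)))
        where
        X : F
        X = x₁ ^^ St.cnt τ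
        lhs : yG * TT * (Ψ₀ * recip (yG * TT) * X) ≡ Ψ₀ * X
        lhs = trans (solve 4 (λ y p r X → y :* ((p :* r) :* X) := (y :* r) :* (p :* X)) refl (yG * TT) Ψ₀ (recip (yG * TT)) X) (trans (cong (_* (Ψ₀ * X)) (recip-inv yT>0)) (*-identityˡ _))
        rhs : yG * TT * (Ψ₀ + Ψ₀) ≡ Ψ₀ * (fromℕ 2 * TT * yG)
        rhs = (solve 3 (λ y t p → (y :* t) :* (p :+ p) := p :* ((# 2 :* t) :* y)) refl yG TT Ψ₀)

      -- At least 2·P₁·rmin gadgets survive the cutting, so `y₀`^G is at most `x₁`^(2·rmin). If some
      -- test had at most rmin hits, `few` would give 1 ≤ 2T·`x₁`^rmin. But `x₁`^S is at most 1/2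
      -- and rmin is at least S², so 2T would be at least 2^S.
      many-hits : fromℕ (2 ℕ.* P₁ b ℕ.+ 3) * fromℕ rmin ≤ sum (λ y → [ Y y ]) → fromℕ 2 * fromℕ T < fromℕ 2 ^^ S → ∀ τ → rmin ℕ.< St.cnt τ
      many-hits enough big τ with rmin ℕ.<? St.cnt τ
      ... | yes p = p
      ... | no ¬p = ⊥-elim (<⇒≱ big (mul-cancel (^^-pos (recip-pos (0<fromℕ 1)) S) (subst₂ _≤_ (sym half-pow) refl contra)))
        where
        M : ℕ
        M = rmin
        G≥ : 2 ℕ.* P₁ b ℕ.* M ℕ.≤ G
        G≥ = fromℕ-≤⁻ (lin 7 (sc 8 (≤-reflexive (fromℕ-* (2 ℕ.* P₁ b) M)) ⊹ sc 8 (≤-reflexive (sym (cong (_* μ) (fromℕ-+ (2 ℕ.* P₁ b) 3)))) ⊹ sc 8 enough ⊹ sc 8 (Sw.gadgets-lost (ℕₚ.m≤n+m 3 _)) ⊹ sc 8 Li.pieces-gtotal ⊹ sc 3 Sh≤ ⊹ sc 24 (*-nonneg (≤⇒0≤- (fromℕ-≤ 0<b)) Sh≥0) ⊹ sc 18 (<⇒≤ 0<μ)) (solve 9 (λ g l q q3 m o yy H b → # 8 :* (g :- l) := (# 8 :* ((q :* m) :- l)) :+ ((# 8 :* ((q3 :* m) :- ((q :+ # 3) :* m))) :+ ((# 8 :* (yy :- (q3 :* m))) :+ ((# 8 :* ((o :+ (# 3 :* H)) :- yy)) :+ ((# 8 :* (g :- o)) :+ ((# 3 :* ((# 2 :* m)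 :- ((# 8 :* b) :* H))) :+ ((# 24 :* (((b :- # 1) :* H) :- # 0)) :+ (# 18 :* (m :- # 0))))))))) refl (fromℕ G) (fromℕ (2 ℕ.* P₁ b ℕ.* M)) (fromℕ (2 ℕ.* P₁ b)) (fromℕ (2 ℕ.* P₁ b ℕ.+ 3)) μ (sum (λ y → [ A.okY y ])) (sum (λ y → [ Y y ])) Sw.Sh 𝕓))
          where
          Sh≥0 : 0F ≤ Sw.Sh
          Sh≥0 = *-nonneg (0≤fromℕ _) e≥0 ⊹ sum-nonneg (λ x → []-nonneg (Sw.shallow x))
        y≤x : y₀ ^^ P₁ b ≤ x₁
        -- By `P₁-eq` the product P₁·ξp₀/2 is 8ξ, so the left side is at most 1/(1+8ξ), and
        -- (1-2ξ)(1+8ξ) ≥ 1 because 4ξ ≤ 1.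
        y≤x = (lin 0 (sc 1 (*-nonneg (≤⇒0≤- (one-minus-pow px≥0 px≤1 (P₁ b))) (<⇒≤ x₁>0)) ⊹ sc 1 (≤-reflexive (sym (cong (λ z → y₀ ^^ P₁ b * (1F - fromℕ 2 * ξ) * ξ * half * z) P₁-eq))) ⊹ sc 8 (≤-reflexive (sym (cong (λ z → y₀ ^^ P₁ b * (1F - fromℕ 2 * ξ) * ξ * z) 2half))) ⊹ sc 4 (*-nonneg (*-nonneg (^^-nonneg (<⇒≤ y₀>0) (P₁ b)) (<⇒≤ 0<ξ)) (≤⇒0≤- 4ξ≤1)) ⊹ sc 2 (*-nonneg (^^-nonneg (<⇒≤ y₀>0) (P₁ b)) (<⇒≤ 0<ξ))) (solve 5 (λ Y x P p hf → # 1 :* ((# 1 :- (# 2 :* x)) :- Y) := (# 1 :* (((# 1 :- (Y :* (# 1 :+ (P :* (x :* (p :* hf)))))) :* (# 1 :- (# 2 :* x))) :- # 0)) :+ ((# 1 :* (((((Y :* (# 1 :- (# 2 :* x))) :* x) :* hf) :* (P :* p)) :- ((((Y :* (# 1 :- (# 2 :* x))) :* x) :* hf) :* # 16))) :+ ((# 8 :* ((((Y :* (# 1 :- (# 2 :* x))) :* x) :* (# 2 :* hf)) :- (((Y :* (# 1 :- (# 2 :* x))) :* x) :* # 1))) :+ ((# 4 :* (((Y :* x) :* (# 1 :- (# 4 :* x))) :- # 0)) :+ (# 2 :* ((Y :* x) :- # 0)))))) refl (y₀ ^^ P₁ b) ξ (fromℕ (P₁ b)) p₀ half))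
          where
          px≥0 : 0F ≤ ξ * (p₀ * half)
          px≥0 = *-nonneg (<⇒≤ 0<ξ) (*-nonneg (<⇒≤ 0<p₀) (<⇒≤ (recip-pos (0<fromℕ 1))))
          px≤1 : ξ * (p₀ * half) ≤ 1F
          px≤1 = ≤-trans px≤ξ (lin 0 (sc 1 4ξ≤1 ⊹ sc 3 (<⇒≤ 0<ξ)) (solve 1 (λ x → # 1 :* (# 1 :- x) := (# 1 :* (# 1 :- (# 4 :* x))) :+ (# 3 :* (x :- # 0))) refl ξ))
        x₁≤1 : x₁ ≤ 1F
        x₁≤1 = (lin 0 (sc 2 (<⇒≤ 0<ξ)) (solve 1 (λ x → # 1 :* (# 1 :- (# 1 :- (# 2 :* x))) := # 2 :* (x :- # 0)) refl ξ))
        y₀≤1 : y₀ ≤ 1F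
        y₀≤1 = (lin 0 (sc 1 (*-nonneg (<⇒≤ 0<ξ) (*-nonneg (<⇒≤ 0<p₀) (<⇒≤ (recip-pos (0<fromℕ 1)))))) (solve 1 (λ x → # 1 :* (# 1 :- (# 1 :- x)) := # 1 :* (x :- # 0)) refl (ξ * (p₀ * half))))
        xM : F
        xM = x₁ ^^ M
        xM>0 : 0F < xM
        xM>0 = ^^-pos x₁>0 M
        yG≤ : yG ≤ xM * xM
        yG≤ = ≤-trans (pow-antitone (<⇒≤ y₀>0) y₀≤1 G≥) (≤-reflexive (trans (cong (y₀ ^^_) split) (trans (^^-+ y₀ (P₁ b ℕ.* M) (P₁ b ℕ.* M)) (cong₂ _*_ (^^-* y₀ (P₁ b) M) (^^-* y₀ (P₁ b) M)))) ⨾ mul-mono₂ pw≥0 pw≥0 pw pw)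
          where
          infixr 3 _⨾_
          _⨾_ : ∀ {x y z} → x ≤ y → y ≤ z → x ≤ z
          _⨾_ = ≤-trans
          split : 2 ℕ.* P₁ b ℕ.* M ≡ P₁ b ℕ.* M ℕ.+ P₁ b ℕ.* M
          split = trans (ℕₚ.*-assoc 2 (P₁ b) M) (cong (P₁ b ℕ.* M ℕ.+_) (ℕₚ.+-identityʳ _))
          pw≥0 : 0F ≤ (y₀ ^^ P₁ b) ^^ M
          pw≥0 = ^^-nonneg (^^-nonneg (<⇒≤ y₀>0) (P₁ b)) M
          pw : (y₀ ^^ P₁ b) ^^ M ≤ xM
          pw = ^^-mono (^^-nonneg (<⇒≤ y₀>0) (P₁ b)) y≤x M
        one≤ : 1F ≤ fromℕ 2 * TT * xM
        one≤ = mul-cancel xM>0 (lin 0 (sc 1 (pow-antitone (<⇒≤ x₁>0) x₁≤1 (ℕₚ.≮⇒≥ ¬p)) ⊹ sc 1 (few τ) ⊹ sc 2 (*-nonneg (<⇒≤ 0<TT) (≤⇒0≤- yG≤))) (solve 4 (λ x t y z → # 1 :* ((x :* ((# 2 :* t) :* x)) :- (x :* # 1)) := (# 1 :* (z :- x)) :+ ((# 1 :* (((# 2 :* t) :* y) :- z)) :+ (# 2 :* ((t :* ((x :* x) :- y)) :- # 0)))) refl xM TT yG (x₁ ^^ St.cnt τ)))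
        xS≤half : x₁ ^^ S ≤ half
        xS≤half = (lin 1 (sc 1 (one-minus-pow 2ξ≥0 2ξ≤1 S) ⊹ sc 1 (≤-reflexive (sym (cong (x₁ ^^ S *_) 2sξ))) ⊹ sc 1 (≤-reflexive (sym 2half))) (solve 4 (λ y s x hf → # 2 :* (hf :- y) := (# 1 :* (# 1 :- (y :* (# 1 :+ (s :* (# 2 :* x)))))) :+ ((# 1 :* ((y :* ((# 2 :* s) :* x)) :- (y :* # 1))) :+ (# 1 :* ((# 2 :* hf) :- # 1)))) refl (x₁ ^^ S) 𝕤 ξ half))
          where
          2ξ≥0 : 0F ≤ fromℕ 2 * ξ
          2ξ≥0 = *-nonneg (0≤fromℕ 2) (<⇒≤ 0<ξ)
          2ξ≤1 : fromℕ 2 * ξ ≤ 1F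
          2ξ≤1 = (lin 0 (sc 1 4ξ≤1 ⊹ sc 2 (<⇒≤ 0<ξ)) (solve 1 (λ x → # 1 :* (# 1 :- (# 2 :* x)) := (# 1 :* (# 1 :- (# 4 :* x))) :+ (# 2 :* (x :- # 0))) refl ξ))
        SS≤M : S ℕ.* S ℕ.≤ M
        SS≤M = fromℕ-≤⁻ (mul-cancel 0<ℛ (lin 0 (sc 1 (≤-reflexive (cong (ℛ *_) (fromℕ-* S S))) ⊹ sc 1 nE ⊹ sc 1 N≤Rr) (solve 5 (λ R s ss m N → # 1 :* ((R :* m) :- (R :* ss)) := (# 1 :* ((R :* (s :* s)) :- (R :* ss))) :+ ((# 1 :* (N :- (R :* (s :* s)))) :+ (# 1 :* ((R :* m) :- N)))) refl ℛ 𝕤 (fromℕ (S ℕ.* S)) μ ℕN)))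
        xM≤ : xM ≤ half ^^ S
        xM≤ = ≤-trans (pow-antitone (<⇒≤ x₁>0) x₁≤1 SS≤M ≤≡ ^^-* x₁ S S) (^^-mono (^^-nonneg (<⇒≤ x₁>0) S) xS≤half S)
        half-pow : half ^^ S * fromℕ 2 ^^ S ≡ 1F
        half-pow = trans (sym (*-^^ half (fromℕ 2) S)) (trans (cong (_^^ S) (trans (*-comm half (fromℕ 2)) 2half)) (one^^ S))
        contra : 1F ≤ half ^^ S * (fromℕ 2 * TT)
        contra = (lin 0 (sc 1 one≤ ⊹ sc 2 (*-nonneg (<⇒≤ 0<TT) (≤⇒0≤- xM≤))) (solve 3 (λ t x z → # 1 :* ((z :* (# 2 :* t)) :- # 1) := (# 1 :* (((# 2 :* t) :* x) :- # 1)) :+ (# 2 :* ((t :* (z :- x)) :- # 0))) refl TT xM (half ^^ S)))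

    embedded : Embedded arc arcD real Y test b rmin S
    embedded = record
      { r = St.r ; φ = St.φ ; ι = St.ι ; ι-inj = St.ι-inj
      ; φ-inj = λ x y rx ry → St.φ-inj x y (all-done x) rx (all-done y) ry ; avoid = λ x rx → St.avoid x (all-done x) rx
      ; arcs = λ x y rx ry → St.arcs x y (all-done x) rx (all-done y) ry
      ; count = trans (cong (fromℕ St.r +_) (sum-cong (λ x → cong (λ c → [ c ∧ real x ]) (sym (all-done x))))) St.count
      ; hit = St.hit
      ; hit-ok = λ τ y h → let _ , Yr , t₁ , t₂ , ins , outs = St.hit-ok τ y h in Yr , t₁ , t₂ , (λ d a → proj₂ (proj₂ (ins d a))) , λ d a → proj₂ (proj₂ (outs d a))
      ; many-hits = λ enough big τ → <-≤-trans (fromℕ-< (many-hits enough big τ)) (≤-reflexive (St.cnt-ok τ)) }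

-- The exponential series, the degree bound, and the choice of tree size.

module Numerics where
  open import Defs
  open OrderedField
  open Sums
  open Transport using (hh; cap)
  open RandomWalks
  open Selection
  open Shifting
  open Embed

  ℚ→F-^ : ∀ p a → ℚ→F (p ^ℚ a) ≡ ℚ→F p ^^ a
  ℚ→F-^ p zero = ℚ→F-1
  ℚ→F-^ p (suc a) = trans (ℚ→F-* p (p ^ℚ a)) (cong (ℚ→F p *_) (ℚ→F-^ p a))

  PE inv! : ℕ → F
  PE N = ℚ→F (partialE N)
  inv! N = ℚ→F ((ℤ.+ 1 ℚ./ (N !)) {{ℕₚ._!≢0 N}})

  PE-suc : ∀ N → PE (suc N) ≡ PE N + inv! N
  PE-suc N = ℚ→F-+ (partialE N) _

  inv!-eq : ∀ N → fromℕ (N !) * inv! N ≡ 1F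
  inv!-eq N = ℚ→F-recip (N !) {{ℕₚ._!≢0 N}}

  0<! : ∀ N → 0F < fromℕ (N !)
  0<! N = fromℕ-< (ℕₚ.n≢0⇒n>0 (ℕ.≢-nonZero⁻¹ (N !) {{ℕₚ._!≢0 N}}))

  inv!-step : ∀ N → fromℕ (suc N) * inv! (suc N) ≡ inv! N
  inv!-step N = ≤-antisym (mul-cancel (0<! N) (≤-reflexive eq)) (mul-cancel (0<! N) (≤-reflexive (sym eq)))
    where
    eq : fromℕ (N !) * (fromℕ (suc N) * inv! (suc N)) ≡ fromℕ (N !) * inv! N
    eq = trans (solve 3 (λ a b c → a :* (b :* c) := (b :* a) :* c) refl (fromℕ (N !)) (fromℕ (suc N)) (inv! (suc N))) (trans (cong (_* inv! (suc N)) (sym (fromℕ-* (suc N) (N !)))) (trans (inv!-eq (suc N)) (sym (inv!-eq N))))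

  inv!-nonneg : ∀ N → 0F ≤ inv! N
  inv!-nonneg N = mul-cancel (0<! N) ((zeroʳ _) ≡≤ (0≤1 ≤≡ sym (inv!-eq N)))

  -- The surplus 1/(N+1)! carries the induction, since twice 1/(N+2)! does not exceed it.
  PE-bound : ∀ N → PE (suc (suc N)) + inv! (suc N) ≤ fromℕ 3
  PE-bound zero = (lin 0 (sc 1 (≤-reflexive (PE-suc 1)) ⊹ sc 1 (≤-reflexive (PE-suc 0)) ⊹ sc 1 (≤-reflexive ℚ→F-0) ⊹ sc 1 (≤-reflexive (inv!-eq 0)) ⊹ sc 2 (≤-reflexive (inv!-eq 1))) (solve 5 (λ a b z i0 i1 → # 1 :* (# 3 :- (a :+ i1)) := (# 1 :* ((b :+ i1) :- a)) :+ ((# 1 :* ((z :+ i0) :- b)) :+ ((# 1 :* (# 0 :- z)) :+ ((# 1 :* (# 1 :- (# 1 :* i0))) :+ (# 2 :* (# 1 :- (# 1 :* i1))))))) refl (PE 2) (PE 1) (PE 0) (inv! 0) (inv! 1)))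
  PE-bound (suc N) = (lin 0 (sc 1 (≤-reflexive (PE-suc (suc (suc N)))) ⊹ sc 1 (PE-bound N) ⊹ sc 1 (≤-reflexive (inv!-step (suc N))) ⊹ sc 1 (*-nonneg (≤⇒0≤- (fromℕ-≤ {2} {suc (suc N)} (ℕ.s≤s (ℕ.s≤s ℕ.z≤n)))) (inv!-nonneg (suc (suc N))))) (solve 5 (λ a b i j m → # 1 :* (# 3 :- (a :+ j)) := (# 1 :* ((b :+ j) :- a)) :+ ((# 1 :* (# 3 :- (b :+ i))) :+ ((# 1 :* (i :- (m :* j))) :+ (# 1 :* (((m :- # 2) :* j) :- # 0))))) refl (PE (suc (suc (suc N)))) (PE (suc (suc N))) (inv! (suc N)) (inv! (suc (suc N))) (fromℕ (suc (suc N)))))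

  PE-nonneg : ∀ N → 0F ≤ PE N
  PE-nonneg zero = ≤-reflexive (sym ℚ→F-0)
  PE-nonneg (suc N) = (PE-nonneg N ⊹ inv!-nonneg N) ≤≡ sym (PE-suc N)

  PE≤3 : ∀ N → PE N ≤ fromℕ 3
  PE≤3 N = (lin 0 (sc 1 (≤-reflexive (sym (PE-suc N))) ⊹ sc 1 (≤-reflexive (sym (PE-suc (suc N)))) ⊹ sc 1 (inv!-nonneg N) ⊹ sc 2 (inv!-nonneg (suc N)) ⊹ sc 1 (PE-bound N)) (solve 5 (λ a b c i j → # 1 :* (# 3 :- a) := (# 1 :* (b :- (a :+ i))) :+ ((# 1 :* (c :- (b :+ j))) :+ ((# 1 :* (i :- # 0)) :+ ((# 2 :* (j :- # 0)) :+ (# 1 :* (# 3 :- (c :+ j))))))) refl (PE N) (PE (suc N)) (PE (suc (suc N))) (inv! N) (inv! (suc N))))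

  -- With its converse companion `ExpLE⇒2^≤` this replaces the exponential by integer powers,
  -- through 2 ≤ e ≤ 3.
  3^≤⇒ExpLE : ∀ a M → 3 ℕ.^ a ℕ.≤ M → ExpLE a M
  3^≤⇒ExpLE a M h N = ℚ→F-≤⁻ (ℚ→F-^ (partialE N) a ≡≤ ≤-trans (^^-mono (PE-nonneg N) (PE≤3 N) a) (sym (fromℕ-^ 3 a) ≡≤ (fromℕ-≤ h ≤≡ sym (ℚ→F-ℕ M))))

  ExpLE⇒2^≤ : ∀ a M → ExpLE a M → 2 ℕ.^ a ℕ.≤ M
  ExpLE⇒2^≤ a M h = fromℕ-≤⁻ (trans (fromℕ-^ 2 a) (trans (cong (_^^ a) (sym PE2)) (sym (ℚ→F-^ (partialE 2) a))) ≡≤ (ℚ→F-≤ (h 2) ≤≡ ℚ→F-ℕ M))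
    where
    PE2 : PE 2 ≡ fromℕ 2
    PE2 = (≤-antisym (lin 0 (sc 1 (≤-reflexive (PE-suc 1)) ⊹ sc 1 (≤-reflexive (PE-suc 0)) ⊹ sc 1 (≤-reflexive ℚ→F-0) ⊹ sc 1 (≤-reflexive (inv!-eq 0)) ⊹ sc 1 (≤-reflexive (inv!-eq 1))) (solve 5 (λ a b z i0 i1 → # 1 :* (# 2 :- a) := (# 1 :* ((b :+ i1) :- a)) :+ ((# 1 :* ((z :+ i0) :- b)) :+ ((# 1 :* (# 0 :- z)) :+ ((# 1 :* (# 1 :- (# 1 :* i0))) :+ (# 1 :* (# 1 :- (# 1 :* i1))))))) refl (PE 2) (PE 1) (PE 0) (inv! 0) (inv! 1))) (lin 0 (sc 1 (≤-reflexive (sym (PE-suc 1))) ⊹ sc 1 (≤-reflexive (sym (PE-suc 0))) ⊹ sc 1 (≤-reflexive (sym ℚ→F-0)) ⊹ sc 1 (≤-reflexive (sym (inv!-eq 0))) ⊹ sc 1 (≤-reflexive (sym (inv!-eq 1)))) (solve 5 (λ a b z i0 i1 → # 1 :* (a :- # 2) := (# 1 :* (a :- (b :+ i1))) :+ ((# 1 :* (b :- (z :+ i0))) :+ ((# 1 :* (z :- # 0)) :+ ((# 1 :* ((# 1 :* i0) :- # 1)) :+ (# 1 :* ((# 1 :* i1) :- # 1)))))) refl (PE 2) (PE 1) (PE 0) (inv! 0) (inv! 1))))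

  -- the last argument at which f is still at most n
  last≤ : ∀ (f : ℕ → ℕ) n m → f 0 ℕ.≤ n → n ℕ.< f m → ∃[ a ] (f a ℕ.≤ n × n ℕ.< f (suc a))
  last≤ f n zero h0 hm = ⊥-elim (ℕₚ.<⇒≱ hm h0)
  last≤ f n (suc m) h0 hm with f m ℕ.≤? n
  ... | yes p = m , p , hm
  ... | no p = last≤ f n m h0 (ℕₚ.≰⇒> p)

  n<2^n : ∀ n → n ℕ.< 2 ℕ.^ n
  n<2^n zero = ℕ.s≤s ℕ.z≤n
  n<2^n (suc n) = ℕₚ.≤-trans (ℕₚ.+-mono-≤ (ℕₚ.≤-trans (ℕ.s≤s ℕ.z≤n) (n<2^n n)) (n<2^n n)) (ℕₚ.≤-reflexive (cong (2 ℕ.^ n ℕ.+_) (sym (ℕₚ.+-identityʳ _))))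

  -- Δ ≤ exp(√(log n / K)) makes every fixed power of Δ + 1 small compared with n.
  degree-power : ∀ C k → ∃[ n₀ ] ∀ K n Δ → 1 ℕ.≤ K → n₀ ℕ.≤ n → 1 ℕ.≤ Δ → DegreeBound K Δ n → C ℕ.* (suc Δ ℕ.^ k) ℕ.^ 4 ℕ.≤ n
  degree-power C k = 2 ℕ.^ big , bound
    where
    -- From `A` on, a² is at least C + 8(a+1)k. For smaller a the power is below the constant
    -- 2^`big`.
    A big : ℕ
    A = C ℕ.+ (k ℕ.* 8 ℕ.+ k ℕ.* 8) ℕ.+ 1
    big = C ℕ.+ 2 ℕ.* suc A ℕ.* k ℕ.* 4
    bound : ∀ K n Δ → 1 ℕ.≤ K → 2 ℕ.^ big ℕ.≤ n → 1 ℕ.≤ Δ → DegreeBound K Δ n → C ℕ.* (suc Δ ℕ.^ k) ℕ.^ 4 ℕ.≤ n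
    bound K n Δ K≥1 n≥ Δ≥1 db = ℕₚ.≤-trans step (main (ℕₚ.≤-total A a))
      where
      3^Δ : Δ ℕ.< 3 ℕ.^ Δ
      3^Δ = ℕₚ.<-≤-trans (n<2^n Δ) (ℕₚ.^-monoˡ-≤ Δ (ℕ.s≤s (ℕ.s≤s ℕ.z≤n)))
      -- a is the integer part of log₃ Δ: then e^a ≤ Δ, so the degree bound at the exponent a/1
      -- gives n ≥ 2^(Ka²), while Δ + 1 ≤ 4^(a+1).
      fa : ∃[ a ] (3 ℕ.^ a ℕ.≤ Δ × Δ ℕ.< 3 ℕ.^ suc a)
      fa = last≤ (3 ℕ.^_) Δ Δ Δ≥1 3^Δ
      a : ℕ
      a = proj₁ fa
      Δ<4 : suc Δ ℕ.≤ 2 ℕ.^ (2 ℕ.* suc a)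
      Δ<4 = ℕₚ.≤-trans (proj₂ (proj₂ fa)) (subst (3 ℕ.^ suc a ℕ.≤_) (ℕₚ.^-*-assoc 2 2 (suc a)) (ℕₚ.^-monoˡ-≤ (suc a) (ℕ.s≤s (ℕ.s≤s (ℕ.s≤s ℕ.z≤n)))))
      step : C ℕ.* (suc Δ ℕ.^ k) ℕ.^ 4 ℕ.≤ 2 ℕ.^ (C ℕ.+ 2 ℕ.* suc a ℕ.* k ℕ.* 4)
      step = ℕₚ.≤-trans (ℕₚ.*-mono-≤ (ℕₚ.<⇒≤ (n<2^n C)) (ℕₚ.≤-trans (ℕₚ.^-monoˡ-≤ 4 (ℕₚ.^-monoˡ-≤ k Δ<4))
          (ℕₚ.≤-reflexive (trans (cong (ℕ._^ 4) (ℕₚ.^-*-assoc 2 (2 ℕ.* suc a) k)) (ℕₚ.^-*-assoc 2 (2 ℕ.* suc a ℕ.* k) 4))))) (ℕₚ.≤-reflexive (sym (ℕₚ.^-distribˡ-+-* 2 C (2 ℕ.* suc a ℕ.* k ℕ.* 4))))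
      main : A ℕ.≤ a ⊎ a ℕ.≤ A → 2 ℕ.^ (C ℕ.+ 2 ℕ.* suc a ℕ.* k ℕ.* 4) ℕ.≤ n
      main (inj₂ a≤A) = ℕₚ.≤-trans (ℕₚ.^-monoʳ-≤ 2 (ℕₚ.+-monoʳ-≤ C (ℕₚ.*-monoˡ-≤ 4 (ℕₚ.*-monoˡ-≤ k (ℕₚ.*-monoʳ-≤ 2 (ℕ.s≤s a≤A)))))) n≥
      main (inj₁ A≤a) = ℕₚ.≤-trans (ℕₚ.^-monoʳ-≤ 2 (ℕₚ.≤-trans quad (ℕₚ.≤-trans (ℕₚ.m≤n*m (a ℕ.* a) K {{ℕ.>-nonZero K≥1}}) (ℕₚ.≤-reflexive (sym (ℕₚ.*-assoc K a a))))))
          (ExpLE⇒2^≤ (K ℕ.* a ℕ.* a) n (subst (ExpLE (K ℕ.* a ℕ.* a)) (ℕₚ.^-identityʳ n) (db a 1 (subst (ExpLE a) (sym (ℕₚ.^-identityʳ Δ)) (3^≤⇒ExpLE a Δ (proj₁ (proj₂ fa)))))))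
        where
        quad : C ℕ.+ 2 ℕ.* suc a ℕ.* k ℕ.* 4 ℕ.≤ a ℕ.* a
        quad = fromℕ-≤⁻ (lin 0 (sc 1 (≤-reflexive (trans (fromℕ-+ C _) (cong (fromℕ C +_) (trans (fromℕ-* (2 ℕ.* suc a ℕ.* k) 4) (cong (_* fromℕ 4) (trans (fromℕ-* (2 ℕ.* suc a) k) (cong (_* fromℕ k) (fromℕ-* 2 (suc a))))))))) ⊹ sc 8 (≤-reflexive (cong (_* fromℕ k) (fromℕ-suc a))) ⊹ sc 1 (≤-reflexive (sym (fromℕ-* a a))) ⊹ sc 1 (*-nonneg (≤⇒0≤- (fromℕ-≤ A≤a)) (0≤fromℕ a)) ⊹ sc 1 (≤-reflexive (sym (cong (_* fromℕ a) A-eq))) ⊹ sc 1 (*-nonneg (≤⇒0≤- a≥1) (0≤fromℕ C)) ⊹ sc 8 (*-nonneg (≤⇒0≤- a≥1) (0≤fromℕ k)) ⊹ sc 1 (0≤fromℕ a)) (solve 7 (λ l aa a C k a′ A → # 1 :* (aa :- l) := (# 1 :* ((C :+ (((# 2 :* a′) :* k) :* # 4)) :- l)) :+ ((# 8 :* (((# 1 :+ a) :* k) :- (a′ :* k))) :+ ((# 1 :* (aa :- (a :* a))) :+ ((# 1 :* (((a :- A) :* a) :- # 0)) :+ ((# 1 :* ((A :* a) :- (((C :+ ((k :* # 8) :+ (k :* # 8))) :+ # 1) :* a))) :+ ((# 1 :* (((a :- # 1) :* C) :- # 0)) :+ ((# 8 :* (((a :- # 1) :* k) :- # 0)) :+ (#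 1 :* (a :- # 0))))))))) refl (fromℕ (C ℕ.+ 2 ℕ.* suc a ℕ.* k ℕ.* 4)) (fromℕ (a ℕ.* a)) (fromℕ a) (fromℕ C) (fromℕ k) (fromℕ (suc a)) (fromℕ A)))
          where
          A-eq : fromℕ A ≡ fromℕ C + (fromℕ k * fromℕ 8 + fromℕ k * fromℕ 8) + 1F
          A-eq = trans (fromℕ-+ (C ℕ.+ (k ℕ.* 8 ℕ.+ k ℕ.* 8)) 1) (cong (_+ 1F) (trans (fromℕ-+ C _) (cong (fromℕ C +_) (trans (fromℕ-+ (k ℕ.* 8) _) (cong₂ _+_ (fromℕ-* k 8) (fromℕ-* k 8))))))
          a≥1 : 1F ≤ fromℕ a
          a≥1 = fromℕ-≤ (ℕₚ.≤-trans (ℕₚ.m≤n+m 1 (C ℕ.+ (k ℕ.* 8 ℕ.+ k ℕ.* 8))) A≤a)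

  *-^ : ∀ m n e → (m ℕ.* n) ℕ.^ e ≡ m ℕ.^ e ℕ.* n ℕ.^ e
  *-^ m n zero = refl
  *-^ m n (suc e) = trans (cong (m ℕ.* n ℕ.*_) (*-^ m n e)) (ℕₚ.[m*n]*[o*p]≡[m*o]*[n*p] m n (m ℕ.^ e) (n ℕ.^ e))

  Powers : ℕ → ℕ → ℕ → Set
  Powers C k n₀ = ∀ K n Δ D → 1 ℕ.≤ K → n₀ ℕ.≤ n → 1 ℕ.≤ Δ → DegreeBound K Δ n → D ≡ suc Δ ℕ.^ k → C ℕ.* D ℕ.^ 4 ℕ.≤ n

  degree-power′ : ∀ C k → ∃ (Powers C k)
  degree-power′ C k = go (degree-power C k)
    where
    go : ∃[ n₀ ] (∀ K n Δ → 1 ℕ.≤ K → n₀ ℕ.≤ n → 1 ℕ.≤ Δ → DegreeBound K Δ n → C ℕ.* (suc Δ ℕ.^ k) ℕ.^ 4 ℕ.≤ n) → ∃ (Powers C k)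
    go (n₀ , h) = n₀ , λ { K n Δ _ a b c d refl → h K n Δ a b c d }

  -- Induction on the degree: with q = s/2, one factor of the polynomial is absorbed by 2^q and the
  -- polynomial of lower degree, at q, by the other 2^q.
  poly<exp : ∀ e C → ∃[ s₀ ] ∀ s → s₀ ℕ.≤ s → C ℕ.* suc s ℕ.^ e ℕ.< 2 ℕ.^ s
  poly<exp zero C = C , λ s h → ℕₚ.≤-<-trans (ℕₚ.≤-trans (ℕₚ.≤-reflexive (ℕₚ.*-identityʳ C)) h) (n<2^n s)
  poly<exp (suc e) C = go (poly<exp e (C ℕ.* 2 ℕ.^ suc e))
    where
    go : ∃[ s₀ ] (∀ s → s₀ ℕ.≤ s → C ℕ.* 2 ℕ.^ suc e ℕ.* suc s ℕ.^ e ℕ.< 2 ℕ.^ s) → ∃[ s₀ ] ∀ s → s₀ ℕ.≤ s → C ℕ.* suc s ℕ.^ suc e ℕ.< 2 ℕ.^ s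
    go (s₀ , h) = 2 ℕ.* s₀ ℕ.+ 1 , λ s hs → let q = s DM./ 2 in ℕₚ.<-≤-trans (small s q (split s) (enough s hs)) (ℕₚ.≤-trans (ℕₚ.≤-reflexive (sym (ℕₚ.^-distribˡ-+-* 2 q q))) (ℕₚ.^-monoʳ-≤ 2 (twice s)))
      where
      s≤ : ∀ s → s ≡ s DM.% 2 ℕ.+ s DM./ 2 ℕ.* 2
      s≤ s = DM.m≡m%n+[m/n]*n s 2
      twice : ∀ s → s DM./ 2 ℕ.+ s DM./ 2 ℕ.≤ s
      twice s = ℕₚ.≤-trans (ℕₚ.≤-reflexive (trans (cong (s DM./ 2 ℕ.+_) (sym (ℕₚ.+-identityʳ _))) (ℕₚ.*-comm 2 (s DM./ 2)))) (DM.m/n*n≤m s 2)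
      split : ∀ s → suc s ℕ.≤ 2 ℕ.* suc (s DM./ 2)
      split s = ℕₚ.≤-trans (ℕₚ.≤-reflexive (cong suc (s≤ s))) (ℕₚ.≤-trans (ℕ.s≤s (ℕₚ.+-monoˡ-≤ _ (ℕₚ.≤-pred (DM.m%n<n s 2)))) (ℕₚ.≤-reflexive (trans (cong (2 ℕ.+_) (ℕₚ.*-comm (s DM./ 2) 2)) (sym (ℕₚ.*-suc 2 (s DM./ 2))))))
      enough : ∀ s → 2 ℕ.* s₀ ℕ.+ 1 ℕ.≤ s → s₀ ℕ.≤ s DM./ 2
      enough s hs = subst (ℕ._≤ s DM./ 2) (DM.m*n/n≡m s₀ 2) (DM./-monoˡ-≤ 2 (ℕₚ.≤-trans (ℕₚ.≤-reflexive (ℕₚ.*-comm s₀ 2)) (ℕₚ.≤-trans (ℕₚ.m≤m+n _ 1) hs)))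
      small : ∀ s q → suc s ℕ.≤ 2 ℕ.* suc q → s₀ ℕ.≤ q → C ℕ.* suc s ℕ.^ suc e ℕ.< 2 ℕ.^ q ℕ.* 2 ℕ.^ q
      small s q le hq = ℕₚ.≤-<-trans (ℕₚ.*-monoʳ-≤ C (ℕₚ.^-monoˡ-≤ (suc e) le)) (ℕₚ.≤-<-trans (ℕₚ.≤-reflexive rearr) (ℕₚ.≤-<-trans (ℕₚ.*-monoʳ-≤ (C ℕ.* 2 ℕ.^ suc e ℕ.* suc q ℕ.^ e) (n<2^n q)) (ℕₚ.*-monoˡ-< (2 ℕ.^ q) {{ℕ.>-nonZero (ℕₚ.≤-<-trans ℕ.z≤n (n<2^n q))}} (h q hq))))
        where
        open ≡-Reasoning
        rearr : C ℕ.* (2 ℕ.* suc q) ℕ.^ suc e ≡ C ℕ.* 2 ℕ.^ suc e ℕ.* suc q ℕ.^ e ℕ.* suc q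
        rearr = begin
          C ℕ.* (2 ℕ.* suc q) ℕ.^ suc e ≡⟨ cong (C ℕ.*_) (*-^ 2 (suc q) (suc e)) ⟩
          C ℕ.* (2 ℕ.^ suc e ℕ.* suc q ℕ.^ suc e) ≡⟨ sym (ℕₚ.*-assoc C _ _) ⟩
          C ℕ.* 2 ℕ.^ suc e ℕ.* (suc q ℕ.* suc q ℕ.^ e) ≡⟨ cong (C ℕ.* 2 ℕ.^ suc e ℕ.*_) (ℕₚ.*-comm (suc q) _) ⟩
          C ℕ.* 2 ℕ.^ suc e ℕ.* (suc q ℕ.^ e ℕ.* suc q) ≡⟨ sym (ℕₚ.*-assoc (C ℕ.* 2 ℕ.^ suc e) _ _) ⟩
          C ℕ.* 2 ℕ.^ suc e ℕ.* suc q ℕ.^ e ℕ.* suc q ∎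

  IsNat-* : ∀ {x y} → IsNat x → IsNat y → IsNat (x * y)
  IsNat-* (k , refl) (l , refl) = k ℕ.* l , sym (fromℕ-* k l)

  IsNat-ℕ : ∀ k → IsNat (fromℕ k)
  IsNat-ℕ k = k , refl

  -- The base suc s is kept behind an equation: conversion checking would otherwise unfold its powers.
  poly<exp′ : ∀ e C → ∃[ s₀ ] ∀ s → s₀ ℕ.≤ s → ∀ t → t ≡ suc s → C ℕ.* t ℕ.^ e ℕ.< 2 ℕ.^ s
  poly<exp′ e C = go (poly<exp e C)
    where
    go : ∃[ s₀ ] (∀ s → s₀ ℕ.≤ s → C ℕ.* suc s ℕ.^ e ℕ.< 2 ℕ.^ s) → ∃[ s₀ ] ∀ s → s₀ ℕ.≤ s → ∀ t → t ≡ suc s → C ℕ.* t ℕ.^ e ℕ.< 2 ℕ.^ s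
    go (s₀ , h) = s₀ , λ { s hs _ refl → h s hs }

  -- The number of triples of a host vertex and two signed host vertices.
  tests : ℕ → ℕ
  tests N = N ℕ.* (2 ℕ.* N ℕ.* (2 ℕ.* N))

  tests<2^S : ∀ n C S t → n ℕ.≤ C ℕ.* t ℕ.^ 4 → 8 ℕ.* C ℕ.^ 3 ℕ.* t ℕ.^ 12 ℕ.< 2 ℕ.^ S → fromℕ 2 * fromℕ (tests n) < fromℕ 2 ^^ S
  tests<2^S n C S t n≤ lt = ≤-<-trans (≤-reflexive tests-eq) (<-≤-trans (fromℕ-< (ℕₚ.≤-<-trans cube lt)) (≤-reflexive (fromℕ-^ 2 S)))
    where
    tests-eq : fromℕ 2 * fromℕ (tests n) ≡ fromℕ (8 ℕ.* n ℕ.^ 3)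
    tests-eq = trans (cong (fromℕ 2 *_) (trans (fromℕ-* n _) (cong (fromℕ n *_) (trans (fromℕ-* (2 ℕ.* n) (2 ℕ.* n)) (cong₂ _*_ (fromℕ-* 2 n) (fromℕ-* 2 n))))))
      (sym (trans (fromℕ-* 8 (n ℕ.^ 3)) (trans (cong (fromℕ 8 *_) (fromℕ-^ n 3)) (solve 1 (λ n → # 8 :* (n :* (n :* (n :* # 1))) := # 2 :* (n :* ((# 2 :* n) :* (# 2 :* n)))) refl (fromℕ n)))))
    cube : 8 ℕ.* n ℕ.^ 3 ℕ.≤ 8 ℕ.* C ℕ.^ 3 ℕ.* t ℕ.^ 12
    cube = ℕₚ.≤-trans (ℕₚ.*-monoʳ-≤ 8 (ℕₚ.^-monoˡ-≤ 3 n≤)) (ℕₚ.≤-reflexive (trans (cong (8 ℕ.*_) (trans (*-^ C (t ℕ.^ 4) 3) (cong (C ℕ.^ 3 ℕ.*_) (ℕₚ.^-*-assoc t 4 3)))) (sym (ℕₚ.*-assoc 8 (C ℕ.^ 3) (t ℕ.^ 12)))))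

  self≤ : ∀ C m → 1 ℕ.≤ C → 1 ℕ.≤ m → m ℕ.≤ C ℕ.* m ℕ.^ 4
  self≤ C m c1 m1 = ℕₚ.≤-trans (ℕₚ.m≤m*n m (m ℕ.^ 3) {{ℕₚ.m^n≢0 m 3 {{ℕ.>-nonZero m1}}}}) (ℕₚ.m≤n*m (m ℕ.^ 4) C {{ℕ.>-nonZero c1}})

  -- `X` adds up the constants of all conditions in `Num`, so that X·S⁴ ≤ n implies each of them;
  -- the summand 1 provides the strictness of `nB`.
  module SizeConstants (b R : ℕ) where
    𝕓 ℛ c P xA xB xC xD X : F
    𝕓 = fromℕ b
    ℛ = fromℕ R
    c = fromℕ (suc (cap b))
    P = fromℕ (P₁ b)
    xA = fromℕ 2 * c * P * ℛ
    xB = fromℕ 1024 * sqr (sqr (𝕓 * ℛ))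
    xC = fromℕ 256 * sqr (𝕓 * ℛ)
    xD = fromℕ 8 * 𝕓 * ℛ * ℛ * c
    X = xA + xB + xC + xD + ℛ + 1F
    nat : IsNat X
    nat = IsNat-+ (IsNat-+ (IsNat-+ (IsNat-+ (IsNat-+ nA′ nB′) nC′) nD′) (IsNat-ℕ R)) (IsNat-ℕ 1)
      where
      nbR : IsNat (𝕓 * ℛ)
      nbR = IsNat-* (IsNat-ℕ b) (IsNat-ℕ R)
      nA′ : IsNat xA
      nA′ = IsNat-* (IsNat-* (IsNat-* (IsNat-ℕ 2) (IsNat-ℕ _)) (IsNat-ℕ _)) (IsNat-ℕ R)
      nB′ : IsNat xB
      nB′ = IsNat-* (IsNat-ℕ 1024) (IsNat-* (IsNat-* nbR nbR) (IsNat-* nbR nbR))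
      nC′ : IsNat xC
      nC′ = IsNat-* (IsNat-ℕ 256) (IsNat-* nbR nbR)
      nD′ : IsNat xD
      nD′ = IsNat-* (IsNat-* (IsNat-* (IsNat-* (IsNat-ℕ 8) (IsNat-ℕ b)) (IsNat-ℕ R)) (IsNat-ℕ R)) (IsNat-ℕ _)

  Exceeds : ℕ → ℕ → Set
  Exceeds C s₀ = ∀ s → s₀ ℕ.≤ s → ∀ t → t ≡ suc s → 8 ℕ.* C ℕ.^ 3 ℕ.* t ℕ.^ 12 ℕ.< 2 ℕ.^ s

  module ChooseS (b R C k n₁ s₀ : ℕ) (C-eq : fromℕ C ≡ SizeConstants.X b R) (dp : Powers C (suc k) n₁) (pe : Exceeds C s₀) where
    open SizeConstants b R
    xA≥0 : 0F ≤ xA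
    xA≥0 = *-nonneg (*-nonneg (*-nonneg (0≤fromℕ 2) (0≤fromℕ _)) (0≤fromℕ _)) (0≤fromℕ R)
    xB≥0 : 0F ≤ xB
    xB≥0 = *-nonneg (0≤fromℕ 1024) (sq-nonneg _)
    xC≥0 : 0F ≤ xC
    xC≥0 = *-nonneg (0≤fromℕ 256) (sq-nonneg _)
    xD≥0 : 0F ≤ xD
    xD≥0 = *-nonneg (*-nonneg (*-nonneg (*-nonneg (0≤fromℕ 8) (0≤fromℕ b)) (0≤fromℕ R)) (0≤fromℕ R)) (0≤fromℕ _)
    C≥1 : 1 ℕ.≤ C
    C≥1 = fromℕ-≤⁻ (lin 0 (sc 1 (≤-reflexive (sym C-eq)) ⊹ sc 1 xA≥0 ⊹ sc 1 xB≥0 ⊹ sc 1 xC≥0 ⊹ sc 1 xD≥0 ⊹ sc 1 (0≤fromℕ R)) (solve 6 (λ C xA xB xC xD R → # 1 :* (C :- # 1) := (# 1 :* (C :- (((((xA :+ xB) :+ xC) :+ xD) :+ R) :+ # 1))) :+ ((# 1 :* (xA :- # 0)) :+ ((# 1 :* (xB :- # 0)) :+ ((# 1 :* (xC :- # 0)) :+ ((# 1 :* (xD :- # 0)) :+ (# 1 :* (R :- # 0))))))) refl (fromℕ C) xA xB xC xD ℛ))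
    f : ℕ → ℕ
    f s = C ℕ.* s ℕ.^ 4
    opaque
      threshold : ℕ
      threshold = n₁ ℕ.+ C ℕ.* s₀ ℕ.^ 4
      n₁≤ : n₁ ℕ.≤ threshold
      n₁≤ = ℕₚ.m≤m+n n₁ _
      s₀≤ : f s₀ ℕ.≤ threshold
      s₀≤ = ℕₚ.m≤n+m _ n₁
    module _ (K n Δ : ℕ) (K≥1 : 1 ℕ.≤ K) (n≥ : threshold ℕ.≤ n) (Δ≥1 : 1 ℕ.≤ Δ) (db : DegreeBound K Δ n) where
      top : n ℕ.< f (suc n)
      top = self≤ C (suc n) C≥1 (ℕ.s≤s ℕ.z≤n)
      -- S is the largest number with C·S⁴ ≤ n. That is small enough for `Num`, yet at least every
      -- power of Δ + 1 whose fourth power times C is at most n, and large enough for 2^S to exceed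
      -- 8n³.
      la : ∃[ s ] (f s ℕ.≤ n × n ℕ.< f (suc s))
      la = last≤ f n (suc n) (ℕₚ.≤-trans (ℕₚ.≤-reflexive (ℕₚ.*-zeroʳ C)) ℕ.z≤n) top
      S : ℕ
      S = proj₁ la
      below-S : ∀ s → f s ℕ.≤ n → s ℕ.≤ S
      below-S s h = go (s ℕ.≤? S)
        where
        go : Dec (s ℕ.≤ S) → s ℕ.≤ S
        go (yes p) = p
        go (no ¬p) = ⊥-elim (ℕₚ.<⇒≱ (proj₂ (proj₂ la)) (ℕₚ.≤-trans (ℕₚ.*-monoʳ-≤ C (ℕₚ.^-monoˡ-≤ 4 (ℕₚ.≰⇒> ¬p))) h))
      Δ≤S : suc Δ ℕ.^ suc k ℕ.≤ S
      Δ≤S = go (suc Δ ℕ.^ suc k) refl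
        where
        go : ∀ D → D ≡ suc Δ ℕ.^ suc k → D ℕ.≤ S
        go D eq = below-S D (dp K n Δ D K≥1 (ℕₚ.≤-trans n₁≤ n≥) Δ≥1 db eq)
      2≤S : 2 ℕ.≤ S
      2≤S = ℕₚ.≤-trans (ℕₚ.≤-trans (ℕ.s≤s Δ≥1) (ℕₚ.m≤m*n (suc Δ) (suc Δ ℕ.^ k) {{ℕₚ.m^n≢0 (suc Δ) k}})) Δ≤S
      s₀≤S : s₀ ℕ.≤ S
      s₀≤S = below-S s₀ (ℕₚ.≤-trans s₀≤ n≥)
      𝕤 : F
      𝕤 = fromℕ S
      1≤𝕤 : 1F ≤ 𝕤
      1≤𝕤 = fromℕ-≤ (ℕₚ.≤-trans (ℕ.s≤s ℕ.z≤n) 2≤S)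
      numS : ∀ N → n ℕ.≤ N → Num b R S N
      numS N n≤N = record
        { nA = ≤-trans (mul-mono xA≥0 (lin 0 (sc 1 (≤-reflexive (sym (solve 1 (λ s → (s :* s) :* (s :* s) := ((s :* s) :* s) :* s) refl 𝕤))) ⊹ sc 1 (*-nonneg s³≥0 (≤⇒0≤- 1≤𝕤))) (solve 3 (λ s3 s4 s → # 1 :* (s4 :- s3) := (# 1 :* (s4 :- (s3 :* s))) :+ (# 1 :* ((s3 :* (s :- # 1)) :- # 0))) refl (𝕤 * 𝕤 * 𝕤) s⁴ 𝕤))) (use xA (lin 0 (sc 1 (≤-reflexive (sym C-eq)) ⊹ sc 1 xB≥0 ⊹ sc 1 xC≥0 ⊹ sc 1 xD≥0 ⊹ sc 1 (0≤fromℕ R) ⊹ 0≤fromℕ 1) (solve 6 (λ C xA xB xC xD R → # 1 :* (C :- xA) := (# 1 :* (C :- (((((xA :+ xB) :+ xC) :+ xD) :+ R) :+ # 1))) :+ ((# 1 :* (xB :- # 0)) :+ ((# 1 :* (xC :- # 0)) :+ ((# 1 :* (xD :- # 0)) :+ ((# 1 :* (R :- # 0)) :+ # 1))))) refl (fromℕ C) xA xB xC xD ℛ)))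
        ; nB = <-≤-trans (lin< 0 (0<fromℕ 0 ⊹< sc 1 (≤-reflexive (solve 3 (λ b R s → # 1024 :* ((((b :* R) :* s) :* ((b :* R) :* s)) :* (((b :* R) :* s) :* ((b :* R) :* s))) := (# 1024 :* (((b :* R) :* (b :* R)) :* ((b :* R) :* (b :* R)))) :* ((s :* s) :* (s :* s))) refl 𝕓 ℛ 𝕤)) ⊹ sc 1 s⁴≥1) (solve 3 (λ s4 ss xB → # 1 :* (((xB :+ # 1) :* s4) :- ss) := # 1 :+ ((# 1 :* ((xB :* s4) :- ss)) :+ (# 1 :* (s4 :- # 1)))) refl s⁴ (fromℕ 1024 * sqr (sqr (𝕓 * ℛ * 𝕤))) xB))
                (use (xB + 1F) (lin 0 (sc 1 (≤-reflexive (sym C-eq)) ⊹ sc 1 xA≥0 ⊹ sc 1 xC≥0 ⊹ sc 1 xD≥0 ⊹ sc 1 (0≤fromℕ R)) (solve 6 (λ C xA xB xC xD R → # 1 :* (C :- (xB :+ # 1)) := (# 1 :* (C :- (((((xA :+ xB) :+ xC) :+ xD) :+ R) :+ # 1))) :+ ((# 1 :* (xA :- # 0)) :+ ((# 1 :* (xC :- # 0)) :+ ((# 1 :* (xD :- # 0)) :+ (# 1 :* (R :- # 0)))))) refl (fromℕ C) xA xB xC xD ℛ)))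
        ; nC = ≤-trans ((solve 3 (λ b R s → # 256 :* (((b :* R) :* s) :* ((b :* R) :* s)) := (# 256 :* ((b :* R) :* (b :* R))) :* (s :* s)) refl 𝕓 ℛ 𝕤) ≡≤ mul-mono xC≥0 s²≤) (use xC (lin 0 (sc 1 (≤-reflexive (sym C-eq)) ⊹ sc 1 xA≥0 ⊹ sc 1 xB≥0 ⊹ sc 1 xD≥0 ⊹ sc 1 (0≤fromℕ R) ⊹ 0≤fromℕ 1) (solve 6 (λ C xA xB xC xD R → # 1 :* (C :- xC) := (# 1 :* (C :- (((((xA :+ xB) :+ xC) :+ xD) :+ R) :+ # 1))) :+ ((# 1 :* (xA :- # 0)) :+ ((# 1 :* (xB :- # 0)) :+ ((# 1 :* (xD :- # 0)) :+ ((# 1 :* (R :- # 0)) :+ # 1))))) refl (fromℕ C) xA xB xC xD ℛ)))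
        ; nD = ≤-trans (mul-mono xD≥0 s²≤) (use xD (lin 0 (sc 1 (≤-reflexive (sym C-eq)) ⊹ sc 1 xA≥0 ⊹ sc 1 xB≥0 ⊹ sc 1 xC≥0 ⊹ sc 1 (0≤fromℕ R) ⊹ 0≤fromℕ 1) (solve 6 (λ C xA xB xC xD R → # 1 :* (C :- xD) := (# 1 :* (C :- (((((xA :+ xB) :+ xC) :+ xD) :+ R) :+ # 1))) :+ ((# 1 :* (xA :- # 0)) :+ ((# 1 :* (xB :- # 0)) :+ ((# 1 :* (xC :- # 0)) :+ ((# 1 :* (R :- # 0)) :+ # 1))))) refl (fromℕ C) xA xB xC xD ℛ)))
        ; nE = ≤-trans (mul-mono (0≤fromℕ R) s²≤) (use ℛ (lin 0 (sc 1 (≤-reflexive (sym C-eq)) ⊹ sc 1 xA≥0 ⊹ sc 1 xB≥0 ⊹ sc 1 xC≥0 ⊹ sc 1 xD≥0 ⊹ 0≤fromℕ 1) (solve 6 (λ C xA xB xC xD R → # 1 :* (C :- R) := (# 1 :* (C :- (((((xA :+ xB) :+ xC) :+ xD) :+ R) :+ # 1))) :+ ((# 1 :* (xA :- # 0)) :+ ((# 1 :* (xB :- # 0)) :+ ((# 1 :* (xC :- # 0)) :+ ((# 1 :* (xD :- # 0)) :+ # 1))))) refl (fromℕ C) xA xB xC xD ℛ))) }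
        where
        s⁴ : F
        s⁴ = 𝕤 * 𝕤 * (𝕤 * 𝕤)
        0≤𝕤 : 0F ≤ 𝕤
        0≤𝕤 = 0≤fromℕ S
        s³≥0 : 0F ≤ 𝕤 * 𝕤 * 𝕤
        s³≥0 = *-nonneg (*-nonneg 0≤𝕤 0≤𝕤) 0≤𝕤
        s²≥1 : 1F ≤ 𝕤 * 𝕤
        s²≥1 = (sym (*-identityˡ 1F)) ≡≤ mul-mono₂ 0≤1 0≤1 1≤𝕤 1≤𝕤
        s²≤ : 𝕤 * 𝕤 ≤ s⁴
        s²≤ = (lin 0 (sc 1 (*-nonneg (sq-nonneg 𝕤) (≤⇒0≤- s²≥1))) (solve 1 (λ s2 → # 1 :* ((s2 :* s2) :- s2) := # 1 :* ((s2 :* (s2 :- # 1)) :- # 0)) refl (𝕤 * 𝕤)))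
        s⁴≥1 : 1F ≤ s⁴
        s⁴≥1 = ≤-trans s²≥1 s²≤
        use : ∀ x → x ≤ fromℕ C → x * s⁴ ≤ fromℕ N
        use x h = ≤-trans (subst₂ _≤_ (*-comm s⁴ x) (*-comm s⁴ (fromℕ C)) (mul-mono (≤-trans 0≤1 s⁴≥1) h))
          (≤-trans (≤-reflexive (sym (trans (fromℕ-* C (S ℕ.^ 4)) (cong (fromℕ C *_) (trans (fromℕ-^ S 4) (solve 1 (λ s → s :* (s :* (s :* (s :* # 1))) := (s :* s) :* (s :* s)) refl 𝕤)))))) (fromℕ-≤ (ℕₚ.≤-trans (proj₁ (proj₂ la)) n≤N)))
      big : fromℕ 2 * fromℕ (tests n) < fromℕ 2 ^^ S
      big = go (suc S) refl (ℕₚ.<⇒≤ (proj₂ (proj₂ la)))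
        where
        go : ∀ t → t ≡ suc S → n ℕ.≤ C ℕ.* t ℕ.^ 4 → fromℕ 2 * fromℕ (tests n) < fromℕ 2 ^^ S
        go t eq h = tests<2^S n C S t h (pe S s₀≤S t eq)
      found : ∃[ S ] (2 ℕ.≤ S × suc Δ ℕ.^ suc k ℕ.≤ S × (∀ N → n ℕ.≤ N → Num b R S N) × fromℕ 2 * fromℕ (tests n) < fromℕ 2 ^^ S)
      found = S , 2≤S , Δ≤S , numS , big

  Chooses : ℕ → ℕ → ℕ → Set
  Chooses b R n₀ = ∀ K n Δ → 1 ℕ.≤ K → n₀ ℕ.≤ n → 1 ℕ.≤ Δ → DegreeBound K Δ n →
    ∃[ S ] (2 ℕ.≤ S × suc Δ ℕ.^ suc (kk′ b R) ℕ.≤ S × (∀ N → n ℕ.≤ N → Num b R S N) × fromℕ 2 * fromℕ (tests n) < fromℕ 2 ^^ S)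

  opaque
    choose-S : ∀ b R → ∃ (Chooses b R)
    choose-S b R = go (SizeConstants.nat b R)
      where
      go : IsNat (SizeConstants.X b R) → ∃ (Chooses b R)
      go (C , eq) = go₂ (degree-power′ C (suc (kk′ b R))) (poly<exp′ 12 (8 ℕ.* C ℕ.^ 3))
        where
        go₂ : ∃ (Powers C (suc (kk′ b R))) → ∃ (Exceeds C) → ∃ (Chooses b R)
        go₂ (n₁ , dp) (s₀ , pe) = ChooseS.threshold b R C (kk′ b R) n₁ s₀ (sym eq) dp pe , ChooseS.found b R C (kk′ b R) n₁ s₀ (sym eq) dp pe

-- Placing the set-aside vertices by swaps.

module Absorbing where
  open OrderedField
  open Sums
  open Step using (adjOf)

  module Absorption {N n M : ℕ} (arc : Fin N → Fin N → Bool) (arcD : Fin n → Fin n → Bool)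
    (antisym : ∀ x y → arcD x y ≡ true → arcD y x ≡ false)
    (real Y : Fin n → Bool) (φ : Fin n → Fin N) (ι : Fin M → Fin N) (υ : Fin M → Fin n)
    (υ-inj : ∀ i j → υ i ≡ υ j → i ≡ j) (υ-missing : ∀ i → real (υ i) ≡ false) (υ-cover : ∀ x → real x ≡ false → ∃[ i ] υ i ≡ x)
    (φ-inj : ∀ x y → real x ≡ true → real y ≡ true → φ x ≡ φ y → x ≡ y) (ι-inj : ∀ i j → ι i ≡ ι j → i ≡ j)
    (avoid : ∀ x → real x ≡ true → ∀ i → ¬ φ x ≡ ι i)
    (arcs : ∀ x y → real x ≡ true → real y ≡ true → arcD x y ≡ true → arc (φ x) (φ y) ≡ true)
    (u₁ u₂ : Fin M → Fin n)
    (nbrs : ∀ i z → arcD z (υ i) ≡ true ⊎ arcD (υ i) z ≡ true → (z ≡ u₁ i ⊎ z ≡ u₂ i) × real z ≡ true × Y z ≡ false)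
    (Y-nbrs : ∀ y → Y y ≡ true → ∀ d → arcD d y ≡ true ⊎ arcD y d ≡ true → real d ≡ true × Y d ≡ false)
    where

    -- y can give up its place to `υ i` and move to z: its image suits both neighbours of `υ i`, and
    -- z suits the images of the neighbours of y.
    Fits : Fin M → Fin N → Fin n → Set
    Fits i z y = Y y ≡ true × real y ≡ true × adjOf arc (arcD (u₁ i) (υ i)) (φ (u₁ i)) (φ y) ≡ true × adjOf arc (arcD (u₂ i) (υ i)) (φ (u₂ i)) (φ y) ≡ true ×
      (∀ d → arcD d y ≡ true → arc (φ d) z ≡ true) × (∀ d → arcD y d ≡ true → arc z (φ d) ≡ true)

    module _ (supply : ∀ i z → Σ (Fin n → Bool) λ hit → (∀ y → hit y ≡ true → Fits i z y) × fromℕ M < sum (λ y → [ hit y ])) where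

      private
        Dom : ℕ → Fin n → Set
        Dom j x = real x ≡ true ⊎ ∃[ i ] (toℕ i ℕ.< j × υ i ≡ x)

      -- After j swaps the first j set-aside vertices are placed. Only vertices of `Y` have moved,
      -- at most j of them, so the images entering the conditions of `Fits` are still those under φ.
      record Stage (j : ℕ) : Set where
        field
          ψ : Fin n → Fin N
          used : Fin n → Bool
          used-Y : ∀ y → used y ≡ true → Y y ≡ true
          used-few : sum (λ y → [ used y ]) ≤ fromℕ j
          same : ∀ x → real x ≡ true → used x ≡ false → ψ x ≡ φ x
          ψ-inj : ∀ x y → Dom j x → Dom j y → ψ x ≡ ψ y → x ≡ y
          ψ-arcs : ∀ x y → Dom j x → Dom j y → arcD x y ≡ true → arc (ψ x) (ψ y) ≡ true
          ψ-fresh : ∀ x → Dom j x → ∀ i → j ℕ.≤ toℕ i → ¬ ψ x ≡ ι i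

      start : Stage 0
      start = record
        { ψ = φ ; used = λ _ → false ; used-Y = λ y () ; used-few = ≤-reflexive (sum-zero {n} (λ _ → refl)) ; same = λ _ _ _ → refl
        ; ψ-inj = λ { x y (inj₁ a) (inj₁ b) → φ-inj x y a b } ; ψ-arcs = λ { x y (inj₁ a) (inj₁ b) → arcs x y a b } ; ψ-fresh = λ { x (inj₁ a) i _ → avoid x a i } }

      private
        module Next (j : ℕ) (i : Fin M) (i≡j : toℕ i ≡ j) (st : Stage j) (y : Fin n) (y-unused : Stage.used st y ≡ false) (fits : Fits i (ι i) y) where
          open Stage st

          u : Fin n
          u = υ i

          Yy : Y y ≡ true
          Yy = proj₁ fits
          ry : real y ≡ true
          ry = proj₁ (proj₂ fits)

          private
            u≢y : ¬ u ≡ y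
            u≢y e = contradiction (trans (sym ry) (trans (cong real (sym e)) (υ-missing i))) λ ()

            ψ′ : Fin n → Fin N
            ψ′ x = if x == u then φ y else if x == y then ι i else ψ x

            ψ′-u : ψ′ u ≡ φ y
            ψ′-u rewrite ==-refl u = refl

            ψ′-y : ψ′ y ≡ ι i
            ψ′-y rewrite ≢⇒== {i = y} {u} (λ e → u≢y (sym e)) | ==-refl y = refl

            ψ′-o : ∀ x → ¬ x ≡ u → ¬ x ≡ y → ψ′ x ≡ ψ x
            ψ′-o x a b rewrite ≢⇒== {i = x} {u} a | ≢⇒== {i = x} {y} b = refl

            ψy : ψ y ≡ φ y
            ψy = same y ry y-unused

            dom-y : Dom j y
            dom-y = inj₁ ry

          data View (x : Fin n) : Set where
            is-u : x ≡ u → View x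
            is-y : x ≡ y → View x
            is-o : ¬ x ≡ u → ¬ x ≡ y → Dom j x → View x

          view : ∀ x → Dom (suc j) x → View x
          view x d with x Finₚ.≟ u | x Finₚ.≟ y
          ... | yes a | _ = is-u a
          ... | no _ | yes b = is-y b
          ... | no a | no b = is-o a b (down d)
            where
            down : Dom (suc j) x → Dom j x
            down (inj₁ r) = inj₁ r
            down (inj₂ (i′ , ℕ.s≤s l , e)) with ℕₚ.m≤n⇒m<n∨m≡n l
            ... | inj₁ l′ = inj₂ (i′ , l′ , e)
            ... | inj₂ eq = ⊥-elim (a (trans (sym e) (cong υ (Finₚ.toℕ-injective (trans eq (sym i≡j))))))

          private
            o≢φy : ∀ x → ¬ x ≡ y → Dom j x → ¬ ψ x ≡ φ y
            o≢φy x b d e = b (ψ-inj x y d dom-y (trans e (sym ψy)))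

            o≢ι : ∀ x → Dom j x → ¬ ψ x ≡ ι i
            o≢ι x d = ψ-fresh x d i (ℕₚ.≤-reflexive (sym i≡j))

          inj′ : ∀ x z → View x → View z → ψ′ x ≡ ψ′ z → x ≡ z
          inj′ x z (is-u refl) (is-u refl) e = refl
          inj′ x z (is-u refl) (is-y refl) e = ⊥-elim (avoid y ry i (trans (sym ψ′-u) (trans e ψ′-y)))
          inj′ x z (is-u refl) (is-o a b d) e = ⊥-elim (o≢φy z b d (trans (sym (ψ′-o z a b)) (trans (sym e) ψ′-u)))
          inj′ x z (is-y refl) (is-u refl) e = ⊥-elim (avoid y ry i (trans (sym ψ′-u) (trans (sym e) ψ′-y)))
          inj′ x z (is-y refl) (is-y refl) e = refl
          inj′ x z (is-y refl) (is-o a b d) e = ⊥-elim (o≢ι z d (trans (sym (ψ′-o z a b)) (trans (sym e) ψ′-y)))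
          inj′ x z (is-o a b d) (is-u refl) e = ⊥-elim (o≢φy x b d (trans (sym (ψ′-o x a b)) (trans e ψ′-u)))
          inj′ x z (is-o a b d) (is-y refl) e = ⊥-elim (o≢ι x d (trans (sym (ψ′-o x a b)) (trans e ψ′-y)))
          inj′ x z (is-o a b d) (is-o a′ b′ d′) e = ψ-inj x z d d′ (trans (sym (ψ′-o x a b)) (trans e (ψ′-o z a′ b′)))

          -- neighbours of u and of y have not moved
          still : ∀ d → real d ≡ true → Y d ≡ false → ψ′ d ≡ φ d
          still d rd Yd = trans (ψ′-o d (λ e → contradiction (trans (sym rd) (trans (cong real e) (υ-missing i))) λ ()) (λ e → contradiction (trans (sym Yy) (trans (cong Y (sym e)) Yd)) λ ())) (same d rd (unused (Bool-dec (used d))))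
            where
            unused : used d ≡ true ⊎ used d ≡ false → used d ≡ false
            unused (inj₂ e) = e
            unused (inj₁ e) = contradiction (trans (sym (used-Y d e)) Yd) λ ()

          private
            to-u : ∀ d → arcD d u ≡ true → arc (ψ′ d) (φ y) ≡ true
            to-u d a = subst (λ v → arc v (φ y) ≡ true) (sym (still d (proj₁ (proj₂ nb)) (proj₂ (proj₂ nb)))) (go (proj₁ nb))
              where
              nb : (d ≡ u₁ i ⊎ d ≡ u₂ i) × real d ≡ true × Y d ≡ false
              nb = nbrs i d (inj₁ a)
              go : d ≡ u₁ i ⊎ d ≡ u₂ i → arc (φ d) (φ y) ≡ true
              go (inj₁ e) = subst (λ s → adjOf arc s (φ d) (φ y) ≡ true) a (subst (λ v → adjOf arc (arcD v u) (φ v) (φ y) ≡ true) (sym e) (proj₁ (proj₂ (proj₂ fits))))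
              go (inj₂ e) = subst (λ s → adjOf arc s (φ d) (φ y) ≡ true) a (subst (λ v → adjOf arc (arcD v u) (φ v) (φ y) ≡ true) (sym e) (proj₁ (proj₂ (proj₂ (proj₂ fits)))))

            from-u : ∀ d → arcD u d ≡ true → arc (φ y) (ψ′ d) ≡ true
            from-u d a = subst (λ v → arc (φ y) v ≡ true) (sym (still d (proj₁ (proj₂ nb)) (proj₂ (proj₂ nb)))) (go (proj₁ nb))
              where
              nb : (d ≡ u₁ i ⊎ d ≡ u₂ i) × real d ≡ true × Y d ≡ false
              nb = nbrs i d (inj₂ a)
              go : d ≡ u₁ i ⊎ d ≡ u₂ i → arc (φ y) (φ d) ≡ true
              go (inj₁ e) = subst (λ s → adjOf arc s (φ d) (φ y) ≡ true) (antisym u d a) (subst (λ v → adjOf arc (arcD v u) (φ v) (φ y) ≡ true) (sym e) (proj₁ (proj₂ (proj₂ fits))))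
              go (inj₂ e) = subst (λ s → adjOf arc s (φ d) (φ y) ≡ true) (antisym u d a) (subst (λ v → adjOf arc (arcD v u) (φ v) (φ y) ≡ true) (sym e) (proj₁ (proj₂ (proj₂ (proj₂ fits)))))

            to-y : ∀ d → arcD d y ≡ true → arc (ψ′ d) (ι i) ≡ true
            to-y d a = let rd , Yd = Y-nbrs y Yy d (inj₁ a) in subst (λ v → arc v (ι i) ≡ true) (sym (still d rd Yd)) (proj₁ (proj₂ (proj₂ (proj₂ (proj₂ fits)))) d a)

            from-y : ∀ d → arcD y d ≡ true → arc (ι i) (ψ′ d) ≡ true
            from-y d a = let rd , Yd = Y-nbrs y Yy d (inj₂ a) in subst (λ v → arc (ι i) v ≡ true) (sym (still d rd Yd)) (proj₂ (proj₂ (proj₂ (proj₂ (proj₂ fits)))) d a)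

            arcs′ : ∀ x z → View x → View z → arcD x z ≡ true → arc (ψ′ x) (ψ′ z) ≡ true
            arcs′ x z (is-u refl) _ a = subst (λ v → arc v (ψ′ z) ≡ true) (sym ψ′-u) (from-u z a)
            arcs′ x z (is-y refl) _ a = subst (λ v → arc v (ψ′ z) ≡ true) (sym ψ′-y) (from-y z a)
            arcs′ x z (is-o _ _ _) (is-u refl) a = subst (λ v → arc (ψ′ x) v ≡ true) (sym ψ′-u) (to-u x a)
            arcs′ x z (is-o _ _ _) (is-y refl) a = subst (λ v → arc (ψ′ x) v ≡ true) (sym ψ′-y) (to-y x a)
            arcs′ x z (is-o a b d) (is-o a′ b′ d′) e = subst₂ (λ v w → arc v w ≡ true) (sym (ψ′-o x a b)) (sym (ψ′-o z a′ b′)) (ψ-arcs x z d d′ e)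

            fresh′ : ∀ x → View x → ∀ i′ → suc j ℕ.≤ toℕ i′ → ¬ ψ′ x ≡ ι i′
            fresh′ x (is-u refl) i′ _ e = avoid y ry i′ (trans (sym ψ′-u) e)
            fresh′ x (is-y refl) i′ l e = ℕₚ.<⇒≢ l (trans (sym i≡j) (cong toℕ (ι-inj i i′ (trans (sym ψ′-y) e))))
            fresh′ x (is-o a b d) i′ l e = ψ-fresh x d i′ (ℕₚ.<⇒≤ l) (trans (sym (ψ′-o x a b)) e)

            used′ : Fin n → Bool
            used′ x = (x == y) ∨ used x

          next : Stage (suc j)
          next = record
            { ψ = ψ′ ; used = used′
            ; used-Y = used-Y′
            ; used-few = ≤-trans (sum-mono few) (≤-reflexive (sum-+ _ _) ⨾ (≤-reflexive (cong (_+ sum (λ x → [ used x ])) (sum-[==] y)) ⨾ (+-mono-≤ (≤-refl {1F}) used-few ≤≡ sym (fromℕ-suc j))))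
            ; same = same′
            ; ψ-inj = λ x z dx dz → inj′ x z (view x dx) (view z dz)
            ; ψ-arcs = λ x z dx dz → arcs′ x z (view x dx) (view z dz)
            ; ψ-fresh = λ x dx → fresh′ x (view x dx) }
            where
            infixr 3 _⨾_
            _⨾_ : ∀ {x y z} → x ≤ y → y ≤ z → x ≤ z
            _⨾_ = ≤-trans
            few : ∀ x → [ used′ x ] ≤ [ x == y ] + [ used x ]
            few x with x == y
            ... | true = (lin 0 (sc 1 ([]-nonneg (used x))) (solve 1 (λ v → # 1 :* ((# 1 :+ v) :- # 1) := # 1 :* (v :- # 0)) refl ([ used x ])))
            ... | false = ≤-reflexive (sym (+-identityˡ _))
            used-Y′ : ∀ x → used′ x ≡ true → Y x ≡ true
            used-Y′ x h with x Finₚ.≟ y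
            ... | yes refl = Yy
            ... | no _ = used-Y x h
            same′ : ∀ x → real x ≡ true → used′ x ≡ false → ψ′ x ≡ φ x
            same′ x rx h = trans (ψ′-o x (λ e → contradiction (trans (sym rx) (trans (cong real e) (υ-missing i))) λ ())
                (λ e → contradiction (trans (sym (trans (cong (_== y) e) (==-refl y))) (proj₁ (∨-false (x == y) (used x) h))) λ ())) (same x rx (proj₂ (∨-false (x == y) (used x) h)))

        stage : ∀ j → j ℕ.≤ M → Stage j
        stage zero _ = start
        stage (suc j) j<M = go (stage j (ℕₚ.<⇒≤ j<M)) (supply i (ι i))
          where
          i : Fin M
          i = Fin.fromℕ< j<M
          go : Stage j → Σ (Fin n → Bool) (λ hit → (∀ y → hit y ≡ true → Fits i (ι i) y) × fromℕ M < sum (λ y → [ hit y ])) → Stage (suc j)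
          go st (hit , ok , many) = pick (sum-<⇒∃ (λ y → [ Stage.used st y ]) (λ y → [ hit y ]) (≤-<-trans (≤-trans (Stage.used-few st) (fromℕ-≤ (ℕₚ.<⇒≤ j<M))) many))
            where
            pick : ∃[ y ] [ Stage.used st y ] < [ hit y ] → Stage (suc j)
            pick (y , lt) = Next.next j i (Finₚ.toℕ-fromℕ< j<M) st y (proj₁ ([]<[]⇒ {Stage.used st y} {hit y} lt)) (ok y (proj₂ ([]<[]⇒ {Stage.used st y} {hit y} lt)))

      absorbed : Σ (Fin n → Fin N) λ f → (∀ x y → f x ≡ f y → x ≡ y) × (∀ x y → arcD x y ≡ true → arc (f x) (f y) ≡ true)
      absorbed = go (stage M ℕₚ.≤-refl)
        where
        all : ∀ x → Dom M x
        all x with Bool-dec (real x)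
        ... | inj₁ r = inj₁ r
        ... | inj₂ m = let i , e = υ-cover x m in inj₂ (i , Finₚ.toℕ<n i , e)
        go : Stage M → _
        go st = Stage.ψ st , (λ x y → Stage.ψ-inj st x y (all x) (all y)) , (λ x y → Stage.ψ-arcs st x y (all x) (all y))

-- Translation of the hypotheses, and the case of a larger host.

module Spacious where
  open import Defs
  open OrderedField
  open Sums
  open Transport using (hh; cap)
  open RandomWalks
  open Selection
  open Step using (adjOf)
  open Loop
  open Degeneracy
  open Shifting
  open Embed
  open Numerics
  open Absorbing

  opaque
    unfolding sum

    list-sum : ∀ {n} {A : Set} (f : A → ℕ) (g : Fin n → A) → fromℕ (ListAction.sum (List.map f (List.tabulate g))) ≡ sum (λ i → fromℕ (f (g i)))
    list-sum {zero} f g = refl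
    list-sum {suc n} f g = trans (fromℕ-+ (f (g zero)) _) (cong (fromℕ (f (g zero)) +_) (list-sum f (g ∘ suc)))

  indicator-F : ∀ c → fromℕ (indicator c) ≡ [ c ]
  indicator-F true = refl
  indicator-F false = refl

  count-F : ∀ {n} (α : Fin n → Bool) → fromℕ (ListAction.sum (List.map (λ j → indicator (α j)) (List.allFin n))) ≡ sum (λ j → [ α j ])
  count-F α = trans (list-sum (λ j → indicator (α j)) id) (sum-cong (λ j → indicator-F (α j)))

  ≤-max : ∀ {n} {A : Set} (f : A → ℕ) (g : Fin n → A) i → f (g i) ℕ.≤ List.foldr ℕ._⊔_ 0 (List.map f (List.tabulate g))
  ≤-max f g zero = ℕₚ.m≤m⊔n _ _
  ≤-max f g (suc i) = ℕₚ.≤-trans (≤-max f (g ∘ suc) i) (ℕₚ.m≤n⊔m _ _)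

  degree-F : ∀ Q x → fromℕ (degree Q x) ≡ sum (λ y → [ adj Q x y ])
  degree-F Q x = count-F (adj Q x)

  degree≤max : ∀ Q x → degree Q x ℕ.≤ maxDegree Q
  degree≤max Q x = ≤-max (degree Q) id x

  deg≤Δ : ∀ Q y → sum (λ x → [ adj Q x y ]) ≤ fromℕ (maxDegree Q)
  deg≤Δ Q y = sum-cong (λ x → cong [_] (adj-sym Q x y)) ≡≤ (sym (degree-F Q y) ≡≤ fromℕ-≤ (degree≤max Q y))

  -- The relevant reciprocals of rationals are replaced by natural numbers.
  record Scale (α : ℚ) : Set where
    field
      m b : ℕ
      b≡ : b ≡ 2 ℕ.* suc m
      0<b : 0 ℕ.< b
      1≤mα : 1F ≤ fromℕ (suc m) * ℚ→F α

  scale : ∀ α → ℚ.0ℚ ℚ.< α → Scale α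
  scale α h = let m , p = archimedean α h in record { m = m ; b = 2 ℕ.* suc m ; b≡ = refl ; 0<b = ℕ.s≤s ℕ.z≤n ; 1≤mα = p }

  module Density (α : ℚ) (sca : Scale α) (G : Digraph) (mind : MinSemiDegreeAtLeast G (ℚ.½ ℚ.+ α)) where
    open Scale sca

    -- b = 2(m+1) and (m+1)α ≥ 1 make α at least 2/b, the margin with which the loop starts.
    dens : ∀ s v → (fromℕ b + fromℕ 4) * fromℕ (dsize G) ≤ fromℕ 2 * fromℕ b * sum (λ i → [ adjOf (arc G) s v i ])
    dens s v = (lin 0 (sc 2 (*-nonneg (0≤fromℕ b) (≤⇒0≤- low)) ⊹ sc 1 (≤-reflexive (sym (cong (λ z → fromℕ b * fromℕ (dsize G) * z) ℚ→F-½))) ⊹ sc 2 (≤-reflexive (sym (cong (λ z → z * ℚ→F α * fromℕ (dsize G)) (trans (cong fromℕ b≡) (fromℕ-* 2 (suc m)))))) ⊹ sc 4 (*-nonneg (0≤fromℕ (dsize G)) (≤⇒0≤- 1≤mα))) (solve 6 (λ b N q h a M → # 1 :* (((# 2 :* b) :* q) :- ((b :+ # 4) :* N)) := (# 2 :* ((b :* (q :- ((h :+ a) :* N))) :- # 0)) :+ ((# 1 :* (((b :* N) :* (# 2 :* h)) :- ((b :* N) :* # 1))) :+ ((# 2 :* (((b :* a) :* N) :- (((# 2 :* M) :* a) :* N))) :+ (# 4 :* ((N :* ((M :* a) :- # 1)) :- # 0))))) refl (fromℕ b) (fromℕ (dsize G)) q (ℚ→F ℚ.½) (ℚ→F α)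 (fromℕ (suc m))))
      where
      q : F
      q = sum (λ i → [ adjOf (arc G) s v i ])
      bridge : ∀ k → (ℚ.½ ℚ.+ α) ℚ.* ℚ[ dsize G ] ℚ.≤ ℚ[ k ] → (ℚ→F ℚ.½ + ℚ→F α) * fromℕ (dsize G) ≤ fromℕ k
      bridge k h = sym (trans (ℚ→F-* (ℚ.½ ℚ.+ α) ℚ[ dsize G ]) (cong₂ _*_ (ℚ→F-+ ℚ.½ α) (ℚ→F-ℕ (dsize G)))) ≡≤ (ℚ→F-≤ h ≤≡ ℚ→F-ℕ k)
      low : (ℚ→F ℚ.½ + ℚ→F α) * fromℕ (dsize G) ≤ q
      low = go s
        where
        go : ∀ s → (ℚ→F ℚ.½ + ℚ→F α) * fromℕ (dsize G) ≤ sum (λ i → [ adjOf (arc G) s v i ])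
        go true = bridge _ (proj₁ (mind v)) ≤≡ count-F (arc G v)
        go false = bridge _ (proj₂ (mind v)) ≤≡ count-F (λ j → arc G j v)

  record Oriented (Q : Graph) (arcD : Fin (size Q) → Fin (size Q) → Bool) : Set where
    field
      antisym : ∀ x y → arcD x y ≡ true → arcD y x ≡ false
      Adj⇒E : ∀ x y → arcD x y ≡ true ⊎ arcD y x ≡ true → adj Q x y ≡ true

  Embeds : ∀ {n N} → (Fin n → Fin n → Bool) → (Fin N → Fin N → Bool) → Set
  Embeds {n} {N} arcD arc = Σ (Fin n → Fin N) λ f → (∀ i j → f i ≡ f j → i ≡ j) × (∀ i j → arcD i j ≡ true → arc (f i) (f j) ≡ true)

  contains-all : ∀ G Q → (∀ arcD → Oriented Q arcD → Embeds arcD (arc G)) → ContainsAllOrientations G Q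
  contains-all G Q h (record { dsize = _ ; arc = arcD ; arc-irr = irr }) (refl , or) = h arcD (record { antisym = anti ; Adj⇒E = A⇒E })
    where
    anti : ∀ x y → arcD x y ≡ true → arcD y x ≡ false
    anti x y e with arcD y x | proj₂ (or x y)
    ... | false | _ = refl
    ... | true | k = trans (sym (cong (_∧ true) e)) k
    A⇒E : ∀ x y → arcD x y ≡ true ⊎ arcD y x ≡ true → adj Q x y ≡ true
    A⇒E x y (inj₁ e) = trans (sym (proj₁ (or x y))) (cong (_∨ arcD y x) e)
    A⇒E x y (inj₂ e) = trans (sym (proj₁ (or x y))) (trans (cong (arcD x y ∨_) e) (∨-true (arcD x y)))
      where
      ∨-true : ∀ c → c ∨ true ≡ true
      ∨-true true = refl
      ∨-true false = refl

  -- Maximum degree 0 falls outside the estimates, which take Δ ≥ 1; any injection serves.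
  embeds-edgeless : ∀ Q → maxDegree Q ≡ 0 → ∀ {N} (arc : Fin N → Fin N → Bool) → size Q ℕ.≤ N → ∀ arcD → Oriented Q arcD → Embeds arcD arc
  embeds-edgeless Q Δ0 arc n≤N arcD or = (λ i → Fin.inject≤ i n≤N) , (λ i j → Finₚ.inject≤-injective n≤N n≤N i j) , λ i j a → ⊥-elim (no-edge i j (Oriented.Adj⇒E or i j (inj₁ a)))
    where
    no-edge : ∀ i j → adj Q i j ≡ true → ⊥
    no-edge i j e = <⇒≱ (0<fromℕ 0) (≤-trans (≤-reflexive (cong [_] (sym e))) (≤-trans (term≤sum (λ y → []-nonneg (adj Q i y)) j) (sym (degree-F Q i) ≡≤ fromℕ-≤ (subst (degree Q i ℕ.≤_) Δ0 (degree≤max Q i)))))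

  record SmallDegen (Q : Graph) : Set where
    field
      d : Degen (λ x y → adj Q x y ≡ true)
      small : exceptions d * exceptions d ≤ fromℕ 4 * fromℕ (size Q)

  -- With ζ < 1 and Δ ≥ 1 the hypothesis gives |Q₀|⁴ ≤ n. The exceptions are at most |Q₀| + |Q₀|²,
  -- hence at most 2|Q₀|², whose square is at most 4n.
  exceptions-small : ∀ Q₀ Q ζ → ℚ.0ℚ ℚ.< ζ → ζ ℚ.< ℚ.1ℚ → 1 ℕ.≤ maxDegree Q → ObtainedFrom Q₀ Q → ℚ[ size Q₀ ℕ.* maxDegree Q ] ^ℚ 4 ℚ.≤ (ζ ^ℚ 4) ℚ.* ℚ[ size Q ]
    → SmallDegen Q
  exceptions-small Q₀ Q ζ 0<ζ ζ<1 1≤Δ obt small = go (graph-degen {Q₀} {Q} obt)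
    where
    q₀ n z D : F
    q₀ = fromℕ (size Q₀)
    n = fromℕ (size Q)
    z = ℚ→F ζ
    D = fromℕ (size Q₀ ℕ.* maxDegree Q)
    z≥0 : 0F ≤ z
    z≥0 = sym ℚ→F-0 ≡≤ ℚ→F-≤ (ℚₚ.<⇒≤ 0<ζ)
    z≤1 : z ≤ 1F
    z≤1 = ℚ→F-≤ (ℚₚ.<⇒≤ ζ<1) ≤≡ ℚ→F-1
    D⁴≤ : D ^^ 4 ≤ n
    D⁴≤ = ≤-trans (sym (trans (ℚ→F-^ _ 4) (cong (_^^ 4) (ℚ→F-ℕ (size Q₀ ℕ.* maxDegree Q)))) ≡≤ (ℚ→F-≤ small ≤≡ trans (ℚ→F-* (ζ ^ℚ 4) _) (cong₂ _*_ (ℚ→F-^ ζ 4) (ℚ→F-ℕ (size Q)))))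
      (lin 0 (sc 1 (*-nonneg (≤⇒0≤- (pow-antitone z≥0 z≤1 {0} {4} ℕ.z≤n)) (0≤fromℕ (size Q)))) (solve 2 (λ n y → # 1 :* (n :- (y :* n)) := # 1 :* (((# 1 :- y) :* n) :- # 0)) refl n (z ^^ 4)))
    q₀≤D : q₀ ≤ D
    q₀≤D = fromℕ-≤ (ℕₚ.m≤m*n (size Q₀) (maxDegree Q) {{ℕ.>-nonZero 1≤Δ}})
    q₀⁴≤ : q₀ ^^ 4 ≤ n
    q₀⁴≤ = ≤-trans (^^-mono (0≤fromℕ (size Q₀)) q₀≤D 4) D⁴≤
    q₀≤q₀² : q₀ ≤ q₀ * q₀
    q₀≤q₀² = fromℕ-≤ (self (size Q₀)) ≤≡ fromℕ-* (size Q₀) (size Q₀)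
      where
      self : ∀ k → k ℕ.≤ k ℕ.* k
      self zero = ℕ.z≤n
      self (suc k) = ℕₚ.m≤m*n (suc k) (suc k)
    go : Σ (Degen (λ x y → adj Q x y ≡ true)) (λ d → exceptions d ≤ q₀ + q₀ * q₀) → SmallDegen Q
    go (d , le) = record { d = d ; small = ≤-trans (mul-mono₂ e≥0 e≥0 e≤ e≤) (lin 0 (sc 4 q₀⁴≤) (solve 2 (λ q n → # 1 :* ((# 4 :* n) :- ((# 2 :* (q :* q)) :* (# 2 :* (q :* q)))) := # 4 :* (n :- (q :* (q :* (q :* (q :* # 1)))))) refl q₀ n)) }
      where
      e≥0 : 0F ≤ exceptions d
      e≥0 = sum-nonneg (λ x → []-nonneg (Degen.exc d x))
      e≤ : exceptions d ≤ fromℕ 2 * (q₀ * q₀)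
      e≤ = (lin 0 (sc 1 le ⊹ sc 1 q₀≤q₀²) (solve 3 (λ e q s → # 1 :* ((# 2 :* s) :- e) := (# 1 :* ((q :+ s) :- e)) :+ (# 1 :* (s :- q))) refl (exceptions d) q₀ (q₀ * q₀)))

  sign : Fin 2 → Bool
  sign zero = true
  sign (suc _) = false

  signed : ∀ N → Fin (2 ℕ.* N) → Bool × Fin N
  signed N i = let s , p = Fin.remQuot {2} N i in sign s , p

  signed-surj : ∀ N s (p : Fin N) → ∃[ i ] signed N i ≡ (s , p)
  signed-surj N true p = Fin.combine {2} {N} zero p , cong (λ (q : Fin 2 × Fin N) → sign (proj₁ q) , proj₂ q) (Finₚ.remQuot-combine {2} {N} zero p)
  signed-surj N false p = Fin.combine {2} {N} (suc zero) p , cong (λ (q : Fin 2 × Fin N) → sign (proj₁ q) , proj₂ q) (Finₚ.remQuot-combine {2} {N} (suc zero) p)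

  signedTest : ∀ {N} → Fin N → Bool × Fin N → Bool × Fin N → Test N
  signedTest z (s₁ , p₁) (s₂ , p₂) = mkTest z s₁ p₁ s₂ p₂

  testOf₂ : ∀ N → Fin N → Fin (2 ℕ.* N) × Fin (2 ℕ.* N) → Test N
  testOf₂ N z (a , c) = signedTest z (signed N a) (signed N c)

  testOf₁ : ∀ N → Fin N × Fin (2 ℕ.* N ℕ.* (2 ℕ.* N)) → Test N
  testOf₁ N (z , r) = testOf₂ N z (Fin.remQuot {2 ℕ.* N} (2 ℕ.* N) r)

  -- Tests are numbered by a `Fin` because the potential sums over them.
  testOf : ∀ N → Fin (tests N) → Test N
  testOf N i = testOf₁ N (Fin.remQuot {N} (2 ℕ.* N ℕ.* (2 ℕ.* N)) i)

  testOf-surj : ∀ N z s₁ p₁ s₂ p₂ → ∃[ i ] testOf N i ≡ mkTest z s₁ p₁ s₂ p₂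
  testOf-surj N z s₁ p₁ s₂ p₂ = go (signed-surj N s₁ p₁) (signed-surj N s₂ p₂)
    where
    go : ∃[ a ] signed N a ≡ (s₁ , p₁) → ∃[ c ] signed N c ≡ (s₂ , p₂) → ∃[ i ] testOf N i ≡ mkTest z s₁ p₁ s₂ p₂
    go (a , ea) (c , ec) = Fin.combine {N} {2 ℕ.* N ℕ.* (2 ℕ.* N)} z (Fin.combine {2 ℕ.* N} {2 ℕ.* N} a c) ,
      trans (cong (testOf₁ N) (Finₚ.remQuot-combine {N} {2 ℕ.* N ℕ.* (2 ℕ.* N)} z (Fin.combine {2 ℕ.* N} {2 ℕ.* N} a c)))
        (trans (cong (testOf₂ N z) (Finₚ.remQuot-combine {2 ℕ.* N} {2 ℕ.* N} a c)) (cong₂ (signedTest z) ea ec))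

  widen : ∀ α n N → (ℚ.1ℚ ℚ.+ α) ℚ.* ℚ[ n ] ℚ.≤ ℚ[ N ] → (1F + ℚ→F α) * fromℕ n ≤ fromℕ N
  widen α n N h = sym (trans (ℚ→F-* (ℚ.1ℚ ℚ.+ α) ℚ[ n ]) (cong₂ _*_ (trans (ℚ→F-+ ℚ.1ℚ α) (cong (_+ ℚ→F α) ℚ→F-1)) (ℚ→F-ℕ n))) ≡≤ (ℚ→F-≤ h ≤≡ ℚ→F-ℕ N)

  -- All vertices are real and no swap takes place: rmin = |G| - n host vertices are spare, a
  -- constant proportion, so the loop alone embeds everything.
  spacious : ∀ α (sca : Scale α) n₀ → Chooses (Scale.b sca) (suc (suc (Scale.m sca))) n₀ → ∀ K Q → SmallDegen Q → 1 ℕ.≤ K → n₀ ℕ.≤ size Q → 1 ℕ.≤ size Q → 1 ℕ.≤ maxDegree Q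
    → DegreeBound K (maxDegree Q) (size Q) → ∀ G → MinSemiDegreeAtLeast G (ℚ.½ ℚ.+ α) → (ℚ.1ℚ ℚ.+ α) ℚ.* ℚ[ size Q ] ℚ.≤ ℚ[ dsize G ] → ∀ arcD → Oriented Q arcD → Embeds arcD (arc G)
  spacious α sca n₀ choose K Q sd 1≤K n₀≤n 0<n 1≤Δ db G mind large arcD or = go (choose K (size Q) (maxDegree Q) 1≤K n₀≤n 1≤Δ db)
    where
    open Scale sca
    open SmallDegen sd
    open Oriented or
    open Density α sca G mind
    n N rmin R : ℕ
    n = size Q
    N = dsize G
    rmin = N ℕ.∸ n
    -- (m+2)n ≤ (m+1)N follows from the size hypothesis and (m+1)α ≥ 1, and rearranges to N ≤
    -- (m+2)·rmin.
    R = suc (suc m)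
    large′ : (1F + ℚ→F α) * fromℕ n ≤ fromℕ N
    large′ = widen α n N large
    scaled : (fromℕ (suc m) + 1F) * fromℕ n ≤ fromℕ (suc m) * fromℕ N
    scaled = (lin 0 (sc 1 (*-nonneg (0≤fromℕ (suc m)) (≤⇒0≤- large′)) ⊹ sc 1 (*-nonneg (0≤fromℕ n) (≤⇒0≤- 1≤mα))) (solve 4 (λ n N M a → # 1 :* ((M :* N) :- ((M :+ # 1) :* n)) := (# 1 :* ((M :* (N :- ((# 1 :+ a) :* n))) :- # 0)) :+ (# 1 :* ((n :* ((M :* a) :- # 1)) :- # 0))) refl (fromℕ n) (fromℕ N) (fromℕ (suc m)) (ℚ→F α)))
    n<N : n ℕ.< N
    n<N = fromℕ-<⁻ (less (≤-or-> (fromℕ N) (fromℕ n)))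
      where
      less : fromℕ N ≤ fromℕ n ⊎ fromℕ n < fromℕ N → fromℕ n < fromℕ N
      less (inj₂ h) = h
      less (inj₁ h) = ⊥-elim (<-irrefl (lin< 0 (0<fromℕ 0 ⊹< sc 1 scaled ⊹ sc 1 (*-nonneg (0≤fromℕ (suc m)) (≤⇒0≤- h)) ⊹ sc 1 (fromℕ-≤ 0<n)) (solve 3 (λ n N M → # 1 :* (# 0 :- # 0) := # 1 :+ ((# 1 :* ((M :* N) :- ((M :+ # 1) :* n))) :+ ((# 1 :* ((M :* (n :- N)) :- # 0)) :+ (# 1 :* (n :- # 1))))) refl (fromℕ n) (fromℕ N) (fromℕ (suc m)))))
    rest : fromℕ n + fromℕ rmin ≡ fromℕ N
    rest = trans (sym (fromℕ-+ n rmin)) (cong fromℕ (ℕₚ.m+[n∸m]≡n (ℕₚ.<⇒≤ n<N)))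
    N≤Rr : fromℕ N ≤ fromℕ R * fromℕ rmin
    N≤Rr = (lin 0 (sc 1 (≤-reflexive (sym (cong (_* fromℕ rmin) (fromℕ-suc (suc m))))) ⊹ sc 1 (≤-reflexive (sym rest)) ⊹ sc 1 (≤-reflexive (sym (cong (fromℕ (suc m) *_) rest))) ⊹ sc 1 scaled) (solve 5 (λ n N r M R → # 1 :* ((R :* r) :- N) := (# 1 :* ((R :* r) :- ((# 1 :+ M) :* r))) :+ ((# 1 :* ((n :+ r) :- N)) :+ ((# 1 :* ((M :* (n :+ r)) :- (M :* N))) :+ (# 1 :* ((M :* N) :- ((M :+ # 1) :* n)))))) refl (fromℕ n) (fromℕ N) (fromℕ rmin) (fromℕ (suc m)) (fromℕ R)))
    room : sum {n} (λ _ → [ true ]) + fromℕ rmin ≤ fromℕ N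
    room = ≤-reflexive (trans (cong (_+ fromℕ rmin) (trans (sum-const n 1F) (*-identityʳ _))) rest)
    go : ∃[ S ] (2 ℕ.≤ S × suc (maxDegree Q) ℕ.^ suc (kk′ b R) ℕ.≤ S × (∀ N → n ℕ.≤ N → Num b R S N) × fromℕ 2 * fromℕ (tests n) < fromℕ 2 ^^ S) → Embeds arcD (arc G)
    go (S , 2≤S , S-big , num , _) = φ , φ-inj-all , λ x y → arcs x y refl refl
      where
      v : Fin N
      v = Fin.fromℕ< (ℕₚ.≤-<-trans ℕ.z≤n n<N)
      -- The potential divides by the number of tests, so one arbitrary test is supplied.
      embedded : Embedded {T = 1} (arc G) arcD (λ _ → true) (λ _ → false) (λ _ → mkTest v true v true v) b rmin S
      embedded = Embedding.embedded (arc G) {b} {R} {rmin} {S} 0<b (ℕ.s≤s ℕ.z≤n) (ℕₚ.m<n⇒0<n∸m n<N) 2≤S dens 0<n (ℕₚ.<⇒≤ n<N) N≤Rr (num N (ℕₚ.<⇒≤ n<N)) (adj Q) d small arcD antisym Adj⇒E (adj-sym Q)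
        (λ _ → true) (λ _ → false) id (λ _ ()) (λ _ ()) (λ _ ()) (maxDegree Q) (deg≤Δ Q) S-big room {1} (ℕ.s≤s ℕ.z≤n) (λ _ → mkTest v true v true v)
      open Embedded embedded
      φ-inj-all : ∀ x y → φ x ≡ φ y → x ≡ y
      φ-inj-all x y = φ-inj x y refl refl

-- The spanning case: reserving vertices of degree at most two.

module TightCase where
  open import Defs
  open OrderedField
  open Sums
  open RandomWalks
  open Selection
  open Step using (adjOf)
  open Loop
  open Degeneracy
  open Shifting
  open Embed
  open Numerics
  open Absorbing
  open Spacious

  _∖_ : ∀ {n} → (Fin n → Bool) → Fin n → Fin n → Bool
  (β ∖ p) x = β x ∧ not (x == p)

  ∖-true : ∀ {n} (β : Fin n → Bool) {p z} → β z ≡ true → ¬ z ≡ p → (β ∖ p) z ≡ true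
  ∖-true β h ne = cong₂ (λ s t → s ∧ not t) h (≢⇒== ne)

  count-∖ : ∀ {n} (β : Fin n → Bool) p → β p ≡ true → sum (λ x → [ β x ]) ≡ 1F + sum (λ x → [ (β ∖ p) x ])
  count-∖ β p h = trans (sum-cong split) (trans (sum-+ (λ x → [ x == p ]) (λ x → [ (β ∖ p) x ])) (cong (_+ sum (λ x → [ (β ∖ p) x ])) (sum-[==] p)))
    where
    split : ∀ x → [ β x ] ≡ [ x == p ] + [ β x ∧ not (x == p) ]
    split x with x Finₚ.≟ p
    ... | yes refl = trans (cong [_] h) (trans (sym (+-identityʳ 1F)) (cong (λ s → 1F + [ s ∧ false ]) (sym h)))
    ... | no _ = trans (cong [_] (∧-t (β x))) (sym (+-identityˡ _))
      where
      ∧-t : ∀ c → c ≡ c ∧ true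
      ∧-t true = refl
      ∧-t false = refl

  none-left : ∀ {n} (β : Fin n → Bool) → sum (λ x → [ β x ]) ≡ 0F → ∀ z → β z ≡ true → ⊥
  none-left β h z e = <⇒≱ (0<fromℕ 0) (sym (cong [_] e) ≡≤ (term≤sum (λ x → []-nonneg (β x)) z ≤≡ h))

  -- A common form for both hypotheses: vertices `f a` whose neighbours are among `u a` and `v a`
  -- and are never slots themselves. A leaf has `u a` = `v a`.
  record Slots (Q : Graph) (k : ℕ) : Set where
    field
      f u v : Fin k → Fin (size Q)
      f-inj : ∀ a c → f a ≡ f c → a ≡ c
      u-adj : ∀ a → adj Q (f a) (u a) ≡ true
      v-adj : ∀ a → adj Q (f a) (v a) ≡ true
      only : ∀ a z → adj Q (f a) z ≡ true → z ≡ u a ⊎ z ≡ v a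
      u≢f : ∀ a c → ¬ u a ≡ f c
      v≢f : ∀ a c → ¬ v a ≡ f c

  leaf-slots : ∀ Q k → LeafEdges Q k → Slots Q k
  leaf-slots Q k (E , inj , adjE , deg) = record
    { f = λ a → E a zero ; u = λ a → E a (suc zero) ; v = λ a → E a (suc zero) ; f-inj = λ a c h → proj₁ (inj a c zero zero h) ; u-adj = adjE ; v-adj = adjE
    ; only = only ; u≢f = λ a c h → contradiction (proj₂ (inj a c _ _ h)) λ () ; v≢f = λ a c h → contradiction (proj₂ (inj a c _ _ h)) λ () }
    where
    only : ∀ a z → adj Q (E a zero) z ≡ true → z ≡ E a (suc zero) ⊎ z ≡ E a (suc zero)
    only a z h with z Finₚ.≟ E a (suc zero)
    ... | yes e = inj₁ e
    ... | no ne = ⊥-elim (none-left (β ∖ _) rest z (∖-true β h ne))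
      where
      β : Fin (size Q) → Bool
      β = adj Q (E a zero)
      rest : sum (λ x → [ (β ∖ E a (suc zero)) x ]) ≡ 0F
      rest = (≤-antisym (lin 0 (sc 1 (≤-reflexive (sym (count-∖ β _ (adjE a)))) ⊹ sc 1 (≤-reflexive (sym (degree-F Q (E a zero)))) ⊹ sc 1 (≤-reflexive (cong fromℕ (deg a)))) (solve 3 (λ r s d → # 1 :* (# 0 :- r) := (# 1 :* (s :- (# 1 :+ r))) :+ ((# 1 :* (d :- s)) :+ (# 1 :* (# 1 :- d)))) refl (sum (λ x → [ (β ∖ E a (suc zero)) x ])) (sum (λ x → [ β x ])) (fromℕ (degree Q (E a zero))))) (lin 0 (sc 1 (≤-reflexive (count-∖ β _ (adjE a))) ⊹ sc 1 (≤-reflexive (degree-F Q (E a zero))) ⊹ sc 1 (≤-reflexive (sym (cong fromℕ (deg a))))) (solve 3 (λ r s d → # 1 :* (r :- # 0) := (# 1 :* ((# 1 :+ r) :- s)) :+ ((# 1 :* (s :- d)) :+ (# 1 :* (d :- # 1)))) refl (sum (λ x → [ (β ∖ E a (suc zero)) x ])) (sum (λ x → [ β x ])) (fromℕ (degree Q (E a zero))))))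

  -- The slot is the middle vertex of a path. Its two path neighbours exhaust its degree, and
  -- disjointness of the paths keeps them away from all other middle vertices.
  path-slots : ∀ Q k → BarePaths7 Q k → Slots Q k
  path-slots Q k (P , inj , adjP , deg) = record
    { f = f ; u = u ; v = v ; f-inj = λ a c h → proj₁ (inj a c i₃ i₃ h) ; u-adj = u-adj ; v-adj = v-adj
    ; only = only ; u≢f = λ a c h → contradiction (proj₂ (inj a c i₂ i₃ h)) λ () ; v≢f = λ a c h → contradiction (proj₂ (inj a c i₄ i₃ h)) λ () }
    where
    i₂ i₃ i₄ : Fin 7
    i₂ = suc (suc zero)
    i₃ = suc (suc (suc zero))
    i₄ = suc (suc (suc (suc zero)))
    f u v : Fin k → Fin (size Q)
    f a = P a i₃
    u a = P a i₂
    v a = P a i₄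
    u-adj : ∀ a → adj Q (f a) (u a) ≡ true
    u-adj a = trans (adj-sym Q (f a) (u a)) (adjP a (suc (suc zero)))
    v-adj : ∀ a → adj Q (f a) (v a) ≡ true
    v-adj a = adjP a (suc (suc (suc zero)))
    only : ∀ a z → adj Q (f a) z ≡ true → z ≡ u a ⊎ z ≡ v a
    only a z h with z Finₚ.≟ u a | z Finₚ.≟ v a
    ... | yes e | _ = inj₁ e
    ... | no _ | yes e = inj₂ e
    ... | no nu | no nv = ⊥-elim (none-left ((β ∖ u a) ∖ v a) rest z (∖-true (β ∖ u a) (∖-true β h nu) nv))
      where
      β : Fin (size Q) → Bool
      β = adj Q (f a)
      v≢u : ¬ v a ≡ u a
      v≢u e = contradiction (proj₂ (inj a a i₄ i₂ e)) λ ()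
      rest : sum (λ x → [ ((β ∖ u a) ∖ v a) x ]) ≡ 0F
      rest = (≤-antisym (lin 0 (sc 1 (≤-reflexive (sym (count-∖ β (u a) (u-adj a)))) ⊹ sc 1 (≤-reflexive (sym (count-∖ (β ∖ u a) (v a) (∖-true β (v-adj a) v≢u)))) ⊹ sc 1 (≤-reflexive (sym (degree-F Q (f a)))) ⊹ sc 1 (≤-reflexive (cong fromℕ (deg a (suc (suc zero)))))) (solve 4 (λ r t s d → # 1 :* (# 0 :- r) := (# 1 :* (s :- (# 1 :+ t))) :+ ((# 1 :* (t :- (# 1 :+ r))) :+ ((# 1 :* (d :- s)) :+ (# 1 :* (# 2 :- d))))) refl (sum (λ x → [ ((β ∖ u a) ∖ v a) x ])) (sum (λ x → [ (β ∖ u a) x ])) (sum (λ x → [ β x ])) (fromℕ (degree Q (f a))))) (lin 0 (sc 1 (≤-reflexive (count-∖ β (u a) (u-adj a))) ⊹ sc 1 (≤-reflexive (count-∖ (β ∖ u a) (v a) (∖-true β (v-adj a) v≢u))) ⊹ sc 1 (≤-reflexive (degree-F Q (f a))) ⊹ sc 1 (≤-reflexive (sym (cong fromℕ (deg a (suc (suc zero))))))) (solve 4 (λ r t s d → # 1 :* (r :- # 0) := (# 1 :* ((# 1 :+ t) :- s)) :+ ((# 1 :* ((# 1 :+ r) :- t)) :+ ((# 1 :* (s :- d)) :+ (# 1 :* (d :- # 2))))) refl (sum (λ x → [ ((β ∖ u a) ∖ v a) x ])) (sum (λ x → [ (β ∖ u a) x ])) (sum (λ x → [ β x ])) (fromℕ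 (degree Q (f a))))))

  subset-of-size : ∀ {m} (β : Fin m → Bool) k → fromℕ k ≤ sum (λ x → [ β x ]) → Σ (Fin m → Bool) λ U → (∀ x → U x ≡ true → β x ≡ true) × sum (λ x → [ U x ]) ≡ fromℕ k
  subset-of-size {m} β zero h = (λ _ → false) , (λ x ()) , sum-zero {m} (λ _ → refl)
  subset-of-size {zero} β (suc k) h = ⊥-elim (<⇒≱ (0<fromℕ k) (h ≤≡ sum-0 _))
  subset-of-size {suc m} β (suc k) h = go (Bool-dec (β zero))
    where
    B : F
    B = sum (λ x → [ β (suc x) ])
    extend : Bool → (Fin m → Bool) → Fin (suc m) → Bool
    extend c U zero = c
    extend c U (suc x) = U x
    go : β zero ≡ true ⊎ β zero ≡ false → Σ (Fin (suc m) → Bool) λ U → (∀ x → U x ≡ true → β x ≡ true) × sum (λ x → [ U x ]) ≡ fromℕ (suc k)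
    go (inj₁ e) = let U , sub , cnt = subset-of-size (β ∘ suc) k (lin 0 (sc 1 (≤-reflexive (sym (fromℕ-suc k))) ⊹ sc 1 h ⊹ sc 1 (≤-reflexive (sum-suc (λ x → [ β x ]))) ⊹ sc 1 (≤-reflexive (cong [_] e))) (solve 5 (λ k K s b t → # 1 :* (t :- k) := (# 1 :* (K :- (# 1 :+ k))) :+ ((# 1 :* (s :- K)) :+ ((# 1 :* ((b :+ t) :- s)) :+ (# 1 :* (# 1 :- b))))) refl (fromℕ k) (fromℕ (suc k)) (sum (λ x → [ β x ])) ([ β zero ]) B))
      in extend true U , (λ { zero _ → e ; (suc x) → sub x }) , trans (sum-suc _) (trans (cong (1F +_) cnt) (sym (fromℕ-suc k)))
    go (inj₂ e) = let U , sub , cnt = subset-of-size (β ∘ suc) (suc k) (lin 0 (sc 1 h ⊹ sc 1 (≤-reflexive (sum-suc (λ x → [ β x ]))) ⊹ sc 1 (≤-reflexive (cong [_] e))) (solve 4 (λ K s b t → # 1 :* (t :- K) := (# 1 :* (s :- K)) :+ ((# 1 :* ((b :+ t) :- s)) :+ (# 1 :* (# 0 :- b)))) refl (fromℕ (suc k)) (sum (λ x → [ β x ])) ([ β zero ]) B))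
      in extend false U , (λ { zero () ; (suc x) → sub x }) , trans (sum-suc _) (trans (cong (0F +_) cnt) (+-identityˡ _))

  module Gadgets (Q : Graph) {k : ℕ} (slots : Slots Q k) (d : Degen (λ x y → adj Q x y ≡ true)) where
    open Slots slots
    open Degen d using (exc; p; par)

    n : ℕ
    n = size Q

    private
      Slot? : Fin n → Set
      Slot? y = (∃[ a ] f a ≡ y) ⊎ (∀ a → ¬ f a ≡ y)

      slot? : ∀ y → Slot? y
      slot? y = search λ a → dec (f a Finₚ.≟ y)
        where
        dec : ∀ {a} → Dec (f a ≡ y) → f a ≡ y ⊎ ¬ f a ≡ y
        dec (yes e) = inj₁ e
        dec (no ne) = inj₂ ne

      inSlot : ∀ {y} → Slot? y → Bool
      inSlot (inj₁ _) = true
      inSlot (inj₂ _) = false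

    -- The neighbour of a slot vertex that is not its parent (the parent again, for a leaf).
    private
      otherOf : ∀ {y} → Slot? y → Fin n
      otherOf {y} (inj₁ (a , _)) = if p y == u a then v a else u a
      otherOf {y} (inj₂ _) = y

    -- Slots with a parent. They serve both as vertices to set aside and as swap partners, being
    -- pairwise non-adjacent.
    Z : Fin n → Bool
    Z y = inSlot (slot? y) ∧ not (exc y)

    w : Fin n → Fin n
    w y = otherOf (slot? y)

    private
      Z-notslot : ∀ z → (∀ a → ¬ z ≡ f a) → Z z ≡ false
      Z-notslot z h = go (slot? z)
        where
        go : (s : Slot? z) → inSlot s ∧ not (exc z) ≡ false
        go (inj₁ (a , e)) = ⊥-elim (h a (sym e))
        go (inj₂ _) = refl

    record Good (y w : Fin n) : Set where
      field
        nonexc : exc y ≡ false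
        kid : adj Q y w ≡ true
        nbr : ∀ z → adj Q y z ≡ true → (z ≡ p y ⊎ z ≡ w) × Z z ≡ false

    good : ∀ y → Z y ≡ true → Good y (w y)
    good y = go (slot? y)
      where
      go : (s : Slot? y) → inSlot s ∧ not (exc y) ≡ true → Good y (otherOf s)
      go (inj₁ (a , refl)) h = record { nonexc = ne ; kid = kid (p (f a) Finₚ.≟ u a) ; nbr = λ z e → two z (only a z e) , plain z (only a z e) }
        where
        not-true : ∀ c → not c ≡ true → c ≡ false
        not-true false _ = refl
        ne : exc (f a) ≡ false
        ne = not-true _ h
        par-only : p (f a) ≡ u a ⊎ p (f a) ≡ v a
        par-only = only a _ (proj₁ (par (f a) ne))
        kid : (q : Dec (p (f a) ≡ u a)) → adj Q (f a) (if does q then v a else u a) ≡ true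
        kid (yes _) = v-adj a
        kid (no _) = u-adj a
        plain : ∀ z → z ≡ u a ⊎ z ≡ v a → Z z ≡ false
        plain z (inj₁ refl) = Z-notslot z (u≢f a)
        plain z (inj₂ refl) = Z-notslot z (v≢f a)
        two′ : ∀ z (q : Dec (p (f a) ≡ u a)) → p (f a) ≡ u a ⊎ p (f a) ≡ v a → z ≡ u a ⊎ z ≡ v a → z ≡ p (f a) ⊎ z ≡ (if does q then v a else u a)
        two′ z (yes e) _ (inj₁ h) = inj₁ (trans h (sym e))
        two′ z (yes _) _ (inj₂ h) = inj₂ h
        two′ z (no _) _ (inj₁ h) = inj₂ h
        two′ z (no ¬e) (inj₁ e) (inj₂ h) = ⊥-elim (¬e e)
        two′ z (no _) (inj₂ e) (inj₂ h) = inj₁ (trans h (sym e))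
        two : ∀ z → z ≡ u a ⊎ z ≡ v a → z ≡ p (f a) ⊎ z ≡ (if p (f a) == u a then v a else u a)
        two z = two′ z (p (f a) Finₚ.≟ u a) par-only

    -- Discarding exceptional slots costs at most the number of exceptions.
    many : fromℕ k ≤ sum (λ y → [ Z y ]) + exceptions d
    many = (lin 0 (sc 1 (≤-reflexive (sym (sum-const k 1F))) ⊹ sc 1 (sum-mono each) ⊹ sc 1 (≤-reflexive (sum-+ (λ a → [ Z (f a) ]) (λ a → [ exc (f a) ]))) ⊹ sc 1 (sum-inj f f-inj (λ y → [ Z y ]) (λ y → []-nonneg (Z y))) ⊹ sc 1 (sum-inj f f-inj (λ y → [ exc y ]) (λ y → []-nonneg (exc y)))) (solve 7 (λ k one z e zf ef ze → # 1 :* ((z :+ e) :- k) := (# 1 :* (one :- (k :* # 1))) :+ ((# 1 :* (ze :- one)) :+ ((# 1 :* ((zf :+ ef) :- ze)) :+ ((# 1 :* (z :- zf)) :+ (# 1 :* (e :- ef)))))) refl (fromℕ k) (sum {k} (λ _ → 1F)) (sum (λ y → [ Z y ])) (sum (λ y → [ exc y ])) (sum (λ a → [ Z (f a) ])) (sum (λ a → [ exc (f a) ])) (sum (λ a → [ Z (f a) ] + [ exc (f a) ]))))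
      where
      each : ∀ a → 1F ≤ [ Z (f a) ] + [ exc (f a) ]
      each a = go (slot? (f a)) (exc (f a))
        where
        go : (s : Slot? (f a)) → ∀ c → 1F ≤ [ inSlot s ∧ not c ] + [ c ]
        go (inj₁ _) true = ≤-reflexive (sym (+-identityˡ _))
        go (inj₁ _) false = ≤-reflexive (sym (+-identityʳ _))
        go (inj₂ h) c = ⊥-elim (h a refl)

  divide : ∀ n V → 1 ℕ.≤ V → ∃[ M ] (fromℕ V * fromℕ M ≤ fromℕ n × n ℕ.< V ℕ.* suc M)
  divide n (suc V) _ = n DM./ suc V , le , lt
    where
    open ℕₚ.≤-Reasoning
    M : ℕ
    M = n DM./ suc V
    eq : n ≡ n DM.% suc V ℕ.+ M ℕ.* suc V
    eq = DM.m≡m%n+[m/n]*n n (suc V)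
    le : fromℕ (suc V) * fromℕ M ≤ fromℕ n
    le = sym (fromℕ-* (suc V) M) ≡≤ fromℕ-≤ (subst (ℕ._≤ n) (ℕₚ.*-comm M (suc V)) (DM.m/n*n≤m n (suc V)))
    lt : n ℕ.< suc V ℕ.* suc M
    lt = begin-strict
      n ≡⟨ eq ⟩
      n DM.% suc V ℕ.+ M ℕ.* suc V <⟨ ℕₚ.+-monoˡ-< (M ℕ.* suc V) (DM.m%n<n n (suc V)) ⟩
      suc M ℕ.* suc V ≡⟨ ℕₚ.*-comm (suc M) (suc V) ⟩
      suc V ℕ.* suc M ∎

  -- About n/`V` vertices are set aside. The k slots then number at least `W` = 2P + 5 times that
  -- many: 2P + 3 for the hits, one for those set aside, and one for the exceptional ones.
  module TightNumbers (P Λ : ℕ) where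
    W V R : ℕ
    W = 2 ℕ.* P ℕ.+ 5
    V = suc Λ ℕ.* W
    R = 2 ℕ.* V

    private
      1≤V : 1 ℕ.≤ V
      1≤V = ℕₚ.*-mono-≤ {1} {suc Λ} {1} {W} (ℕ.s≤s ℕ.z≤n) (ℕₚ.≤-trans (ℕ.s≤s ℕ.z≤n) (ℕₚ.m≤n+m 5 _))

    0<R : 0 ℕ.< R
    0<R = ℕₚ.*-mono-≤ {1} {2} {1} {V} (ℕ.s≤s ℕ.z≤n) 1≤V

    record Portion (n : ℕ) : Set where
      field
        M : ℕ
        VM≤n : fromℕ V * fromℕ M ≤ fromℕ n
        n≤RM : fromℕ n ≤ fromℕ R * fromℕ M
        8V≤M : 8 ℕ.* V ℕ.≤ M
        0<M : 0 ℕ.< M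

    portion : ∀ n → 8 ℕ.* V ℕ.* V ℕ.≤ n → Portion n
    portion n h = go (divide n V 1≤V)
      where
      go : ∃[ M ] (fromℕ V * fromℕ M ≤ fromℕ n × n ℕ.< V ℕ.* suc M) → Portion n
      go (M , le , lt) = record { M = M ; VM≤n = le ; 8V≤M = 8V≤M ; 0<M = 0<M
          ; n≤RM = (lin 0 (sc 1 (fromℕ-≤ (ℕₚ.<⇒≤ lt)) ⊹ sc 1 (≤-reflexive (fromℕ-* V (suc M))) ⊹ sc 1 (≤-reflexive (cong (fromℕ V *_) (fromℕ-suc M))) ⊹ sc 1 (≤-reflexive (sym (cong (_* fromℕ M) (fromℕ-* 2 V)))) ⊹ sc 1 (*-nonneg (0≤fromℕ V) (≤⇒0≤- (fromℕ-≤ 0<M)))) (solve 6 (λ n vm V sM M R → # 1 :* ((R :* M) :- n) := (# 1 :* (vm :- n)) :+ ((# 1 :* ((V :* sM) :- vm)) :+ ((# 1 :* ((V :* (# 1 :+ M)) :- (V :* sM))) :+ ((# 1 :* ((R :* M) :- ((# 2 :* V) :* M))) :+ (# 1 :* ((V :* (M :- # 1)) :- # 0)))))) refl (fromℕ n) (fromℕ (V ℕ.* suc M)) (fromℕ V) (fromℕ (suc M)) (fromℕ M) (fromℕ R))) }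
        where
        8V≤M : 8 ℕ.* V ℕ.≤ M
        8V≤M = ℕₚ.≤-pred (ℕₚ.*-cancelˡ-< V (8 ℕ.* V) (suc M) (ℕₚ.≤-<-trans (ℕₚ.≤-reflexive (ℕₚ.*-comm V (8 ℕ.* V))) (ℕₚ.≤-<-trans h lt)))
        0<M : 0 ℕ.< M
        0<M = ℕₚ.≤-trans (ℕₚ.≤-trans 1≤V (ℕₚ.m≤n*m V 8)) 8V≤M

    -- e² ≤ 4n ≤ 8VM ≤ M², the last because M ≥ 8V.
    exc≤M : ∀ {n e} (po : Portion n) → 0F ≤ e → e * e ≤ fromℕ 4 * fromℕ n → e ≤ fromℕ (Portion.M po)
    exc≤M {n} {e} po 0≤e h = sq-cancel (0≤fromℕ M) (lin 0 (sc 1 h ⊹ sc 4 n≤RM ⊹ sc 4 (≤-reflexive (cong (_* fromℕ M) (fromℕ-* 2 V))) ⊹ sc 1 (≤-reflexive (sym (cong (_* fromℕ M) (fromℕ-* 8 V)))) ⊹ sc 1 (*-nonneg (0≤fromℕ M) (≤⇒0≤- (fromℕ-≤ 8V≤M)))) (solve 6 (λ e n M V R v8 → # 1 :* ((M :* M) :- (e :* e)) := (# 1 :* ((# 4 :* n) :- (e :* e))) :+ ((# 4 :* ((R :* M) :- n)) :+ ((# 4 :* (((# 2 :* V) :* M) :- (R :* M))) :+ ((# 1 :* ((v8 :* M) :- ((# 8 :* V) :* M))) :+ (# 1 :* ((M :* (M :- v8)) :- # 0)))))) refl e (fromℕ n) (fromℕ M) (fromℕ V) (fromℕ R) (fromℕ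 (8 ℕ.* V))))
      where open Portion po

    WM≤k : ∀ {n k λ′} (po : Portion n) → 0F ≤ λ′ → 1F ≤ fromℕ (suc Λ) * λ′ → λ′ * fromℕ n ≤ fromℕ k → fromℕ W * fromℕ (Portion.M po) ≤ fromℕ k
    WM≤k {n} {k} {λ′} po 0≤λ h₁ h₂ = mul-cancel (0<fromℕ Λ) (lin 0 (sc 1 VM≤n ⊹ sc 1 (≤-reflexive (sym (cong (_* fromℕ M) (fromℕ-* (suc Λ) W)))) ⊹ sc 1 (*-nonneg (0≤fromℕ n) (≤⇒0≤- h₁)) ⊹ sc 1 (*-nonneg (0≤fromℕ (suc Λ)) (≤⇒0≤- h₂))) (solve 7 (λ L W M V n k l → # 1 :* ((L :* k) :- (L :* (W :* M))) := (# 1 :* (n :- (V :* M))) :+ ((# 1 :* ((V :* M) :- ((L :* W) :* M))) :+ ((# 1 :* ((n :* ((L :* l) :- # 1)) :- # 0)) :+ (# 1 :* ((L :* (k :- (l :* n))) :- # 0))))) refl (fromℕ (suc Λ)) (fromℕ W) (fromℕ M) (fromℕ V) (fromℕ n) (fromℕ k) λ′))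
      where open Portion po

    surplus : ∀ {M k z e} → fromℕ W * M ≤ k → k ≤ z + e → e ≤ M → fromℕ (2 ℕ.* P ℕ.+ 3) * M + M ≤ z
    surplus {M} {k} {z} {e} enough many e≤M = (lin 0 (sc 1 (≤-reflexive (cong (_* M) (fromℕ-+ (2 ℕ.* P) 3))) ⊹ sc 1 (≤-reflexive (sym (cong (_* M) (fromℕ-+ (2 ℕ.* P) 5)))) ⊹ sc 1 enough ⊹ sc 1 many ⊹ sc 1 e≤M) (solve 7 (λ P q3 W M z e k → # 1 :* (z :- ((q3 :* M) :+ M)) := (# 1 :* (((P :+ # 3) :* M) :- (q3 :* M))) :+ ((# 1 :* ((W :* M) :- ((P :+ # 5) :* M))) :+ ((# 1 :* (k :- (W :* M))) :+ ((# 1 :* ((z :+ e) :- k)) :+ (# 1 :* (M :- e)))))) refl (fromℕ (2 ℕ.* P)) (fromℕ (2 ℕ.* P ℕ.+ 3)) (fromℕ W) M z e k))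

  module Tight {α : ℚ} (sca : Scale α) (Q : Graph) {k : ℕ} (slots : Slots Q k) (sd : SmallDegen Q) (G : Digraph) (mind : MinSemiDegreeAtLeast G (ℚ.½ ℚ.+ α)) (N≡n : dsize G ≡ size Q)
    {M R : ℕ} (0<M : 0 ℕ.< M) (0<R : 0 ℕ.< R) (n≤RM : fromℕ (size Q) ≤ fromℕ R * fromℕ M)
    (plenty : ∀ z → fromℕ k ≤ z + exceptions (SmallDegen.d sd) → fromℕ (2 ℕ.* P₁ (Scale.b sca) ℕ.+ 3) * fromℕ M + fromℕ M ≤ z)
    (0<n : 0 ℕ.< size Q) {S : ℕ} (2≤S : 2 ℕ.≤ S) (S-big : suc (maxDegree Q) ℕ.^ suc (kk′ (Scale.b sca) R) ℕ.≤ S) (num : Num (Scale.b sca) R S (dsize G)) (tests< : fromℕ 2 * fromℕ (tests (dsize G)) < fromℕ 2 ^^ S)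
    (arcD : Fin (size Q) → Fin (size Q) → Bool) (or : Oriented Q arcD) where

    open SmallDegen sd using (d; small)
    open Scale sca using (b; 0<b)
    open Density α sca G mind
    open Oriented or
    open Gadgets Q slots d
    open Degen d using (exc; p; par)

    private
      N : ℕ
      N = dsize G
      Z-many : fromℕ (2 ℕ.* P₁ b ℕ.+ 3) * fromℕ M + fromℕ M ≤ sum (λ y → [ Z y ])
      Z-many = plenty _ many
      drop : ∀ {q M z} → 0F ≤ q → 0F ≤ M → q * M + M ≤ z → M ≤ z
      drop {q} {M} {z} h₁ h₂ h = (lin 0 (sc 1 (*-nonneg h₁ h₂) ⊹ sc 1 h) (solve 3 (λ x M z → # 1 :* (z :- M) := (# 1 :* (x :- # 0)) :+ (# 1 :* (z :- (x :+ M)))) refl (q * M) M z))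
      chosen : Σ (Fin n → Bool) λ U → (∀ x → U x ≡ true → Z x ≡ true) × sum (λ x → [ U x ]) ≡ fromℕ M
      chosen = subset-of-size Z M (drop (0≤fromℕ (2 ℕ.* P₁ b ℕ.+ 3)) (0≤fromℕ M) Z-many)

    U : Fin n → Bool
    U = proj₁ chosen
    private
      U⇒Z : ∀ x → U x ≡ true → Z x ≡ true
      U⇒Z = proj₁ (proj₂ chosen)
      U-size : sum (λ x → [ U x ]) ≡ fromℕ M
      U-size = proj₂ (proj₂ chosen)

    -- `U` is set aside and `Y`, the rest of `Z`, provides the swap partners.
    real Y : Fin n → Bool
    real x = not (U x)
    Y x = Z x ∧ not (U x)

    private
      Y⇒Z : ∀ y → Y y ≡ true → Z y ≡ true × real y ≡ true
      Y⇒Z y h = ∧-true {Z y} h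
      ¬Z⇒ : ∀ z → Z z ≡ false → real z ≡ true × Y z ≡ false
      ¬Z⇒ z h = go (Bool-dec (U z)) , cong (_∧ not (U z)) h
        where
        go : U z ≡ true ⊎ U z ≡ false → not (U z) ≡ true
        go (inj₁ e) = contradiction (trans (sym (U⇒Z z e)) h) λ ()
        go (inj₂ e) = cong not e
      Y-size : sum (λ y → [ Z y ]) ≡ sum (λ y → [ Y y ]) + sum (λ y → [ U y ])
      Y-size = trans (sum-cong λ y → split (Z y) (U y) (U⇒Z y)) (sum-+ (λ y → [ Y y ]) (λ y → [ U y ]))
        where
        split : ∀ z u → (u ≡ true → z ≡ true) → [ z ] ≡ [ z ∧ not u ] + [ u ]
        split true true _ = sym (+-identityˡ _)
        split true false _ = sym (+-identityʳ _)
        split false false _ = sym (+-identityˡ _)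
        split false true h = contradiction (h refl) λ ()
      real-size : sum (λ x → [ real x ]) + fromℕ M ≡ fromℕ n
      real-size = trans (cong (sum (λ x → [ real x ]) +_) (sym U-size)) (trans (sym (sum-+ (λ x → [ real x ]) (λ x → [ U x ])))
          (trans (sum-cong (λ x → one (U x))) (trans (sum-const n 1F) (*-identityʳ _))))
        where
        one : ∀ c → [ not c ] + [ c ] ≡ 1F
        one true = +-identityˡ _
        one false = +-identityʳ _
      Y-real : ∀ y → Y y ≡ true → real y ≡ true × (∀ z → adj Q z y ≡ true → real z ≡ true × (z ≡ p y ⊎ z ≡ w y))
      Y-real y h = proj₂ (Y⇒Z y h) , λ z e → let two , nz = Good.nbr (good y (proj₁ (Y⇒Z y h))) z (trans (adj-sym Q y z) e) in proj₁ (¬Z⇒ z nz) , two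
      Y-kid : ∀ y → Y y ≡ true → w y ≡ p y ⊎ adj Q (w y) y ≡ true
      Y-kid y h = inj₂ (trans (adj-sym Q (w y) y) (Good.kid (good y (proj₁ (Y⇒Z y h)))))
      Y-nonexc : ∀ y → Y y ≡ true → exc y ≡ false
      Y-nonexc y h = Good.nonexc (good y (proj₁ (Y⇒Z y h)))
      n≤N : n ℕ.≤ N
      n≤N = ℕₚ.≤-reflexive (sym N≡n)
      0<T : 0 ℕ.< tests N
      0<T = subst (λ z → 0 ℕ.< tests z) (sym N≡n) (pos n 0<n)
        where
        pos : ∀ n → 0 ℕ.< n → 0 ℕ.< tests n
        pos (suc n) _ = ℕ.s≤s ℕ.z≤n

      embedded : Embedded (arc G) arcD real Y (testOf N) b M S
      embedded = Embedding.embedded (arc G) {b} {R} {M} {S} 0<b 0<R 0<M 2≤S dens 0<n n≤N (cong fromℕ N≡n ≡≤ n≤RM) num (adj Q) d small arcD antisym Adj⇒E (adj-sym Q)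
        real Y w Y-real Y-kid Y-nonexc (maxDegree Q) (deg≤Δ Q) S-big (≤-reflexive (trans real-size (cong fromℕ (sym N≡n)))) {tests N} 0<T (testOf N)
      module Em = Embedded embedded

      -- Host and graph have equal order, so embedding all but M vertices leaves M host vertices.
      r≡M : Em.r ≡ M
      r≡M = ℕₚ.≤-antisym (fromℕ-≤⁻ (≤-reflexive eq)) (fromℕ-≤⁻ (≤-reflexive (sym eq)))
        where
        finish : ∀ {r M s N n} → r + s ≡ N → s + M ≡ n → N ≡ n → r ≡ M
        finish {r} {M} {s} {N} {n} h₁ h₃ h₄ = (≤-antisym (lin 0 (sc 1 (≤-reflexive h₁) ⊹ sc 1 (≤-reflexive (sym h₃)) ⊹ sc 1 (≤-reflexive h₄)) (solve 5 (λ r M s N n → # 1 :* (M :- r) := (# 1 :* (N :- (r :+ s))) :+ ((# 1 :* ((s :+ M) :- n)) :+ (# 1 :* (n :- N)))) refl r M s N n)) (lin 0 (sc 1 (≤-reflexive (sym h₁)) ⊹ sc 1 (≤-reflexive h₃) ⊹ sc 1 (≤-reflexive (sym h₄))) (solve 5 (λ r M s N n → # 1 :* (r :- M) := (# 1 :* ((r :+ s) :- N)) :+ ((# 1 :* (n :- (s :+ M))) :+ (# 1 :* (N :- n)))) refl r M s N n)))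
        eq : fromℕ Em.r ≡ fromℕ M
        eq = finish Em.count real-size (cong fromℕ N≡n)

      module Index {r : ℕ} (υ : Fin r → Fin n) (υ-inj : ∀ i j → υ i ≡ υ j → i ≡ j) (υ-U : ∀ i → U (υ i) ≡ true) (υ-cover : ∀ x → U x ≡ true → ∃[ i ] υ i ≡ x) (r≡ : r ≡ Em.r) where
        open Em using (φ; hit; hit-ok)

        ι : Fin r → Fin N
        ι i = Em.ι (subst Fin r≡ i)

        ι-inj : ∀ i j → ι i ≡ ι j → i ≡ j
        ι-inj i j h = subst-inj r≡ (Em.ι-inj _ _ h)
          where
          subst-inj : ∀ {r s} (e : r ≡ s) {i j : Fin r} → subst Fin e i ≡ subst Fin e j → i ≡ j
          subst-inj refl h = h

        not-false : ∀ c → not c ≡ false → c ≡ true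
        not-false true _ = refl

        nbrs : ∀ i z → arcD z (υ i) ≡ true ⊎ arcD (υ i) z ≡ true → (z ≡ p (υ i) ⊎ z ≡ w (υ i)) × real z ≡ true × Y z ≡ false
        nbrs i z a = let two , nz = Good.nbr (good (υ i) (U⇒Z _ (υ-U i))) z (trans (adj-sym Q (υ i) z) (Adj⇒E z (υ i) a)) in two , ¬Z⇒ z nz

        Y-nbrs : ∀ y → Y y ≡ true → ∀ z → arcD z y ≡ true ⊎ arcD y z ≡ true → real z ≡ true × Y z ≡ false
        Y-nbrs y h z a = ¬Z⇒ z (proj₂ (Good.nbr (good y (proj₁ (Y⇒Z y h))) z (trans (adj-sym Q y z) (Adj⇒E z y a))))

        module Ab = Absorption (arc G) arcD antisym real Y φ ι υ υ-inj (λ i → cong not (υ-U i)) (λ x h → υ-cover x (not-false (U x) h))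
          Em.φ-inj ι-inj (λ x rx i → Em.avoid x rx _) Em.arcs
          (λ i → p (υ i)) (λ i → w (υ i)) nbrs Y-nbrs

        -- The images of the two neighbours of the set-aside vertex, with their signs, and z form
        -- one of the tests of the loop. Its hits exceed the number of vertices to be absorbed.
        supply : ∀ i z → Σ (Fin n → Bool) λ hit → (∀ y → hit y ≡ true → Ab.Fits i z y) × fromℕ r < sum (λ y → [ hit y ])
        supply i z = go (testOf-surj N z (arcD (p (υ i)) (υ i)) (φ (p (υ i))) (arcD (w (υ i)) (υ i)) (φ (w (υ i))))
          where
          go : ∃[ τ ] testOf N τ ≡ mkTest z (arcD (p (υ i)) (υ i)) (φ (p (υ i))) (arcD (w (υ i)) (υ i)) (φ (w (υ i))) → Σ (Fin n → Bool) λ hit → (∀ y → hit y ≡ true → Ab.Fits i z y) × fromℕ r < sum (λ y → [ hit y ])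
          go (τ , eq) = hit τ , (λ y h → fits y (subst (λ t → Passes (arc G) arcD real Y φ t y) eq (hit-ok τ y h))) ,
              subst (λ m → fromℕ m < sum (λ y → [ hit τ y ])) (sym (trans r≡ r≡M)) (Em.many-hits (Y-enough Z-many) tests< τ)
            where
            fits : ∀ y → Passes (arc G) arcD real Y φ (mkTest z (arcD (p (υ i)) (υ i)) (φ (p (υ i))) (arcD (w (υ i)) (υ i)) (φ (w (υ i)))) y → Ab.Fits i z y
            fits y ((Yy , ry) , t₁ , t₂ , ins , outs) = Yy , ry , t₁ , t₂ , ins , outs
            Y-enough : fromℕ (2 ℕ.* P₁ b ℕ.+ 3) * fromℕ M + fromℕ M ≤ sum (λ y → [ Z y ]) → fromℕ (2 ℕ.* P₁ b ℕ.+ 3) * fromℕ M ≤ sum (λ y → [ Y y ])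
            Y-enough h = cancel h (trans Y-size (cong (sum (λ y → [ Y y ]) +_) U-size))
              where
              cancel : ∀ {x M z y} → x + M ≤ z → z ≡ y + M → x ≤ y
              cancel {x} {M} {z} {y} h e = (lin 0 (sc 1 h ⊹ sc 1 (≤-reflexive e)) (solve 4 (λ x M z y → # 1 :* (y :- x) := (# 1 :* (z :- (x :+ M))) :+ (# 1 :* ((y :+ M) :- z))) refl x M z y))

        embedding : Embeds arcD (arc G)
        embedding = Ab.absorbed supply

    embeds : Embeds arcD (arc G)
    embeds = go (keepSub U)
      where
      go : ∃[ r ] Σ (Fin r → Fin n) (λ κ → (∀ i j → κ i ≡ κ j → i ≡ j) × (∀ i → U (κ i) ≡ true) × (∀ f → sum (λ i → [ U i ] * f i) ≡ sum (f ∘ κ))) → Embeds arcD (arc G)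
      go (r , κ , inj , ok , sums) = Index.embedding κ inj ok cover r≡
        where
        cover : ∀ x → U x ≡ true → ∃[ i ] κ i ≡ x
        cover x h = let i , e = count-pos⇒∃ (λ i → κ i == x) (<-≤-trans (0<fromℕ 0) (≤-reflexive one)) in i , ==⇒≡ (κ i) x e
          where
          one : 1F ≡ sum (λ i → [ κ i == x ])
          one = trans (sym (cong [_] h)) (trans (sym (sum-δ x (λ i → [ U i ]))) (trans (sum-cong (λ i → *-comm [ i == x ] [ U i ])) (sums (λ i → [ i == x ]))))
        r≡ : r ≡ Em.r
        r≡ = trans (ℕₚ.≤-antisym (fromℕ-≤⁻ (≤-reflexive eq)) (fromℕ-≤⁻ (≤-reflexive (sym eq)))) (sym r≡M)
          where
          eq : fromℕ r ≡ fromℕ M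
          eq = trans (sym (trans (sum-const r 1F) (*-identityʳ _))) (trans (sym (sums (λ _ → 1F))) (trans (sum-cong (λ x → *-identityʳ [ U x ])) U-size))

  tight : ∀ α (sca : Scale α) λ′ Λ → 0F ≤ λ′ → 1F ≤ fromℕ (suc Λ) * λ′ → ∀ n₀ → Chooses (Scale.b sca) (TightNumbers.R (P₁ (Scale.b sca)) Λ) n₀ → ∀ K Q → SmallDegen Q → 1 ℕ.≤ K → n₀ ℕ.≤ size Q → 1 ℕ.≤ size Q
    → 8 ℕ.* TightNumbers.V (P₁ (Scale.b sca)) Λ ℕ.* TightNumbers.V (P₁ (Scale.b sca)) Λ ℕ.≤ size Q → 1 ℕ.≤ maxDegree Q → DegreeBound K (maxDegree Q) (size Q) → ∀ G → MinSemiDegreeAtLeast G (ℚ.½ ℚ.+ α) → dsize G ≡ size Q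
    → ∀ k → λ′ * fromℕ (size Q) ≤ fromℕ k → Slots Q k → ∀ arcD → Oriented Q arcD → Embeds arcD (arc G)
  tight α sca λ′ Λ 0≤λ 1≤Λλ n₀ choose K Q sd 1≤K n₀≤n 0<n V²≤n 1≤Δ db G mind N≡n k λn≤k slots arcD or = go (choose K (size Q) (maxDegree Q) 1≤K n₀≤n 1≤Δ db)
    where
    open Scale sca using (b)
    open TightNumbers (P₁ b) Λ
    go : ∃[ S ] (2 ℕ.≤ S × suc (maxDegree Q) ℕ.^ suc (kk′ b R) ℕ.≤ S × (∀ N → size Q ℕ.≤ N → Num b R S N) × fromℕ 2 * fromℕ (tests (size Q)) < fromℕ 2 ^^ S) → Embeds arcD (arc G)
    go (S , 2≤S , S-big , num , t<) = Tight.embeds sca Q slots sd G mind N≡n 0<M 0<R n≤RM plenty 0<n 2≤S S-big (num _ (ℕₚ.≤-reflexive (sym N≡n))) (subst (λ z → fromℕ 2 * fromℕ (tests z) < fromℕ 2 ^^ S) (sym N≡n) t<) arcD or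
      where
      po : Portion (size Q)
      po = portion (size Q) V²≤n
      open Portion po
      open SmallDegen sd
      plenty : ∀ z → fromℕ k ≤ z + exceptions d → fromℕ (2 ℕ.* P₁ b ℕ.+ 3) * fromℕ M + fromℕ M ≤ z
      plenty z h = surplus (WM≤k po 0≤λ 1≤Λλ λn≤k) h (exc≤M po (sum-nonneg (λ x → []-nonneg (Degen.exc d x))) small)

-- Assembling both cases.

module Conclusion where
  open import Defs
  open OrderedField
  open Sums
  open Numerics
  open Embed
  open Spacious
  open TightCase

  -- `n₁` and `n₂` come from the choice of tree size in the two cases; 8V² makes the reserved
  -- portion at least 8V.
  threshold : ℕ → ℕ → ℕ → ℕ
  threshold n₁ n₂ V = suc (n₁ ℕ.+ n₂ ℕ.+ 8 ℕ.* V ℕ.* V)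

  Conclusions : ℚ → ℚ → Graph → Digraph → Set
  Conclusions α λ' Q G = ((ℚ.1ℚ ℚ.+ α) ℚ.* ℚ[ size Q ] ℚ.≤ ℚ[ dsize G ] → ContainsAllOrientations G Q) ×
    (dsize G ≡ size Q → (∃[ k ] (λ' ℚ.* ℚ[ size Q ] ℚ.≤ ℚ[ k ] × BarePaths7 Q k) ⊎ ∃[ k ] (λ' ℚ.* ℚ[ size Q ] ℚ.≤ ℚ[ k ] × LeafEdges Q k)) → ContainsAllOrientations G Q)

  conclude : ∀ α (sca : Scale α) λ' Λ → ℚ.0ℚ ℚ.< λ' → 1F ≤ fromℕ (suc Λ) * ℚ→F λ' → ∀ n₁ → Chooses (Scale.b sca) (suc (suc (Scale.m sca))) n₁ → ∀ n₂ → Chooses (Scale.b sca) (TightNumbers.R (P₁ (Scale.b sca)) Λ) n₂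
    → ∀ ζ → ℚ.0ℚ ℚ.< ζ → ζ ℚ.< ℚ.1ℚ → ∀ K → 1 ℕ.≤ K → ∀ (Q₀ Q : Graph) → threshold n₁ n₂ (TightNumbers.V (P₁ (Scale.b sca)) Λ) ℕ.≤ size Q → ObtainedFrom Q₀ Q
    → ℚ[ size Q₀ ℕ.* maxDegree Q ] ^ℚ 4 ℚ.≤ (ζ ^ℚ 4) ℚ.* ℚ[ size Q ] → DegreeBound K (maxDegree Q) (size Q) → ∀ (G : Digraph) → MinSemiDegreeAtLeast G (ℚ.½ ℚ.+ α)
    → Conclusions α λ' Q G
  conclude α sca λ' Λ 0<λ 1≤Λλ n₁ ch₁ n₂ ch₂ ζ 0<ζ ζ<1 K 1≤K Q₀ Q n≥ obt small db G mind = by-degree (maxDegree Q) refl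
    where
    b V : ℕ
    b = Scale.b sca
    V = TightNumbers.V (P₁ b) Λ
    parts : ∀ x y z → suc (x ℕ.+ y ℕ.+ z) ℕ.≤ size Q → x ℕ.≤ size Q × y ℕ.≤ size Q × z ℕ.≤ size Q × 1 ℕ.≤ size Q
    parts x y z h = ℕₚ.≤-trans (ℕₚ.≤-trans (ℕₚ.m≤m+n x y) (ℕₚ.m≤m+n _ z)) (ℕₚ.<⇒≤ h) , ℕₚ.≤-trans (ℕₚ.≤-trans (ℕₚ.m≤n+m y x) (ℕₚ.m≤m+n _ z)) (ℕₚ.<⇒≤ h) ,
      ℕₚ.≤-trans (ℕₚ.m≤n+m z (x ℕ.+ y)) (ℕₚ.<⇒≤ h) , ℕₚ.≤-trans (ℕ.s≤s ℕ.z≤n) h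
    bounds : n₁ ℕ.≤ size Q × n₂ ℕ.≤ size Q × 8 ℕ.* V ℕ.* V ℕ.≤ size Q × 1 ℕ.≤ size Q
    bounds = parts n₁ n₂ (8 ℕ.* V ℕ.* V) n≥
    N≥n : (ℚ.1ℚ ℚ.+ α) ℚ.* ℚ[ size Q ] ℚ.≤ ℚ[ dsize G ] → size Q ℕ.≤ dsize G
    N≥n large = fromℕ-≤⁻ (≤-trans (lin 0 (sc 1 (*-nonneg (0≤fromℕ (size Q)) α≥0)) (solve 2 (λ n a → # 1 :* (((# 1 :+ a) :* n) :- n) := # 1 :* ((n :* a) :- # 0)) refl (fromℕ (size Q)) (ℚ→F α))) (widen α (size Q) (dsize G) large))
      where
      α≥0 : 0F ≤ ℚ→F α
      α≥0 = scale≥0 (Scale.1≤mα sca)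
        where
        scale≥0 : ∀ {M a} → 1F ≤ fromℕ (suc M) * a → 0F ≤ a
        scale≥0 {M} {a} h = nonneg (≤-or-> 0F a)
          where
          nonneg : 0F ≤ a ⊎ a < 0F → 0F ≤ a
          nonneg (inj₁ h) = h
          nonneg (inj₂ l) = ⊥-elim (<-irrefl (lin< 0 (0<fromℕ 0 ⊹< sc 1 (<⇒≤ (*-pos (0<fromℕ M) (<⇒0<- l))) ⊹ sc 1 h) (solve 2 (λ M a → # 1 :* (# 0 :- # 0) := # 1 :+ ((# 1 :* ((M :* (# 0 :- a)) :- # 0)) :+ (# 1 :* ((M :* a) :- # 1)))) refl (fromℕ (suc M)) a)))
    by-degree : ∀ Δ → maxDegree Q ≡ Δ → Conclusions α λ' Q G
    by-degree zero Δ0 = (λ large → contains-all G Q (embeds-edgeless Q Δ0 (arc G) (N≥n large))) , λ N≡n _ → contains-all G Q (embeds-edgeless Q Δ0 (arc G) (ℕₚ.≤-reflexive (sym N≡n)))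
    by-degree (suc Δ) eq =
        (λ large → contains-all G Q (spacious α sca n₁ ch₁ K Q sd 1≤K (proj₁ bounds) 0<n 1≤Δ db G mind large)) ,
        λ { N≡n (inj₁ (k , λn≤k , P)) → contains-all G Q (go N≡n k λn≤k (path-slots Q k P)) ; N≡n (inj₂ (k , λn≤k , L)) → contains-all G Q (go N≡n k λn≤k (leaf-slots Q k L)) }
      where
      1≤Δ : 1 ℕ.≤ maxDegree Q
      1≤Δ = ℕₚ.≤-trans (ℕ.s≤s ℕ.z≤n) (ℕₚ.≤-reflexive (sym eq))
      0<n : 1 ℕ.≤ size Q
      0<n = proj₂ (proj₂ (proj₂ bounds))
      sd : SmallDegen Q
      sd = exceptions-small Q₀ Q ζ 0<ζ ζ<1 1≤Δ obt small
      go : dsize G ≡ size Q → ∀ k → λ' ℚ.* ℚ[ size Q ] ℚ.≤ ℚ[ k ] → Slots Q k → ∀ arcD → Oriented Q arcD → Embeds arcD (arc G)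
      go N≡n k h slots = tight α sca (ℚ→F λ') Λ (sym ℚ→F-0 ≡≤ ℚ→F-≤ (ℚₚ.<⇒≤ 0<λ)) 1≤Λλ n₂ ch₂ K Q sd 1≤K (proj₁ (proj₂ bounds)) 0<n (proj₁ (proj₂ (proj₂ bounds))) 1≤Δ db G mind N≡n k
        (sym (trans (ℚ→F-* λ' ℚ[ size Q ]) (cong (ℚ→F λ' *_) (ℚ→F-ℕ (size Q)))) ≡≤ (ℚ→F-≤ h ≤≡ ℚ→F-ℕ k)) slots

  sufficiently-large : ∀ α → ℚ.0ℚ ℚ.< α → ∀ λ' → ℚ.0ℚ ℚ.< λ' → ∃[ n₀ ] (∀ ζ → ℚ.0ℚ ℚ.< ζ → ζ ℚ.< ℚ.1ℚ → ∀ K → 1 ℕ.≤ K → ∀ (Q₀ Q : Graph) → n₀ ℕ.≤ size Q → ObtainedFrom Q₀ Q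
    → ℚ[ size Q₀ ℕ.* maxDegree Q ] ^ℚ 4 ℚ.≤ (ζ ^ℚ 4) ℚ.* ℚ[ size Q ] → DegreeBound K (maxDegree Q) (size Q) → ∀ (G : Digraph) → MinSemiDegreeAtLeast G (ℚ.½ ℚ.+ α) → Conclusions α λ' Q G)
  sufficiently-large α 0<α λ' 0<λ = go (scale α 0<α) (archimedean λ' 0<λ)
    where
    go : Scale α → ∃[ m ] 1F ≤ fromℕ (suc m) * ℚ→F λ' → _
    go sca (Λ , 1≤Λλ) = with-sizes (choose-S b (suc (suc (Scale.m sca)))) (choose-S b (TightNumbers.R (P₁ b) Λ))
      where
      b : ℕ
      b = Scale.b sca
      with-sizes : ∃ (Chooses b (suc (suc (Scale.m sca)))) → ∃ (Chooses b (TightNumbers.R (P₁ b) Λ)) → _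
      with-sizes (n₁ , ch₁) (n₂ , ch₂) = threshold n₁ n₂ (TightNumbers.V (P₁ b) Λ) , conclude α sca λ' Λ 0<λ 1≤Λλ n₁ ch₁ n₂ ch₂

open import Defs
open import Data.Nat using (ℕ) renaming (_≤_ to _≤ℕ_; _*_ to _*ℕ_)
open import Data.Rational using (ℚ; 0ℚ; 1ℚ; ½; _+_; _*_; _≤_; _<_)
open import Data.Product using (_×_; ∃-syntax)
open import Data.Sum using (_⊎_)
open import Relation.Binary.PropositionalEquality using (_≡_)

theorem1p4 : ∀ (α : ℚ) → 0ℚ < α →
    ∃[ λ₀ ] (0ℚ < λ₀ × ∀ (λ' : ℚ) → 0ℚ < λ' → λ' < λ₀ →
    ∃[ ζ₀ ] (0ℚ < ζ₀ × ∀ (ζ : ℚ) → 0ℚ < ζ → ζ < ζ₀ →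
    ∃[ K₀ ] ∀ (K : ℕ) → K₀ ≤ℕ K →
    ∃[ n₀ ] ∀ (n : ℕ) → n₀ ≤ℕ n →
    ∀ (Q₀ Q : Graph) → size Q ≡ n → ObtainedFrom Q₀ Q →
    ℚ[ size Q₀ *ℕ maxDegree Q ] ^ℚ 4 ≤ (ζ ^ℚ 4) * ℚ[ n ] →
    DegreeBound K (maxDegree Q) n →
    ∀ (G : Digraph) → MinSemiDegreeAtLeast G (½ + α) →
    ((1ℚ + α) * ℚ[ n ] ≤ ℚ[ dsize G ] → ContainsAllOrientations G Q) ×
    (dsize G ≡ n →
    (∃[ k ] (λ' * ℚ[ n ] ≤ ℚ[ k ] × BarePaths7 Q k)
    ⊎ ∃[ k ] (λ' * ℚ[ n ] ≤ ℚ[ k ] × LeafEdges Q k)) →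
    ContainsAllOrientations G Q)))
-- The threshold 1 for ζ gives (|Q₀|Δ)⁴ ≤ n, and K ≥ 1 gives Δ ≤ exp(√(log n)), already below every
-- fixed power of n. The constants coming from α and λ' are absorbed into n₀.
theorem1p4 α 0<α = 1ℚ , ℚₚ.positive⁻¹ 1ℚ , λ λ' 0<λ' _ → 1ℚ , ℚₚ.positive⁻¹ 1ℚ , λ ζ 0<ζ ζ<1 → 1 , λ K 1≤K →
  let n₀ , embeds = Conclusion.sufficiently-large α 0<α λ' 0<λ' in n₀ , λ { _ n≥n₀ Q₀ Q refl → embeds ζ 0<ζ ζ<1 K 1≤K Q₀ Q n≥n₀ }
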